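{- Let $0<|q|<1$. With the notation of the context (with $\ell=3$), the following identities hold: $$R_{01}(0) =-1 -3q^3 \frac{(-q^3; q^{6})_{\infty}}{(q^{6}; q^{6})_{\infty}} \sum_{n \in \mathbb{Z}} \frac{(-1)^nq^{6n^2+9n}}{1-q^{6n+4}} + \frac{(q^{6}; q^{6})_{\infty}^4 (-q^3; q^3)_{\infty}^{4} (q; q^2)_{\infty}}{(q^{4}; q^{4})_{\infty} (q^2, q^{10}, q^{12}; q^{12})_{\infty}^2},$$ $$R_{01}(1)=\frac{(-q^3, q^6; q^6)_{\infty}}{(q^2, q^4; q^6)_{\infty}},$$ $$R_{01}(2)=\frac{(q^3; q^3)_{\infty} (-q^6; q^6)_{\infty}}{(q, q^5; q^6)_{\infty} (q^4, q^8; q^{12})_{\infty}}.$$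
   Context: Notation: $(a_1,\dots,a_j;q)_\infty=\prod_{k\ge0}(1-a_1q^k)\cdots(1-a_jq^k)$. A partition without repeated odd parts is a partition of $n$ in which each odd part occurs at most once. For such a partition $\lambda$, its $M_2$-rank is $\lceil l(\lambda)/2\rceil-\nu(\lambda)$, where $l(\lambda)$ is the largest part and $\nu(\lambda)$ the number of parts. For $n\ge1$ let $N_2(m,n)$ be the number of partitions of $n$ without repeated odd parts with $M_2$-rank $m$, and set $N_2(m,0)=0$ for all $m$ (the empty partition is not counted). For a positive integer $\ell$ and an integer $s$, let $N_2(s,\ell,n)=\sum_{m\equiv s \pmod \ell}N_2(m,n)$. Define $R_{st}(d)=\sum_{n\ge0}\big(N_2(s,\ell,\ell n+d)-N_2(t,\ell,\ell n+d)\big)q^n$. Sums over $n\in\mathbb{Z}$ with terms $1/(1-q^{k})$ for negative $k$ are understood as analytic functions in $0<|q|<1$. -}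

module Defs where

open import Data.Bool using (Bool; true; false; if_then_else_; not; _∨_; _∧_)
open import Data.Nat as ℕ using (ℕ; zero; suc; _≡ᵇ_; _⊔_; NonZero)
open import Data.Nat.Base using (_%_; _/_)
open import Data.List using (List; []; _∷_; _++_; map; concatMap; filter; length; foldr; replicate)
open import Data.Integer as ℤ using (ℤ; +_; -[1+_]; _-_; _+_; _*_; -_; ∣_∣; _≤ᵇ_; _%ℕ_)
open import Relation.Nullary.Decidable using (does)

-- parts≤ k n : all partitions of n whose parts are all ≤ k
-- (each listed once, as a nonincreasing list).  Recursion on k:
-- choose the multiplicity m of the part k, then partition the rest
-- with parts ≤ k-1.
parts≤ : ℕ → ℕ → List (List ℕ)
parts≤ zero zero    = [] ∷ []
parts≤ zero (suc _) = []
parts≤ (suc k) n = concatMap choose (upto (n / suc k))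
  where
  upto : ℕ → List ℕ
  upto zero    = zero ∷ []
  upto (suc m) = upto m ++ (suc m ∷ [])
  choose : ℕ → List (List ℕ)
  choose m = map (replicate m (suc k) ++_) (parts≤ k (n ℕ.∸ m ℕ.* suc k))

partitions : ℕ → List (List ℕ)
partitions n = parts≤ n n

allᵇ : {A : Set} → (A → Bool) → List A → Bool
allᵇ p []       = true
allᵇ p (x ∷ xs) = p x ∧ allᵇ p xs

isOdd : ℕ → Bool
isOdd n = (n % 2) ≡ᵇ 1

noRepeatedOdd : List ℕ → Bool
noRepeatedOdd λs = allᵇ (λ p → not (isOdd p) ∨ (length (filter (λ x → x ℕ.≟ p) λs) ℕ.≤ᵇ 1)) λs

partitionsNRO : ℕ → List (List ℕ)
partitionsNRO n = filter (λ λs → noRepeatedOdd λs Data.Bool.≟ true) (partitions n)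
  where import Data.Bool

largestPart : List ℕ → ℕ
largestPart = foldr _⊔_ 0

numParts : List ℕ → ℕ
numParts = length

M2rank : List ℕ → ℤ
M2rank λs = + ((largestPart λs ℕ.+ 1) / 2) - + numParts λs

-- N₂(s,ℓ,n) = #{ λ ⊢ n without repeated odd parts : M₂-rank ≡ s (mod ℓ) },
-- with N₂(·,ℓ,0) = 0 (the empty partition is not counted).
N2 : ℤ → (ℓ : ℕ) → .{{NonZero ℓ}} → ℕ → ℕ
N2 s ℓ zero = 0
N2 s ℓ (suc n) =
  length (filter (λ λs → ((M2rank λs - s) %ℕ ℓ) ℕ.≟ 0) (partitionsNRO (suc n)))

-- Formal power series with integer coefficients: PS = ℕ → ℤ,
-- f n = coefficient of q^n.  (All functions below are holomorphic in
-- |q|<1, so identities of analytic functions = identities of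
-- coefficient sequences.)

PS : Set
PS = ℕ → ℤ

Σ< : ℕ → (ℕ → ℤ) → ℤ
Σ< zero    f = + 0
Σ< (suc n) f = Σ< n f + f n

cst : ℤ → PS
cst c zero    = c
cst c (suc _) = + 0

mono : ℤ → ℕ → PS
mono c m n = if m ≡ᵇ n then c else + 0

_⊕_ : PS → PS → PS
(f ⊕ g) n = f n + g n

⊖_ : PS → PS
(⊖ f) n = - f n

_⊝_ : PS → PS → PS
f ⊝ g = f ⊕ (⊖ g)

_⊗_ : PS → PS → PS
(f ⊗ g) n = Σ< (suc n) (λ i → f i * g (n ℕ.∸ i))

infixl 6 _⊕_ _⊝_
infixl 7 _⊗_

_^ˢ_ : PS → ℕ → PS
f ^ˢ zero  = cst (+ 1)
f ^ˢ suc k = f ⊗ (f ^ˢ k)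

infixr 8 _^ˢ_

-- Reciprocal of a power series f with f 0 = 1:
-- b₀ = 1,  b_N = - Σ_{i=1}^{N} f i * b_{N-i}.
-- invUpTo f N is a function that is correct at all indices ≤ N.
invUpTo : PS → ℕ → PS
invUpTo f zero    = cst (+ 1)
invUpTo f (suc N) k =
  if k ℕ.≤ᵇ N then g k
  else - Σ< (suc N) (λ i → f (suc i) * g (N ℕ.∸ i))
  where g = invUpTo f N

inv : PS → PS
inv f N = invUpTo f N N

-- f / g  (g with constant term 1)
_⊘_ : PS → PS → PS
f ⊘ g = f ⊗ inv g

infixl 7 _⊘_

-- q-Pochhammer symbol (c q^e ; q^s)_∞ = ∏_{k ≥ 0} (1 - c q^{e + s k}),  s ≥ 1.
-- Coefficient of q^N only depends on the factors with k ≤ N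
-- (the others are ≡ 1 mod q^{N+1}), so we truncate there.
pochFin : ℤ → ℕ → ℕ → ℕ → PS
pochFin c e s zero    = cst (+ 1)
pochFin c e s (suc K) = pochFin c e s K ⊗ (cst (+ 1) ⊝ mono c (e ℕ.+ s ℕ.* K))

poch : ℤ → ℕ → ℕ → PS
poch c e s N = pochFin c e s (suc N) N

P : ℕ → ℕ → PS
P e s = poch (+ 1) e s

Pm : ℕ → ℕ → PS
Pm e s = poch (- + 1) e s

-- Laurent expansion of the bilateral sum
--   S(q) = Σ_{n∈ℤ} (-1)^n q^{6n²+9n} / (1 - q^{6n+4})
-- (in 0<|q|<1).  For b > 0,  q^a/(1-q^b) = Σ_{j≥0} q^{a+jb};
-- for b < 0,  q^a/(1-q^b) = -q^{a-b}/(1-q^{-b}) = - Σ_{j≥1} q^{a+j|b|}.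

divb : ℕ → ℕ → Bool
divb zero    k = k ≡ᵇ 0
divb (suc b) k = (k % suc b) ≡ᵇ 0

geomCoeff : ℤ → ℤ → ℤ → ℤ
geomCoeff a (+ zero) M = + 0   -- never used (b = 6n+4 ≠ 0)
geomCoeff a (+ suc b) M =
  if (a ≤ᵇ M) ∧ divb (suc b) ∣ M - a ∣ then + 1 else + 0
geomCoeff a -[1+ b ] M =
  if (a + + suc b ≤ᵇ M) ∧ divb (suc b) ∣ M - a ∣ then - + 1 else + 0

sgn : ℤ → ℤ
sgn n = if isOdd ∣ n ∣ then - + 1 else + 1

Sterm : ℤ → ℤ → ℤ
Sterm n M = sgn n * geomCoeff (+ 6 * n * n + + 9 * n) (+ 6 * n + + 4) M

-- coefficient of q^M (M ∈ ℤ) in S(q).  Only n with |n| ≤ |M| + 4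
-- contribute: the lowest exponent of the n-th term is 6n²+9n ≥ n for
-- n ≥ 0 and 6m²-3m-4 ≥ m-4 for n = -m < 0.  We sum over
-- -(|M|+5) ≤ n ≤ |M|+5.
Scoeff : ℤ → ℤ
Scoeff M = Σ< (suc (2 ℕ.* B)) (λ i → Sterm (+ i - + B) M)
  where B = ∣ M ∣ ℕ.+ 5

-- q^k · S(q) as a power series (valid for k ≥ 1, since S = O(q^{-1})):
-- coefficient of q^N is the coefficient of q^{N-k} in S.
qShiftS : ℕ → PS
qShiftS k N = Scoeff (+ N - + k)

R : ℤ → ℤ → ℕ → PS
R s t d n = + N2 s 3 (3 ℕ.* n ℕ.+ d) - + N2 t 3 (3 ℕ.* n ℕ.+ d)

module Submission where

-- Let F = 1 + Σ (N₂(0,3,n) - N₂(1,3,n)) qⁿ, ψ₁ = Σ (-1)ᵏ q^{2k²+k} and ψ₃ = ψ₁(q³). Removing 2 from every part and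
-- inserting a new largest part (Dyson) yields a recurrence for the generating function of M₂-rank ≥ r, whose solution is
-- Σ_{k≥1} (-1)^{k+1} q^{2k²-k+2rk} / ψ₁; hence ψ₁ F = H for a Lambert series H. Sorting exponents modulo 3, ψ₁ has the
-- components a, -ψ₃, 0 and H has the components h₀, h₁, 0, a linear system for the components A, B, C of F. It is solved by
--   ψ₃ h₀ + a h₁ = ψ₃ E = ψ₁³   and (taking the component 0 of the last equality)   ψ₁ E = a³ - q ψ₃³,
-- with a Lambert series E equal to its own component 0. Here α E = W = α h₀ + β h₁ for the theta series α = Σ q^{3k²-2k},
-- β = Σ q^{3k²} and W = Σ (1 - 3k) q^{3k²-2k}, by rearranging the products of theta and Lambert series along lattice lines;
-- and W Σ q^{n²} = η⁴ for η = Σ (-1)ᵏ q^{3k²+k}, by the rotation of order 3 of the Eisenstein lattice and Jacobi's identity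
-- for η³. The triple product turns all theta series into infinite products, which gives the remaining identities a α = ψ₃ β
-- and α (Σ q^{n²}) ψ₁³ = ψ₃ η⁴.

open import Defs
open import Algebra using (CommutativeRing)
open import Algebra.Solver.Ring.AlmostCommutativeRing using (fromCommutativeRing; _-Raw-AlmostCommutative⟶_)
open import Algebra.Structures using (IsCommutativeRing)
open import Data.Bool as Bool using (true; false; if_then_else_; Bool; not; _∨_; _∧_)
open import Data.Empty using (⊥; ⊥-elim)
open import Data.Integer as ℤ using (ℤ; +_; -[1+_]; 0ℤ; 1ℤ; _+_; _*_; -_; _-_; ∣_∣; _%ℕ_; _≤ᵇ_)
open import Data.Integer.Tactic.RingSolver using (solve-∀)
open import Data.List using (List; []; _∷_; _++_; map; filter; cartesianProduct; deduplicate; upTo; foldr; length; replicate; applyUpTo)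
open import Data.List.Membership.Propositional using (_∈_)
open import Data.List.Membership.Propositional.Properties using (∈-filter⁺; ∈-filter⁻; ∈-map⁺; ∈-map⁻; ∈-++⁺ˡ; ∈-++⁺ʳ; ∈-++⁻; ∈-deduplicate⁺; ∈-cartesianProduct⁺; ∈-upTo⁺)
open import Data.List.Membership.Propositional.Properties.WithK using (unique∧set⇒bag)
open import Data.List.Properties using (filter-accept; filter-reject)
open import Data.List.Relation.Binary.BagAndSetEquality using (∼bag⇒↭)
open import Data.List.Relation.Binary.Permutation.Propositional as ↭ using (_↭_)
open import Data.List.Relation.Unary.All as All using (All; []; _∷_)
open import Data.List.Relation.Unary.AllPairs using ([]; _∷_)
open import Data.List.Relation.Unary.Any using (here; there)
open import Data.List.Relation.Unary.Unique.DecPropositional.Properties using (deduplicate-!)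
open import Data.List.Relation.Unary.Unique.Propositional using (Unique)
open import Data.List.Relation.Unary.Unique.Propositional.Properties as Unique using ()
open import Data.Maybe using (Maybe; just; nothing)
open import Data.Nat as ℕ using (ℕ; zero; suc; _≤_; _<_; z≤n; s≤s; _∸_; _/_; _⊔_; _%_; _≡ᵇ_)
open import Data.Nat.Tactic.RingSolver using () renaming (solve-∀ to solveℕ)
open import Data.Product using (_×_; _,_; proj₁; proj₂; ∃; ∃₂)
open import Data.Product.Properties using (≡-dec)
open import Data.Sum using (_⊎_; inj₁; inj₂)
open import Data.Sum.Properties using (inj₁-injective; inj₂-injective)
open import Data.Unit using (⊤; tt)
open import Function using (_∘_; mk⇔; id)
open import Level using (0ℓ)
open import Relation.Binary.Definitions using (DecidableEquality)
open import Relation.Binary.PropositionalEquality hiding (J)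
open import Relation.Nullary using (¬_; Dec; yes; no; does)
open import Relation.Nullary.Decidable using (¬?; ⌊_⌋)
import Algebra.Solver.Ring
import Data.Bool.Properties as Boolₚ
import Data.Integer.Properties as ℤₚ
import Data.Nat.DivMod as ℕ÷
import Data.Nat.Properties as ℕₚ

open ≡-Reasoning

-- The series h₀ and h₁ are never evaluated separately; only the combination ψ₃ h₀ + a h₁ is. The
-- result shows this: B and C come out as products, while A keeps the term h₁ / ψ₃, which is the
-- bilateral sum of the first identity. The expression a³ - q ψ₃³ is the determinant of the linear
-- system for A, B, C. Its value ψ₁ E shares the factor E with the right-hand side ψ₃ E of the
-- combination, so E cancels from the solution. E serves for this because its exponents have the
-- form k (1 + 6j) with k ≠ 0: they are divisible by 3 exactly when k is, and dividing them by 3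
-- reproduces the same family. The factor 3 in H comes from writing the weight [r ≡ 0] - [r ≡ 1]
-- modulo 3 through the indicators of r ≥ s and r ≤ -s. For s ≥ 1 these two have the same generating
-- function, since both satisfy one recurrence. The summand 1 of F stands for the empty partition.
-- It makes ψ₁ F = H hold without correction terms and returns as the -1 of the first identity.

-- Sums of finitely supported families of integers

sumL : {I : Set} → (I → ℤ) → List I → ℤ
sumL f []       = 0ℤ
sumL f (i ∷ is) = f i + sumL f is

module _ {I : Set} where

  sumL-cong : {f g : I → ℤ} (is : List I) → (∀ i → i ∈ is → f i ≡ g i) → sumL f is ≡ sumL g is
  sumL-cong []       h = refl
  sumL-cong (i ∷ is) h = cong₂ _+_ (h i (here refl)) (sumL-cong is (λ j p → h j (there p)))

  sumL-++ : (f : I → ℤ) (is js : List I) → sumL f (is ++ js) ≡ sumL f is + sumL f js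
  sumL-++ f []       js = sym (ℤₚ.+-identityˡ _)
  sumL-++ f (i ∷ is) js = trans (cong (_+_ (f i)) (sumL-++ f is js)) (sym (ℤₚ.+-assoc (f i) _ _))

  sumL-↭ : (f : I → ℤ) {is js : List I} → is ↭ js → sumL f is ≡ sumL f js
  sumL-↭ f ↭.refl         = refl
  sumL-↭ f (↭.prep i p)   = cong (_+_ (f i)) (sumL-↭ f p)
  sumL-↭ f (↭.swap i j p) = trans (cong (λ s → f i + (f j + s)) (sumL-↭ f p)) (swap (f i) (f j) _)
    where
    swap : ∀ a b c → a + (b + c) ≡ b + (a + c)
    swap = solve-∀
  sumL-↭ f (↭.trans p q)  = trans (sumL-↭ f p) (sumL-↭ f q)

  sumL-+ : (f g : I → ℤ) (is : List I) → sumL (λ i → f i + g i) is ≡ sumL f is + sumL g is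
  sumL-+ f g []       = refl
  sumL-+ f g (i ∷ is) = trans (cong (_+_ (f i + g i)) (sumL-+ f g is)) (lem (f i) (g i) _ _)
    where
    lem : ∀ a b c d → a + b + (c + d) ≡ a + c + (b + d)
    lem = solve-∀

  sumL-*ˡ : (c : ℤ) (f : I → ℤ) (is : List I) → sumL (λ i → c * f i) is ≡ c * sumL f is
  sumL-*ˡ c f []       = sym (ℤₚ.*-zeroʳ c)
  sumL-*ˡ c f (i ∷ is) = trans (cong (_+_ (c * f i)) (sumL-*ˡ c f is)) (sym (ℤₚ.*-distribˡ-+ c (f i) _))

  sumL-0 : {f : I → ℤ} (is : List I) → (∀ i → i ∈ is → f i ≡ 0ℤ) → sumL f is ≡ 0ℤ
  sumL-0 []       h = refl
  sumL-0 (i ∷ is) h rewrite h i (here refl) = trans (ℤₚ.+-identityˡ _) (sumL-0 is (λ j p → h j (there p)))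

  nz? : (f : I → ℤ) (i : I) → Dec (f i ≢ 0ℤ)
  nz? f i = ¬? (f i ℤₚ.≟ 0ℤ)

  z? : (f : I → ℤ) (i : I) → Dec (f i ≡ 0ℤ)
  z? f i = f i ℤₚ.≟ 0ℤ

  sumL-filter : (f : I → ℤ) (is : List I) → sumL f (filter (nz? f) is) ≡ sumL f is
  sumL-filter f [] = refl
  sumL-filter f (i ∷ is) with f i ℤₚ.≟ 0ℤ
  ... | yes p rewrite p = trans (sumL-filter f is) (sym (ℤₚ.+-identityˡ _))
  ... | no _  = cong (_+_ (f i)) (sumL-filter f is)

sumL-map : {I J : Set} (f : I → ℤ) (φ : J → I) (js : List J) → sumL f (map φ js) ≡ sumL (f ∘ φ) js
sumL-map f φ []       = refl
sumL-map f φ (j ∷ js) = cong (_+_ (f (φ j))) (sumL-map f φ js)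

-- Coefficientwise, every infinite sum below is a sum of this kind over an index set of integers or pairs, so convergence never enters.
infix 4 _⇓_
record _⇓_ {I : Set} (f : I → ℤ) (s : ℤ) : Set where
  constructor sums
  field
    supp  : List I
    uniq  : Unique supp
    cover : ∀ i → f i ≢ 0ℤ → i ∈ supp
    total : sumL f supp ≡ s
open _⇓_ public

module _ {I : Set} where

  -- Discarding the zero summands leaves two repetition-free lists with the same members, hence
  -- permutations of one another.
  ⇓-unique : {f : I → ℤ} {s t : ℤ} → f ⇓ s → f ⇓ t → s ≡ t
  ⇓-unique {f} {s} {t} (sums L u c e) (sums L′ u′ c′ e′) = begin
    s                         ≡⟨ e ⟨
    sumL f L                  ≡⟨ sumL-filter f L ⟨
    sumL f (filter (nz? f) L)  ≡⟨ sumL-↭ f (∼bag⇒↭ (unique∧set⇒bag (Unique.filter⁺ (nz? f) u) (Unique.filter⁺ (nz? f) u′) (mk⇔ (to {L} c′) (to {L′} c)))) ⟩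
    sumL f (filter (nz? f) L′) ≡⟨ sumL-filter f L′ ⟩
    sumL f L′                 ≡⟨ e′ ⟩
    t                         ∎
    where
    to : ∀ {M M′ : List I} → (∀ i → f i ≢ 0ℤ → i ∈ M′) → ∀ {i} → i ∈ filter (nz? f) M → i ∈ filter (nz? f) M′
    to {M} c p = let q = proj₂ (∈-filter⁻ (nz? f) {xs = M} p) in ∈-filter⁺ (nz? f) (c _ q) q

  ⇓-cong : {f g : I → ℤ} {s : ℤ} → (∀ i → f i ≡ g i) → f ⇓ s → g ⇓ s
  ⇓-cong h (sums L u c e) = sums L u (λ i p → c i (p ∘ trans (sym (h i)))) (trans (sumL-cong L (λ i _ → sym (h i))) e)

  ⇓-≡ : {f : I → ℤ} {s t : ℤ} → s ≡ t → f ⇓ s → f ⇓ t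
  ⇓-≡ refl p = p

  ⇓-0 : {f : I → ℤ} → (∀ i → f i ≡ 0ℤ) → f ⇓ 0ℤ
  ⇓-0 h = sums [] [] (λ i p → ⊥-elim (p (h i))) refl

  ⇓-*ˡ : (c : ℤ) {f : I → ℤ} {s : ℤ} → f ⇓ s → (λ i → c * f i) ⇓ c * s
  ⇓-*ˡ c {f} (sums L u cv e) = sums L u
    (λ i p → cv i (λ q → p (trans (cong (c *_) q) (ℤₚ.*-zeroʳ c)))) (trans (sumL-*ˡ c f L) (cong (c *_) e))

  ⇓-neg : {f : I → ℤ} {s : ℤ} → f ⇓ s → (λ i → - f i) ⇓ - s
  ⇓-neg {f} {s} p = ⇓-cong (λ i → ℤₚ.-1*i≡-i (f i)) (⇓-≡ (ℤₚ.-1*i≡-i s) (⇓-*ˡ (- 1ℤ) p))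

  ⇓-list : {f : I → ℤ} (L : List I) → Unique L → (∀ i → f i ≢ 0ℤ → i ∈ L) → f ⇓ sumL f L
  ⇓-list L u c = sums L u c refl

  -- The zeros of f inside L′ are disjoint from the nonzeros of f inside L.
  ⇓-+ : {f g : I → ℤ} {s t : ℤ} → f ⇓ s → g ⇓ t → (λ i → f i + g i) ⇓ s + t
  ⇓-+ {f} {g} {s} {t} F@(sums L u c e) G@(sums L′ u′ c′ e′) =
    sums M uM (λ i p → cM i (cas i p)) (trans (sumL-+ f g M) (cong₂ _+_ (⇓-unique (⇓-list M uM cMf) F) (⇓-unique (⇓-list M uM cMg) G)))
    where
    M = filter (nz? f) L ++ filter (z? f) L′
    uM = Unique.++⁺ (Unique.filter⁺ (nz? f) u) (Unique.filter⁺ (z? f) u′)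
           (λ (p , q) → proj₂ (∈-filter⁻ (nz? f) {xs = L} p) (proj₂ (∈-filter⁻ (z? f) {xs = L′} q)))
    cMf : ∀ i → f i ≢ 0ℤ → i ∈ M
    cMf i p = ∈-++⁺ˡ (∈-filter⁺ (nz? f) (c i p) p)
    cMg : ∀ i → g i ≢ 0ℤ → i ∈ M
    cMg i p with f i ℤₚ.≟ 0ℤ
    ... | yes z = ∈-++⁺ʳ _ (∈-filter⁺ (z? f) (c′ i p) z)
    ... | no nz = cMf i nz
    cM : ∀ i → f i ≢ 0ℤ ⊎ g i ≢ 0ℤ → i ∈ M
    cM i (inj₁ p) = cMf i p
    cM i (inj₂ p) = cMg i p
    cas : ∀ i → f i + g i ≢ 0ℤ → f i ≢ 0ℤ ⊎ g i ≢ 0ℤ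
    cas i p with f i ℤₚ.≟ 0ℤ
    ... | yes z = inj₂ (λ w → p (cong₂ _+_ z w))
    ... | no nz = inj₁ nz

  ⇓-minus : {f g : I → ℤ} {s t : ℤ} → f ⇓ s → g ⇓ t → (λ i → f i - g i) ⇓ s - t
  ⇓-minus p q = ⇓-+ p (⇓-neg q)

  ⇓-single : {f : I → ℤ} (i : I) → (∀ j → f j ≢ 0ℤ → j ≡ i) → f ⇓ f i
  ⇓-single {f} i h = sums (i ∷ []) ([] ∷ []) (λ j p → here (h j p)) (ℤₚ.+-identityʳ (f i))

  -- Supplies summability of a restricted family whose value is not known in advance, as needed when
  -- a sum is cut into pieces.
  ⇓-sub : {f g : I → ℤ} {s : ℤ} → f ⇓ s → (∀ i → f i ≡ 0ℤ → g i ≡ 0ℤ) → ∃ λ t → g ⇓ t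
  ⇓-sub (sums L u c e) h = _ , ⇓-list L u (λ i p → c i (λ z → p (h i z)))

  ⇓-split : {J : Set} {f : I ⊎ J → ℤ} {s t : ℤ} → f ∘ inj₁ ⇓ s → f ∘ inj₂ ⇓ t → f ⇓ s + t
  ⇓-split {J} {f} (sums L u c e) (sums L′ u′ c′ e′) = sums (map inj₁ L ++ map inj₂ L′)
    (Unique.++⁺ (Unique.map⁺ inj₁-injective u) (Unique.map⁺ inj₂-injective u′) disj) cv
    (trans (sumL-++ f (map inj₁ L) _) (cong₂ _+_ (trans (sumL-map f inj₁ L) e) (trans (sumL-map f inj₂ L′) e′)))
    where
    disj : ∀ {x} → x ∈ map inj₁ L × x ∈ map inj₂ L′ → ⊥
    disj (p , q) with ∈-map⁻ inj₁ p | ∈-map⁻ inj₂ q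
    ... | _ , _ , refl | _ , _ , ()
    cv : ∀ i → f i ≢ 0ℤ → i ∈ map inj₁ L ++ map inj₂ L′
    cv (inj₁ i) p = ∈-++⁺ˡ (∈-map⁺ inj₁ (c i p))
    cv (inj₂ j) p = ∈-++⁺ʳ _ (∈-map⁺ inj₂ (c′ j p))

module _ {I J : Set} {f : I → ℤ} (φ : J → I) (ψ : I → J) (ψφ : ∀ j → ψ (φ j) ≡ j) (φψ : ∀ i → f i ≢ 0ℤ → φ (ψ i) ≡ i) where

  private
    map-unique : (L : List I) → All (λ i → f i ≢ 0ℤ) L → Unique L → Unique (map ψ L)
    map-unique []       _        _        = []
    map-unique (i ∷ L) (p ∷ ps) (a ∷ u) = go L ps a ∷ map-unique L ps u
      where
      go : ∀ M → All (λ k → f k ≢ 0ℤ) M → All (λ k → i ≢ k) M → All (λ k → ψ i ≢ k) (map ψ M)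
      go []      _        _        = []
      go (k ∷ M) (q ∷ qs) (b ∷ bs) =
        (λ e → b (trans (sym (φψ i p)) (trans (cong φ e) (φψ k q)))) ∷ go M qs bs

    all-nz : (L : List I) → All (λ i → f i ≢ 0ℤ) (filter (nz? f) L)
    all-nz L = All.tabulate (λ p → proj₂ (∈-filter⁻ (nz? f) {xs = L} p))

  -- The inverse law `φψ` is demanded on the support only, so `φ` may be any injection whose image
  -- contains the nonzero summands, for instance ℕ into ℤ.
  ⇓-reindex : {s : ℤ} → f ⇓ s → f ∘ φ ⇓ s
  ⇓-reindex {s} (sums L u c e) = sums (map ψ M) (map-unique M (all-nz L) (Unique.filter⁺ (nz? f) u))
    (λ j p → subst (_∈ map ψ M) (ψφ j) (∈-map⁺ ψ (∈-filter⁺ (nz? f) (c (φ j) p) p)))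
    (begin
      sumL (f ∘ φ) (map ψ M)  ≡⟨ sumL-map (f ∘ φ) ψ M ⟩
      sumL (f ∘ φ ∘ ψ) M      ≡⟨ sumL-cong M (λ i p → cong f (φψ i (proj₂ (∈-filter⁻ (nz? f) {xs = L} p)))) ⟩
      sumL f M                ≡⟨ sumL-filter f L ⟩
      sumL f L                ≡⟨ e ⟩
      s                       ∎)
    where M = filter (nz? f) L

  ⇓-unindex : {s : ℤ} → f ∘ φ ⇓ s → f ⇓ s
  ⇓-unindex {s} (sums L u c e) = sums (map φ L)
    (Unique.map⁺ (λ {x} {y} p → trans (sym (ψφ x)) (trans (cong ψ p) (ψφ y))) u)
    (λ i p → subst (_∈ map φ L) (φψ i p) (∈-map⁺ φ (c (ψ i) (λ z → p (trans (cong f (sym (φψ i p))) z)))))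
    (trans (sumL-map f φ L) e)

module _ {I J : Set} {f : I × J → ℤ} {r : I → ℤ} (rows : ∀ i → (λ j → f (i , j)) ⇓ r i) where

  private
    pairs : List I → List (I × J)
    pairs []       = []
    pairs (i ∷ is) = map (i ,_) (supp (rows i)) ++ pairs is

    ∈-pairs⁺ : ∀ {i j} is → i ∈ is → j ∈ supp (rows i) → (i , j) ∈ pairs is
    ∈-pairs⁺ (i ∷ is) (here refl) q = ∈-++⁺ˡ (∈-map⁺ (i ,_) q)
    ∈-pairs⁺ (i ∷ is) (there p)   q = ∈-++⁺ʳ (map (i ,_) (supp (rows i))) (∈-pairs⁺ is p q)

    ∈-pairs⁻ : ∀ {x} is → x ∈ pairs is → proj₁ x ∈ is
    ∈-pairs⁻ (i ∷ is) p with ∈-++⁻ (map (i ,_) (supp (rows i))) p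
    ... | inj₂ q = there (∈-pairs⁻ is q)
    ... | inj₁ q with ∈-map⁻ (i ,_) q
    ...   | _ , _ , refl = here refl

    pairs-unique : ∀ {is} → Unique is → Unique (pairs is)
    pairs-unique {[]}     []      = []
    pairs-unique {i ∷ is} (a ∷ u) = Unique.++⁺ (Unique.map⁺ (λ { refl → refl }) (uniq (rows i))) (pairs-unique u) disj
      where
      disj : ∀ {x} → x ∈ map (i ,_) (supp (rows i)) × x ∈ pairs is → ⊥
      disj (p , q) with ∈-map⁻ (i ,_) p
      ... | _ , _ , refl = All.lookup a (∈-pairs⁻ is q) refl

    sum-pairs : ∀ is → sumL f (pairs is) ≡ sumL r is
    sum-pairs []       = refl
    sum-pairs (i ∷ is) = trans (sumL-++ f (map (i ,_) (supp (rows i))) _)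
      (cong₂ _+_ (trans (sumL-map f (i ,_) (supp (rows i))) (total (rows i))) (sum-pairs is))

  ⇓-fubini : {is : List I} → Unique is → (∀ i j → f (i , j) ≢ 0ℤ → i ∈ is) → f ⇓ sumL r is
  ⇓-fubini {is} u c = sums (pairs is) (pairs-unique u) (λ (i , j) p → ∈-pairs⁺ is (c i j p) (cover (rows i) j p)) (sum-pairs is)

  -- A row with nonzero total contains a nonzero entry, so its index occurs among the first
  -- components of the support of the whole family; this gives finiteness of the set of relevant
  -- rows.
  ⇓-rows : DecidableEquality I → {s : ℤ} → f ⇓ s → r ⇓ s
  ⇓-rows _≟_ {s} F@(sums L u c e) = sums is (deduplicate-! _≟_ (map proj₁ L)) cvr
    (⇓-unique (⇓-fubini (deduplicate-! _≟_ (map proj₁ L)) cv) F)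
    where
    is = deduplicate _≟_ (map proj₁ L)
    cv : ∀ i j → f (i , j) ≢ 0ℤ → i ∈ is
    cv i j p = ∈-deduplicate⁺ _≟_ (∈-map⁺ proj₁ (c (i , j) p))
    cvr : ∀ i → r i ≢ 0ℤ → i ∈ is
    cvr i p with rows i
    ... | sums R uR cR eR = go R eR
      where
      go : ∀ R → sumL (λ j → f (i , j)) R ≡ r i → i ∈ is
      go []      z = ⊥-elim (p (sym z))
      go (j ∷ R) z with f (i , j) ℤₚ.≟ 0ℤ
      ... | no nz = cv i j nz
      ... | yes y = go R (trans (trans (sym (ℤₚ.+-identityˡ _)) (cong (_+ sumL (λ j → f (i , j)) R) (sym y))) z)

⇓-row : {I J : Set} {f : I × J → ℤ} {s : ℤ} → DecidableEquality I → DecidableEquality J → f ⇓ s → ∀ i → ∃ λ t → (λ j → f (i , j)) ⇓ t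
⇓-row {f = f} _≟₁_ _≟₂_ (sums L u c e) i = _ , ⇓-list (deduplicate _≟₂_ (map proj₂ L)) (deduplicate-! _≟₂_ _)
  (λ j p → ∈-deduplicate⁺ _≟₂_ (∈-map⁺ proj₂ (c (i , j) p)))

-- The ring of formal power series

Σ<-cong : ∀ n {f g : ℕ → ℤ} → (∀ i → i < n → f i ≡ g i) → Σ< n f ≡ Σ< n g
Σ<-cong zero    h = refl
Σ<-cong (suc n) h = cong₂ _+_ (Σ<-cong n (λ i p → h i (ℕₚ.m<n⇒m<1+n p))) (h n ℕₚ.≤-refl)

Σ<-0 : ∀ n {f : ℕ → ℤ} → (∀ i → i < n → f i ≡ 0ℤ) → Σ< n f ≡ 0ℤ
Σ<-0 zero    h = refl
Σ<-0 (suc n) h = cong₂ _+_ (Σ<-0 n (λ i p → h i (ℕₚ.m<n⇒m<1+n p))) (h n ℕₚ.≤-refl)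

Σ<-first : ∀ n (f : ℕ → ℤ) → Σ< (suc n) f ≡ f 0 + Σ< n (λ i → f (suc i))
Σ<-first zero    f = trans (ℤₚ.+-identityˡ (f 0)) (sym (ℤₚ.+-identityʳ (f 0)))
Σ<-first (suc n) f = trans (cong (_+ f (suc n)) (Σ<-first n f)) (ℤₚ.+-assoc (f 0) _ _)

Σ<-+ : ∀ n (f g : ℕ → ℤ) → Σ< n (λ i → f i + g i) ≡ Σ< n f + Σ< n g
Σ<-+ zero    f g = refl
Σ<-+ (suc n) f g = trans (cong (_+ (f n + g n)) (Σ<-+ n f g)) (lem (Σ< n f) (Σ< n g) (f n) (g n))
  where
  lem : ∀ a b c d → a + b + (c + d) ≡ a + c + (b + d)
  lem = solve-∀

Σ<-*ˡ : ∀ n c (f : ℕ → ℤ) → Σ< n (λ i → c * f i) ≡ c * Σ< n f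
Σ<-*ˡ zero    c f = sym (ℤₚ.*-zeroʳ c)
Σ<-*ˡ (suc n) c f = trans (cong (_+ c * f n) (Σ<-*ˡ n c f)) (sym (ℤₚ.*-distribˡ-+ c _ (f n)))

private
  tail : PS → PS
  tail f n = f (suc n)

  ⊗-0 : ∀ f g → (f ⊗ g) 0 ≡ f 0 * g 0
  ⊗-0 f g = ℤₚ.+-identityˡ _

  ⊗-suc : ∀ f g n → (f ⊗ g) (suc n) ≡ f 0 * g (suc n) + (tail f ⊗ g) n
  ⊗-suc f g n = Σ<-first (suc n) (λ i → f i * g (suc n ∸ i))

  ⊗-suc′ : ∀ f g n → (f ⊗ g) (suc n) ≡ (f ⊗ tail g) n + f (suc n) * g 0
  ⊗-suc′ f g n = cong₂ _+_
    (Σ<-cong (suc n) (λ i p → cong (λ k → f i * g k) (ℕₚ.+-∸-assoc 1 (ℕₚ.≤-pred p))))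
    (cong (λ k → f (suc n) * g k) (ℕₚ.n∸n≡0 n))

  ⊗-congᵇ : ∀ {f f′ g g′ : PS} n → (∀ i → i ≤ n → f i ≡ f′ i) → (∀ i → i ≤ n → g i ≡ g′ i) → (f ⊗ g) n ≡ (f′ ⊗ g′) n
  ⊗-congᵇ n p q = Σ<-cong (suc n) (λ i l → cong₂ _*_ (p i (ℕₚ.≤-pred l)) (q (n ∸ i) (ℕₚ.m∸n≤m n i)))

  ⊗-comm : ∀ f g n → (f ⊗ g) n ≡ (g ⊗ f) n
  ⊗-comm f g zero    = trans (⊗-0 f g) (trans (ℤₚ.*-comm (f 0) (g 0)) (sym (⊗-0 g f)))
  ⊗-comm f g (suc n) = trans (⊗-suc f g n) (trans (cong₂ _+_ (ℤₚ.*-comm (f 0) _) (⊗-comm (tail f) g n))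
    (trans (ℤₚ.+-comm (g (suc n) * f 0) _) (sym (⊗-suc′ g f n))))

  ⊗-distribˡ : ∀ f g h n → (f ⊗ (g ⊕ h)) n ≡ ((f ⊗ g) ⊕ (f ⊗ h)) n
  ⊗-distribˡ f g h n = trans (Σ<-cong (suc n) (λ i _ → ℤₚ.*-distribˡ-+ (f i) _ _)) (Σ<-+ (suc n) _ _)

  ⊗-distribʳ : ∀ f g h n → ((g ⊕ h) ⊗ f) n ≡ ((g ⊗ f) ⊕ (h ⊗ f)) n
  ⊗-distribʳ f g h n = trans (⊗-comm (g ⊕ h) f n) (trans (⊗-distribˡ f g h n) (cong₂ _+_ (⊗-comm f g n) (⊗-comm f h n)))

  scale : ℤ → PS → PS
  scale c f n = c * f n

  ⊗-scale : ∀ c f g n → (scale c f ⊗ g) n ≡ c * (f ⊗ g) n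
  ⊗-scale c f g n = trans (Σ<-cong (suc n) (λ i _ → ℤₚ.*-assoc c (f i) _)) (Σ<-*ˡ (suc n) c _)

  -- Induction on the coefficient, for all f at once: the tail of f ⊗ g is f₀ times the tail of g
  -- plus (tail f) ⊗ g, and both summands are handled at the smaller index.
  ⊗-assoc : ∀ f g h n → ((f ⊗ g) ⊗ h) n ≡ (f ⊗ (g ⊗ h)) n
  ⊗-assoc f g h zero = trans (⊗-0 (f ⊗ g) h) (trans (cong (_* h 0) (⊗-0 f g))
    (trans (ℤₚ.*-assoc (f 0) _ _) (trans (cong (f 0 *_) (sym (⊗-0 g h))) (sym (⊗-0 f (g ⊗ h))))))
  ⊗-assoc f g h (suc n) = begin
    ((f ⊗ g) ⊗ h) (suc n)
      ≡⟨ ⊗-suc (f ⊗ g) h n ⟩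
    (f ⊗ g) 0 * h (suc n) + (tail (f ⊗ g) ⊗ h) n
      ≡⟨ cong₂ _+_ (cong (_* h (suc n)) (⊗-0 f g)) (⊗-congᵇ {tail (f ⊗ g)} {scale (f 0) (tail g) ⊕ (tail f ⊗ g)} {h} n (λ i _ → ⊗-suc f g i) (λ _ _ → refl)) ⟩
    f 0 * g 0 * h (suc n) + ((scale (f 0) (tail g) ⊕ (tail f ⊗ g)) ⊗ h) n
      ≡⟨ cong (_+_ (f 0 * g 0 * h (suc n))) (⊗-distribʳ h (scale (f 0) (tail g)) (tail f ⊗ g) n) ⟩
    f 0 * g 0 * h (suc n) + ((scale (f 0) (tail g) ⊗ h) n + ((tail f ⊗ g) ⊗ h) n)
      ≡⟨ cong (_+_ (f 0 * g 0 * h (suc n))) (cong₂ _+_ (⊗-scale (f 0) (tail g) h n) (⊗-assoc (tail f) g h n)) ⟩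
    f 0 * g 0 * h (suc n) + (f 0 * (tail g ⊗ h) n + (tail f ⊗ (g ⊗ h)) n)
      ≡⟨ lem (f 0) (g 0) (h (suc n)) _ _ ⟩
    f 0 * (g 0 * h (suc n) + (tail g ⊗ h) n) + (tail f ⊗ (g ⊗ h)) n
      ≡⟨ cong (λ x → f 0 * x + (tail f ⊗ (g ⊗ h)) n) (sym (⊗-suc g h n)) ⟩
    f 0 * (g ⊗ h) (suc n) + (tail f ⊗ (g ⊗ h)) n
      ≡⟨ sym (⊗-suc f (g ⊗ h) n) ⟩
    (f ⊗ (g ⊗ h)) (suc n) ∎
    where
    open ≡-Reasoning
    lem : ∀ a b c d e → a * b * c + (a * d + e) ≡ a * (b * c + d) + e
    lem = solve-∀

  ⊗-cst : ∀ c f n → (cst c ⊗ f) n ≡ c * f n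
  ⊗-cst c f zero    = ⊗-0 (cst c) f
  ⊗-cst c f (suc n) = trans (⊗-suc (cst c) f n)
    (trans (cong (_+_ (c * f (suc n))) (Σ<-0 (suc n) (λ i _ → refl))) (ℤₚ.+-identityʳ _))

infix 4 _≈_
-- A record instead of a bare function type, so that both series can be inferred from a proof.
record _≈_ (f g : PS) : Set where
  constructor coeffs
  field _at_ : ∀ n → f n ≡ g n
open _≈_ public

-- Opaque copies of the series operations keep the type checker from unfolding convolutions.
infixl 6 _+ˢ_ _-ˢ_
infixl 7 _*ˢ_
infix 8 -ˢ_

0ˢ 1ˢ : PS
0ˢ = cst 0ℤ
1ˢ = cst 1ℤ

opaque
  _+ˢ_ _*ˢ_ : PS → PS → PS
  _+ˢ_ = _⊕_
  _*ˢ_ = _⊗_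
  -ˢ_ : PS → PS
  -ˢ_ = ⊖_

  +ˢ-at : ∀ f g n → (f +ˢ g) n ≡ f n + g n
  +ˢ-at f g n = refl
  -ˢ-at : ∀ f n → (-ˢ f) n ≡ - f n
  -ˢ-at f n = refl
  *ˢ-⊗ : ∀ f g → (f *ˢ g) ≡ (f ⊗ g)
  *ˢ-⊗ f g = refl
  *ˢ-at : ∀ f g n → (f *ˢ g) n ≡ Σ< (suc n) (λ i → f i * g (n ∸ i))
  *ˢ-at f g n = refl
  +ˢ-⊕ : ∀ f g → (f +ˢ g) ≡ (f ⊕ g)
  +ˢ-⊕ f g = refl
  0ˢ-at : ∀ n → 0ˢ n ≡ 0ℤ
  0ˢ-at zero    = refl
  0ˢ-at (suc n) = refl
  *ˢ-0 : ∀ f g → (f *ˢ g) 0 ≡ f 0 * g 0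
  *ˢ-0 = ⊗-0
  cst-*ˢ-at : ∀ c f n → (cst c *ˢ f) n ≡ c * f n
  cst-*ˢ-at = ⊗-cst
  *ˢ-congᵇ : ∀ {f f′ g g′ : PS} n → (∀ i → i ≤ n → f i ≡ f′ i) → (∀ i → i ≤ n → g i ≡ g′ i) → (f *ˢ g) n ≡ (f′ *ˢ g′) n
  *ˢ-congᵇ = ⊗-congᵇ

  isCommutativeRing : IsCommutativeRing _≈_ _+ˢ_ _*ˢ_ -ˢ_ 0ˢ 1ˢ
  isCommutativeRing = record
      { isRing = record
        { +-isAbelianGroup = record
          { isGroup = record
            { isMonoid = record
              { isSemigroup = record
                { isMagma = record
                  { isEquivalence = record
                    { refl = coeffs λ _ → refl ; sym = λ p → coeffs λ n → sym (p at n) ; trans = λ p q → coeffs λ n → trans (p at n) (q at n) }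
                  ; ∙-cong = λ p q → coeffs λ n → cong₂ _+_ (p at n) (q at n) }
                ; assoc = λ f g h → coeffs λ n → ℤₚ.+-assoc (f n) (g n) (h n) }
              ; identity = (λ f → coeffs λ n → trans (cong (_+ f n) (0ˢ-at n)) (ℤₚ.+-identityˡ (f n)))
                         , (λ f → coeffs λ n → trans (cong (_+_ (f n)) (0ˢ-at n)) (ℤₚ.+-identityʳ (f n))) }
            ; inverse = (λ f → coeffs λ n → trans (ℤₚ.+-inverseˡ (f n)) (sym (0ˢ-at n)))
                      , (λ f → coeffs λ n → trans (ℤₚ.+-inverseʳ (f n)) (sym (0ˢ-at n)))
            ; ⁻¹-cong = λ p → coeffs λ n → cong -_ (p at n) }
          ; comm = λ f g → coeffs λ n → ℤₚ.+-comm (f n) (g n) }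
        ; *-cong = λ p q → coeffs λ n → ⊗-congᵇ n (λ i _ → p at i) (λ i _ → q at i)
        ; *-assoc = λ f g h → coeffs (⊗-assoc f g h)
        ; *-identity = (λ f → coeffs λ n → trans (⊗-cst 1ℤ f n) (ℤₚ.*-identityˡ (f n)))
                     , (λ f → coeffs λ n → trans (⊗-comm f (cst 1ℤ) n) (trans (⊗-cst 1ℤ f n) (ℤₚ.*-identityˡ (f n))))
        ; distrib = (λ f g h → coeffs (⊗-distribˡ f g h)) , (λ f g h → coeffs (⊗-distribʳ f g h)) }
      ; *-comm = λ f g → coeffs (⊗-comm f g) }

PS-ring : CommutativeRing 0ℓ 0ℓ
PS-ring = record { isCommutativeRing = isCommutativeRing }

_-ˢ_ : PS → PS → PS
f -ˢ g = f +ˢ -ˢ g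

minus-at : ∀ f g n → (f -ˢ g) n ≡ f n - g n
minus-at f g n = trans (+ˢ-at f (-ˢ g) n) (cong (_+_ (f n)) (-ˢ-at g n))

≈-refl : ∀ {f} → f ≈ f
≈-refl = coeffs λ _ → refl

≈-sym : ∀ {f g} → f ≈ g → g ≈ f
≈-sym p = coeffs λ n → sym (p at n)

≈-trans : ∀ {f g h} → f ≈ g → g ≈ h → f ≈ h
≈-trans p q = coeffs λ n → trans (p at n) (q at n)

≡⇒≈ : ∀ {f g} → f ≡ g → f ≈ g
≡⇒≈ refl = ≈-refl

infixr 2 _≈⟨_⟩_ _≈⟨_⟨_
infix 3 _≈∎
_≈⟨_⟩_ : ∀ f {g h} → f ≈ g → g ≈ h → f ≈ h
f ≈⟨ p ⟩ q = ≈-trans p q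
_≈⟨_⟨_ : ∀ f {g h} → g ≈ f → g ≈ h → f ≈ h
f ≈⟨ p ⟨ q = ≈-trans (≈-sym p) q
_≈∎ : ∀ f → f ≈ f
f ≈∎ = ≈-refl

opaque
  unfolding _+ˢ_

  -ˢ-⊝ : ∀ f g → f -ˢ g ≡ f ⊝ g
  -ˢ-⊝ f g = refl
  +ˢ-cong : ∀ {f f′ g g′} → f ≈ f′ → g ≈ g′ → f +ˢ g ≈ f′ +ˢ g′
  +ˢ-cong p q = coeffs λ n → cong₂ _+_ (p at n) (q at n)
  -ˢ-cong : ∀ {f f′ g g′} → f ≈ f′ → g ≈ g′ → f -ˢ g ≈ f′ -ˢ g′
  -ˢ-cong p q = coeffs λ n → cong₂ _-_ (p at n) (q at n)
  *ˢ-cong : ∀ {f f′ g g′} → f ≈ f′ → g ≈ g′ → f *ˢ g ≈ f′ *ˢ g′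
  *ˢ-cong = CommutativeRing.*-cong PS-ring
  negˢ-cong : ∀ {f f′} → f ≈ f′ → -ˢ f ≈ -ˢ f′
  negˢ-cong p = coeffs λ n → cong -_ (p at n)

  *ˢ-comm : ∀ f g → f *ˢ g ≈ g *ˢ f
  *ˢ-comm = CommutativeRing.*-comm PS-ring
  *ˢ-assoc : ∀ f g h → f *ˢ g *ˢ h ≈ f *ˢ (g *ˢ h)
  *ˢ-assoc = CommutativeRing.*-assoc PS-ring
  *ˢ-1 : ∀ f → f *ˢ 1ˢ ≈ f
  *ˢ-1 = CommutativeRing.*-identityʳ PS-ring
  1-*ˢ : ∀ f → 1ˢ *ˢ f ≈ f
  1-*ˢ = CommutativeRing.*-identityˡ PS-ring

*ˢ-congˡ : ∀ {f g g′} → g ≈ g′ → f *ˢ g ≈ f *ˢ g′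
*ˢ-congˡ = *ˢ-cong ≈-refl
*ˢ-congʳ : ∀ {f f′ g} → f ≈ f′ → f *ˢ g ≈ f′ *ˢ g
*ˢ-congʳ p = *ˢ-cong p ≈-refl

opaque
  unfolding _+ˢ_

  cst-+ : ∀ x y → cst (x + y) ≈ cst x +ˢ cst y
  cst-+ x y = coeffs λ { zero → refl ; (suc n) → refl }
  cst-* : ∀ x y → cst (x * y) ≈ cst x *ˢ cst y
  cst-* x y = coeffs λ n → sym (trans (⊗-cst x (cst y) n) (lem n))
    where
    lem : ∀ n → x * cst y n ≡ cst (x * y) n
    lem zero    = refl
    lem (suc n) = ℤₚ.*-zeroʳ x
  cst-neg : ∀ x → cst (- x) ≈ -ˢ cst x
  cst-neg x = coeffs λ { zero → refl ; (suc n) → refl }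
  cst-0 : cst 0ℤ ≈ 0ˢ
  cst-0 = ≈-refl
  cst-1 : cst 1ℤ ≈ 1ˢ
  cst-1 = ≈-refl

private
  cst-morphism : CommutativeRing.rawRing ℤₚ.+-*-commutativeRing -Raw-AlmostCommutative⟶ fromCommutativeRing PS-ring
  cst-morphism = record
    { ⟦_⟧ = cst ; +-homo = cst-+ ; *-homo = cst-* ; -‿homo = cst-neg ; 0-homo = cst-0 ; 1-homo = cst-1 }

  cst≟ : ∀ (x y : ℤ) → Maybe (cst x ≈ cst y)
  cst≟ x y with x ℤₚ.≟ y
  ... | yes refl = just ≈-refl
  ... | no _     = nothing

-- Coefficients are integers embedded by `cst` and compared decidably, so polynomial identities with
-- constants such as 3 or -1 are normalised.
module PS-Solver = Algebra.Solver.Ring (CommutativeRing.rawRing ℤₚ.+-*-commutativeRing) (fromCommutativeRing PS-ring) cst-morphism cst≟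

open PS-Solver using (solve; _:=_; _:+_; _:*_; _:-_; :-_; con)

opaque
  unfolding _+ˢ_

  mono-0-at : ∀ c f n → (mono c 0 *ˢ f) n ≡ c * f n
  mono-0-at c f n = trans (⊗-congᵇ {mono c 0} {cst c} {f} n (λ { zero _ → refl ; (suc i) _ → refl }) (λ _ _ → refl)) (⊗-cst c f n)

  mono-suc-at0 : ∀ c m f → (mono c (suc m) *ˢ f) 0 ≡ 0ℤ
  mono-suc-at0 c m f = refl

  mono-suc-at : ∀ c m f n → (mono c (suc m) *ˢ f) (suc n) ≡ (mono c m *ˢ f) n
  mono-suc-at c m f n = trans (⊗-suc (mono c (suc m)) f n) (ℤₚ.+-identityˡ _)

mono-at-< : ∀ c m f {n} → n < m → (mono c m *ˢ f) n ≡ 0ℤ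
mono-at-< c (suc m) f {zero}  p       = mono-suc-at0 c m f
mono-at-< c (suc m) f {suc n} (s≤s p) = trans (mono-suc-at c m f n) (mono-at-< c m f p)

mono-at-+ : ∀ c m f n → (mono c m *ˢ f) (m ℕ.+ n) ≡ c * f n
mono-at-+ c zero    f n = mono-0-at c f n
mono-at-+ c (suc m) f n = trans (mono-suc-at c m f (m ℕ.+ n)) (mono-at-+ c m f n)

mono-* : ∀ a m b n → mono a m *ˢ mono b n ≈ mono (a * b) (m ℕ.+ n)
mono-* a m b n = coeffs (go m)
  where
  go : ∀ m k → (mono a m *ˢ mono b n) k ≡ mono (a * b) (m ℕ.+ n) k
  go zero k = trans (mono-0-at a (mono b n) k) (lem n k)
    where
    lem : ∀ n k → a * mono b n k ≡ mono (a * b) n k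
    lem zero    zero    = refl
    lem zero    (suc k) = ℤₚ.*-zeroʳ a
    lem (suc n) zero    = ℤₚ.*-zeroʳ a
    lem (suc n) (suc k) = lem n k
  go (suc m) zero    = mono-suc-at0 a m (mono b n)
  go (suc m) (suc k) = trans (mono-suc-at a m (mono b n) k) (go m k)

mono-cst : ∀ c → mono c 0 ≈ cst c
mono-cst c = coeffs λ { zero → refl ; (suc n) → refl }

mono-< : ∀ c {m n} → n < m → mono c m n ≡ 0ℤ
mono-< c {suc m} {zero}  p       = refl
mono-< c {suc m} {suc n} (s≤s p) = mono-< c p

q^_ : ℕ → PS
q^ m = mono 1ℤ m

q^-+ : ∀ m n → q^ m *ˢ q^ n ≈ q^ (m ℕ.+ n)
q^-+ m n = mono-* 1ℤ m 1ℤ n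

q^-0 : q^ 0 ≈ 1ˢ
q^-0 = ≈-trans (mono-cst 1ℤ) cst-1

private
  if-T : ∀ b {x y : ℤ} → Bool.T b → (if b then x else y) ≡ x
  if-T true _ = refl

  if-F : ∀ b {x y : ℤ} → (Bool.T b → ⊥) → (if b then x else y) ≡ y
  if-F true  h = ⊥-elim (h _)
  if-F false h = refl

  invUpTo-suc : ∀ f N {k} → k ≤ N → invUpTo f (suc N) k ≡ invUpTo f N k
  invUpTo-suc f N {k} p = if-T (k ℕ.≤ᵇ N) (ℕₚ.≤⇒≤ᵇ p)

  invUpTo-+ : ∀ f k d → invUpTo f (d ℕ.+ k) k ≡ inv f k
  invUpTo-+ f k zero    = refl
  invUpTo-+ f k (suc d) = trans (invUpTo-suc f (d ℕ.+ k) (ℕₚ.m≤n+m k d)) (invUpTo-+ f k d)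

  invUpTo-≤ : ∀ f {k N} → k ≤ N → invUpTo f N k ≡ inv f k
  invUpTo-≤ f {k} {N} p = subst (λ M → invUpTo f M k ≡ inv f k) (ℕₚ.m∸n+n≡m p) (invUpTo-+ f k (N ∸ k))

  -- All tables `invUpTo f N` agree at the indices they have already settled, so the diagonal read
  -- off by `inv` satisfies the recurrence of a reciprocal.
  inv-suc : ∀ f N → inv f (suc N) ≡ - (Σ< (suc N) (λ i → f (suc i) * inv f (N ∸ i)))
  inv-suc f N = trans (if-F (suc N ℕ.≤ᵇ N) (λ t → ℕₚ.<-irrefl refl (ℕₚ.≤ᵇ⇒≤ (suc N) N t)))
    (cong -_ (Σ<-cong (suc N) (λ i _ → cong (f (suc i) *_) (invUpTo-≤ f (ℕₚ.m∸n≤m N i)))))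

opaque
  unfolding _+ˢ_

  *ˢ-inv : ∀ f → f 0 ≡ 1ℤ → f *ˢ inv f ≈ 1ˢ
  *ˢ-inv f p = coeffs go
    where
    go : ∀ n → (f ⊗ inv f) n ≡ cst 1ℤ n
    go zero    = trans (⊗-0 f (inv f)) (trans (ℤₚ.*-identityʳ (f 0)) p)
    go (suc n) = trans (⊗-suc f (inv f) n) (trans (cong₂ (λ x y → x * y + (tail f ⊗ inv f) n) p (inv-suc f n)) (lem ((tail f ⊗ inv f) n)))
      where
      lem : ∀ x → 1ℤ * - x + x ≡ 0ℤ
      lem = solve-∀

*ˢ-unit : ∀ {f g} → f 0 ≡ 1ℤ → g 0 ≡ 1ℤ → (f *ˢ g) 0 ≡ 1ℤ
*ˢ-unit {f} {g} p q = trans (*ˢ-0 f g) (cong₂ _*_ p q)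

-- A series with constant term 1 is a unit. All later divisions by theta series and products are
-- cancellations of this kind.
*ˢ-cancelˡ : ∀ {f g h} → f 0 ≡ 1ℤ → f *ˢ g ≈ f *ˢ h → g ≈ h
*ˢ-cancelˡ {f} {g} {h} p e =
  g                 ≈⟨ undo g ⟩
  inv f *ˢ (f *ˢ g) ≈⟨ *ˢ-congˡ e ⟩
  inv f *ˢ (f *ˢ h) ≈⟨ undo h ⟨
  h                 ≈∎
  where
  undo : ∀ g → g ≈ inv f *ˢ (f *ˢ g)
  undo g = ≈-trans (≈-sym (1-*ˢ g)) (≈-trans (*ˢ-congʳ (≈-sym (*ˢ-inv f p)))
    (solve 3 (λ a b c → a :* b :* c := b :* (a :* c)) ≈-refl f (inv f) g))

⊘-unique : ∀ {f g h} → g 0 ≡ 1ℤ → h *ˢ g ≈ f → (f ⊘ g) ≈ h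
⊘-unique {f} {g} {h} p e =
  f ⊘ g             ≈⟨ ≡⇒≈ (sym (*ˢ-⊗ f (inv g))) ⟩
  f *ˢ inv g        ≈⟨ *ˢ-congʳ e ⟨
  h *ˢ g *ˢ inv g   ≈⟨ *ˢ-assoc h g (inv g) ⟩
  h *ˢ (g *ˢ inv g) ≈⟨ *ˢ-congˡ (*ˢ-inv g p) ⟩
  h *ˢ 1ˢ           ≈⟨ *ˢ-1 h ⟩
  h                 ≈∎

infix 4 _≈[_]_
_≈[_]_ : PS → ℕ → PS → Set
f ≈[ n ] g = ∀ i → i < n → f i ≡ g i

≈[]-* : ∀ {n f f′ g g′} → f ≈[ n ] f′ → g ≈[ n ] g′ → f *ˢ g ≈[ n ] f′ *ˢ g′
≈[]-* {n} {f} {f′} {g} {g′} p q i l = *ˢ-congᵇ {f} {f′} {g} {g′} i (λ j m → p j (ℕₚ.≤-<-trans m l)) (λ j m → q j (ℕₚ.≤-<-trans m l))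

mono-≈[] : ∀ c {m n} → n ≤ m → mono c m ≈[ n ] 0ˢ
mono-≈[] c p i l = trans (mono-< c (ℕₚ.<-≤-trans l p)) (sym (0ˢ-at i))

-- The derivation q d/dq.
D : PS → PS
D f n = + n * f n

opaque
  unfolding _+ˢ_

  D-* : ∀ f g → D (f *ˢ g) ≈ D f *ˢ g +ˢ f *ˢ D g
  D-* f g = coeffs λ n → trans (sym (Σ<-*ˡ (suc n) (+ n) _))
    (trans (Σ<-cong (suc n) (λ i p → trans (cong (λ m → m * (f i * g (n ∸ i))) (split n i (ℕₚ.≤-pred p))) (lem (+ i) (+ (n ∸ i)) (f i) (g (n ∸ i)))))
      (Σ<-+ (suc n) _ _))
    where
    split : ∀ n i → i ≤ n → + n ≡ + i + + (n ∸ i)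
    split n i p = trans (cong +_ (sym (ℕₚ.m+[n∸m]≡n p))) (ℤₚ.pos-+ i (n ∸ i))
    lem : ∀ a b x y → (a + b) * (x * y) ≡ a * x * y + x * (b * y)
    lem = solve-∀

D-cong : ∀ {f g} → f ≈ g → D f ≈ D g
D-cong p = coeffs λ n → cong (+ n *_) (p at n)

-- Components of a series modulo 3

U : ℕ → PS → PS
U d f n = f (3 ℕ.* n ℕ.+ d)

-- The substitution q ↦ q³, by recursion in steps of three so that the vanishing coefficients
-- compute.
dil : PS → PS
dil f 0 = f 0
dil f 1 = 0ℤ
dil f 2 = 0ℤ
dil f (suc (suc (suc n))) = dil (λ m → f (suc m)) n

U-cong : ∀ d {f g} → f ≈ g → U d f ≈ U d g
U-cong d p = coeffs λ n → p at (3 ℕ.* n ℕ.+ d)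

3*suc : ∀ n d → 3 ℕ.* suc n ℕ.+ d ≡ 3 ℕ.+ (3 ℕ.* n ℕ.+ d)
3*suc n d = cong (ℕ._+ d) (ℕₚ.*-suc 3 n)

private
  dil-split : ∀ f → dil f ≈ cst (f 0) +ˢ q^ 3 *ˢ dil (tail f)
  dil-split f = coeffs λ n → sym (trans (+ˢ-at _ _ n) (go n))
    where
    go : ∀ n → cst (f 0) n + (q^ 3 *ˢ dil (tail f)) n ≡ dil f n
    go 0 = trans (cong (_+_ (f 0)) (mono-at-< 1ℤ 3 (dil (tail f)) (s≤s z≤n))) (ℤₚ.+-identityʳ (f 0))
    go 1 = trans (ℤₚ.+-identityˡ _) (mono-at-< 1ℤ 3 (dil (tail f)) (s≤s (s≤s z≤n)))
    go 2 = trans (ℤₚ.+-identityˡ _) (mono-at-< 1ℤ 3 (dil (tail f)) (s≤s (s≤s (s≤s z≤n))))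
    go (suc (suc (suc n))) = trans (ℤₚ.+-identityˡ _) (trans (mono-at-+ 1ℤ 3 (dil (tail f)) n) (ℤₚ.*-identityˡ _))

  dil-*-at : ∀ f g n → (dil f *ˢ g) n ≡ f 0 * g n + (q^ 3 *ˢ (dil (tail f) *ˢ g)) n
  dil-*-at f g n = trans (≈-trans (*ˢ-congʳ (dil-split f)) (solve 4 (λ a b c d → (a :+ b :* c) :* d := a :* d :+ b :* (c :* d)) ≈-refl (cst (f 0)) (q^ 3) (dil (tail f)) g) at n)
    (trans (+ˢ-at _ _ n) (cong (_+ (q^ 3 *ˢ (dil (tail f) *ˢ g)) n) (cst-*ˢ-at (f 0) g n)))

opaque
  unfolding _+ˢ_

  -- Multiplication by a series in q³ respects residues of exponents. The coefficients of f are
  -- peeled off one at a time, each moving the remainder by q³, that is by one index inside a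
  -- component.
  U-dil-* : ∀ d → d < 3 → ∀ f g → U d (dil f *ˢ g) ≈ f *ˢ U d g
  U-dil-* d d<3 f g = coeffs (go f)
    where
    go : ∀ f n → (dil f *ˢ g) (3 ℕ.* n ℕ.+ d) ≡ (f ⊗ U d g) n
    go f zero = trans (dil-*-at f g d) (trans (cong (_+_ (f 0 * g d)) (mono-at-< 1ℤ 3 (dil (tail f) *ˢ g) d<3))
      (trans (ℤₚ.+-identityʳ _) (sym (⊗-0 f (U d g)))))
    go f (suc n) = trans (dil-*-at f g (3 ℕ.* suc n ℕ.+ d)) (trans (cong (_+_ (f 0 * U d g (suc n)))
      (trans (cong (q^ 3 *ˢ (dil (tail f) *ˢ g)) (3*suc n d))
        (trans (mono-at-+ 1ℤ 3 (dil (tail f) *ˢ g) (3 ℕ.* n ℕ.+ d)) (trans (ℤₚ.*-identityˡ _) (go (tail f) n)))))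
      (sym (⊗-suc f (U d g) n)))

  U-+ : ∀ d f g → U d (f +ˢ g) ≈ U d f +ˢ U d g
  U-+ d f g = ≈-refl

U-ext : ∀ {f g} → U 0 f ≈ U 0 g → U 1 f ≈ U 1 g → U 2 f ≈ U 2 g → f ≈ g
U-ext {f} {g} p q r = coeffs (go f g hyp)
  where
  hyp : ∀ d → d < 3 → ∀ k → f (3 ℕ.* k ℕ.+ d) ≡ g (3 ℕ.* k ℕ.+ d)
  hyp 0 _ k = p at k
  hyp 1 _ k = q at k
  hyp 2 _ k = r at k
  hyp (suc (suc (suc d))) (s≤s (s≤s (s≤s ()))) k
  go : ∀ f g → (∀ d → d < 3 → ∀ k → f (3 ℕ.* k ℕ.+ d) ≡ g (3 ℕ.* k ℕ.+ d)) → ∀ n → f n ≡ g n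
  go f g h 0 = h 0 (s≤s z≤n) 0
  go f g h 1 = h 1 (s≤s (s≤s z≤n)) 0
  go f g h 2 = h 2 ℕₚ.≤-refl 0
  go f g h (suc (suc (suc n))) = go (λ m → f (3 ℕ.+ m)) (λ m → g (3 ℕ.+ m))
    (λ d l k → subst (λ m → f m ≡ g m) (3*suc k d) (h d l (suc k))) n

U-q^1-0 : ∀ f → U 0 (q^ 1 *ˢ f) ≈ q^ 1 *ˢ U 2 f
U-q^1-0 f = coeffs λ
  { zero → trans (mono-suc-at0 1ℤ 0 f) (sym (mono-suc-at0 1ℤ 0 (U 2 f)))
  ; (suc n) → trans (cong (q^ 1 *ˢ f) (trans (3*suc n 0) (cong (3 ℕ.+_) (ℕₚ.+-identityʳ (3 ℕ.* n)))))
      (trans (mono-at-+ 1ℤ 1 f (2 ℕ.+ 3 ℕ.* n)) (trans (cong (λ k → 1ℤ * f k) (ℕₚ.+-comm 2 (3 ℕ.* n)))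
        (sym (mono-at-+ 1ℤ 1 (U 2 f) n)))) }

U-q^1-suc : ∀ d f → U (suc d) (q^ 1 *ˢ f) ≈ U d f
U-q^1-suc d f = coeffs λ n → trans (cong (q^ 1 *ˢ f) (ℕₚ.+-suc (3 ℕ.* n) d))
  (trans (mono-at-+ 1ℤ 1 f (3 ℕ.* n ℕ.+ d)) (ℤₚ.*-identityˡ _))

U-dil-0 : ∀ f → U 0 (dil f) ≈ f
U-dil-0 f = coeffs (go f)
  where
  go : ∀ f n → dil f (3 ℕ.* n ℕ.+ 0) ≡ f n
  go f zero    = refl
  go f (suc n) = trans (cong (dil f) (3*suc n 0)) (go (tail f) n)

U-dil-suc : ∀ d → suc d < 3 → ∀ f → U (suc d) (dil f) ≈ 0ˢ
U-dil-suc d d<3 f = coeffs λ n → trans (go d d<3 f n) (sym (0ˢ-at n))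
  where
  go : ∀ d → suc d < 3 → ∀ f n → dil f (3 ℕ.* n ℕ.+ suc d) ≡ 0ℤ
  go 0 _ f zero = refl
  go 1 _ f zero = refl
  go (suc (suc d)) (s≤s (s≤s (s≤s ()))) f zero
  go d l f (suc n) = trans (cong (dil f) (3*suc n (suc d))) (go d l (tail f) n)

-- In Horner form only multiplication by a single q has to be traced through the residues; a carry
-- from residue 2 to residue 0 costs one q in the components.
dissect : ∀ f → f ≈ dil (U 0 f) +ˢ q^ 1 *ˢ (dil (U 1 f) +ˢ q^ 1 *ˢ dil (U 2 f))
dissect f = U-ext
  (≈-sym (≈-trans (U-+ 0 _ _) (≈-trans (+ˢ-cong (U-dil-0 _) (≈-trans (U-q^1-0 _) (*ˢ-congˡ (≈-trans (U-+ 2 _ _) (+ˢ-cong (U-dil-suc 1 3≤3 _) (≈-trans (U-q^1-suc 1 _) (U-dil-suc 0 2≤3 _)))))))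
    (solve 2 (λ a b → a :+ b :* (con 0ℤ :+ con 0ℤ) := a) ≈-refl (U 0 f) (q^ 1)))))
  (≈-sym (≈-trans (U-+ 1 _ _) (≈-trans (+ˢ-cong (U-dil-suc 0 2≤3 _) (≈-trans (U-q^1-suc 0 _) (≈-trans (U-+ 0 _ _) (+ˢ-cong (U-dil-0 _) (≈-trans (U-q^1-0 _) (*ˢ-congˡ (U-dil-suc 1 3≤3 _)))))))
    (solve 2 (λ a b → con 0ℤ :+ (a :+ b :* con 0ℤ) := a) ≈-refl (U 1 f) (q^ 1)))))
  (≈-sym (≈-trans (U-+ 2 _ _) (≈-trans (+ˢ-cong (U-dil-suc 1 3≤3 _) (≈-trans (U-q^1-suc 1 _) (≈-trans (U-+ 1 _ _) (+ˢ-cong (U-dil-suc 0 2≤3 _) (≈-trans (U-q^1-suc 0 _) (U-dil-0 _))))))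
    (solve 1 (λ a → con 0ℤ :+ (con 0ℤ :+ a) := a) ≈-refl (U 2 f)))))
  where
  3≤3 : 3 ≤ 3
  3≤3 = ℕₚ.≤-refl
  2≤3 : 2 ≤ 3
  2≤3 = ℕₚ.n≤1+n 2

module _ (f g : PS) where

  private
    f0 = U 0 f
    f1 = U 1 f
    f2 = U 2 f
    exp : f *ˢ g ≈ dil f0 *ˢ g +ˢ q^ 1 *ˢ (dil f1 *ˢ g +ˢ q^ 1 *ˢ (dil f2 *ˢ g))
    exp = ≈-trans (*ˢ-congʳ (dissect f)) (solve 5 (λ a b c q g → (a :+ q :* (b :+ q :* c)) :* g := a :* g :+ q :* (b :* g :+ q :* (c :* g))) ≈-refl _ _ _ _ _)

  U-*-0 : U 0 (f *ˢ g) ≈ U 0 f *ˢ U 0 g +ˢ q^ 1 *ˢ (U 1 f *ˢ U 2 g +ˢ U 2 f *ˢ U 1 g)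
  U-*-0 = ≈-trans (U-cong 0 exp) (≈-trans (U-+ 0 _ _) (+ˢ-cong (U-dil-* 0 (s≤s z≤n) f0 g)
    (≈-trans (U-q^1-0 _) (*ˢ-congˡ (≈-trans (U-+ 2 _ _) (+ˢ-cong (U-dil-* 2 ℕₚ.≤-refl f1 g)
      (≈-trans (U-q^1-suc 1 _) (U-dil-* 1 (ℕₚ.n≤1+n 2) f2 g))))))))

  U-*-1 : U 1 (f *ˢ g) ≈ U 0 f *ˢ U 1 g +ˢ (U 1 f *ˢ U 0 g +ˢ q^ 1 *ˢ (U 2 f *ˢ U 2 g))
  U-*-1 = ≈-trans (U-cong 1 exp) (≈-trans (U-+ 1 _ _) (+ˢ-cong (U-dil-* 1 (ℕₚ.n≤1+n 2) f0 g)
    (≈-trans (U-q^1-suc 0 _) (≈-trans (U-+ 0 _ _) (+ˢ-cong (U-dil-* 0 (s≤s z≤n) f1 g)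
      (≈-trans (U-q^1-0 _) (*ˢ-congˡ (U-dil-* 2 ℕₚ.≤-refl f2 g))))))))

  U-*-2 : U 2 (f *ˢ g) ≈ U 0 f *ˢ U 2 g +ˢ (U 1 f *ˢ U 1 g +ˢ U 2 f *ˢ U 0 g)
  U-*-2 = ≈-trans (U-cong 2 exp) (≈-trans (U-+ 2 _ _) (+ˢ-cong (U-dil-* 2 ℕₚ.≤-refl f0 g)
    (≈-trans (U-q^1-suc 1 _) (≈-trans (U-+ 1 _ _) (+ˢ-cong (U-dil-* 1 (ℕₚ.n≤1+n 2) f1 g)
      (≈-trans (U-q^1-suc 0 _) (U-dil-* 0 (s≤s z≤n) f2 g)))))))

-- Signs, integer exponents and indexed families

ℤ-ind : (P : ℤ → Set) → P 0ℤ → (∀ k → P k → P (1ℤ + k)) → (∀ k → P (1ℤ + k) → P k) → ∀ k → P k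
ℤ-ind P z up dn (+ zero)        = z
ℤ-ind P z up dn (+ suc n)       = up (+ n) (ℤ-ind P z up dn (+ n))
ℤ-ind P z up dn -[1+ zero ]     = dn -[1+ 0 ] z
ℤ-ind P z up dn -[1+ suc n ]    = dn -[1+ suc n ] (ℤ-ind P z up dn -[1+ n ])

private
  isOdd-suc : ∀ n → isOdd (suc n) ≡ not (isOdd n)
  isOdd-suc 0             = refl
  isOdd-suc 1             = refl
  isOdd-suc (suc (suc n)) = isOdd-suc n

  if-not : ∀ b → (if not b then - 1ℤ else 1ℤ) ≡ - (if b then - 1ℤ else 1ℤ)
  if-not true  = refl
  if-not false = refl

  sgnℕ : ∀ n → (if isOdd (suc n) then - 1ℤ else 1ℤ) ≡ - (if isOdd n then - 1ℤ else 1ℤ)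
  sgnℕ n = trans (cong (λ b → if b then - 1ℤ else 1ℤ) (isOdd-suc n)) (if-not (isOdd n))

sgn-suc : ∀ k → sgn (1ℤ + k) ≡ - sgn k
sgn-suc (+ n)        = sgnℕ n
sgn-suc -[1+ zero ]  = refl
sgn-suc -[1+ suc n ] = sym (trans (cong -_ (sgnℕ (suc n))) (ℤₚ.neg-involutive _))

sgn-+ : ∀ a b → sgn (a + b) ≡ sgn a * sgn b
sgn-+ a b = ℤ-ind (λ a → sgn (a + b) ≡ sgn a * sgn b)
  (trans (cong sgn (ℤₚ.+-identityˡ b)) (sym (ℤₚ.*-identityˡ (sgn b))))
  (λ k p → trans (cong sgn (ℤₚ.+-assoc 1ℤ k b)) (trans (sgn-suc (k + b)) (trans (cong -_ p)
    (trans (ℤₚ.neg-distribˡ-* (sgn k) (sgn b)) (cong (_* sgn b) (sym (sgn-suc k)))))))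
  (λ k p → ℤₚ.neg-injective (trans (sym (sgn-suc (k + b))) (trans (cong sgn (sym (ℤₚ.+-assoc 1ℤ k b)))
    (trans p (trans (cong (_* sgn b) (sgn-suc k)) (sym (ℤₚ.neg-distribˡ-* (sgn k) (sgn b))))))))
  a

sgn-neg : ∀ k → sgn (- k) ≡ sgn k
sgn-neg k = cong (λ n → if isOdd n then - 1ℤ else 1ℤ) (ℤₚ.∣-i∣≡∣i∣ k)

sgn² : ∀ k → sgn k * sgn k ≡ 1ℤ
sgn² k with isOdd ∣ k ∣
... | true  = refl
... | false = refl

sgn-2* : ∀ k → sgn (k + k) ≡ 1ℤ
sgn-2* k = trans (sgn-+ k k) (sgn² k)

opaque
  -- The coefficient of q^b in q^a, with integer exponents: substitutions and shifts of exponents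
  -- are then identities of integer polynomials, even where an intermediate exponent is negative.
  δ : ℤ → ℤ → ℤ
  δ a b = if ⌊ a ℤₚ.≟ b ⌋ then 1ℤ else 0ℤ

  δ-≡ : ∀ {a b} → a ≡ b → δ a b ≡ 1ℤ
  δ-≡ {a} {b} p with a ℤₚ.≟ b
  ... | yes _ = refl
  ... | no ¬p = ⊥-elim (¬p p)

  δ-≢ : ∀ {a b} → a ≢ b → δ a b ≡ 0ℤ
  δ-≢ {a} {b} p with a ℤₚ.≟ b
  ... | yes q = ⊥-elim (p q)
  ... | no _  = refl

  δ-nz : ∀ {a b} → δ a b ≢ 0ℤ → a ≡ b
  δ-nz {a} {b} p with a ℤₚ.≟ b
  ... | yes q = q
  ... | no _  = ⊥-elim (p refl)

δ-iff : ∀ {a b c d} → (a ≡ b → c ≡ d) → (c ≡ d → a ≡ b) → δ a b ≡ δ c d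
δ-iff {a} {b} {c} {d} f g with a ℤₚ.≟ b
... | yes p = trans (δ-≡ p) (sym (δ-≡ (f p)))
... | no ¬p = trans (δ-≢ ¬p) (sym (δ-≢ (¬p ∘ g)))

δ-+ : ∀ a c n → δ (c + a) n ≡ δ a (n - c)
δ-+ a c n = δ-iff (λ p → trans (lem a c) (cong (_- c) p)) (λ p → trans (cong (_+_ c) p) (lem′ c n))
  where
  lem : ∀ a c → a ≡ c + a - c
  lem = solve-∀
  lem′ : ∀ c n → c + (n - c) ≡ n
  lem′ = solve-∀

*-nzˡ : ∀ {a b} → a * b ≢ 0ℤ → a ≢ 0ℤ
*-nzˡ {a} {b} p refl = p (ℤₚ.*-zeroˡ b)

*-nzʳ : ∀ {a b} → a * b ≢ 0ℤ → b ≢ 0ℤ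
*-nzʳ {a} {b} p refl = p (ℤₚ.*-zeroʳ a)

record Sized (I : Set) : Set where
  field
    size        : I → ℕ
    ball        : ℕ → List I
    ball-unique : ∀ n → Unique (ball n)
    ball-cover  : ∀ n i → size i ℕ.≤ n → i ∈ ball n
    _≟ᴵ_        : DecidableEquality I
open Sized {{...}} public

instance
  Sized-ℕ : Sized ℕ
  Sized-ℕ = record
    { size = λ n → n ; ball = λ n → upTo (suc n) ; ball-unique = λ n → Unique.upTo⁺ (suc n)
    ; ball-cover = λ n i p → ∈-upTo⁺ (s≤s p) ; _≟ᴵ_ = ℕₚ._≟_ }

  Sized-ℤ : Sized ℤ
  Sized-ℤ = record
    { size = ∣_∣ ; ball = λ n → map +_ (upTo (suc n)) ++ map -[1+_] (upTo n)
    ; ball-unique = λ n → Unique.++⁺ (Unique.map⁺ ℤₚ.+-injective (Unique.upTo⁺ (suc n)))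
        (Unique.map⁺ ℤₚ.-[1+-injective (Unique.upTo⁺ n)) disj
    ; ball-cover = λ { n (+ i) p → ∈-++⁺ˡ (∈-map⁺ +_ (∈-upTo⁺ (s≤s p)))
                     ; n -[1+ i ] p → ∈-++⁺ʳ (map +_ (upTo (suc n))) (∈-map⁺ -[1+_] (∈-upTo⁺ p)) }
    ; _≟ᴵ_ = ℤₚ._≟_ }
    where
    disj : ∀ {n m} {x : ℤ} → x ∈ map +_ (upTo n) × x ∈ map -[1+_] (upTo m) → ⊥
    disj (p , q) with ∈-map⁻ +_ p | ∈-map⁻ -[1+_] q
    ... | _ , _ , refl | _ , _ , ()

  Sized-× : {I J : Set} {{_ : Sized I}} {{_ : Sized J}} → Sized (I × J)
  Sized-× = record
    { size = λ (i , j) → size i ℕ.⊔ size j ; ball = λ n → cartesianProduct (ball n) (ball n)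
    ; ball-unique = λ n → Unique.cartesianProduct⁺ (ball-unique n) (ball-unique n)
    ; ball-cover = λ n (i , j) p → ∈-cartesianProduct⁺ (ball-cover n i (ℕₚ.m⊔n≤o⇒m≤o (size i) (size j) p))
        (ball-cover n j (ℕₚ.m⊔n≤o⇒n≤o (size i) (size j) p))
    ; _≟ᴵ_ = ≡-dec _≟ᴵ_ _≟ᴵ_ }

-- An exponent has to be a natural number only where the weight is nonzero. The slack 2 makes room
-- for `fJ`, whose exponent k² + k vanishes at the index k = -1 of size 1.
record Fam (I : Set) {{_ : Sized I}} : Set where
  constructor fam
  field
    wt ex : I → ℤ
    bound : ∀ i → wt i ≢ 0ℤ → ∃ λ m → ex i ≡ + m × size i ℕ.≤ m ℕ.+ 2
open Fam public

cf : {I : Set} → (w e : I → ℤ) → ℤ → I → ℤ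
cf w e N i = w i * δ (e i) N

module _ {I : Set} {{S : Sized I}} where

  opaque
    gf : Fam I → PS
    gf F n = sumL (cf (wt F) (ex F) (+ n)) (ball (n ℕ.+ 2))

    gf-⇓ : ∀ F n → cf (wt F) (ex F) (+ n) ⇓ gf F n
    gf-⇓ F n = ⇓-list (ball (n ℕ.+ 2)) (ball-unique _) λ i p → ball-cover (n ℕ.+ 2) i (lem i p)
      where
      lem : ∀ i → cf (wt F) (ex F) (+ n) i ≢ 0ℤ → size i ℕ.≤ n ℕ.+ 2
      lem i p with bound F i (*-nzˡ p)
      ... | m , e , b = subst (λ k → size i ℕ.≤ k ℕ.+ 2) (ℤₚ.+-injective (trans (sym e) (δ-nz (*-nzʳ {wt F i} p)))) b

  gf-unique : ∀ F f → (∀ n → cf (wt F) (ex F) (+ n) ⇓ f n) → f ≈ gf F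
  gf-unique F f h = coeffs λ n → ⇓-unique (h n) (gf-⇓ F n)

⇓-* : {I J : Set} {{_ : Sized I}} {f : I → ℤ} {g : J → ℤ} {s t : ℤ} → f ⇓ s → g ⇓ t → (λ (i , j) → f i * g j) ⇓ s * t
⇓-* {f = f} {g} {s} {t} F G = ⇓-≡ tot (⇓-fubini {f = λ (i , j) → f i * g j} (λ i → ⇓-*ˡ (f i) G) (uniq F) (λ i j p → cover F i (*-nzˡ p)))
  where
  tot : sumL (λ i → f i * t) (supp F) ≡ s * t
  tot = trans (sumL-cong (supp F) (λ i _ → ℤₚ.*-comm (f i) t)) (trans (sumL-*ˡ t f (supp F)) (trans (cong (_*_ t) (total F)) (ℤₚ.*-comm t s)))

⇓-Σ< : {I : Set} (n : ℕ) {f : ℕ → I → ℤ} {s : ℕ → ℤ} → (∀ a → a ℕ.< n → f a ⇓ s a) → (λ i → Σ< n (λ a → f a i)) ⇓ Σ< n s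
⇓-Σ< zero    h = ⇓-0 (λ _ → refl)
⇓-Σ< (suc n) h = ⇓-+ (⇓-Σ< n (λ a p → h a (ℕₚ.m<n⇒m<1+n p))) (h n ℕₚ.≤-refl)

Σ<-single : ∀ n {f : ℕ → ℤ} k → k ℕ.< n → (∀ a → a ≢ k → f a ≡ 0ℤ) → Σ< n f ≡ f k
Σ<-single (suc n) {f} k k<n h with k ℕₚ.≟ n
... | yes refl = trans (cong (_+ f n) (Σ<-0 n (λ i p → h i (ℕₚ.<⇒≢ p)))) (ℤₚ.+-identityˡ (f n))
... | no k≢n   = trans (cong₂ _+_ (Σ<-single n k (ℕₚ.≤∧≢⇒< (ℕₚ.≤-pred k<n) k≢n) h) (h n (k≢n ∘ sym))) (ℤₚ.+-identityʳ (f k))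

δ-conv : ∀ e f n → Σ< (suc n) (λ a → δ (+ e) (+ a) * δ (+ f) (+ (n ∸ a))) ≡ δ (+ e + + f) (+ n)
δ-conv e f n with e ℕ.+ f ℕₚ.≟ n
... | yes refl = trans (Σ<-single (suc (e ℕ.+ f)) e (s≤s (ℕₚ.m≤m+n e f)) (λ a p → trans (cong (_* δ (+ f) (+ (e ℕ.+ f ∸ a))) (δ-≢ (λ q → p (sym (ℤₚ.+-injective q))))) (ℤₚ.*-zeroˡ (δ (+ f) (+ (e ℕ.+ f ∸ a))))))
  (trans (cong₂ _*_ (δ-≡ {+ e} refl) (δ-≡ (cong +_ (sym (ℕₚ.m+n∸m≡n e f))))) (sym (δ-≡ {+ e + + f} refl)))
... | no ¬p = trans (Σ<-0 (suc n) zeros) (sym (δ-≢ (λ q → ¬p (ℤₚ.+-injective q))))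
  where
  zeros : ∀ a → a ℕ.< suc n → δ (+ e) (+ a) * δ (+ f) (+ (n ∸ a)) ≡ 0ℤ
  zeros a l with e ℕₚ.≟ a
  ... | no q     = trans (cong (_* δ (+ f) (+ (n ∸ a))) (δ-≢ (q ∘ ℤₚ.+-injective))) (ℤₚ.*-zeroˡ (δ (+ f) (+ (n ∸ a))))
  ... | yes refl = trans (cong (δ (+ e) (+ e) *_) (δ-≢ λ q → ¬p (trans (cong (e ℕ.+_) (ℤₚ.+-injective q)) (ℕₚ.m+[n∸m]≡n (ℕₚ.≤-pred l))))) (ℤₚ.*-zeroʳ (δ (+ e) (+ e)))

-- For a fixed pair of indices the convolution collapses to a single `δ`. Products of series thereby
-- become sums over lattice points, where changes of variables are available.
gf-* : {I J : Set} {{_ : Sized I}} {{_ : Sized J}} (F : Fam I) (G : Fam J) (n : ℕ) →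
  cf (λ (i , j) → wt F i * wt G j) (λ (i , j) → ex F i + ex G j) (+ n) ⇓ (gf F *ˢ gf G) n
gf-* F G n = ⇓-≡ (sym (*ˢ-at (gf F) (gf G) n)) (⇓-cong pointwise (⇓-Σ< (suc n) (λ a _ → ⇓-* (gf-⇓ F a) (gf-⇓ G (n ∸ a)))))
  where
  pointwise : ∀ ((i , j) : _ × _) → Σ< (suc n) (λ a → cf (wt F) (ex F) (+ a) i * cf (wt G) (ex G) (+ (n ∸ a)) j)
            ≡ wt F i * wt G j * δ (ex F i + ex G j) (+ n)
  pointwise (i , j) with wt F i * wt G j ℤₚ.≟ 0ℤ
  ... | yes z = trans (Σ<-0 (suc n) (λ a _ → trans (lem (wt F i) (wt G j) (δ (ex F i) (+ a)) (δ (ex G j) (+ (n ∸ a)))) (trans (cong (_* (δ (ex F i) (+ a) * δ (ex G j) (+ (n ∸ a)))) z) (ℤₚ.*-zeroˡ (δ (ex F i) (+ a) * δ (ex G j) (+ (n ∸ a)))))))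
      (sym (trans (cong (_* δ (ex F i + ex G j) (+ n)) z) (ℤₚ.*-zeroˡ (δ (ex F i + ex G j) (+ n)))))
    where
    lem : ∀ a b c d → a * c * (b * d) ≡ a * b * (c * d)
    lem = solve-∀
  ... | no nz with bound F i (*-nzˡ nz) | bound G j (*-nzʳ {wt F i} nz)
  ...   | e , p , _ | f , q , _ rewrite p | q =
    trans (Σ<-cong (suc n) (λ a _ → lem (wt F i) (wt G j) (δ (+ e) (+ a)) (δ (+ f) (+ (n ∸ a)))))
      (trans (Σ<-*ˡ (suc n) (wt F i * wt G j) _) (cong (wt F i * wt G j *_) (δ-conv e f n)))
    where
    lem : ∀ a b c d → a * c * (b * d) ≡ a * b * (c * d)
    lem = solve-∀

-- Theta series and Lambert series

pos : ℤ → ℤ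
pos (+ _)    = 1ℤ
pos -[1+ _ ] = 0ℤ

-- 1 if k, j ≥ 0, -1 if k, j < 0, and 0 otherwise: the signs in the expansion of a bilateral sum of 1/(1 - q^{b_k}), b_k > 0 iff k ≥ 0
ε : ℤ → ℤ → ℤ
ε k j = pos k + pos j - 1ℤ

nz : ℤ → ℤ
nz (+ zero)  = 0ℤ
nz (+ suc _) = 1ℤ
nz -[1+ _ ]  = 1ℤ

private
  Bound : {I : Set} {{_ : Sized I}} → ℤ → I → Set
  Bound e i = ∃ λ m → e ≡ + m × size i ℕ.≤ m ℕ.+ 2

  n≤n*n : ∀ n → n ℕ.≤ n ℕ.* n
  n≤n*n zero    = z≤n
  n≤n*n (suc n) = ℕₚ.m≤m*n (suc n) (suc n)

  quad : ∀ (a b c d : ℤ) (k u v w : ℤ) → u ≡ k * k - k → v ≡ k * k + k → w ≡ k * k →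
    a * u + b * v + c * w + d ≡ a * (k * k - k) + b * (k * k + k) + c * (k * k) + d
  quad a b c d k u v w refl refl refl = refl

  posquad : ∀ a b c d x y z → + (a ℕ.* x ℕ.+ b ℕ.* y ℕ.+ c ℕ.* z ℕ.+ d) ≡ + a * + x + + b * + y + + c * + z + + d
  posquad a b c d x y z = cong₂ _+_ {v = + d} (cong₂ _+_ (cong₂ _+_ (ℤₚ.pos-* a x) (ℤₚ.pos-* b y)) (ℤₚ.pos-* c z)) refl

  -- The numbers k² - k, k² + k and k² are nonnegative for every integer k, and the positive
  -- coefficient `suc c` of k² makes the exponent at least the size of k.
  theta-bound : ∀ a b c d k e → e ≡ + a * (k * k - k) + + b * (k * k + k) + + suc c * (k * k) + + d → Bound e k
  theta-bound a b c d k e p = go k p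
    where
    big : ∀ r n → n ℕ.≤ r ℕ.+ suc c ℕ.* (n ℕ.* n) ℕ.+ d ℕ.+ 2
    big r n = ℕₚ.≤-trans (n≤n*n n) (ℕₚ.≤-trans (ℕₚ.m≤n*m (n ℕ.* n) (suc c)) (ℕₚ.≤-trans (ℕₚ.m≤n+m _ r) (ℕₚ.≤-trans (ℕₚ.m≤m+n _ d) (ℕₚ.m≤m+n _ 2))))
    go : ∀ k → e ≡ + a * (k * k - k) + + b * (k * k + k) + + suc c * (k * k) + + d → Bound e k
    go (+ zero) p = a ℕ.* 0 ℕ.+ b ℕ.* 0 ℕ.+ suc c ℕ.* 0 ℕ.+ d ,
      trans p (sym (posquad a b (suc c) d 0 0 0)) , z≤n
    go (+ suc n) p = a ℕ.* (suc n ℕ.* n) ℕ.+ b ℕ.* (suc n ℕ.* suc (suc n)) ℕ.+ suc c ℕ.* (suc n ℕ.* suc n) ℕ.+ d ,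
      trans p (sym (trans (posquad a b (suc c) d _ _ _) (quad (+ a) (+ b) (+ suc c) (+ d) (+ suc n) _ _ _
        (trans (ℤₚ.pos-* (suc n) n) (l₁ (+ n))) (trans (ℤₚ.pos-* (suc n) (suc (suc n))) (l₂ (+ n))) (ℤₚ.pos-* (suc n) (suc n))))) ,
      big (a ℕ.* (suc n ℕ.* n) ℕ.+ b ℕ.* (suc n ℕ.* suc (suc n))) (suc n)
      where
      l₁ : ∀ x → (1ℤ + x) * x ≡ (1ℤ + x) * (1ℤ + x) - (1ℤ + x)
      l₁ = solve-∀
      l₂ : ∀ x → (1ℤ + x) * (1ℤ + (1ℤ + x)) ≡ (1ℤ + x) * (1ℤ + x) + (1ℤ + x)
      l₂ = solve-∀
    go -[1+ n ] p = a ℕ.* (suc n ℕ.* suc (suc n)) ℕ.+ b ℕ.* (suc n ℕ.* n) ℕ.+ suc c ℕ.* (suc n ℕ.* suc n) ℕ.+ d ,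
      trans p (sym (trans (posquad a b (suc c) d _ _ _) (quad (+ a) (+ b) (+ suc c) (+ d) -[1+ n ] _ _ _
        (trans (ℤₚ.pos-* (suc n) (suc (suc n))) (l₁ (+ n))) (trans (ℤₚ.pos-* (suc n) n) (l₂ (+ n))) (trans (ℤₚ.pos-* (suc n) (suc n)) (l₃ (+ n)))))) ,
      big (a ℕ.* (suc n ℕ.* suc (suc n)) ℕ.+ b ℕ.* (suc n ℕ.* n)) (suc n)
      where
      l₁ : ∀ x → (1ℤ + x) * (1ℤ + (1ℤ + x)) ≡ - (1ℤ + x) * - (1ℤ + x) - - (1ℤ + x)
      l₁ = solve-∀
      l₂ : ∀ x → (1ℤ + x) * x ≡ - (1ℤ + x) * - (1ℤ + x) + - (1ℤ + x)
      l₂ = solve-∀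
      l₃ : ∀ x → (1ℤ + x) * (1ℤ + x) ≡ - (1ℤ + x) * - (1ℤ + x)
      l₃ = solve-∀

  poly : (c₀ c₁ c₂ c₃ c₄ x y : ℤ) → ℤ
  poly c₀ c₁ c₂ c₃ c₄ x y = c₀ + c₁ * x + c₂ * y + c₃ * (x * x) + c₄ * (x * y)

  pospoly : ∀ c₀ c₁ c₂ c₃ c₄ x y → ∃ λ r → poly (+ c₀) (+ c₁) (+ c₂) (+ c₃) (+ c₄) (+ x) (+ y) ≡ + r
  pospoly c₀ c₁ c₂ c₃ c₄ x y = _ , cong₂ _+_ (cong₂ _+_ (cong₂ _+_ (cong (_+_ (+ c₀)) (sym (ℤₚ.pos-* c₁ x))) (sym (ℤₚ.pos-* c₂ y)))
    (trans (cong (_*_ (+ c₃)) (sym (ℤₚ.pos-* x x))) (sym (ℤₚ.pos-* c₃ _)))) (trans (cong (_*_ (+ c₄)) (sym (ℤₚ.pos-* x y))) (sym (ℤₚ.pos-* c₄ _)))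

  -- In the two quadrants where the weight survives, k and j are given by naturals x and y up to a
  -- sign and a shift by 1. The numbers supplied at each use are the coefficients left after |k| +
  -- |j| has been split off from the exponent; they are natural.
  pair-bound : ∀ (k j : ℤ) e c₀ c₁ c₂ c₃ c₄ x y → e ≡ + ∣ k ∣ + + ∣ j ∣ + poly (+ c₀) (+ c₁) (+ c₂) (+ c₃) (+ c₄) (+ x) (+ y) → Bound e (k , j)
  pair-bound k j e c₀ c₁ c₂ c₃ c₄ x y p with pospoly c₀ c₁ c₂ c₃ c₄ x y
  ... | r , q = ∣ k ∣ ℕ.+ ∣ j ∣ ℕ.+ r , trans p (cong (_+_ (+ ∣ k ∣ + + ∣ j ∣)) q) ,
    ℕₚ.≤-trans (ℕₚ.⊔-lub (ℕₚ.m≤m+n ∣ k ∣ ∣ j ∣) (ℕₚ.m≤n+m ∣ j ∣ ∣ k ∣)) (ℕₚ.≤-trans (ℕₚ.m≤m+n _ r) (ℕₚ.m≤m+n _ 2))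

fα : Fam ℤ
fα = fam (λ k → 1ℤ) (λ k → + 3 * k * k - + 2 * k) (λ k _ → theta-bound 2 0 0 0 k _ (lem k))
  where
  lem : ∀ k → + 3 * k * k - + 2 * k ≡ + 2 * (k * k - k) + + 0 * (k * k + k) + + 1 * (k * k) + + 0
  lem = solve-∀

fW : Fam ℤ
fW = fam (λ k → 1ℤ - + 3 * k) (λ k → + 3 * k * k - + 2 * k) (λ k _ → theta-bound 2 0 0 0 k _ (lem k))
  where
  lem : ∀ k → + 3 * k * k - + 2 * k ≡ + 2 * (k * k - k) + + 0 * (k * k + k) + + 1 * (k * k) + + 0
  lem = solve-∀

fβ : Fam ℤ
fβ = fam (λ k → 1ℤ) (λ k → + 3 * k * k) (λ k _ → theta-bound 0 0 2 0 k _ (lem k))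
  where
  lem : ∀ k → + 3 * k * k ≡ + 0 * (k * k - k) + + 0 * (k * k + k) + + 3 * (k * k) + + 0
  lem = solve-∀

fφ : Fam ℤ
fφ = fam (λ k → 1ℤ) (λ k → k * k) (λ k _ → theta-bound 0 0 0 0 k _ (lem k))
  where
  lem : ∀ k → k * k ≡ + 0 * (k * k - k) + + 0 * (k * k + k) + + 1 * (k * k) + + 0
  lem = solve-∀

-- Euler's pentagonal number series in q², equal to (q²; q²)∞.
fη : Fam ℤ
fη = fam (λ k → sgn k) (λ k → + 3 * k * k + k) (λ k _ → theta-bound 0 1 1 0 k _ (lem k))
  where
  lem : ∀ k → + 3 * k * k + k ≡ + 0 * (k * k - k) + + 1 * (k * k + k) + + 2 * (k * k) + + 0
  lem = solve-∀

fψ₁ : Fam ℤ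
fψ₁ = fam (λ k → sgn k) (λ k → + 2 * k * k + k) (λ k _ → theta-bound 0 1 0 0 k _ (lem k))
  where
  lem : ∀ k → + 2 * k * k + k ≡ + 0 * (k * k - k) + + 1 * (k * k + k) + + 1 * (k * k) + + 0
  lem = solve-∀

fψ₃ : Fam ℤ
fψ₃ = fam (λ k → sgn k) (λ k → + 6 * k * k + + 3 * k) (λ k _ → theta-bound 0 3 2 0 k _ (lem k))
  where
  lem : ∀ k → + 6 * k * k + + 3 * k ≡ + 0 * (k * k - k) + + 3 * (k * k + k) + + 3 * (k * k) + + 0
  lem = solve-∀

fa₁ : Fam ℤ
fa₁ = fam (λ k → sgn k) (λ k → + 6 * k * k + k) (λ k _ → theta-bound 0 1 4 0 k _ (lem k))
  where
  lem : ∀ k → + 6 * k * k + k ≡ + 0 * (k * k - k) + + 1 * (k * k + k) + + 5 * (k * k) + + 0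
  lem = solve-∀

fa₂ : Fam ℤ
fa₂ = fam (λ k → sgn k) (λ k → + 6 * k * k + + 5 * k + 1ℤ) (λ k _ → theta-bound 0 5 0 1 k _ (lem k))
  where
  lem : ∀ k → + 6 * k * k + + 5 * k + 1ℤ ≡ + 0 * (k * k - k) + + 5 * (k * k + k) + + 1 * (k * k) + + 1
  lem = solve-∀

-- Jacobi's series for (q²; q²)∞³ summed over all integers. The indices k and -1 - k contribute
-- equally, so it is twice the one-sided series.
fJ : Fam ℤ
fJ = fam (λ k → sgn k * (+ 2 * k + 1ℤ)) (λ k → k * k + k) (λ k _ → go k)
  where
  big : ∀ n → suc n ℕ.≤ suc n ℕ.* n ℕ.+ 2
  big n = ℕₚ.≤-trans (s≤s (ℕₚ.m≤m+n n (n ℕ.* n))) (ℕₚ.≤-trans (ℕₚ.≤-reflexive (ℕₚ.+-comm 1 _)) (ℕₚ.+-monoʳ-≤ (n ℕ.+ n ℕ.* n) (s≤s z≤n)))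
  go : ∀ k → Bound (k * k + k) k
  go (+ n) = n ℕ.* n ℕ.+ n , cong (_+ + n) (sym (ℤₚ.pos-* n n)) , ℕₚ.≤-trans (ℕₚ.m≤n+m n (n ℕ.* n)) (ℕₚ.m≤m+n _ 2)
  go -[1+ n ] = suc n ℕ.* n , trans (lem (+ n)) (sym (ℤₚ.pos-* (suc n) n)) , big n
    where
    lem : ∀ x → - (1ℤ + x) * - (1ℤ + x) + - (1ℤ + x) ≡ (1ℤ + x) * x
    lem = solve-∀

-- Expansion of Σ_{k ≠ 0} (-1)^k q^{2k²+k} / (1 - q^{6k}).
fH : Fam (ℤ × ℤ)
fH = fam (λ (k , j) → sgn k * nz k * ε k j) (λ (k , j) → + 2 * k * k + k + + 6 * k * j) go
  where
  lem⁺ : ∀ X Y → + 2 * (1ℤ + X) * (1ℤ + X) + (1ℤ + X) + + 6 * (1ℤ + X) * Y ≡ (1ℤ + X) + Y + (+ 2 + + 4 * X + + 5 * Y + + 2 * (X * X) + + 6 * (X * Y))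
  lem⁺ = solve-∀
  lem⁻ : ∀ X Y → + 2 * (- (1ℤ + X)) * (- (1ℤ + X)) + (- (1ℤ + X)) + + 6 * (- (1ℤ + X)) * (- (1ℤ + Y)) ≡ (1ℤ + X) + (1ℤ + Y) + (+ 5 + + 8 * X + + 5 * Y + + 2 * (X * X) + + 6 * (X * Y))
  lem⁻ = solve-∀
  go : ((k , j) : ℤ × ℤ) → sgn k * nz k * ε k j ≢ 0ℤ → Bound (+ 2 * k * k + k + + 6 * k * j) (k , j)
  go (+ zero , j) p = ⊥-elim (p (trans (cong (_* ε 0ℤ j) (ℤₚ.*-zeroʳ (sgn 0ℤ))) (ℤₚ.*-zeroˡ (ε 0ℤ j))))
  go (+ suc x , + y) p = pair-bound (+ suc x) (+ y) _ 2 4 5 2 6 x y (lem⁺ (+ x) (+ y))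
  go (-[1+ x ] , -[1+ y ]) p = pair-bound -[1+ x ] -[1+ y ] _ 5 8 5 2 6 x y (lem⁻ (+ x) (+ y))
  go (+ suc x , -[1+ y ]) p = ⊥-elim (p (ℤₚ.*-zeroʳ (sgn (+ suc x) * 1ℤ)))
  go (-[1+ x ] , + y) p = ⊥-elim (p (ℤₚ.*-zeroʳ (sgn -[1+ x ] * 1ℤ)))

-- Expansion of Σ_{k ≠ 0} (-1)^k q^k / (1 - q^{6k}).
fE : Fam (ℤ × ℤ)
fE = fam (λ (k , j) → sgn k * nz k * ε k j) (λ (k , j) → k + + 6 * k * j) go
  where
  lem⁺ : ∀ X Y → (1ℤ + X) + + 6 * (1ℤ + X) * Y ≡ (1ℤ + X) + Y + (+ 0 + + 0 * X + + 5 * Y + + 0 * (X * X) + + 6 * (X * Y))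
  lem⁺ = solve-∀
  lem⁻ : ∀ X Y → (- (1ℤ + X)) + + 6 * (- (1ℤ + X)) * (- (1ℤ + Y)) ≡ (1ℤ + X) + (1ℤ + Y) + (+ 3 + + 4 * X + + 5 * Y + + 0 * (X * X) + + 6 * (X * Y))
  lem⁻ = solve-∀
  go : ((k , j) : ℤ × ℤ) → sgn k * nz k * ε k j ≢ 0ℤ → Bound (k + + 6 * k * j) (k , j)
  go (+ zero , j) p = ⊥-elim (p (trans (cong (_* ε 0ℤ j) (ℤₚ.*-zeroʳ (sgn 0ℤ))) (ℤₚ.*-zeroˡ (ε 0ℤ j))))
  go (+ suc x , + y) p = pair-bound (+ suc x) (+ y) _ 0 0 5 0 6 x y (lem⁺ (+ x) (+ y))
  go (-[1+ x ] , -[1+ y ]) p = pair-bound -[1+ x ] -[1+ y ] _ 3 4 5 0 6 x y (lem⁻ (+ x) (+ y))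
  go (+ suc x , -[1+ y ]) p = ⊥-elim (p (ℤₚ.*-zeroʳ (sgn (+ suc x) * 1ℤ)))
  go (-[1+ x ] , + y) p = ⊥-elim (p (ℤₚ.*-zeroʳ (sgn -[1+ x ] * 1ℤ)))

-- `ft₁`, `ft₂`, `ft₃` are, up to sign, the pieces of `fH` with k = 3a, 3a + 1 and 3a + 2, the last
-- one reflected by a ↦ -1 - a, j ↦ -1 - j. Residues of exponents are dropped and exponents divided
-- by 3, which leaves the denominators 1 - q^{6k}, 1 - q^{6k+2} and 1 - q^{6k+2}.
ft₁ : Fam (ℤ × ℤ)
ft₁ = fam (λ (k , j) → sgn k * nz k * ε k j) (λ (k , j) → + 6 * k * k + k + + 6 * k * j) go
  where
  lem⁺ : ∀ X Y → + 6 * (1ℤ + X) * (1ℤ + X) + (1ℤ + X) + + 6 * (1ℤ + X) * Y ≡ (1ℤ + X) + Y + (+ 6 + + 12 * X + + 5 * Y + + 6 * (X * X) + + 6 * (X * Y))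
  lem⁺ = solve-∀
  lem⁻ : ∀ X Y → + 6 * (- (1ℤ + X)) * (- (1ℤ + X)) + (- (1ℤ + X)) + + 6 * (- (1ℤ + X)) * (- (1ℤ + Y)) ≡ (1ℤ + X) + (1ℤ + Y) + (+ 9 + + 16 * X + + 5 * Y + + 6 * (X * X) + + 6 * (X * Y))
  lem⁻ = solve-∀
  go : ((k , j) : ℤ × ℤ) → sgn k * nz k * ε k j ≢ 0ℤ → Bound (+ 6 * k * k + k + + 6 * k * j) (k , j)
  go (+ zero , j) p = ⊥-elim (p (trans (cong (_* ε 0ℤ j) (ℤₚ.*-zeroʳ (sgn 0ℤ))) (ℤₚ.*-zeroˡ (ε 0ℤ j))))
  go (+ suc x , + y) p = pair-bound (+ suc x) (+ y) _ 6 12 5 6 6 x y (lem⁺ (+ x) (+ y))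
  go (-[1+ x ] , -[1+ y ]) p = pair-bound -[1+ x ] -[1+ y ] _ 9 16 5 6 6 x y (lem⁻ (+ x) (+ y))
  go (+ suc x , -[1+ y ]) p = ⊥-elim (p (ℤₚ.*-zeroʳ (sgn (+ suc x) * 1ℤ)))
  go (-[1+ x ] , + y) p = ⊥-elim (p (ℤₚ.*-zeroʳ (sgn -[1+ x ] * 1ℤ)))

ft₂ : Fam (ℤ × ℤ)
ft₂ = fam (λ (k , j) → sgn k * ε k j) (λ (k , j) → + 6 * k * k + + 5 * k + 1ℤ + (+ 6 * k + + 2) * j) go
  where
  lem⁺ : ∀ X Y → + 6 * X * X + + 5 * X + 1ℤ + (+ 6 * X + + 2) * Y ≡ X + Y + (+ 1 + + 4 * X + + 1 * Y + + 6 * (X * X) + + 6 * (X * Y))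
  lem⁺ = solve-∀
  lem⁻ : ∀ X Y → + 6 * (- (1ℤ + X)) * (- (1ℤ + X)) + + 5 * (- (1ℤ + X)) + 1ℤ + (+ 6 * (- (1ℤ + X)) + + 2) * (- (1ℤ + Y)) ≡ (1ℤ + X) + (1ℤ + Y) + (+ 4 + + 12 * X + + 3 * Y + + 6 * (X * X) + + 6 * (X * Y))
  lem⁻ = solve-∀
  go : ((k , j) : ℤ × ℤ) → sgn k * ε k j ≢ 0ℤ → Bound (+ 6 * k * k + + 5 * k + 1ℤ + (+ 6 * k + + 2) * j) (k , j)
  go (+ x , + y) p = pair-bound (+ x) (+ y) _ 1 4 1 6 6 x y (lem⁺ (+ x) (+ y))
  go (-[1+ x ] , -[1+ y ]) p = pair-bound -[1+ x ] -[1+ y ] _ 4 12 3 6 6 x y (lem⁻ (+ x) (+ y))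
  go (+ x , -[1+ y ]) p = ⊥-elim (p (ℤₚ.*-zeroʳ (sgn (+ x))))
  go (-[1+ x ] , + y) p = ⊥-elim (p (ℤₚ.*-zeroʳ (sgn -[1+ x ])))

ft₃ : Fam (ℤ × ℤ)
ft₃ = fam (λ (k , j) → sgn k * ε k j) (λ (k , j) → + 6 * k * k + + 9 * k + + 2 + (+ 6 * k + + 2) * j) go
  where
  lem⁺ : ∀ X Y → + 6 * X * X + + 9 * X + + 2 + (+ 6 * X + + 2) * Y ≡ X + Y + (+ 2 + + 8 * X + + 1 * Y + + 6 * (X * X) + + 6 * (X * Y))
  lem⁺ = solve-∀
  lem⁻ : ∀ X Y → + 6 * (- (1ℤ + X)) * (- (1ℤ + X)) + + 9 * (- (1ℤ + X)) + + 2 + (+ 6 * (- (1ℤ + X)) + + 2) * (- (1ℤ + Y)) ≡ (1ℤ + X) + (1ℤ + Y) + (+ 1 + + 8 * X + + 3 * Y + + 6 * (X * X) + + 6 * (X * Y))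
  lem⁻ = solve-∀
  go : ((k , j) : ℤ × ℤ) → sgn k * ε k j ≢ 0ℤ → Bound (+ 6 * k * k + + 9 * k + + 2 + (+ 6 * k + + 2) * j) (k , j)
  go (+ x , + y) p = pair-bound (+ x) (+ y) _ 2 8 1 6 6 x y (lem⁺ (+ x) (+ y))
  go (-[1+ x ] , -[1+ y ]) p = pair-bound -[1+ x ] -[1+ y ] _ 1 8 3 6 6 x y (lem⁻ (+ x) (+ y))
  go (+ x , -[1+ y ]) p = ⊥-elim (p (ℤₚ.*-zeroʳ (sgn (+ x))))
  go (-[1+ x ] , + y) p = ⊥-elim (p (ℤₚ.*-zeroʳ (sgn -[1+ x ])))

-- Rearranging products of theta and Lambert series

δ-shift : ∀ c a n → δ (c + a) (c + n) ≡ δ a n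
δ-shift c a n = δ-iff (λ p → trans (lem c a) (trans (cong (_- c) p) (sym (lem c n)))) (cong (_+_ c))
  where
  lem : ∀ c a → a ≡ c + a - c
  lem = solve-∀

δ-shift′ : ∀ {E} c a n → E ≡ c + a → δ E (c + n) ≡ δ a n
δ-shift′ c a n refl = δ-shift c a n

⇓-antisym : {I : Set} {f : I → ℤ} {s : ℤ} (φ : I → I) → (∀ i → φ (φ i) ≡ i) → (∀ i → f (φ i) ≡ - f i) → f ⇓ s → s ≡ 0ℤ
⇓-antisym {f = f} {s} φ inv anti F = self-neg s (⇓-unique (⇓-cong anti (⇓-reindex φ φ inv (λ i _ → inv i) F)) (⇓-neg F))
  where
  self-neg : ∀ s → s ≡ - s → s ≡ 0ℤ
  self-neg (+ zero)  _ = refl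
  self-neg (+ suc _) ()
  self-neg -[1+ _ ]  ()

pos-flip : ∀ k → pos (- 1ℤ - k) ≡ 1ℤ - pos k
pos-flip (+ zero)       = refl
pos-flip (+ suc n)      = refl
pos-flip -[1+ zero ]    = refl
pos-flip -[1+ suc n ]   = refl

pos-suc : ∀ j → j ≢ - 1ℤ → pos (1ℤ + j) ≡ pos j
pos-suc (+ n)        p = refl
pos-suc -[1+ zero ]  p = ⊥-elim (p refl)
pos-suc -[1+ suc n ] p = refl

nz-ε-flip : ∀ k j → nz (- k) * ε (- k) (- 1ℤ - j) ≡ - (nz k * ε k j)
nz-ε-flip (+ zero)  j = refl
nz-ε-flip (+ suc k) j = trans (cong (λ p → 1ℤ * (0ℤ + p - 1ℤ)) (pos-flip j)) (lem (pos j))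
  where
  lem : ∀ p → 1ℤ * (0ℤ + (1ℤ - p) - 1ℤ) ≡ - (1ℤ * (1ℤ + p - 1ℤ))
  lem = solve-∀
nz-ε-flip -[1+ k ]  j = trans (cong (λ p → 1ℤ * (1ℤ + p - 1ℤ)) (pos-flip j)) (lem (pos j))
  where
  lem : ∀ p → 1ℤ * (1ℤ + (1ℤ - p) - 1ℤ) ≡ - (1ℤ * (0ℤ + p - 1ℤ))
  lem = solve-∀

-- The coefficients of Σ u(k) q^{A(k) - m B(k)} / (1 - q^{B(k)}) change with m by a sum without denominators.
module Lambert (u A B : ℤ → ℤ) (x : ℤ → ℤ → ℤ)
  (X : ∀ m N → (λ ((k , j) : ℤ × ℤ) → u k * ε k j * δ (A k + B k * (j - m)) N) ⇓ x m N) where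

  -- After the shift j ↦ j + 1 the expansion for m + 1 has the same exponents as the expansion for
  -- m, and the same signs except in the column j = -1, where `pos` jumps. That column is what
  -- remains of the difference.
  step : ∀ m N → (λ k → u k * δ (A k - B k * (1ℤ + m)) N) ⇓ x (1ℤ + m) N - x m N
  step m N = ⇓-cong atm1 (⇓-reindex {f = g} (λ k → (k , - 1ℤ)) proj₁ (λ _ → refl) onlym1 diff)
    where
    g : ℤ × ℤ → ℤ
    g (k , j) = u k * ε k (1ℤ + j) * δ (A k + B k * ((1ℤ + j) - (1ℤ + m))) N - u k * ε k j * δ (A k + B k * (j - m)) N
    up dn : ℤ × ℤ → ℤ × ℤ
    up (k , j) = (k , 1ℤ + j)
    dn (k , j) = (k , j - 1ℤ)
    l₁ : ∀ j → 1ℤ + j - 1ℤ ≡ j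
    l₁ = solve-∀
    l₂ : ∀ j → 1ℤ + (j - 1ℤ) ≡ j
    l₂ = solve-∀
    diff : g ⇓ x (1ℤ + m) N - x m N
    diff = ⇓-minus (⇓-reindex up dn (λ (k , j) → cong (k ,_) (l₁ j)) (λ (k , j) _ → cong (k ,_) (l₂ j)) (X (1ℤ + m) N)) (X m N)
    same : ∀ k j → A k + B k * ((1ℤ + j) - (1ℤ + m)) ≡ A k + B k * (j - m)
    same k j = lem (A k) (B k) j m
      where
      lem : ∀ a b j m → a + b * ((1ℤ + j) - (1ℤ + m)) ≡ a + b * (j - m)
      lem = solve-∀
    onlym1 : ∀ i → g i ≢ 0ℤ → (proj₁ i , - 1ℤ) ≡ i
    onlym1 (k , j) p with j ℤₚ.≟ - 1ℤ
    ... | yes q = cong (k ,_) (sym q)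
    ... | no q  = ⊥-elim (p (trans (cong (_- u k * ε k j * δ (A k + B k * (j - m)) N)
                    (cong₂ (λ e d → u k * (pos k + e - 1ℤ) * δ d N) (pos-suc j q) (same k j))) (ℤₚ.+-inverseʳ (u k * ε k j * δ (A k + B k * (j - m)) N))))
    atm1 : ∀ k → g (k , - 1ℤ) ≡ u k * δ (A k - B k * (1ℤ + m)) N
    atm1 k = trans (cong₂ (λ d d′ → u k * ε k 0ℤ * δ d N - u k * ε k (- 1ℤ) * δ d′ N) (lem₁ (A k) (B k) m) (lem₂ (A k) (B k) m))
                   (lem (u k) (pos k) (δ (A k - B k * (1ℤ + m)) N))
      where
      lem₁ : ∀ a b m → a + b * (0ℤ - (1ℤ + m)) ≡ a - b * (1ℤ + m)
      lem₁ = solve-∀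
      lem₂ : ∀ a b m → a + b * (- 1ℤ - m) ≡ a - b * (1ℤ + m)
      lem₂ = solve-∀
      lem : ∀ u p d → u * (p + 1ℤ - 1ℤ) * d - u * (p + 0ℤ - 1ℤ) * d ≡ u * d
      lem = solve-∀

-- Rearranging a product theta · Lambert series along the lines where the shifted theta index m = ψ n k is constant.
module Rows (F : Fam ℤ) (G : Fam (ℤ × ℤ)) (φ ψ : ℤ → ℤ → ℤ)
  (ψφ : ∀ m k → ψ (φ m k) k ≡ m) (φψ : ∀ n k → φ (ψ n k) k ≡ n)
  (c : (m N : ℤ) → ℤ × ℤ → ℤ) (e : ℤ → ℤ)
  (conv : ∀ m k j N → wt F (φ m k) * wt G (k , j) * δ (ex F (φ m k) + ex G (k , j)) (e m + N) ≡ c m N (k , j)) where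

  private
    f : ℤ → ℤ × (ℤ × ℤ) → ℤ
    f N (n , kj) = wt F n * wt G kj * δ (ex F n + ex G kj) N

    total-⇓ : ∀ N → ∃ λ s → f N ⇓ s
    total-⇓ (+ n)    = _ , gf-* F G n
    total-⇓ -[1+ n ] = _ , ⇓-0 zeros
      where
      zeros : ∀ i → f -[1+ n ] i ≡ 0ℤ
      zeros (i , kj) with f -[1+ n ] (i , kj) ℤₚ.≟ 0ℤ
      ... | yes z = z
      ... | no nz with bound F i (*-nzˡ (*-nzˡ nz)) | bound G kj (*-nzʳ {wt F i} (*-nzˡ nz))
      ...   | a , p , _ | b , q , _ with trans (sym (cong₂ _+_ p q)) (δ-nz {ex F i + ex G kj} (*-nzʳ {wt F i * wt G kj} nz))
      ...     | ()

    fᵣ : ℤ → ℤ × (ℤ × ℤ) → ℤ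
    fᵣ N (m , (k , j)) = f N (φ m k , (k , j))

    reindexed : ∀ {N s} → f N ⇓ s → fᵣ N ⇓ s
    reindexed {N} = ⇓-reindex {f = f N} (λ (m , (k , j)) → (φ m k , (k , j))) (λ (n , (k , j)) → (ψ n k , (k , j)))
      (λ (m , (k , j)) → cong (_, (k , j)) (ψφ m k)) (λ (n , (k , j)) _ → cong (_, (k , j)) (φψ n k))

    row : ∀ m N → ∃ λ t → c m N ⇓ t
    row m N with ⇓-row _≟ᴵ_ _≟ᴵ_ (reindexed (proj₂ (total-⇓ (e m + N)))) m
    ... | t , r = t , ⇓-cong (λ (k , j) → conv m k j N) r

  x : ℤ → ℤ → ℤ
  x m N = proj₁ (row m N)

  X : ∀ m N → c m N ⇓ x m N
  X m N = proj₂ (row m N)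

  sum-⇓ : ∀ n → (λ m → x m (+ n - e m)) ⇓ (gf F *ˢ gf G) n
  sum-⇓ n = ⇓-rows {f = fᵣ (+ n)} (λ m → ⇓-cong (λ (k , j) → trans (sym (conv m k j (+ n - e m))) (cong (λ N → f N (φ m k , (k , j))) (lem (e m) (+ n)))) (X m (+ n - e m)))
    ℤₚ._≟_ (reindexed (gf-* F G n))
    where
    lem : ∀ e n → e + (n - e) ≡ n
    lem = solve-∀

exα : ℤ → ℤ
exα m = + 3 * m * m - + 2 * m

-- The Lambert series leave out k = 0. Restoring this term, of exponent E 0 = 0, completes the theta
-- series so that a reflection of k can be applied to it.
fill-0 : ∀ {E : ℤ → ℤ} {N s} → E 0ℤ ≡ 0ℤ → (λ k → sgn k * nz k * δ (E k) N) ⇓ s → (λ k → sgn k * δ (E k) N) ⇓ s + δ 0ℤ N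
fill-0 {E} {N} {s} E0 S = ⇓-cong pt (⇓-+ S (⇓-≡ (trans (ℤₚ.*-identityˡ _) (cong (λ a → δ a N) E0)) (⇓-single {f = h} 0ℤ only)))
  where
  h : ℤ → ℤ
  h k = (1ℤ - nz k) * δ (E k) N
  only : ∀ k → h k ≢ 0ℤ → k ≡ 0ℤ
  only (+ zero)  p = refl
  only (+ suc k) p = ⊥-elim (p (ℤₚ.*-zeroˡ (δ (E (+ suc k)) N)))
  only -[1+ k ]  p = ⊥-elim (p (ℤₚ.*-zeroˡ (δ (E -[1+ k ]) N)))
  lem : ∀ s d → s * 1ℤ * d + (1ℤ - 1ℤ) * d ≡ s * d
  lem = solve-∀
  pt : ∀ k → sgn k * nz k * δ (E k) N + h k ≡ sgn k * δ (E k) N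
  pt (+ zero)  = lem′ (δ (E 0ℤ) N)
    where
    lem′ : ∀ d → 0ℤ * d + (1ℤ - 0ℤ) * d ≡ 1ℤ * d
    lem′ = solve-∀
  pt (+ suc k) = lem (sgn (+ suc k)) (δ (E (+ suc k)) N)
  pt -[1+ k ]  = lem (sgn -[1+ k ]) (δ (E -[1+ k ]) N)

sgn-refl : ∀ c k → sgn ((1ℤ + (c + c)) - k) ≡ - sgn k
sgn-refl c k = trans (cong sgn (lem c k)) (trans (sgn-suc ((c + c) - k)) (cong -_ (trans (sgn-+ (c + c) (- k))
  (trans (cong₂ _*_ (sgn-2* c) (sgn-neg k)) (ℤₚ.*-identityˡ (sgn k))))))
  where
  lem : ∀ c k → (1ℤ + (c + c)) - k ≡ 1ℤ + ((c + c) - k)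
  lem = solve-∀

-- k ↦ 2c + 1 - k reverses the sign of every summand.
odd-theta-0 : ∀ {E : ℤ → ℤ} {N s} c → (∀ k → E ((1ℤ + (c + c)) - k) ≡ E k) → (λ k → sgn k * δ (E k) N) ⇓ s → s ≡ 0ℤ
odd-theta-0 {E} {N} c h = ⇓-antisym (λ k → (1ℤ + (c + c)) - k) (lem c)
  (λ k → trans (cong₂ (λ a b → a * δ b N) (sgn-refl c k) (h k)) (sym (ℤₚ.neg-distribˡ-* (sgn k) _)))
  where
  lem : ∀ c k → (1ℤ + (c + c)) - ((1ℤ + (c + c)) - k) ≡ k
  lem = solve-∀

-- The map (k, j) ↦ (-k, -1 - j) exchanges the two quadrants of the expansion; it preserves (-1)^k
-- and reverses `ε`.
antisym-lambert : ∀ {E : ℤ → ℤ → ℤ} {N s} → (∀ k j → E (- k) (- 1ℤ - j) ≡ E k j) →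
  (λ ((k , j) : ℤ × ℤ) → sgn k * nz k * ε k j * δ (E k j) N) ⇓ s → s ≡ 0ℤ
antisym-lambert {E} {N} h = ⇓-antisym (λ (k , j) → (- k , - 1ℤ - j)) (λ (k , j) → cong₂ _,_ (ℤₚ.neg-involutive k) (lem j))
  (λ (k , j) → trans (cong₂ _*_ (trans (ℤₚ.*-assoc (sgn (- k)) _ _) (cong₂ _*_ (sgn-neg k) (nz-ε-flip k j))) (cong (λ e → δ e N) (h k j)))
     (lem′ (sgn k) (nz k) (ε k j) (δ (E k j) N)))
  where
  lem : ∀ j → - 1ℤ - (- 1ℤ - j) ≡ j
  lem = solve-∀
  lem′ : ∀ s n e d → s * - (n * e) * d ≡ - (s * n * e * d)
  lem′ = solve-∀

M₀ : ℕ → ℤ → ℤ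
M₀ n m = m * δ (exα m) (+ n)

-- With n = m - k, row m of the product is q^{3m²-2m} times Σ_{k ≠ 0} (-1)^k q^{3k²+3k-6km} / (1 -
-- q^{6k}). This sum is antisymmetric, hence 0, at m = 0. Passing from m to m + 1 adds a theta
-- series that vanishes by reflection once its k = 0 term is restored, so each step contributes -1
-- and the sum is -m.
module αE where

  A B : ℤ → ℤ
  A k = + 3 * k * k + + 3 * k
  B k = + 6 * k

  private
    i₁ : ∀ m k → (m - k) + k ≡ m
    i₁ = solve-∀
    i₂ : ∀ n k → (n + k) - k ≡ n
    i₂ = solve-∀
    exp : ∀ m k j → + 3 * (m - k) * (m - k) - + 2 * (m - k) + (k + + 6 * k * j)
        ≡ (+ 3 * m * m - + 2 * m) + ((+ 3 * k * k + + 3 * k) + + 6 * k * (j - m))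
    exp = solve-∀

  open Rows fα fE (λ m k → m - k) (λ n k → n + k) i₁ i₂
    (λ m N (k , j) → sgn k * nz k * ε k j * δ (A k + B k * (j - m)) N) exα
    (λ m k j N → cong₂ _*_ (ℤₚ.*-identityˡ (sgn k * nz k * ε k j)) (δ-shift′ (exα m) _ N (exp m k j))) public
  open Lambert (λ k → sgn k * nz k) A B x X

  x-0 : ∀ N → x 0ℤ N ≡ 0ℤ
  x-0 N = antisym-lambert {λ k j → A k + B k * (j - 0ℤ)} lem (X 0ℤ N)
    where
    lem : ∀ k j → + 3 * (- k) * (- k) + + 3 * (- k) + + 6 * (- k) * (- 1ℤ - j - 0ℤ) ≡ + 3 * k * k + + 3 * k + + 6 * k * (j - 0ℤ)
    lem = solve-∀

  x-suc : ∀ m N → x (1ℤ + m) N - x m N + δ 0ℤ N ≡ 0ℤ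
  x-suc m N = odd-theta-0 {λ k → A k - B k * (1ℤ + m)} m (lem m) (fill-0 {λ k → A k - B k * (1ℤ + m)} refl (step m N))
    where
    lem : ∀ m k → + 3 * ((1ℤ + (m + m)) - k) * ((1ℤ + (m + m)) - k) + + 3 * ((1ℤ + (m + m)) - k) - + 6 * ((1ℤ + (m + m)) - k) * (1ℤ + m)
        ≡ + 3 * k * k + + 3 * k - + 6 * k * (1ℤ + m)
    lem = solve-∀

  x-formula : ∀ N m → x m N ≡ - (m * δ 0ℤ N)
  x-formula N = ℤ-ind (λ m → x m N ≡ - (m * δ 0ℤ N)) (trans (x-0 N) (cong -_ (sym (ℤₚ.*-zeroˡ (δ 0ℤ N)))))
    (λ m p → trans (l₁ (x (1ℤ + m) N) (x m N) (δ 0ℤ N)) (trans (cong₂ (λ a b → a + b - δ 0ℤ N) (x-suc m N) p) (l₂ m (δ 0ℤ N))))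
    (λ m p → trans (l₃ (x (1ℤ + m) N) (x m N) (δ 0ℤ N)) (trans (cong₂ (λ a b → b + δ 0ℤ N - a) (x-suc m N) p) (l₄ m (δ 0ℤ N))))
    where
    l₁ : ∀ a b d → a ≡ (a - b + d) + b - d
    l₁ = solve-∀
    l₂ : ∀ m d → 0ℤ + - (m * d) - d ≡ - ((1ℤ + m) * d)
    l₂ = solve-∀
    l₃ : ∀ a b d → b ≡ a + d - (a - b + d)
    l₃ = solve-∀
    l₄ : ∀ m d → - ((1ℤ + m) * d) + d - 0ℤ ≡ - (m * d)
    l₄ = solve-∀

δ-0 : ∀ e n → δ 0ℤ (n - e) ≡ δ e n
δ-0 e n = δ-iff (λ p → trans (l₁ e) (trans (cong (_+_ e) p) (l₂ e n))) (λ p → trans (l₃ e) (cong (_- e) p))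
  where
  l₁ : ∀ e → e ≡ e + 0ℤ
  l₁ = solve-∀
  l₂ : ∀ e n → e + (n - e) ≡ n
  l₂ = solve-∀
  l₃ : ∀ e → 0ℤ ≡ e - e
  l₃ = solve-∀

αE-sum : ∀ n → M₀ n ⇓ - (gf fα *ˢ gf fE) n
αE-sum n = ⇓-cong (λ m → trans (cong -_ (trans (αE.x-formula (+ n - exα m) m) (cong (λ d → - (m * d)) (δ-0 (exα m) (+ n))))) (ℤₚ.neg-involutive _))
  (⇓-neg (αE.sum-⇓ n))

W-sum : ∀ n {s} → M₀ n ⇓ s → gf fW n ≡ gf fα n - + 3 * s
W-sum n {s} M = ⇓-unique (gf-⇓ fW n) (⇓-cong (λ m → lem m (δ (exα m) (+ n))) (⇓-minus (gf-⇓ fα n) (⇓-*ˡ (+ 3) M)))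
  where
  lem : ∀ m d → 1ℤ * d - + 3 * (m * d) ≡ (1ℤ - + 3 * m) * d
  lem = solve-∀

α*E≈W : gf fα *ˢ (1ˢ +ˢ cst (+ 3) *ˢ gf fE) ≈ gf fW
α*E≈W = ≈-trans (PS-Solver.solve 2 (λ a e → a :* (con 1ℤ :+ con (+ 3) :* e) := a :+ con (+ 3) :* (a :* e)) ≈-refl (gf fα) (gf fE))
  (coeffs λ n → trans (+ˢ-at _ _ n) (trans (cong (_+_ (gf fα n)) (cst-*ˢ-at (+ 3) _ n))
    (trans (lem (gf fα n) ((gf fα *ˢ gf fE) n)) (sym (W-sum n (αE-sum n))))))
  where
  open PS-Solver using (_:=_; _:+_; _:*_; con)
  lem : ∀ a b → a + + 3 * b ≡ a - + 3 * - b
  lem = solve-∀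

data Mod3 : ℤ → Set where
  0mod : ∀ a → Mod3 (a + a + a)
  1mod : ∀ a → Mod3 (1ℤ + (a + a + a))
  2mod : ∀ a → Mod3 (+ 2 + (a + a + a))

mod3 : ∀ m → Mod3 m
mod3 = ℤ-ind Mod3 (0mod 0ℤ)
  (λ { _ (0mod a) → 1mod a
     ; _ (1mod a) → subst Mod3 (l₁ a) (2mod a)
     ; _ (2mod a) → subst Mod3 (l₂ a) (0mod (1ℤ + a)) })
  (λ k p → subst Mod3 (l₀ k) (dn p))
  where
  l₁ : ∀ a → + 2 + (a + a + a) ≡ 1ℤ + (1ℤ + (a + a + a))
  l₁ = solve-∀
  l₂ : ∀ a → (1ℤ + a) + (1ℤ + a) + (1ℤ + a) ≡ 1ℤ + (+ 2 + (a + a + a))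
  l₂ = solve-∀
  l₀ : ∀ k → (1ℤ + k) - 1ℤ ≡ k
  l₀ = solve-∀
  l₃ : ∀ a → + 2 + ((a - 1ℤ) + (a - 1ℤ) + (a - 1ℤ)) ≡ a + a + a - 1ℤ
  l₃ = solve-∀
  l₄ : ∀ a → a + a + a ≡ 1ℤ + (a + a + a) - 1ℤ
  l₄ = solve-∀
  l₅ : ∀ a → 1ℤ + (a + a + a) ≡ + 2 + (a + a + a) - 1ℤ
  l₅ = solve-∀
  dn : ∀ {m} → Mod3 m → Mod3 (m - 1ℤ)
  dn (0mod a) = subst Mod3 (l₃ a) (2mod (a - 1ℤ))
  dn (1mod a) = subst Mod3 (l₄ a) (0mod a)
  dn (2mod a) = subst Mod3 (l₅ a) (1mod a)

theta-reindex : ∀ {E E′ : ℤ → ℤ} {N s t} (c : ℤ) (φ : ℤ → ℤ) (ψ : ℤ → ℤ) → (∀ k → ψ (φ k) ≡ k) → (∀ k → φ (ψ k) ≡ k) →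
  (∀ k → sgn (φ k) ≡ c * sgn k) → (∀ k → E (φ k) ≡ E′ k) →
  (λ k → sgn k * δ (E k) N) ⇓ s → (λ k → sgn k * δ (E′ k) N) ⇓ t → s ≡ c * t
theta-reindex {E} {E′} {N} c φ ψ ψφ φψ sg ex S T = ⇓-unique
  (⇓-reindex φ ψ ψφ (λ i _ → φψ i) S)
  (⇓-cong (λ k → sym (trans (cong₂ (λ a b → a * δ b N) (sg k) (ex k)) (ℤₚ.*-assoc c (sgn k) (δ (E′ k) N)))) (⇓-*ˡ c T))

sgn-even-shift : ∀ c k → sgn ((c + c) + k) ≡ 1ℤ * sgn k
sgn-even-shift c k = trans (sgn-+ (c + c) k) (cong (_* sgn k) (sgn-2* c))

sgn-even-refl : ∀ c k → sgn ((c + c) - k) ≡ 1ℤ * sgn k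
sgn-even-refl c k = trans (sgn-even-shift c (- k)) (cong (_*_ 1ℤ) (sgn-neg k))

sgn-odd-shift : ∀ c k → sgn (1ℤ + ((c + c) + k)) ≡ - 1ℤ * sgn k
sgn-odd-shift c k = trans (sgn-suc ((c + c) + k)) (trans (cong -_ (sgn-even-shift c k)) (lem (sgn k)))
  where
  lem : ∀ s → - (1ℤ * s) ≡ - 1ℤ * s
  lem = solve-∀

ρE ζE : ℤ → ℤ → ℤ
ρE m k = + 9 * k * k + + 3 * k - + 6 * k * (1ℤ + m)
ζE m k = + 9 * k * k + + 9 * k + + 2 - (+ 6 * k + + 2) * (1ℤ + m)

-- Σ s q^{ρE m} = Σ s q^{ζE m} + Σ s q^{ζE (-1-m)}; one of the three series vanishes, depending on m modulo 3
ρ-rec : ∀ m N {r z w} → (λ k → sgn k * δ (ρE m k) N) ⇓ r → (λ k → sgn k * δ (ζE m k) N) ⇓ z →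
  (λ k → sgn k * δ (ζE (- 1ℤ - m) k) N) ⇓ w → r ≡ z + w
ρ-rec m N = go (mod3 m)
  where
  -- The exponents `ρE m`, `ζE m` and `ζE (-1 - m)` are quadratics in k with leading coefficient 9
  -- and centres (2m+1)/6, (2m-1)/6 and -(2m+3)/6. The one with a half-integral centre gives the
  -- vanishing series. The centres of the other two have an integral sum or difference, which
  -- dictates the substitution; its parity decides the sign.
  go : ∀ {m r z w} → Mod3 m → (λ k → sgn k * δ (ρE m k) N) ⇓ r → (λ k → sgn k * δ (ζE m k) N) ⇓ z →
    (λ k → sgn k * δ (ζE (- 1ℤ - m) k) N) ⇓ w → r ≡ z + w
  go {r = r} {z} {w} (0mod a) R Z Wt = trans (lem r) (cong₂ _+_
    (sym (theta-reindex {ζE (a + a + a)} {ρE (a + a + a)} 1ℤ (λ k → (a + a) - k) (λ k → (a + a) - k) (i₁ a) (i₁ a) (sgn-even-refl a) (i₂ a) Z R))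
    (sym (odd-theta-0 {ζE (- 1ℤ - (a + a + a))} (- 1ℤ - a) (i₃ a) Wt)))
    where
    lem : ∀ r → r ≡ 1ℤ * r + 0ℤ
    lem = solve-∀
    i₁ : ∀ a k → (a + a) - ((a + a) - k) ≡ k
    i₁ = solve-∀
    i₂ : ∀ a k → + 9 * ((a + a) - k) * ((a + a) - k) + + 9 * ((a + a) - k) + + 2 - (+ 6 * ((a + a) - k) + + 2) * (1ℤ + (a + a + a))
       ≡ + 9 * k * k + + 3 * k - + 6 * k * (1ℤ + (a + a + a))
    i₂ = solve-∀
    i₃ : ∀ a k → let k′ = (1ℤ + ((- 1ℤ - a) + (- 1ℤ - a))) - k in
      + 9 * k′ * k′ + + 9 * k′ + + 2 - (+ 6 * k′ + + 2) * (1ℤ + (- 1ℤ - (a + a + a)))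
       ≡ + 9 * k * k + + 9 * k + + 2 - (+ 6 * k + + 2) * (1ℤ + (- 1ℤ - (a + a + a)))
    i₃ a k = lem₃ a k
      where
      lem₃ : ∀ a k → + 9 * ((1ℤ + ((- 1ℤ - a) + (- 1ℤ - a))) - k) * ((1ℤ + ((- 1ℤ - a) + (- 1ℤ - a))) - k) + + 9 * ((1ℤ + ((- 1ℤ - a) + (- 1ℤ - a))) - k) + + 2 - (+ 6 * ((1ℤ + ((- 1ℤ - a) + (- 1ℤ - a))) - k) + + 2) * (1ℤ + (- 1ℤ - (a + a + a)))
         ≡ + 9 * k * k + + 9 * k + + 2 - (+ 6 * k + + 2) * (1ℤ + (- 1ℤ - (a + a + a)))
      lem₃ = solve-∀
  go {r = r} {z} {w} (1mod a) R Z Wt = trans (odd-theta-0 {ρE (1ℤ + (a + a + a))} a (i₁ a) R)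
    (trans (lem w) (cong (_+ w) (sym (trans
      (theta-reindex {ζE (1ℤ + (a + a + a))} {ζE (- 1ℤ - (1ℤ + (a + a + a)))} (- 1ℤ) (λ k → 1ℤ + ((a + a) + k)) (λ k → k - (1ℤ + (a + a))) (i₂ a) (i₃ a) (sgn-odd-shift a) (i₄ a) Z Wt)
      (ℤₚ.-1*i≡-i w)))))
    where
    lem : ∀ w → 0ℤ ≡ - w + w
    lem = solve-∀
    i₁ : ∀ a k → + 9 * ((1ℤ + (a + a)) - k) * ((1ℤ + (a + a)) - k) + + 3 * ((1ℤ + (a + a)) - k) - + 6 * ((1ℤ + (a + a)) - k) * (1ℤ + (1ℤ + (a + a + a)))
       ≡ + 9 * k * k + + 3 * k - + 6 * k * (1ℤ + (1ℤ + (a + a + a)))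
    i₁ = solve-∀
    i₂ : ∀ a k → (1ℤ + ((a + a) + k)) - (1ℤ + (a + a)) ≡ k
    i₂ = solve-∀
    i₃ : ∀ a k → 1ℤ + ((a + a) + (k - (1ℤ + (a + a)))) ≡ k
    i₃ = solve-∀
    i₄ : ∀ a k → + 9 * (1ℤ + ((a + a) + k)) * (1ℤ + ((a + a) + k)) + + 9 * (1ℤ + ((a + a) + k)) + + 2 - (+ 6 * (1ℤ + ((a + a) + k)) + + 2) * (1ℤ + (1ℤ + (a + a + a)))
       ≡ + 9 * k * k + + 9 * k + + 2 - (+ 6 * k + + 2) * (1ℤ + (- 1ℤ - (1ℤ + (a + a + a))))
    i₄ = solve-∀
  go {r = r} {z} {w} (2mod a) R Z Wt = trans (lem r) (cong₂ _+_
    (sym (odd-theta-0 {ζE (+ 2 + (a + a + a))} a (i₁ a) Z))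
    (sym (theta-reindex {ζE (- 1ℤ - (+ 2 + (a + a + a)))} {ρE (+ 2 + (a + a + a))} 1ℤ (λ k → ((- 1ℤ - a) + (- 1ℤ - a)) + k) (λ k → k - ((- 1ℤ - a) + (- 1ℤ - a))) (i₂ a) (i₃ a) (sgn-even-shift (- 1ℤ - a)) (i₄ a) Wt R)))
    where
    lem : ∀ r → r ≡ 0ℤ + 1ℤ * r
    lem = solve-∀
    i₁ : ∀ a k → + 9 * ((1ℤ + (a + a)) - k) * ((1ℤ + (a + a)) - k) + + 9 * ((1ℤ + (a + a)) - k) + + 2 - (+ 6 * ((1ℤ + (a + a)) - k) + + 2) * (1ℤ + (+ 2 + (a + a + a)))
       ≡ + 9 * k * k + + 9 * k + + 2 - (+ 6 * k + + 2) * (1ℤ + (+ 2 + (a + a + a)))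
    i₁ = solve-∀
    i₂ : ∀ a k → (((- 1ℤ - a) + (- 1ℤ - a)) + k) - ((- 1ℤ - a) + (- 1ℤ - a)) ≡ k
    i₂ = solve-∀
    i₃ : ∀ a k → ((- 1ℤ - a) + (- 1ℤ - a)) + (k - ((- 1ℤ - a) + (- 1ℤ - a))) ≡ k
    i₃ = solve-∀
    i₄ : ∀ a k → + 9 * (((- 1ℤ - a) + (- 1ℤ - a)) + k) * (((- 1ℤ - a) + (- 1ℤ - a)) + k) + + 9 * (((- 1ℤ - a) + (- 1ℤ - a)) + k) + + 2 - (+ 6 * (((- 1ℤ - a) + (- 1ℤ - a)) + k) + + 2) * (1ℤ + (- 1ℤ - (+ 2 + (a + a + a))))
       ≡ + 9 * k * k + + 3 * k - + 6 * k * (1ℤ + (+ 2 + (a + a + a)))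
    i₄ = solve-∀

module αt₁ where

  private
    i₁ : ∀ m k → (m - k) + k ≡ m
    i₁ = solve-∀
    i₂ : ∀ n k → (n + k) - k ≡ n
    i₂ = solve-∀
    exp : ∀ m k j → + 3 * (m - k) * (m - k) - + 2 * (m - k) + (+ 6 * k * k + k + + 6 * k * j)
        ≡ (+ 3 * m * m - + 2 * m) + ((+ 9 * k * k + + 3 * k) + + 6 * k * (j - m))
    exp = solve-∀

  open Rows fα ft₁ (λ m k → m - k) (λ n k → n + k) i₁ i₂
    (λ m N (k , j) → sgn k * nz k * ε k j * δ ((+ 9 * k * k + + 3 * k) + + 6 * k * (j - m)) N) exα
    (λ m k j N → cong₂ _*_ (ℤₚ.*-identityˡ (sgn k * nz k * ε k j)) (δ-shift′ (exα m) _ N (exp m k j))) public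
  open Lambert (λ k → sgn k * nz k) (λ k → + 9 * k * k + + 3 * k) (λ k → + 6 * k) x X public

  x-0 : ∀ N → x 0ℤ N ≡ 0ℤ
  x-0 N = antisym-lambert {λ k j → + 9 * k * k + + 3 * k + + 6 * k * (j - 0ℤ)} lem (X 0ℤ N)
    where
    lem : ∀ k j → + 9 * (- k) * (- k) + + 3 * (- k) + + 6 * (- k) * (- 1ℤ - j - 0ℤ) ≡ + 9 * k * k + + 3 * k + + 6 * k * (j - 0ℤ)
    lem = solve-∀

-- The index of α is reflected, n = 1 - m + k, because this choice gives row m the same prefactor
-- q^{3m²-2m} as in `αt₁`.
module αt₂ where

  private
    i₁ : ∀ m k → 1ℤ - (1ℤ - m + k) + k ≡ m
    i₁ = solve-∀
    i₂ : ∀ n k → 1ℤ - (1ℤ - n + k) + k ≡ n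
    i₂ = solve-∀
    exp : ∀ m k j → + 3 * (1ℤ - m + k) * (1ℤ - m + k) - + 2 * (1ℤ - m + k) + (+ 6 * k * k + + 5 * k + 1ℤ + (+ 6 * k + + 2) * j)
        ≡ (+ 3 * m * m - + 2 * m) + ((+ 9 * k * k + + 9 * k + + 2) + (+ 6 * k + + 2) * (j - m))
    exp = solve-∀

  open Rows fα ft₂ (λ m k → 1ℤ - m + k) (λ n k → 1ℤ - n + k) i₁ i₂
    (λ m N (k , j) → sgn k * ε k j * δ ((+ 9 * k * k + + 9 * k + + 2) + (+ 6 * k + + 2) * (j - m)) N) exα
    (λ m k j N → cong₂ _*_ (ℤₚ.*-identityˡ (sgn k * ε k j)) (δ-shift′ (exα m) _ N (exp m k j))) public
  open Lambert sgn (λ k → + 9 * k * k + + 9 * k + + 2) (λ k → + 6 * k + + 2) x X public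

-- With n = m + k the exponents of row m become those of row -m of `αt₂`. This is how β enters: it
-- shifts the rows of t₃ onto rows that already occur.
module βt₃ where

  private
    i₁ : ∀ m k → (m + k) - k ≡ m
    i₁ = solve-∀
    i₂ : ∀ n k → (n - k) + k ≡ n
    i₂ = solve-∀
    exp : ∀ m k j → + 3 * (m + k) * (m + k) + (+ 6 * k * k + + 9 * k + + 2 + (+ 6 * k + + 2) * j)
        ≡ (+ 3 * m * m - + 2 * m) + ((+ 9 * k * k + + 9 * k + + 2) + (+ 6 * k + + 2) * (j - - m))
    exp = solve-∀

  open Rows fβ ft₃ (λ m k → m + k) (λ n k → n - k) i₁ i₂
    (λ m N (k , j) → sgn k * ε k j * δ ((+ 9 * k * k + + 9 * k + + 2) + (+ 6 * k + + 2) * (j - - m)) N) exα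
    (λ m k j N → cong₂ _*_ (ℤₚ.*-identityˡ (sgn k * ε k j)) (δ-shift′ (exα m) _ N (exp m k j))) public

  x≡ : ∀ m N → x m N ≡ αt₂.x (- m) N
  x≡ m N = ⇓-unique (X m N) (αt₂.X (- m) N)

private
  module T1 = αt₁
  module T2 = αt₂

T-step : ∀ m N → T1.x (1ℤ + m) N - T1.x m N + δ 0ℤ N
  ≡ (T2.x (1ℤ + m) N - T2.x m N) + (T2.x (- m) N - T2.x (- 1ℤ - m) N)
T-step m N = ρ-rec m N (fill-0 {ρE m} refl (T1.step m N)) (T2.step m N) (⇓-≡ (cong (λ a → T2.x a N - T2.x (- 1ℤ - m) N) (lem m)) (T2.step (- 1ℤ - m) N))
  where
  lem : ∀ m → 1ℤ + (- 1ℤ - m) ≡ - m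
  lem = solve-∀

-- The rows of t₁ and t₂ are not known individually. Their combination is 0 at m = 0, because the
-- two t₂ rows coincide there, and its increments are known from `T-step`; it is the same function
-- -m of the row as for α E.
T-formula : ∀ N m → T1.x m N - T2.x m N + T2.x (- m) N ≡ - (m * δ 0ℤ N)
T-formula N = ℤ-ind (λ m → T1.x m N - T2.x m N + T2.x (- m) N ≡ - (m * δ 0ℤ N))
  (trans (cong (λ t → t - T2.x 0ℤ N + T2.x 0ℤ N) (T1.x-0 N)) (l₀ (T2.x 0ℤ N) (δ 0ℤ N)))
  (λ m p → trans (cong (λ a → T1.x (1ℤ + m) N - T2.x (1ℤ + m) N + T2.x a N) (l₃ m))
    (trans (l₁ (T1.x (1ℤ + m) N) (T1.x m N) (δ 0ℤ N) (T2.x (1ℤ + m) N) (T2.x m N) (T2.x (- m) N) (T2.x (- 1ℤ - m) N))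
      (trans (cong₂ _+_ (cong (λ u → u - ((T2.x (1ℤ + m) N - T2.x m N) + (T2.x (- m) N - T2.x (- 1ℤ - m) N)) - δ 0ℤ N) (T-step m N)) p)
        (l₂ ((T2.x (1ℤ + m) N - T2.x m N) + (T2.x (- m) N - T2.x (- 1ℤ - m) N)) m (δ 0ℤ N)))))
  (λ m p → trans (l₄ (T1.x (1ℤ + m) N) (T1.x m N) (δ 0ℤ N) (T2.x (1ℤ + m) N) (T2.x m N) (T2.x (- m) N) (T2.x (- 1ℤ - m) N))
    (trans (cong₂ (λ u v → u - v + ((T2.x (1ℤ + m) N - T2.x m N) + (T2.x (- m) N - T2.x (- 1ℤ - m) N)) + δ 0ℤ N)
        (trans (cong (λ a → T1.x (1ℤ + m) N - T2.x (1ℤ + m) N + T2.x a N) (sym (l₃ m))) p) (T-step m N))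
      (l₅ ((T2.x (1ℤ + m) N - T2.x m N) + (T2.x (- m) N - T2.x (- 1ℤ - m) N)) m (δ 0ℤ N))))
  where
  l₀ : ∀ z d → 0ℤ - z + z ≡ - (0ℤ * d)
  l₀ = solve-∀
  l₁ : ∀ x′ x d z′ z w w′ → x′ - z′ + w′ ≡ (x′ - x + d) - ((z′ - z) + (w - w′)) - d + (x - z + w)
  l₁ = solve-∀
  l₂ : ∀ t m d → t - t - d + - (m * d) ≡ - ((1ℤ + m) * d)
  l₂ = solve-∀
  l₃ : ∀ m → - (1ℤ + m) ≡ - 1ℤ - m
  l₃ = solve-∀
  l₄ : ∀ x′ x d z′ z w w′ → x - z + w ≡ (x′ - z′ + w′) - (x′ - x + d) + ((z′ - z) + (w - w′)) + d
  l₄ = solve-∀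
  l₅ : ∀ t m d → - ((1ℤ + m) * d) - t + t + d ≡ - (m * d)
  l₅ = solve-∀

αt-sum : ∀ n → M₀ n ⇓ - ((gf fα *ˢ gf ft₁) n - (gf fα *ˢ gf ft₂) n + (gf fβ *ˢ gf ft₃) n)
αt-sum n = ⇓-cong pt (⇓-neg (⇓-+ (⇓-minus (T1.sum-⇓ n) (T2.sum-⇓ n)) (βt₃.sum-⇓ n)))
  where
  pt : ∀ m → - (T1.x m (+ n - exα m) - T2.x m (+ n - exα m) + βt₃.x m (+ n - exα m)) ≡ M₀ n m
  pt m = trans (cong -_ (trans (cong (_+_ (T1.x m (+ n - exα m) - T2.x m (+ n - exα m))) (βt₃.x≡ m (+ n - exα m)))
    (trans (T-formula (+ n - exα m) m) (cong (λ d → - (m * d)) (δ-0 (exα m) (+ n)))))) (ℤₚ.neg-involutive _)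

h₀ h₁ : PS
h₀ = 1ˢ +ˢ cst (+ 3) *ˢ (gf ft₁ -ˢ gf ft₂)
h₁ = cst (+ 3) *ˢ gf ft₃

α*h₀+β*h₁≈W : gf fα *ˢ h₀ +ˢ gf fβ *ˢ h₁ ≈ gf fW
α*h₀+β*h₁≈W = ≈-trans expand (coeffs at-n)
  where
  open PS-Solver using (_:=_; _:+_; _:*_; _:-_; con)
  expand : gf fα *ˢ h₀ +ˢ gf fβ *ˢ h₁ ≈ gf fα +ˢ cst (+ 3) *ˢ (gf fα *ˢ gf ft₁ -ˢ gf fα *ˢ gf ft₂ +ˢ gf fβ *ˢ gf ft₃)
  expand = PS-Solver.solve 5 (λ a b t u v → a :* (con 1ℤ :+ con (+ 3) :* (t :- u)) :+ b :* (con (+ 3) :* v) :=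
    a :+ con (+ 3) :* (a :* t :- a :* u :+ b :* v)) ≈-refl (gf fα) (gf fβ) (gf ft₁) (gf ft₂) (gf ft₃)
  lem : ∀ a b → a + + 3 * b ≡ a - + 3 * - b
  lem = solve-∀
  at-n : ∀ n → (gf fα +ˢ cst (+ 3) *ˢ (gf fα *ˢ gf ft₁ -ˢ gf fα *ˢ gf ft₂ +ˢ gf fβ *ˢ gf ft₃)) n ≡ gf fW n
  at-n n = trans (+ˢ-at _ _ n) (trans (cong (_+_ (gf fα n)) (trans (cst-*ˢ-at (+ 3) _ n) (cong (_*_ (+ 3))
      (trans (+ˢ-at _ _ n) (cong (_+ (gf fβ *ˢ gf ft₃) n) (minus-at _ _ n))))))
    (trans (lem (gf fα n) ((gf fα *ˢ gf ft₁) n - (gf fα *ˢ gf ft₂) n + (gf fβ *ˢ gf ft₃) n)) (sym (W-sum n (αt-sum n)))))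

-- Lattice sums and the rotation of order 3

private
  halfℕ : ℕ → ℕ ⊎ ℕ
  halfℕ 0 = inj₁ 0
  halfℕ 1 = inj₂ 0
  halfℕ (suc (suc n)) with halfℕ n
  ... | inj₁ a = inj₁ (suc a)
  ... | inj₂ a = inj₂ (suc a)

  halfℕ-even : ∀ a → halfℕ (a ℕ.+ a) ≡ inj₁ a
  halfℕ-even zero = refl
  halfℕ-even (suc a) rewrite ℕₚ.+-suc a a | halfℕ-even a = refl

  halfℕ-odd : ∀ a → halfℕ (suc (a ℕ.+ a)) ≡ inj₂ a
  halfℕ-odd zero = refl
  halfℕ-odd (suc a) rewrite ℕₚ.+-suc a a | halfℕ-odd a = refl

  unhalfℕ : ℕ ⊎ ℕ → ℕ
  unhalfℕ (inj₁ a) = a ℕ.+ a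
  unhalfℕ (inj₂ a) = suc (a ℕ.+ a)

  unhalf-halfℕ : ∀ n → unhalfℕ (halfℕ n) ≡ n
  unhalf-halfℕ 0 = refl
  unhalf-halfℕ 1 = refl
  unhalf-halfℕ (suc (suc n)) with halfℕ n | unhalf-halfℕ n
  ... | inj₁ a | refl = cong suc (ℕₚ.+-suc a a)
  ... | inj₂ a | refl = cong (suc ∘ suc) (ℕₚ.+-suc a a)

half : ℤ → ℤ ⊎ ℤ
half (+ n) with halfℕ n
... | inj₁ a = inj₁ (+ a)
... | inj₂ a = inj₂ (+ a)
half -[1+ n ] with halfℕ n
... | inj₁ a = inj₂ -[1+ a ]
... | inj₂ a = inj₁ -[1+ a ]

unhalf : ℤ ⊎ ℤ → ℤ
unhalf (inj₁ a) = a + a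
unhalf (inj₂ a) = 1ℤ + (a + a)

half-unhalf : ∀ x → half (unhalf x) ≡ x
half-unhalf (inj₁ (+ a))    rewrite halfℕ-even a = refl
half-unhalf (inj₁ -[1+ a ]) rewrite halfℕ-odd a = refl
half-unhalf (inj₂ (+ a))    rewrite halfℕ-odd a = refl
half-unhalf (inj₂ -[1+ a ]) rewrite halfℕ-even a = refl

unhalf-half : ∀ k → unhalf (half k) ≡ k
unhalf-half (+ n) with halfℕ n | unhalf-halfℕ n
... | inj₁ a | refl = refl
... | inj₂ a | refl = refl
unhalf-half -[1+ n ] with halfℕ n | unhalf-halfℕ n
... | inj₁ a | refl = refl
... | inj₂ a | refl = refl

⇓-unsplit : {I J : Set} {f : I ⊎ J → ℤ} {s : ℤ} → I → J → f ⇓ s →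
  ∃₂ λ s₁ s₂ → (f ∘ inj₁ ⇓ s₁) × (f ∘ inj₂ ⇓ s₂) × (s ≡ s₁ + s₂)
⇓-unsplit {I} {J} {f} i₀ j₀ F = _ , _ , F₁ , F₂ , ⇓-unique F (⇓-split F₁ F₂)
  where
  f₁ f₂ : I ⊎ J → ℤ
  f₁ (inj₁ i) = f (inj₁ i)
  f₁ (inj₂ j) = 0ℤ
  f₂ (inj₁ i) = 0ℤ
  f₂ (inj₂ j) = f (inj₂ j)
  p₁ : I ⊎ J → I
  p₁ (inj₁ i) = i
  p₁ (inj₂ _) = i₀
  p₂ : I ⊎ J → J
  p₂ (inj₁ _) = j₀
  p₂ (inj₂ j) = j
  F₁ = ⇓-reindex {f = f₁} inj₁ p₁ (λ _ → refl) (λ { (inj₁ i) _ → refl ; (inj₂ j) p → ⊥-elim (p refl) })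
    (proj₂ (⇓-sub F (λ { (inj₁ i) z → z ; (inj₂ j) _ → refl })))
  F₂ = ⇓-reindex {f = f₂} inj₂ p₂ (λ _ → refl) (λ { (inj₁ i) p → ⊥-elim (p refl) ; (inj₂ j) _ → refl })
    (proj₂ (⇓-sub F (λ { (inj₁ i) _ → refl ; (inj₂ j) z → z })))

-- For n = k + 2t the form 3k² + n² is 4 (k² + kt + t²), a multiple of the Eisenstein norm.
-- Splitting by the parity of n - k exposes this lattice, and (-1)^{k+n} is constant on each class.
⇓-parity : {f : ℤ × ℤ → ℤ} {s : ℤ} → f ⇓ s → ∃₂ λ s₁ s₂ →
  ((λ (k , t) → f (k , k + (t + t))) ⇓ s₁) × ((λ (k , t) → f (k , k + (1ℤ + (t + t)))) ⇓ s₂) × (s ≡ s₁ + s₂)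
⇓-parity {f} F = ⇓-unsplit (0ℤ , 0ℤ) (0ℤ , 0ℤ) (⇓-reindex {f = f} φ ψ ψφ (λ (k , n) _ → φψ k n) F)
  where
  tag : ℤ → ℤ ⊎ ℤ → ℤ × ℤ ⊎ ℤ × ℤ
  tag k (inj₁ t) = inj₁ (k , t)
  tag k (inj₂ t) = inj₂ (k , t)
  φ : ℤ × ℤ ⊎ ℤ × ℤ → ℤ × ℤ
  φ (inj₁ (k , t)) = (k , k + (t + t))
  φ (inj₂ (k , t)) = (k , k + (1ℤ + (t + t)))
  ψ : ℤ × ℤ → ℤ × ℤ ⊎ ℤ × ℤ
  ψ (k , n) = tag k (half (n - k))
  l₁ : ∀ k t → k + t - k ≡ t
  l₁ = solve-∀
  l₂ : ∀ k n → k + (n - k) ≡ n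
  l₂ = solve-∀
  ψφ : ∀ x → ψ (φ x) ≡ x
  ψφ (inj₁ (k , t)) = cong (tag k) (trans (cong half (l₁ k (t + t))) (half-unhalf (inj₁ t)))
  ψφ (inj₂ (k , t)) = cong (tag k) (trans (cong half (l₁ k (1ℤ + (t + t)))) (half-unhalf (inj₂ t)))
  φ-tag : ∀ k x → φ (tag k x) ≡ (k , k + unhalf x)
  φ-tag k (inj₁ t) = refl
  φ-tag k (inj₂ t) = refl
  φψ : ∀ k n → φ (ψ (k , n)) ≡ (k , n)
  φψ k n = trans (φ-tag k (half (n - k))) (cong (k ,_) (trans (cong (_+_ k) (unhalf-half (n - k))) (l₂ k n)))

sgn-k,k+2t : ∀ k t → sgn k * sgn (k + (t + t)) ≡ 1ℤ
sgn-k,k+2t k t = trans (cong (_*_ (sgn k)) (trans (sgn-+ k (t + t)) (trans (cong (_*_ (sgn k)) (sgn-2* t)) (ℤₚ.*-identityʳ (sgn k))))) (sgn² k)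

sgn-k,k+1+2t : ∀ k t → sgn k * sgn (k + (1ℤ + (t + t))) ≡ - 1ℤ
sgn-k,k+1+2t k t = trans (cong (λ x → sgn k * sgn x) (lem k t)) (trans (cong (_*_ (sgn k)) (sgn-suc (k + (t + t))))
  (trans (sym (ℤₚ.neg-distribʳ-* (sgn k) _)) (cong -_ (sgn-k,k+2t k t))))
  where
  lem : ∀ k t → k + (1ℤ + (t + t)) ≡ 1ℤ + (k + (t + t))
  lem = solve-∀

δ-cong : ∀ {a b n} → a ≡ b → δ a n ≡ δ b n
δ-cong refl = refl

Λ : (w e : ℤ → ℤ → ℤ) → ℤ → ℤ × ℤ → ℤ
Λ w e N (k , t) = w k t * δ (e k t) N

Λ-reindex : (f g f⁻ g⁻ : ℤ → ℤ → ℤ) → (∀ k t → f⁻ (f k t) (g k t) ≡ k) → (∀ k t → g⁻ (f k t) (g k t) ≡ t) →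
  (∀ k t → f (f⁻ k t) (g⁻ k t) ≡ k) → (∀ k t → g (f⁻ k t) (g⁻ k t) ≡ t) →
  (w e e′ : ℤ → ℤ → ℤ) → (∀ k t → e (f k t) (g k t) ≡ e′ k t) →
  ∀ {N s} → Λ w e N ⇓ s → Λ (λ k t → w (f k t) (g k t)) e′ N ⇓ s
Λ-reindex f g f⁻ g⁻ i₁ i₂ i₃ i₄ w e e′ h {N} S = ⇓-cong (λ (k , t) → cong (_*_ (w (f k t) (g k t))) (δ-cong (h k t)))
  (⇓-reindex {f = Λ w e N} (λ (k , t) → f k t , g k t) (λ (k , t) → f⁻ k t , g⁻ k t)
    (λ (k , t) → cong₂ _,_ (i₁ k t) (i₂ k t)) (λ (k , t) _ → cong₂ _,_ (i₃ k t) (i₄ k t)) S)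

gf-*-parity : (F G : Fam ℤ) (n : ℕ) (w₀ w₁ e₀ e₁ : ℤ → ℤ → ℤ) →
  (∀ k t → wt F k * wt G (k + (t + t)) ≡ w₀ k t) → (∀ k t → wt F k * wt G (k + (1ℤ + (t + t))) ≡ w₁ k t) →
  (∀ k t → ex F k + ex G (k + (t + t)) ≡ e₀ k t) → (∀ k t → ex F k + ex G (k + (1ℤ + (t + t))) ≡ e₁ k t) →
  ∃₂ λ s₀ s₁ → Λ w₀ e₀ (+ n) ⇓ s₀ × Λ w₁ e₁ (+ n) ⇓ s₁ × (gf F *ˢ gf G) n ≡ s₀ + s₁
gf-*-parity F G n w₀ w₁ e₀ e₁ a b c d = go (⇓-parity (gf-* F G n))
  where
  f : ℤ × ℤ → ℤ
  f = cf (λ (i , j) → wt F i * wt G j) (λ (i , j) → ex F i + ex G j) (+ n)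
  go : (∃₂ λ s₀ s₁ → ((λ (k , t) → f (k , k + (t + t))) ⇓ s₀) × ((λ (k , t) → f (k , k + (1ℤ + (t + t)))) ⇓ s₁) × (gf F *ˢ gf G) n ≡ s₀ + s₁) →
    ∃₂ λ s₀ s₁ → Λ w₀ e₀ (+ n) ⇓ s₀ × Λ w₁ e₁ (+ n) ⇓ s₁ × (gf F *ˢ gf G) n ≡ s₀ + s₁
  go (s₀ , s₁ , A , B , p) = s₀ , s₁ , ⇓-cong (λ (k , t) → cong₂ (λ w e → w * δ e (+ n)) (a k t) (c k t)) A ,
    ⇓-cong (λ (k , t) → cong₂ (λ w e → w * δ e (+ n)) (b k t) (d k t)) B , p

private
  rot₁ : ∀ k t → - (1ℤ + t) - (- k - t - 1ℤ) ≡ k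
  rot₁ = solve-∀
  rot₂ : ∀ t → 1ℤ + t - 1ℤ ≡ t
  rot₂ = solve-∀
  rot₃ : ∀ k → 1ℤ + (k - 1ℤ) ≡ k
  rot₃ = solve-∀
  rot₄ : ∀ k t → - (- k - t) - (k - 1ℤ) - 1ℤ ≡ t
  rot₄ = solve-∀
  rot₅ : ∀ k t → - t - (- k - t) ≡ k
  rot₅ = solve-∀
  rot₆ : ∀ k t → - (- k - t) - k ≡ t
  rot₆ = solve-∀
  pull : ∀ x y z → x * (y * z) ≡ x * y * z
  pull = solve-∀

module Rotation (w e : ℤ → ℤ → ℤ) where
  by-120° : ∀ e′ → (∀ k t → e (- k - t) (k - 1ℤ) ≡ e′ k t) → ∀ {N s} → Λ w e N ⇓ s → Λ (λ k t → w (- k - t) (k - 1ℤ)) e′ N ⇓ s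
  by-120° e′ = Λ-reindex (λ k t → - k - t) (λ k t → k - 1ℤ) (λ k t → 1ℤ + t) (λ k t → - k - t - 1ℤ)
    (λ k t → rot₃ k) rot₄ rot₁ (λ k t → rot₂ t) w e e′
  by-240° : ∀ e′ → (∀ k t → e (1ℤ + t) (- k - t - 1ℤ) ≡ e′ k t) → ∀ {N s} → Λ w e N ⇓ s → Λ (λ k t → w (1ℤ + t) (- k - t - 1ℤ)) e′ N ⇓ s
  by-240° e′ = Λ-reindex (λ k t → 1ℤ + t) (λ k t → - k - t - 1ℤ) (λ k t → - k - t) (λ k t → k - 1ℤ)
    rot₁ (λ k t → rot₂ t) (λ k t → rot₃ k) rot₄ w e e′
  even-by-120° : ∀ e′ → (∀ k t → e t (- k - t) ≡ e′ k t) → ∀ {N s} → Λ w e N ⇓ s → Λ (λ k t → w t (- k - t)) e′ N ⇓ s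
  even-by-120° e′ = Λ-reindex (λ k t → t) (λ k t → - k - t) (λ k t → - k - t) (λ k t → k)
    rot₅ (λ k t → refl) (λ k t → refl) rot₆ w e e′

private
  wA wB eA eB wC wD eC eD : ℤ → ℤ → ℤ
  wA k t = 1ℤ - + 3 * k
  wB k t = 1ℤ - + 3 * k
  eA k t = + 3 * k * k - + 2 * k + (k + (t + t)) * (k + (t + t))
  eB k t = + 3 * k * k - + 2 * k + (k + (1ℤ + (t + t))) * (k + (1ℤ + (t + t)))
  wC k t = 1ℤ * (+ 2 * (k + (t + t)) + 1ℤ)
  wD k t = - 1ℤ * (+ 2 * (k + (1ℤ + (t + t))) + 1ℤ)
  eC k t = + 3 * k * k + k + ((k + (t + t)) * (k + (t + t)) + (k + (t + t)))
  eD k t = + 3 * k * k + k + ((k + (1ℤ + (t + t))) * (k + (1ℤ + (t + t))) + (k + (1ℤ + (t + t))))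

  Wφ-parity : ∀ n → ∃₂ λ a b → Λ wA eA (+ n) ⇓ a × Λ wB eB (+ n) ⇓ b × (gf fW *ˢ gf fφ) n ≡ a + b
  Wφ-parity n = gf-*-parity fW fφ n wA wB eA eB (λ k t → ℤₚ.*-identityʳ (1ℤ - + 3 * k)) (λ k t → ℤₚ.*-identityʳ (1ℤ - + 3 * k))
    (λ k t → refl) (λ k t → refl)

  ηJ-parity : ∀ n → ∃₂ λ c d → Λ wC eC (+ n) ⇓ c × Λ wD eD (+ n) ⇓ d × (gf fη *ˢ gf fJ) n ≡ c + d
  ηJ-parity n = gf-*-parity fη fJ n wC wD eC eD wt₀ wt₁ (λ k t → refl) (λ k t → refl)
    where
    wt₀ : ∀ k t → sgn k * (sgn (k + (t + t)) * (+ 2 * (k + (t + t)) + 1ℤ)) ≡ 1ℤ * (+ 2 * (k + (t + t)) + 1ℤ)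
    wt₀ k t = trans (pull (sgn k) (sgn (k + (t + t))) (+ 2 * (k + (t + t)) + 1ℤ)) (cong (_* (+ 2 * (k + (t + t)) + 1ℤ)) (sgn-k,k+2t k t))
    wt₁ : ∀ k t → sgn k * (sgn (k + (1ℤ + (t + t))) * (+ 2 * (k + (1ℤ + (t + t))) + 1ℤ)) ≡ - 1ℤ * (+ 2 * (k + (1ℤ + (t + t))) + 1ℤ)
    wt₁ k t = trans (pull (sgn k) (sgn (k + (1ℤ + (t + t)))) (+ 2 * (k + (1ℤ + (t + t))) + 1ℤ)) (cong (_* (+ 2 * (k + (1ℤ + (t + t))) + 1ℤ)) (sgn-k,k+1+2t k t))

  eB-by-120° : ∀ k t → + 3 * (- k - t) * (- k - t) - + 2 * (- k - t) + (- k - t + (1ℤ + (k - 1ℤ + (k - 1ℤ)))) * (- k - t + (1ℤ + (k - 1ℤ + (k - 1ℤ))))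
     ≡ + 3 * k * k - + 2 * k + (k + (1ℤ + (t + t))) * (k + (1ℤ + (t + t)))
  eB-by-120° = solve-∀
  eB-by-240° : ∀ k t → + 3 * (1ℤ + t) * (1ℤ + t) - + 2 * (1ℤ + t) + (1ℤ + t + (1ℤ + ((- k - t - 1ℤ) + (- k - t - 1ℤ)))) * (1ℤ + t + (1ℤ + ((- k - t - 1ℤ) + (- k - t - 1ℤ))))
     ≡ + 3 * k * k - + 2 * k + (k + (1ℤ + (t + t))) * (k + (1ℤ + (t + t)))
  eB-by-240° = solve-∀
  eC-by-120° : ∀ k t → + 3 * t * t + t + ((t + ((- k - t) + (- k - t))) * (t + ((- k - t) + (- k - t))) + (t + ((- k - t) + (- k - t))))
     ≡ + 3 * k * k - + 2 * k + (k + (t + t)) * (k + (t + t))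
  eC-by-120° = solve-∀
  eD-by-120° : ∀ k t → + 3 * (- k - t) * (- k - t) + (- k - t) + ((- k - t + (1ℤ + (k - 1ℤ + (k - 1ℤ)))) * (- k - t + (1ℤ + (k - 1ℤ + (k - 1ℤ)))) + (- k - t + (1ℤ + (k - 1ℤ + (k - 1ℤ)))))
     ≡ + 3 * k * k - + 2 * k + (k + (t + t)) * (k + (t + t))
  eD-by-120° = solve-∀

  -- The exponent is invariant under the rotation, while the weights 1 - 3k over an orbit k, -k - t,
  -- 1 + t add up to 0; so three times the sum vanishes.
  B≡0 : ∀ {N b} → Λ wB eB N ⇓ b → b ≡ 0ℤ
  B≡0 {N} {b} B = third (ℤₚ.i*j≡0⇒i≡0∨j≡0 (+ 3) (trans (l b) 3b))
    where
    third : + 3 ≡ 0ℤ ⊎ b ≡ 0ℤ → b ≡ 0ℤ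
    third (inj₂ z) = z
    l : ∀ b → + 3 * b ≡ b + b + b
    l = solve-∀
    w₃ : ∀ k t d → (1ℤ - + 3 * k) * d + (1ℤ - + 3 * (- k - t)) * d + (1ℤ - + 3 * (1ℤ + t)) * d ≡ 0ℤ
    w₃ = solve-∀
    3b : b + b + b ≡ 0ℤ
    3b = ⇓-unique (⇓-+ (⇓-+ B (Rotation.by-120° wB eB eB eB-by-120° B)) (Rotation.by-240° wB eB eB eB-by-240° B))
      (⇓-0 λ (k , t) → w₃ k t (δ (eB k t) N))

  -- Suitable changes of variables carry both parity classes of η J to the even class of W φ. There
  -- the two linear weights combine to 2 (1 - 3k).
  C+D≡2A : ∀ {N a c d} → Λ wA eA N ⇓ a → Λ wC eC N ⇓ c → Λ wD eD N ⇓ d → c + d ≡ + 2 * a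
  C+D≡2A {N} A C D = ⇓-unique (⇓-+ (Rotation.even-by-120° wC eC eA eC-by-120° C) (Rotation.by-120° wD eD eA eD-by-120° D))
    (⇓-cong (λ (k , t) → sym (l k t (δ (eA k t) N))) (⇓-*ˡ (+ 2) A))
    where
    l : ∀ k t d → 1ℤ * (+ 2 * (t + ((- k - t) + (- k - t))) + 1ℤ) * d + - 1ℤ * (+ 2 * (- k - t + (1ℤ + (k - 1ℤ + (k - 1ℤ)))) + 1ℤ) * d
        ≡ + 2 * ((1ℤ - + 3 * k) * d)
    l = solve-∀

-- Points k, n correspond to Eisenstein integers; a rotation by 120° permutes the summands of both sides.
2*W*φ≈η*J : cst (+ 2) *ˢ (gf fW *ˢ gf fφ) ≈ gf fη *ˢ gf fJ
2*W*φ≈η*J = coeffs λ n → go n (Wφ-parity n) (ηJ-parity n)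
  where
  go : ∀ n → (∃₂ λ a b → Λ wA eA (+ n) ⇓ a × Λ wB eB (+ n) ⇓ b × (gf fW *ˢ gf fφ) n ≡ a + b) →
    (∃₂ λ c d → Λ wC eC (+ n) ⇓ c × Λ wD eD (+ n) ⇓ d × (gf fη *ˢ gf fJ) n ≡ c + d) →
    (cst (+ 2) *ˢ (gf fW *ˢ gf fφ)) n ≡ (gf fη *ˢ gf fJ) n
  go n (a , b , A , B , p) (c , d , C , D , q) =
    trans (cst-*ˢ-at (+ 2) _ n) (trans (cong (_*_ (+ 2)) (trans p (trans (cong (_+_ a) (B≡0 B)) (ℤₚ.+-identityʳ a)))) (trans (sym (C+D≡2A A C D)) (sym q)))

-- The differential equation for Jacobi's series

DFam : {I : Set} {{_ : Sized I}} → Fam I → Fam I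
DFam F = fam (λ i → wt F i * ex F i) (ex F) (λ i p → bound F i (*-nzˡ p))

D-gf : {I : Set} {{_ : Sized I}} (F : Fam I) → D (gf F) ≈ gf (DFam F)
D-gf F = gf-unique (DFam F) (D (gf F)) (λ n → ⇓-cong (pt n) (⇓-*ˡ (+ n) (gf-⇓ F n)))
  where
  pt : ∀ n i → + n * (wt F i * δ (ex F i) (+ n)) ≡ wt F i * ex F i * δ (ex F i) (+ n)
  pt n i with ex F i ℤₚ.≟ + n
  ... | yes p = trans (lem (+ n) (wt F i) (δ (ex F i) (+ n))) (cong (λ e → wt F i * e * δ (ex F i) (+ n)) (sym p))
    where
    lem : ∀ n w d → n * (w * d) ≡ w * n * d
    lem = solve-∀
  ... | no ¬p = trans (cong (λ d → + n * (wt F i * d)) (δ-≢ ¬p)) (trans (lem (+ n) (wt F i) (ex F i)) (cong (_*_ (wt F i * ex F i)) (sym (δ-≢ ¬p))))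
    where
    lem : ∀ n w e → n * (w * 0ℤ) ≡ w * e * 0ℤ
    lem = solve-∀

private
  mE mO : ℤ → ℤ → ℤ
  mE k t = k + (t + t)
  mO k t = k + (1ℤ + (t + t))

  wηDJ wDηJ : ℤ → ℤ → ℤ
  wηDJ k m = (+ 2 * m + 1ℤ) * (m * m + m)
  wDηJ k m = (+ 3 * k * k + k) * (+ 2 * m + 1ℤ)

  sgn-factor₁ : ∀ {s} x y k m → x * y ≡ s → x * (y * (+ 2 * m + 1ℤ) * (m * m + m)) ≡ s * wηDJ k m
  sgn-factor₁ x y k m refl = l x y (+ 2 * m + 1ℤ) (m * m + m)
    where
    l : ∀ x y a b → x * (y * a * b) ≡ x * y * (a * b)
    l = solve-∀

  sgn-factor₂ : ∀ {s} x y k m → x * y ≡ s → x * (+ 3 * k * k + k) * (y * (+ 2 * m + 1ℤ)) ≡ s * wDηJ k m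
  sgn-factor₂ x y k m refl = l x y (+ 3 * k * k + k) (+ 2 * m + 1ℤ)
    where
    l : ∀ x y a b → x * a * (y * b) ≡ x * y * (a * b)
    l = solve-∀

  ηDJ-parity : ∀ n → ∃₂ λ a b → Λ (λ k t → 1ℤ * wηDJ k (mE k t)) eC (+ n) ⇓ a × Λ (λ k t → - 1ℤ * wηDJ k (mO k t)) eD (+ n) ⇓ b ×
    (gf fη *ˢ gf (DFam fJ)) n ≡ a + b
  ηDJ-parity n = gf-*-parity fη (DFam fJ) n (λ k t → 1ℤ * wηDJ k (mE k t)) (λ k t → - 1ℤ * wηDJ k (mO k t)) eC eD
    (λ k t → sgn-factor₁ (sgn k) (sgn (mE k t)) k (mE k t) (sgn-k,k+2t k t)) (λ k t → sgn-factor₁ (sgn k) (sgn (mO k t)) k (mO k t) (sgn-k,k+1+2t k t))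
    (λ k t → refl) (λ k t → refl)

  DηJ-parity : ∀ n → ∃₂ λ a b → Λ (λ k t → 1ℤ * wDηJ k (mE k t)) eC (+ n) ⇓ a × Λ (λ k t → - 1ℤ * wDηJ k (mO k t)) eD (+ n) ⇓ b ×
    (gf (DFam fη) *ˢ gf fJ) n ≡ a + b
  DηJ-parity n = gf-*-parity (DFam fη) fJ n (λ k t → 1ℤ * wDηJ k (mE k t)) (λ k t → - 1ℤ * wDηJ k (mO k t)) eC eD
    (λ k t → sgn-factor₂ (sgn k) (sgn (mE k t)) k (mE k t) (sgn-k,k+2t k t)) (λ k t → sgn-factor₂ (sgn k) (sgn (mO k t)) k (mO k t) (sgn-k,k+1+2t k t))
    (λ k t → refl) (λ k t → refl)

  eD-by-refl : ∀ k t → + 3 * t * t + t + ((t + (1ℤ + ((- 1ℤ - k - t) + (- 1ℤ - k - t)))) * (t + (1ℤ + ((- 1ℤ - k - t) + (- 1ℤ - k - t)))) + (t + (1ℤ + ((- 1ℤ - k - t) + (- 1ℤ - k - t)))))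
    ≡ + 3 * k * k + k + ((k + (t + t)) * (k + (t + t)) + (k + (t + t)))
  eD-by-refl = solve-∀

  -- The affine map (k, t) ↦ (t, -1 - k - t) turns the exponent of the odd class into that of the
  -- even class, so both classes can be compared summand by summand.
  odd-to-even : ∀ w {N s} → Λ w eD N ⇓ s → Λ (λ k t → w t (- 1ℤ - k - t)) eC N ⇓ s
  odd-to-even w = Λ-reindex (λ k t → t) (λ k t → - 1ℤ - k - t) (λ k t → - 1ℤ - k - t) (λ k t → k)
    l₁ (λ k t → refl) (λ k t → refl) l₂ w eD eC eD-by-refl
    where
    l₁ : ∀ k t → - 1ℤ - t - (- 1ℤ - k - t) ≡ k
    l₁ = solve-∀
    l₂ : ∀ k t → - 1ℤ - (- 1ℤ - k - t) - k ≡ t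
    l₂ = solve-∀

  ηDJ-cancel : ∀ k t d →
    1ℤ * ((+ 2 * (k + (t + t)) + 1ℤ) * ((k + (t + t)) * (k + (t + t)) + (k + (t + t)))) * d
    + - 1ℤ * ((+ 2 * (t + (1ℤ + ((- 1ℤ - k - t) + (- 1ℤ - k - t)))) + 1ℤ) * ((t + (1ℤ + ((- 1ℤ - k - t) + (- 1ℤ - k - t)))) * (t + (1ℤ + ((- 1ℤ - k - t) + (- 1ℤ - k - t)))) + (t + (1ℤ + ((- 1ℤ - k - t) + (- 1ℤ - k - t)))))) * d
    ≡ + 3 * (1ℤ * ((+ 3 * k * k + k) * (+ 2 * (k + (t + t)) + 1ℤ)) * d
    + - 1ℤ * ((+ 3 * t * t + t) * (+ 2 * (t + (1ℤ + ((- 1ℤ - k - t) + (- 1ℤ - k - t)))) + 1ℤ)) * d)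
  ηDJ-cancel = solve-∀

  ηDJ-cancel′ : ∀ N i → Λ (λ k t → 1ℤ * wηDJ k (mE k t)) eC N i + Λ (λ k t → - 1ℤ * wηDJ t (mO t (- 1ℤ - k - t))) eC N i
    ≡ + 3 * (Λ (λ k t → 1ℤ * wDηJ k (mE k t)) eC N i + Λ (λ k t → - 1ℤ * wDηJ t (mO t (- 1ℤ - k - t))) eC N i)
  ηDJ-cancel′ N (k , t) = ηDJ-cancel k t (δ (eC k t) N)

-- This is the logarithmic derivative of J = 2 η³ with denominators cleared. Once the odd classes
-- are moved to the even one, the cubic weights of the two sides agree as polynomials.
η*DJ≈3*Dη*J : gf fη *ˢ D (gf fJ) ≈ cst (+ 3) *ˢ (D (gf fη) *ˢ gf fJ)
η*DJ≈3*Dη*J = ≈-trans (*ˢ-congˡ (D-gf fJ)) (≈-trans (coeffs λ n → go n (ηDJ-parity n) (DηJ-parity n)) (*ˢ-congˡ (*ˢ-congʳ (≈-sym (D-gf fη)))))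
  where
  go : ∀ n → (∃₂ λ a b → Λ (λ k t → 1ℤ * wηDJ k (mE k t)) eC (+ n) ⇓ a × Λ (λ k t → - 1ℤ * wηDJ k (mO k t)) eD (+ n) ⇓ b ×
      (gf fη *ˢ gf (DFam fJ)) n ≡ a + b) →
    (∃₂ λ a b → Λ (λ k t → 1ℤ * wDηJ k (mE k t)) eC (+ n) ⇓ a × Λ (λ k t → - 1ℤ * wDηJ k (mO k t)) eD (+ n) ⇓ b ×
      (gf (DFam fη) *ˢ gf fJ) n ≡ a + b) →
    (gf fη *ˢ gf (DFam fJ)) n ≡ (cst (+ 3) *ˢ (gf (DFam fη) *ˢ gf fJ)) n
  go n (a , b , A , B , p) (c , d , C , E , q) = trans p (trans
    (⇓-unique (⇓-+ A (odd-to-even (λ k t → - 1ℤ * wηDJ k (mO k t)) B)) (⇓-cong (λ i → sym (ηDJ-cancel′ (+ n) i))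
      (⇓-*ˡ (+ 3) (⇓-+ C (odd-to-even (λ k t → - 1ℤ * wDηJ k (mO k t)) E)))))
    (trans (cong (_*_ (+ 3)) (sym q)) (sym (cst-*ˢ-at (+ 3) _ n))))

-- Infinite sums and products of power series

infix 4 _⇛_
_⇛_ : {I : Set} → (I → PS) → PS → Set
F ⇛ S = ∀ n → (λ i → F i n) ⇓ S n

module _ {I : Set} where

  ⇛-unique : {F : I → PS} {S T : PS} → F ⇛ S → F ⇛ T → S ≈ T
  ⇛-unique p q = coeffs λ n → ⇓-unique (p n) (q n)

  ⇛-cong : {F G : I → PS} {S : PS} → (∀ i → F i ≈ G i) → F ⇛ S → G ⇛ S
  ⇛-cong h p n = ⇓-cong (λ i → h i at n) (p n)

  ⇛-≈ : {F : I → PS} {S T : PS} → S ≈ T → F ⇛ S → F ⇛ T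
  ⇛-≈ h p n = ⇓-≡ (h at n) (p n)

  ⇛-+ : {F G : I → PS} {S T : PS} → F ⇛ S → G ⇛ T → (λ i → F i +ˢ G i) ⇛ S +ˢ T
  ⇛-+ {F} {G} {S} {T} p q n = ⇓-≡ (sym (+ˢ-at S T n)) (⇓-cong (λ i → sym (+ˢ-at (F i) (G i) n)) (⇓-+ (p n) (q n)))

  ⇛-neg : {F : I → PS} {S : PS} → F ⇛ S → (λ i → -ˢ F i) ⇛ -ˢ S
  ⇛-neg {F} {S} p n = ⇓-≡ (sym (-ˢ-at S n)) (⇓-cong (λ i → sym (-ˢ-at (F i) n)) (⇓-neg (p n)))

  ⇛-minus : {F G : I → PS} {S T : PS} → F ⇛ S → G ⇛ T → (λ i → F i -ˢ G i) ⇛ S -ˢ T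
  ⇛-minus p q = ⇛-+ p (⇛-neg q)

  ⇛-*ˡ : (g : PS) {F : I → PS} {S : PS} → F ⇛ S → (λ i → g *ˢ F i) ⇛ g *ˢ S
  ⇛-*ˡ g {F} {S} p n = ⇓-≡ (sym (*ˢ-at g S n)) (⇓-cong (λ i → sym (*ˢ-at g (F i) n))
    (⇓-Σ< (suc n) (λ a _ → ⇓-*ˡ (g a) (p (n ℕ.∸ a)))))

  ⇛-bij : {J : Set} {F : I → PS} {S : PS} (φ : J → I) (ψ : I → J) → (∀ j → ψ (φ j) ≡ j) → (∀ i → φ (ψ i) ≡ i) → F ⇛ S → F ∘ φ ⇛ S
  ⇛-bij {F = F} φ ψ ψφ φψ p n = ⇓-reindex {f = λ i → F i n} φ ψ ψφ (λ i _ → φψ i) (p n)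

  module _ {{_ : Sized I}} (F : I → PS) (ord : ∀ i → F i ≈[ size i ] 0ˢ) where

    Sum : PS
    Sum n = sumL (λ i → F i n) (ball n)

    Sum-⇛ : F ⇛ Sum
    Sum-⇛ n = ⇓-list (ball n) (ball-unique n) (λ i p → ball-cover n i (ℕₚ.≮⇒≥ (λ l → p (trans (ord i n l) (0ˢ-at n)))))

⇛-pred : {F : ℕ → PS} {S : PS} → F 0 ≈ 0ˢ → F ⇛ S → F ∘ suc ⇛ S
⇛-pred {F} h p n = ⇓-reindex {f = λ i → F i n} suc ℕ.pred (λ _ → refl)
  (λ { zero q → ⊥-elim (q (trans (h at n) (0ˢ-at n))) ; (suc i) _ → refl }) (p n)

prodFin : (ℕ → PS) → ℕ → PS
prodFin f zero    = 1ˢ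
prodFin f (suc K) = prodFin f K *ˢ f K

Π∞ : (ℕ → PS) → PS
Π∞ f n = prodFin f (suc n) n

≈[]-refl : ∀ {n f} → f ≈[ n ] f
≈[]-refl i _ = refl

≈[]-sym : ∀ {n f g} → f ≈[ n ] g → g ≈[ n ] f
≈[]-sym p i l = sym (p i l)

≈[]-trans : ∀ {n f g h} → f ≈[ n ] g → g ≈[ n ] h → f ≈[ n ] h
≈[]-trans p q i l = trans (p i l) (q i l)

≈⇒≈[] : ∀ {n f g} → f ≈ g → f ≈[ n ] g
≈⇒≈[] p i _ = p at i

≈[]-≤ : ∀ {m n f g} → m ℕ.≤ n → f ≈[ n ] g → f ≈[ m ] g
≈[]-≤ l p i m = p i (ℕₚ.<-≤-trans m l)

≈[]-+ : ∀ {n f f′ g g′} → f ≈[ n ] f′ → g ≈[ n ] g′ → f +ˢ g ≈[ n ] f′ +ˢ g′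
≈[]-+ {f = f} {f′} {g} {g′} p q i l = trans (+ˢ-at f g i) (trans (cong₂ _+_ (p i l) (q i l)) (sym (+ˢ-at f′ g′ i)))

≈[]-neg : ∀ {n f f′} → f ≈[ n ] f′ → -ˢ f ≈[ n ] -ˢ f′
≈[]-neg {f = f} {f′} p i l = trans (-ˢ-at f i) (trans (cong -_ (p i l)) (sym (-ˢ-at f′ i)))

1-0 : 1ˢ -ˢ 0ˢ ≈ 1ˢ
1-0 = solve 0 (con 1ℤ :- con 0ℤ := con 1ℤ) ≈-refl

1-≈[] : ∀ {n f} → f ≈[ n ] 0ˢ → 1ˢ -ˢ f ≈[ n ] 1ˢ
1-≈[] p = ≈[]-trans (≈[]-+ ≈[]-refl (≈[]-neg p)) (≈⇒≈[] 1-0)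

*-≈[]-0ˡ : ∀ {n f} g → f ≈[ n ] 0ˢ → f *ˢ g ≈[ n ] 0ˢ
*-≈[]-0ˡ g p = ≈[]-trans (≈[]-* p ≈[]-refl) (≈⇒≈[] (solve 1 (λ g → con 0ℤ :* g := con 0ℤ) ≈-refl g))

*-≈[]-0ʳ : ∀ {n g} f → g ≈[ n ] 0ˢ → f *ˢ g ≈[ n ] 0ˢ
*-≈[]-0ʳ f p = ≈[]-trans (≈[]-* ≈[]-refl p) (≈⇒≈[] (solve 1 (λ f → f :* con 0ℤ := con 0ℤ) ≈-refl f))

-- Factor k is 1 modulo q^{k+1}, so the factors from index n on leave the coefficients up to q^n
-- unchanged.
Conv : (ℕ → PS) → Set
Conv f = ∀ k → f k ≈[ suc k ] 1ˢ

prodFin-stable : ∀ {f} → Conv f → ∀ K d → prodFin f (d ℕ.+ K) ≈[ suc K ] prodFin f K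
prodFin-stable c K zero    = ≈[]-refl
prodFin-stable {f} c K (suc d) = ≈[]-trans (≈[]-* {g′ = 1ˢ} (prodFin-stable c K d) (≈[]-≤ (s≤s (ℕₚ.m≤n+m K d)) (c (d ℕ.+ K)))) (≈⇒≈[] (*ˢ-1 _))

Π∞-≈[] : ∀ {f} → Conv f → ∀ K → Π∞ f ≈[ suc K ] prodFin f K
Π∞-≈[] {f} c K i l = trans (prodFin-stable c i 1 i ℕₚ.≤-refl)
  (sym (subst (λ M → prodFin f M i ≡ prodFin f i i) (ℕₚ.m∸n+n≡m (ℕₚ.≤-pred l)) (prodFin-stable c i (K ℕ.∸ i) i ℕₚ.≤-refl)))

prodFin-cong : ∀ {f g} → (∀ k → f k ≈ g k) → ∀ K → prodFin f K ≈ prodFin g K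
prodFin-cong h zero    = ≈-refl
prodFin-cong h (suc K) = *ˢ-cong (prodFin-cong h K) (h K)

Π∞-cong : ∀ {f g} → (∀ k → f k ≈ g k) → Π∞ f ≈ Π∞ g
Π∞-cong h = coeffs λ n → prodFin-cong h (suc n) at n

Π∞-0 : ∀ {f} → Conv f → Π∞ f 0 ≡ 1ℤ
Π∞-0 c = trans (Π∞-≈[] c 0 0 (s≤s z≤n)) refl

prodFin-* : ∀ f g K → prodFin (λ k → f k *ˢ g k) K ≈ prodFin f K *ˢ prodFin g K
prodFin-* f g zero    = ≈-sym (*ˢ-1 1ˢ)
prodFin-* f g (suc K) = ≈-trans (*ˢ-congʳ (prodFin-* f g K)) (solve 4 (λ a b c d → a :* b :* (c :* d) := a :* c :* (b :* d)) ≈-refl _ _ _ _)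

Π∞-* : ∀ {f g} → Conv f → Conv g → Π∞ (λ k → f k *ˢ g k) ≈ Π∞ f *ˢ Π∞ g
Π∞-* {f} {g} c d = coeffs λ n → trans (prodFin-* f g (suc n) at n)
  (sym (≈[]-* (Π∞-≈[] c (suc n)) (Π∞-≈[] d (suc n)) n (s≤s (ℕₚ.n≤1+n n))))

-- For a series obeying a functional equation that splits off one factor at a time: the remainders
-- `T b` tend to 1.
Π∞-intro : ∀ {f S} (T : ℕ → PS) → Conv f → (∀ b → S ≈ prodFin f b *ˢ T b) → (∀ b → T b ≈[ b ] 1ˢ) → S ≈ Π∞ f
Π∞-intro {f} {S} T c h t = coeffs λ n → trans (h (suc n) at n)
  (trans (≈[]-* {g′ = 1ˢ} (≈[]-refl {f = prodFin f (suc n)}) (t (suc n)) n ℕₚ.≤-refl) (*ˢ-1 _ at n))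

prodFin-2 : ∀ f K → prodFin f (K ℕ.+ K) ≈ prodFin (λ k → f (k ℕ.+ k)) K *ˢ prodFin (λ k → f (suc (k ℕ.+ k))) K
prodFin-2 f zero    = ≈-sym (*ˢ-1 1ˢ)
prodFin-2 f (suc K) = ≈-trans (≡⇒≈ (cong (prodFin f ∘ suc) (ℕₚ.+-suc K K)))
  (≈-trans (*ˢ-congʳ (*ˢ-congʳ (prodFin-2 f K))) (solve 4 (λ a b c d → a :* b :* c :* d := a :* c :* (b :* d)) ≈-refl _ _ _ _))

Π∞-2 : ∀ {f} → Conv f → Conv (λ k → f (k ℕ.+ k)) → Conv (λ k → f (suc (k ℕ.+ k))) →
  Π∞ f ≈ Π∞ (λ k → f (k ℕ.+ k)) *ˢ Π∞ (λ k → f (suc (k ℕ.+ k)))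
Π∞-2 {f} c d e = coeffs λ n → trans (Π∞-≈[] c (suc n ℕ.+ suc n) n (s≤s (ℕₚ.m≤n⇒m≤1+n (ℕₚ.m≤m+n n (suc n)))))
  (trans (prodFin-2 f (suc n) at n) (sym (≈[]-* (Π∞-≈[] d (suc n)) (Π∞-≈[] e (suc n)) n (s≤s (ℕₚ.n≤1+n n)))))

tri* : ℕ → ℕ
tri* k = k ℕ.+ (k ℕ.+ k)

prodFin-3 : ∀ f K → prodFin f (tri* K) ≈ prodFin (λ k → f (tri* k)) K *ˢ prodFin (λ k → f (suc (tri* k))) K *ˢ prodFin (λ k → f (suc (suc (tri* k)))) K
prodFin-3 f zero    = solve 0 (con 1ℤ := con 1ℤ :* con 1ℤ :* con 1ℤ) ≈-refl
prodFin-3 f (suc K) = ≈-trans (≡⇒≈ (cong (prodFin f) (lem K)))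
  (≈-trans (*ˢ-congʳ (*ˢ-congʳ (*ˢ-congʳ (prodFin-3 f K)))) (solve 6 (λ a b c d e f → a :* b :* c :* d :* e :* f := (a :* d) :* (b :* e) :* (c :* f)) ≈-refl _ _ _ _ _ _))
  where
  lem : ∀ K → tri* (suc K) ≡ suc (suc (suc (tri* K)))
  lem K = cong suc (trans (cong (K ℕ.+_) (cong suc (ℕₚ.+-suc K K))) (trans (ℕₚ.+-suc K _) (cong suc (ℕₚ.+-suc K _))))

Π∞-3 : ∀ {f} → Conv f → Conv (λ k → f (tri* k)) → Conv (λ k → f (suc (tri* k))) → Conv (λ k → f (suc (suc (tri* k)))) →
  Π∞ f ≈ Π∞ (λ k → f (tri* k)) *ˢ Π∞ (λ k → f (suc (tri* k))) *ˢ Π∞ (λ k → f (suc (suc (tri* k))))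
Π∞-3 {f} c d e g = coeffs λ n → trans (Π∞-≈[] c (tri* (suc n)) n (s≤s (ℕₚ.m≤n⇒m≤1+n (ℕₚ.m≤m+n n (suc n ℕ.+ suc n)))))
  (trans (prodFin-3 f (suc n) at n) (sym (≈[]-* (≈[]-* (Π∞-≈[] d (suc n)) (Π∞-≈[] e (suc n))) (Π∞-≈[] g (suc n)) n (s≤s (ℕₚ.n≤1+n n)))))

-- Jacobi's triple product

pw : PS → ℕ → PS
pw p zero    = 1ˢ
pw p (suc n) = p *ˢ pw p n

pw-+ : ∀ p m n → pw p (m ℕ.+ n) ≈ pw p m *ˢ pw p n
pw-+ p zero    n = ≈-sym (1-*ˢ _)
pw-+ p (suc m) n = ≈-trans (*ˢ-congˡ (pw-+ p m n)) (≈-sym (*ˢ-assoc _ _ _))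

≈[]-*-0 : ∀ {f g m n} → f ≈[ m ] 0ˢ → g ≈[ n ] 0ˢ → f *ˢ g ≈[ m ℕ.+ n ] 0ˢ
≈[]-*-0 {f} {g} {m} {n} p q i l = trans (*ˢ-at f g i) (trans (Σ<-0 (suc i) zeros) (sym (0ˢ-at i)))
  where
  zeros : ∀ j → j < suc i → f j * g (i ℕ.∸ j) ≡ 0ℤ
  zeros j j≤i with j ℕₚ.<? m
  ... | yes j<m = trans (cong (_* g (i ℕ.∸ j)) (trans (p j j<m) (0ˢ-at j))) (ℤₚ.*-zeroˡ (g (i ℕ.∸ j)))
  ... | no j≮m  = trans (cong (_*_ (f j)) (trans (q (i ℕ.∸ j) i-j<n) (0ˢ-at (i ℕ.∸ j)))) (ℤₚ.*-zeroʳ (f j))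
    where
    i-j<n : i ℕ.∸ j < n
    i-j<n = ℕₚ.+-cancelˡ-< j _ _ (subst (_< j ℕ.+ n) (sym (ℕₚ.m+[n∸m]≡n (ℕₚ.≤-pred j≤i)))
      (ℕₚ.<-≤-trans l (ℕₚ.+-monoˡ-≤ n (ℕₚ.≮⇒≥ j≮m))))

pw-≈[] : ∀ {p} → p ≈[ 1 ] 0ˢ → ∀ n → pw p n ≈[ n ] 0ˢ
pw-≈[] h zero    i ()
pw-≈[] h (suc n) = ≈[]-*-0 h (pw-≈[] h n)

-- X′ stands for p / X, so that negative powers of X become powers of X′, and p may carry a sign, as
-- the series a requires. The proof shows Σ_j t_j / (p; p)_{a-j} = (X; p)_a (X′; p)_∞ by raising a
-- from 0, where it is Euler's expansion; then it multiplies by (p; p)_∞ and lets a grow.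
module JTP (X X′ p : PS) (XX′ : X *ˢ X′ ≈ p) (X-0 : X ≈[ 1 ] 0ˢ) (X′-0 : X′ ≈[ 1 ] 0ˢ) where

  private
    p-0 : p ≈[ 1 ] 0ˢ
    p-0 = ≈[]-trans (≈⇒≈[] (≈-sym XX′)) (*-≈[]-0ˡ X′ X-0)

  factor : PS → ℕ → PS
  factor Y k = 1ˢ -ˢ Y *ˢ pw p k

  factor-conv : ∀ {Y} → Y ≈[ 1 ] 0ˢ → Conv (factor Y)
  factor-conv h k = 1-≈[] (≈[]-*-0 h (pw-≈[] p-0 k))

  t⁺ t⁻ : ℕ → PS
  t⁺ zero    = 1ˢ
  t⁺ (suc n) = -ˢ (X *ˢ pw p n) *ˢ t⁺ n
  t⁻ zero    = 1ˢ
  t⁻ (suc n) = -ˢ (X′ *ˢ pw p n) *ˢ t⁻ n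

  t : ℤ → PS
  t (+ n)    = t⁺ n
  t -[1+ n ] = t⁻ (suc n)

  private
    neg-0 : ∀ {n f} → f ≈[ n ] 0ˢ → -ˢ f ≈[ n ] 0ˢ
    neg-0 h = ≈[]-trans (≈[]-neg h) (≈⇒≈[] (solve 0 (:- con 0ℤ := con 0ℤ) ≈-refl))

    t⁺-ord : ∀ n → t⁺ n ≈[ n ] 0ˢ
    t⁺-ord zero    i ()
    t⁺-ord (suc n) = ≈[]-*-0 (neg-0 (*-≈[]-0ˡ (pw p n) X-0)) (t⁺-ord n)

    t⁻-ord : ∀ n → t⁻ n ≈[ n ] 0ˢ
    t⁻-ord zero    i ()
    t⁻-ord (suc n) = ≈[]-*-0 (neg-0 (*-≈[]-0ˡ (pw p n) X′-0)) (t⁻-ord n)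

    t-ord : ∀ j → t j ≈[ ∣ j ∣ ] 0ˢ
    t-ord (+ n)    = t⁺-ord n
    t-ord -[1+ n ] = t⁻-ord (suc n)

    fp : ℕ → PS
    fp = factor p
    pf : ℕ → PS
    pf = prodFin fp

    pf-0 : ∀ m → pf m 0 ≡ 1ℤ
    pf-0 zero    = refl
    pf-0 (suc m) = *ˢ-unit {pf m} {fp m} (pf-0 m) (factor-conv p-0 m 0 (s≤s z≤n))

    ip : ℤ → PS
    ip (+ m)    = inv (pf m)
    ip -[1+ _ ] = 0ˢ

    pz : ℤ → PS
    pz (+ m)    = pw p m
    pz -[1+ _ ] = 0ˢ

    -- Reading 1 / (p; p)_m as 0 for negative m keeps the recurrence valid for all integers; at m =
    -- -1 the factor p⁰ = 1 carries it.
    ip-suc : ∀ m → ip (1ℤ + m) ≈ ip m +ˢ pz (1ℤ + m) *ˢ ip (1ℤ + m)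
    ip-suc -[1+ suc m ] = solve 0 (con 0ℤ := con 0ℤ :+ con 0ℤ :* con 0ℤ) ≈-refl
    ip-suc -[1+ zero ]  = solve 1 (λ a → a := con 0ℤ :+ con 1ℤ :* a) ≈-refl (inv (pf 0))
    ip-suc (+ m)        = ≈-trans (solve 2 (λ a b → a := a :* (con 1ℤ :- b) :+ b :* a) ≈-refl A (pw p (suc m))) (+ˢ-cong A*f ≈-refl)
      where
      A B : PS
      A = inv (pf (suc m))
      B = inv (pf m)
      A*f : A *ˢ fp m ≈ B
      A*f =
        A *ˢ fp m                     ≈⟨ *ˢ-1 _ ⟨
        A *ˢ fp m *ˢ 1ˢ               ≈⟨ *ˢ-congˡ (*ˢ-inv (pf m) (pf-0 m)) ⟨
        A *ˢ fp m *ˢ (pf m *ˢ B)      ≈⟨ solve 4 (λ a f g b → a :* f :* (g :* b) := (g :* f :* a) :* b) ≈-refl A (fp m) (pf m) B ⟩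
        pf m *ˢ fp m *ˢ A *ˢ B        ≈⟨ *ˢ-congʳ (*ˢ-inv (pf (suc m)) (pf-0 (suc m))) ⟩
        1ˢ *ˢ B                       ≈⟨ 1-*ˢ B ⟩
        B                             ≈∎

    -- Euler's expansion of the product over 1 - X′pᵏ

    B-term : ℕ → ℕ → PS
    B-term b i = t⁻ i *ˢ pw p (b ℕ.* i) *ˢ ip (+ i)

    B-ord : ∀ b i → B-term b i ≈[ i ] 0ˢ
    B-ord b i = *-≈[]-0ˡ _ (*-≈[]-0ˡ _ (t⁻-ord i))

    Bs : ℕ → PS
    Bs b = Sum (B-term b) (B-ord b)

    Bs-⇛ : ∀ b → B-term b ⇛ Bs b
    Bs-⇛ b = Sum-⇛ (B-term b) (B-ord b)

    Bs-step : ∀ b → Bs b ≈ factor X′ b *ˢ Bs (suc b)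
    Bs-step b =
      Bs b                                                   ≈⟨ solve 2 (λ x y → x := (x :- y) :+ y) ≈-refl (Bs b) (Bs (suc b)) ⟩
      Bs b -ˢ Bs (suc b) +ˢ Bs (suc b)                       ≈⟨ +ˢ-cong (⇛-unique shifted (⇛-*ˡ (-ˢ (X′ *ˢ pw p b)) (Bs-⇛ (suc b)))) ≈-refl ⟩
      -ˢ (X′ *ˢ pw p b) *ˢ Bs (suc b) +ˢ Bs (suc b)          ≈⟨ solve 2 (λ x y → :- x :* y :+ y := (con 1ℤ :- x) :* y) ≈-refl (X′ *ˢ pw p b) (Bs (suc b)) ⟩
      factor X′ b *ˢ Bs (suc b)                              ≈∎
      where
      diff : ∀ i → B-term b i -ˢ B-term (suc b) i ≈ t⁻ i *ˢ pw p (b ℕ.* i) *ˢ (ip (+ i) -ˢ pw p i *ˢ ip (+ i))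
      diff i = ≈-trans (-ˢ-cong ≈-refl (*ˢ-congʳ (*ˢ-congˡ (pw-+ p i (b ℕ.* i)))))
        (solve 4 (λ a b c d → a :* b :* d :- a :* (c :* b) :* d := a :* b :* (d :- c :* d)) ≈-refl (t⁻ i) (pw p (b ℕ.* i)) (pw p i) (ip (+ i)))
      diff-0 : B-term b 0 -ˢ B-term (suc b) 0 ≈ 0ˢ
      diff-0 = ≈-trans (diff 0) (solve 2 (λ a b → a :* (b :- con 1ℤ :* b) := con 0ℤ) ≈-refl (t⁻ 0 *ˢ pw p (b ℕ.* 0)) (ip 0ℤ))
      diff-suc : ∀ i → B-term b (suc i) -ˢ B-term (suc b) (suc i) ≈ -ˢ (X′ *ˢ pw p b) *ˢ B-term (suc b) i
      diff-suc i =
        B-term b (suc i) -ˢ B-term (suc b) (suc i)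
          ≈⟨ diff (suc i) ⟩
        t⁻ (suc i) *ˢ pw p (b ℕ.* suc i) *ˢ (ip (+ suc i) -ˢ pw p (suc i) *ˢ ip (+ suc i))
          ≈⟨ *ˢ-cong (*ˢ-congˡ (≈-trans (≡⇒≈ (cong (pw p) (ℕₚ.*-suc b i))) (pw-+ p b (b ℕ.* i)))) (≈-trans (-ˢ-cong (ip-suc (+ i)) ≈-refl) (solve 2 (λ a b → a :+ b :- b := a) ≈-refl (ip (+ i)) (pw p (suc i) *ˢ ip (+ suc i)))) ⟩
        -ˢ (X′ *ˢ pw p i) *ˢ t⁻ i *ˢ (pw p b *ˢ pw p (b ℕ.* i)) *ˢ ip (+ i)
          ≈⟨ solve 6 (λ x i t b c d → :- (x :* i) :* t :* (b :* c) :* d := :- (x :* b) :* (t :* (i :* c) :* d)) ≈-refl X′ (pw p i) (t⁻ i) (pw p b) (pw p (b ℕ.* i)) (ip (+ i)) ⟩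
        -ˢ (X′ *ˢ pw p b) *ˢ (t⁻ i *ˢ (pw p i *ˢ pw p (b ℕ.* i)) *ˢ ip (+ i))
          ≈⟨ *ˢ-congˡ (*ˢ-congʳ (*ˢ-congˡ (pw-+ p i (b ℕ.* i)))) ⟨
        -ˢ (X′ *ˢ pw p b) *ˢ B-term (suc b) i ≈∎
      shifted : (λ i → -ˢ (X′ *ˢ pw p b) *ˢ B-term (suc b) i) ⇛ Bs b -ˢ Bs (suc b)
      shifted = ⇛-cong diff-suc (⇛-pred diff-0 (⇛-minus (Bs-⇛ b) (Bs-⇛ (suc b))))

    Bs-prod : ∀ b → Bs 0 ≈ prodFin (factor X′) b *ˢ Bs b
    Bs-prod zero    = ≈-sym (1-*ˢ _)
    Bs-prod (suc b) = ≈-trans (Bs-prod b) (≈-trans (*ˢ-congˡ (Bs-step b)) (≈-sym (*ˢ-assoc _ _ _)))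

    Bs-1 : ∀ b → Bs b ≈[ b ] 1ˢ
    Bs-1 b n l = ⇓-unique (Bs-⇛ b n) (⇓-≡ (≈-trans b0 ≈-refl at n) (⇓-single {f = λ i → B-term b i n} 0 only))
      where
      inv-1 : inv 1ˢ ≈ 1ˢ
      inv-1 = ≈-trans (≈-sym (1-*ˢ _)) (*ˢ-inv 1ˢ refl)
      b0 : B-term b 0 ≈ 1ˢ
      b0 = ≈-trans (*ˢ-cong (*ˢ-congˡ (≡⇒≈ (cong (pw p) (ℕₚ.*-zeroʳ b)))) inv-1) (solve 0 (con 1ℤ :* con 1ℤ :* con 1ℤ := con 1ℤ) ≈-refl)
      only : ∀ i → B-term b i n ≢ 0ℤ → i ≡ 0
      only zero    _ = refl
      only (suc i) q = ⊥-elim (q (trans (*-≈[]-0ˡ (ip (+ suc i)) (*-≈[]-0ʳ (t⁻ (suc i)) (≈[]-≤ (ℕₚ.m≤m*n b (suc i)) (pw-≈[] p-0 (b ℕ.* suc i)))) n l) (0ˢ-at n)))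

    Bs-Π : Bs 0 ≈ Π∞ (factor X′)
    Bs-Π = Π∞-intro Bs (factor-conv X′-0) Bs-prod Bs-1

    G-term : ℕ → ℤ → PS
    G-term a j = t j *ˢ ip (+ a - j)

    G-ord : ∀ a j → G-term a j ≈[ ∣ j ∣ ] 0ˢ
    G-ord a j = *-≈[]-0ˡ _ (t-ord j)

    Gs : ℕ → PS
    Gs a = Sum (G-term a) (G-ord a)

    Gs-⇛ : ∀ a → G-term a ⇛ Gs a
    Gs-⇛ a = Sum-⇛ (G-term a) (G-ord a)

    -- The exchange of t_{i+1} p^{a-i} for -X p^a t_i: by definition of `t⁺` for i ≥ 0, by X X′ = p
    -- for i < 0, and trivially for i > a, where `ip` is 0.
    key : ∀ a i → t (1ℤ + i) *ˢ (pz (+ a - i) *ˢ ip (+ a - i)) ≈ -ˢ (X *ˢ pw p a) *ˢ (t i *ˢ ip (+ a - i))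
    key a -[1+ n ] =
      t (1ℤ + -[1+ n ]) *ˢ (pw p (a ℕ.+ suc n) *ˢ I)
        ≈⟨ *ˢ-cong (t-neg n) (*ˢ-congʳ (≈-trans (pw-+ p a (suc n)) (*ˢ-congˡ (*ˢ-congʳ (≈-sym XX′))))) ⟩
      t⁻ n *ˢ (pw p a *ˢ (X *ˢ X′ *ˢ pw p n) *ˢ I)
        ≈⟨ solve 6 (λ t a x y n i → t :* (a :* (x :* y :* n) :* i) := :- (x :* a) :* (:- (y :* n) :* t :* i)) ≈-refl (t⁻ n) (pw p a) X X′ (pw p n) I ⟩
      -ˢ (X *ˢ pw p a) *ˢ (t⁻ (suc n) *ˢ I) ≈∎
      where
      I = ip (+ (a ℕ.+ suc n))
      t-neg : ∀ n → t (1ℤ + -[1+ n ]) ≈ t⁻ n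
      t-neg zero    = ≈-refl
      t-neg (suc n) = ≈-refl
    key a (+ n) with n ℕₚ.≤? a
    ... | yes n≤a = subst (λ m → t⁺ (suc n) *ˢ (pz m *ˢ ip m) ≈ -ˢ (X *ˢ pw p a) *ˢ (t⁺ n *ˢ ip m)) (sym a-n)
        (≈-trans (solve 5 (λ x n t d i → :- (x :* n) :* t :* (d :* i) := :- (x :* (d :* n)) :* (t :* i)) ≈-refl X (pw p n) (t⁺ n) (pw p (a ℕ.∸ n)) (ip (+ (a ℕ.∸ n))))
          (*ˢ-congʳ (negˢ-cong (*ˢ-congˡ (≈-trans (≈-sym (pw-+ p (a ℕ.∸ n) n)) (≡⇒≈ (cong (pw p) (ℕₚ.m∸n+n≡m n≤a))))))))
      where
      a-n : + a - + n ≡ + (a ℕ.∸ n)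
      a-n = trans (ℤₚ.m-n≡m⊖n a n) (ℤₚ.⊖-≥ n≤a)
    ... | no n≰a = subst (λ m → t⁺ (suc n) *ˢ (pz m *ˢ ip m) ≈ -ˢ (X *ˢ pw p a) *ˢ (t⁺ n *ˢ ip m)) (sym (proj₂ neg))
        (solve 3 (λ t x s → t :* (con 0ℤ :* con 0ℤ) := x :* (s :* con 0ℤ)) ≈-refl (t⁺ (suc n)) (-ˢ (X *ˢ pw p a)) (t⁺ n))
      where
      neg : ∃ λ d → + a - + n ≡ -[1+ d ]
      neg with ℕₚ.m≤n⇒∃[o]m+o≡n (ℕₚ.≰⇒> n≰a)
      ... | d , refl = d , trans (ℤₚ.m-n≡m⊖n a (suc a ℕ.+ d)) (trans (ℤₚ.⊖-< (s≤s (ℕₚ.m≤m+n a d)))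
        (cong (λ x → - (+ x)) (trans (cong (ℕ._∸ a) (sym (ℕₚ.+-suc a d))) (ℕₚ.m+n∸m≡n a (suc d)))))

    Gs-step : ∀ a → Gs (suc a) ≈ Gs a *ˢ factor X a
    Gs-step a = ≈-trans (≈-trans (solve 2 (λ x y → x := y :+ (x :- y)) ≈-refl (Gs (suc a)) (Gs a))
        (+ˢ-cong ≈-refl (⇛-unique shifted (⇛-*ˡ (-ˢ (X *ˢ pw p a)) (Gs-⇛ a)))))
      (solve 2 (λ y z → y :+ :- z :* y := y :* (con 1ℤ :- z)) ≈-refl (Gs a) (X *ˢ pw p a))
      where
      l₁ : ∀ a j → 1ℤ + a - j ≡ 1ℤ + (a - j)
      l₁ = solve-∀
      l₂ : ∀ a j → 1ℤ + (a - (1ℤ + j)) ≡ a - j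
      l₂ = solve-∀
      l₃ : ∀ j → 1ℤ + j - 1ℤ ≡ j
      l₃ = solve-∀
      l₄ : ∀ j → 1ℤ + (j - 1ℤ) ≡ j
      l₄ = solve-∀
      diff : ∀ j → G-term (suc a) j -ˢ G-term a j ≈ t j *ˢ (pz (1ℤ + (+ a - j)) *ˢ ip (1ℤ + (+ a - j)))
      diff j = ≈-trans (-ˢ-cong (*ˢ-congˡ (≈-trans (≡⇒≈ (cong ip (l₁ (+ a) j))) (ip-suc (+ a - j)))) ≈-refl)
        (solve 3 (λ t i e → t :* (i :+ e) :- t :* i := t :* e) ≈-refl (t j) (ip (+ a - j)) _)
      shifted : (λ j → -ˢ (X *ˢ pw p a) *ˢ G-term a j) ⇛ Gs (suc a) -ˢ Gs a
      shifted = ⇛-cong (λ j → ≈-trans (≡⇒≈ (cong (λ m → t (1ℤ + j) *ˢ (pz m *ˢ ip m)) (l₂ (+ a) j))) (key a j))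
        (⇛-bij (λ j → 1ℤ + j) (λ j → j - 1ℤ) l₃ l₄ (⇛-cong diff (⇛-minus (Gs-⇛ (suc a)) (Gs-⇛ a))))

    Gs-0 : Gs 0 ≈ Bs 0
    Gs-0 = ⇛-unique (λ n → ⇓-reindex {f = λ j → G-term 0 j n} φ ψ ψφ (φψ n) (Gs-⇛ 0 n)) (⇛-cong same (Bs-⇛ 0))
      where
      φ : ℕ → ℤ
      φ i = - (+ i)
      ψ : ℤ → ℕ
      ψ j = ∣ j ∣
      ψφ : ∀ i → ψ (φ i) ≡ i
      ψφ zero    = refl
      ψφ (suc i) = refl
      φψ : ∀ n j → G-term 0 j n ≢ 0ℤ → φ (ψ j) ≡ j
      φψ n (+ zero)   q = refl
      φψ n (+ suc j)  q = ⊥-elim (q (trans (solve 1 (λ t → t :* con 0ℤ := con 0ℤ) ≈-refl (t⁺ (suc j)) at n) (0ˢ-at n)))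
      φψ n -[1+ j ]   q = refl
      same : ∀ i → B-term 0 i ≈ G-term 0 (φ i)
      same zero    = *ˢ-congʳ (*ˢ-1 _)
      same (suc i) = *ˢ-congʳ (*ˢ-1 _)

    Gs-prod : ∀ a → Gs a ≈ prodFin (factor X) a *ˢ Bs 0
    Gs-prod zero    = ≈-trans Gs-0 (≈-sym (1-*ˢ _))
    Gs-prod (suc a) = ≈-trans (Gs-step a) (≈-trans (*ˢ-congʳ (Gs-prod a)) (solve 3 (λ a b c → a :* b :* c := a :* c :* b) ≈-refl _ _ _))

    pinf : PS
    pinf = Π∞ fp

    pinf-ip : ∀ m → pinf *ˢ ip (+ m) ≈[ suc m ] 1ˢ
    pinf-ip m = ≈[]-trans (≈[]-* (Π∞-≈[] (factor-conv p-0) m) ≈[]-refl) (≈⇒≈[] (*ˢ-inv (pf m) (pf-0 m)))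

  rhs : PS
  rhs = Π∞ (factor p) *ˢ (Π∞ (factor X) *ˢ Π∞ (factor X′))

  triple-product : t ⇛ rhs
  triple-product n = ⇓-≡ val (⇓-cong pt (⇛-*ˡ pinf (Gs-⇛ (n ℕ.+ n)) n))
    where
    -- For j ≤ n this gives a - j ≥ n, so (p; p)_∞ / (p; p)_{a-j} is 1 up to q^n; for j > n the
    -- summand itself starts beyond q^n.
    a = n ℕ.+ n
    val : (pinf *ˢ Gs a) n ≡ rhs n
    val = ≈[]-* (≈[]-refl {f = pinf}) (≈[]-trans (≈⇒≈[] (Gs-prod a)) (≈[]-* (≈[]-≤ (s≤s (ℕₚ.m≤m+n n n)) (≈[]-sym (Π∞-≈[] (factor-conv X-0) a))) (≈⇒≈[] Bs-Π))) n ℕₚ.≤-refl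
    near : ∀ j m → + a - j ≡ + (n ℕ.+ m) → (pinf *ˢ G-term a j) n ≡ t j n
    near j m e = trans (≈-trans (solve 3 (λ a b c → a :* (b :* c) := b :* (a :* c)) ≈-refl pinf (t j) (ip (+ a - j))) (*ˢ-congˡ (*ˢ-congˡ (≡⇒≈ (cong ip e)))) at n)
      (trans (≈[]-* {g′ = 1ˢ} (≈[]-refl {f = t j}) (≈[]-≤ (s≤s (ℕₚ.m≤m+n n m)) (pinf-ip (n ℕ.+ m))) n ℕₚ.≤-refl) (*ˢ-1 (t j) at n))
    pt : ∀ j → (pinf *ˢ G-term a j) n ≡ t j n
    pt -[1+ k ] = near -[1+ k ] (n ℕ.+ suc k) (cong +_ (ℕₚ.+-assoc n n (suc k)))
    pt (+ k) with k ℕₚ.≤? n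
    ... | yes k≤n = near (+ k) (n ℕ.∸ k) (trans (ℤₚ.m-n≡m⊖n a k) (trans (ℤₚ.⊖-≥ (ℕₚ.≤-trans k≤n (ℕₚ.m≤m+n n n))) (cong +_ (ℕₚ.+-∸-assoc n k≤n))))
    ... | no k≰n = trans (*-≈[]-0ʳ pinf (G-ord a (+ k)) n (ℕₚ.≰⇒> k≰n)) (sym (t-ord (+ k) n (ℕₚ.≰⇒> k≰n)))

mono-at : ∀ w m n → mono w m n ≡ w * δ (+ m) (+ n)
mono-at w m n with m ℕₚ.≟ n
... | yes p = trans (eq m n p) (sym (trans (cong (_*_ w) (δ-≡ (cong +_ p))) (ℤₚ.*-identityʳ w)))
  where
  eq : ∀ m n → m ≡ n → mono w m n ≡ w
  eq zero    zero    _ = refl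
  eq (suc m) (suc n) p = eq m n (ℕₚ.suc-injective p)
... | no ¬p = trans (ne m n ¬p) (sym (trans (cong (_*_ w) (δ-≢ (¬p ∘ ℤₚ.+-injective))) (ℤₚ.*-zeroʳ w)))
  where
  ne : ∀ m n → m ≢ n → mono w m n ≡ 0ℤ
  ne zero    zero    p with () ← p refl
  ne zero    (suc n) p = refl
  ne (suc m) zero    p = refl
  ne (suc m) (suc n) p = ne m n (p ∘ cong suc)

IsMono : PS → ℤ → ℤ → Set
IsMono f w e = ∃ λ m → e ≡ + m × f ≈ mono w m

IsMono-at : ∀ {f w e} → IsMono f w e → ∀ n → f n ≡ w * δ e (+ n)
IsMono-at {w = w} (m , p , q) n = trans (q at n) (trans (mono-at w m n) (cong (λ e → w * δ e (+ n)) (sym p)))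

IsMono-* : ∀ {f g w v e e′} → IsMono f w e → IsMono g v e′ → IsMono (f *ˢ g) (w * v) (e + e′)
IsMono-* {w = w} {v} (m , p , q) (m′ , p′ , q′) = m ℕ.+ m′ , cong₂ _+_ p p′ , ≈-trans (*ˢ-cong q q′) (mono-* w m v m′)

mono-neg : ∀ w m → -ˢ mono w m ≈ mono (- w) m
mono-neg w m = coeffs λ n → trans (-ˢ-at (mono w m) n) (lem m n)
  where
  lem : ∀ m n → - mono w m n ≡ mono (- w) m n
  lem zero    zero    = refl
  lem zero    (suc n) = refl
  lem (suc m) zero    = refl
  lem (suc m) (suc n) = lem m n

IsMono-neg : ∀ {f w e} → IsMono f w e → IsMono (-ˢ f) (- w) e
IsMono-neg {w = w} (m , p , q) = m , p , ≈-trans (negˢ-cong q) (mono-neg w m)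

IsMono-≡ : ∀ {f w w′ e e′} → w ≡ w′ → e ≡ e′ → IsMono f w e → IsMono f w′ e′
IsMono-≡ refl refl h = h

IsMono-1 : IsMono 1ˢ 1ℤ 0ℤ
IsMono-1 = 0 , refl , ≈-sym (mono-cst 1ℤ)

mono-IsMono : ∀ w m → IsMono (mono w m) w (+ m)
mono-IsMono w m = m , refl , ≈-refl

pw-mono : ∀ γ → γ * γ ≡ 1ℤ → ∀ s n → pw (mono γ s) (n ℕ.+ n) ≈ mono 1ℤ (s ℕ.* (n ℕ.+ n))
pw-mono γ γ² s zero = ≈-trans (≈-sym (mono-cst 1ℤ)) (≡⇒≈ (cong (mono 1ℤ) (sym (ℕₚ.*-zeroʳ s))))
pw-mono γ γ² s (suc n) =
  pw (mono γ s) (suc n ℕ.+ suc n)                              ≈⟨ ≡⇒≈ (cong (λ k → pw (mono γ s) (suc k)) (ℕₚ.+-suc n n)) ⟩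
  mono γ s *ˢ (mono γ s *ˢ pw (mono γ s) (n ℕ.+ n))            ≈⟨ *ˢ-congˡ (*ˢ-congˡ (pw-mono γ γ² s n)) ⟩
  mono γ s *ˢ (mono γ s *ˢ mono 1ℤ (s ℕ.* (n ℕ.+ n)))          ≈⟨ ≈-trans (*ˢ-congˡ (mono-* γ s 1ℤ _)) (mono-* γ s _ _) ⟩
  mono (γ * (γ * 1ℤ)) (s ℕ.+ (s ℕ.+ s ℕ.* (n ℕ.+ n)))          ≈⟨ ≡⇒≈ (cong₂ mono (trans (cong (_*_ γ) (ℤₚ.*-identityʳ γ)) γ²) (lem s n)) ⟩
  mono 1ℤ (s ℕ.* (suc n ℕ.+ suc n))                            ≈∎
  where
  lem : ∀ s n → s ℕ.+ (s ℕ.+ s ℕ.* (n ℕ.+ n)) ≡ s ℕ.* (suc n ℕ.+ suc n)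
  lem = solveℕ

pw-1 : ∀ s n → pw (mono 1ℤ s) n ≈ mono 1ℤ (s ℕ.* n)
pw-1 s zero    = ≈-trans (≈-sym (mono-cst 1ℤ)) (≡⇒≈ (cong (mono 1ℤ) (sym (ℕₚ.*-zeroʳ s))))
pw-1 s (suc n) = ≈-trans (*ˢ-congˡ (pw-1 s n)) (≈-trans (mono-* 1ℤ s 1ℤ _) (≡⇒≈ (cong (mono 1ℤ) (sym (ℕₚ.*-suc s n)))))

fac : ℤ → ℕ → ℕ → ℕ → PS
fac c e s k = 1ˢ -ˢ mono c (e ℕ.+ s ℕ.* k)

fac-conv : ∀ c e s → Conv (fac c (suc e) (suc s))
fac-conv c e s k = 1-≈[] (mono-≈[] c (s≤s (ℕₚ.≤-trans (ℕₚ.m≤m+n k (s ℕ.* k)) (ℕₚ.m≤n+m _ e))))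

pochFin-prodFin : ∀ c e s K → pochFin c e s K ≈ prodFin (fac c e s) K
pochFin-prodFin c e s zero    = ≈-refl
pochFin-prodFin c e s (suc K) = ≈-trans (≡⇒≈ (sym (trans (*ˢ-⊗ _ _) (cong (pochFin c e s K ⊗_) (-ˢ-⊝ 1ˢ (mono c (e ℕ.+ s ℕ.* K)))))))
  (*ˢ-congʳ (pochFin-prodFin c e s K))

poch-Π∞ : ∀ c e s → poch c e s ≈ Π∞ (fac c e s)
poch-Π∞ c e s = coeffs λ n → pochFin-prodFin c e s (suc n) at n

poch-unit : ∀ c e s → poch c (suc e) (suc s) 0 ≡ 1ℤ
poch-unit c e s = trans (poch-Π∞ c (suc e) (suc s) at 0) (Π∞-0 (fac-conv c e s))

poch-2 : ∀ c e s → poch c (suc e) (suc s) ≈ poch c (suc e) (suc s ℕ.+ suc s) *ˢ poch c (suc e ℕ.+ suc s) (suc s ℕ.+ suc s)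
poch-2 c e s = ≈-trans (poch-Π∞ c (suc e) (suc s)) (≈-trans (Π∞-2 (fac-conv c e s) (conv-cong f₀ (fac-conv c e (s ℕ.+ suc s))) (conv-cong f₁ (fac-conv c (e ℕ.+ suc s) (s ℕ.+ suc s))))
  (*ˢ-cong (≈-trans (Π∞-cong f₀) (≈-sym (poch-Π∞ c _ _))) (≈-trans (Π∞-cong f₁) (≈-sym (poch-Π∞ c _ _)))))
  where
  conv-cong : ∀ {f g} → (∀ k → f k ≈ g k) → Conv g → Conv f
  conv-cong h c k i l = trans (h k at i) (c k i l)
  f₀ : ∀ k → fac c (suc e) (suc s) (k ℕ.+ k) ≈ fac c (suc e) (suc s ℕ.+ suc s) k
  f₀ k = ≡⇒≈ (cong (λ m → 1ˢ -ˢ mono c m) (lem e s k))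
    where
    lem : ∀ e s k → suc e ℕ.+ suc s ℕ.* (k ℕ.+ k) ≡ suc e ℕ.+ (suc s ℕ.+ suc s) ℕ.* k
    lem = solveℕ
  f₁ : ∀ k → fac c (suc e) (suc s) (suc (k ℕ.+ k)) ≈ fac c (suc e ℕ.+ suc s) (suc s ℕ.+ suc s) k
  f₁ k = ≡⇒≈ (cong (λ m → 1ˢ -ˢ mono c m) (lem e s k))
    where
    lem : ∀ e s k → suc e ℕ.+ suc s ℕ.* (suc (k ℕ.+ k)) ≡ suc e ℕ.+ suc s ℕ.+ (suc s ℕ.+ suc s) ℕ.* k
    lem = solveℕ

poch-3 : ∀ c e s → let s₃ = suc s ℕ.+ suc s ℕ.+ suc s in
  poch c (suc e) (suc s) ≈ poch c (suc e) s₃ *ˢ poch c (suc e ℕ.+ suc s) s₃ *ˢ poch c (suc e ℕ.+ suc s ℕ.+ suc s) s₃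
poch-3 c e s = ≈-trans (poch-Π∞ c (suc e) (suc s)) (≈-trans (Π∞-3 (fac-conv c e s) (conv-cong f₀ (fac-conv c e (s ℕ.+ suc s ℕ.+ suc s))) (conv-cong f₁ (fac-conv c (e ℕ.+ suc s) (s ℕ.+ suc s ℕ.+ suc s))) (conv-cong f₂ (fac-conv c (e ℕ.+ suc s ℕ.+ suc s) (s ℕ.+ suc s ℕ.+ suc s))))
  (*ˢ-cong (*ˢ-cong (≈-trans (Π∞-cong f₀) (≈-sym (poch-Π∞ c _ _))) (≈-trans (Π∞-cong f₁) (≈-sym (poch-Π∞ c _ _)))) (≈-trans (Π∞-cong f₂) (≈-sym (poch-Π∞ c _ _)))))
  where
  conv-cong : ∀ {f g} → (∀ k → f k ≈ g k) → Conv g → Conv f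
  conv-cong h c k i l = trans (h k at i) (c k i l)
  s₃ = suc s ℕ.+ suc s ℕ.+ suc s
  f₀ : ∀ k → fac c (suc e) (suc s) (tri* k) ≈ fac c (suc e) s₃ k
  f₀ k = ≡⇒≈ (cong (λ m → 1ˢ -ˢ mono c m) (lem e s k))
    where
    lem : ∀ e s k → suc e ℕ.+ suc s ℕ.* (k ℕ.+ (k ℕ.+ k)) ≡ suc e ℕ.+ (suc s ℕ.+ suc s ℕ.+ suc s) ℕ.* k
    lem = solveℕ
  f₁ : ∀ k → fac c (suc e) (suc s) (suc (tri* k)) ≈ fac c (suc e ℕ.+ suc s) s₃ k
  f₁ k = ≡⇒≈ (cong (λ m → 1ˢ -ˢ mono c m) (lem e s k))
    where
    lem : ∀ e s k → suc e ℕ.+ suc s ℕ.* (suc (k ℕ.+ (k ℕ.+ k))) ≡ suc e ℕ.+ suc s ℕ.+ (suc s ℕ.+ suc s ℕ.+ suc s) ℕ.* k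
    lem = solveℕ
  f₂ : ∀ k → fac c (suc e) (suc s) (suc (suc (tri* k))) ≈ fac c (suc e ℕ.+ suc s ℕ.+ suc s) s₃ k
  f₂ k = ≡⇒≈ (cong (λ m → 1ˢ -ˢ mono c m) (lem e s k))
    where
    lem : ∀ e s k → suc e ℕ.+ suc s ℕ.* (suc (suc (k ℕ.+ (k ℕ.+ k)))) ≡ suc e ℕ.+ suc s ℕ.+ suc s ℕ.+ (suc s ℕ.+ suc s ℕ.+ suc s) ℕ.* k
    lem = solveℕ

P*Pm : ∀ e s → P (suc e) (suc s) *ˢ Pm (suc e) (suc s) ≈ P (suc e ℕ.+ suc e) (suc s ℕ.+ suc s)
P*Pm e s = ≈-trans (*ˢ-cong (poch-Π∞ _ _ _) (poch-Π∞ _ _ _)) (≈-trans (≈-sym (Π∞-* (fac-conv _ e s) (fac-conv _ e s)))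
  (≈-trans (Π∞-cong sq) (≈-sym (poch-Π∞ _ _ _))))
  where
  lem : ∀ e s k → (suc e ℕ.+ suc s ℕ.* k) ℕ.+ (suc e ℕ.+ suc s ℕ.* k) ≡ (suc e ℕ.+ suc e) ℕ.+ (suc s ℕ.+ suc s) ℕ.* k
  lem = solveℕ
  sq : ∀ k → fac 1ℤ (suc e) (suc s) k *ˢ fac (- 1ℤ) (suc e) (suc s) k ≈ fac 1ℤ (suc e ℕ.+ suc e) (suc s ℕ.+ suc s) k
  sq k = ≈-trans (*ˢ-congˡ (-ˢ-cong ≈-refl (≈-sym (mono-neg 1ℤ m)))) (≈-trans (solve 1 (λ x → (con 1ℤ :- x) :* (con 1ℤ :- :- x) := con 1ℤ :- x :* x) ≈-refl (mono 1ℤ m))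
    (-ˢ-cong ≈-refl (≈-trans (mono-* 1ℤ m 1ℤ m) (≡⇒≈ (cong (mono 1ℤ) (lem e s k))))))
    where m = suc e ℕ.+ suc s ℕ.* k

-- A theta family is recognised by its first-order recurrence in the index, which is that of the
-- terms of the triple product with X = c q^{e+1} and X′ = c q^{e′+1}. The shifts by 1 guarantee
-- that X and X′ have no constant term.
module Theta (c : ℤ) (c² : c * c ≡ 1ℤ) (e e′ : ℕ) (F : Fam ℤ) (wt-0 : wt F 0ℤ ≡ 1ℤ) (ex-0 : ex F 0ℤ ≡ 0ℤ)
  (wt-suc : ∀ j → wt F (1ℤ + j) ≡ - c * wt F j)
  (ex-suc : ∀ j → ex F (1ℤ + j) ≡ ex F j + (+ suc e + (+ suc e + + suc e′) * j)) where

  private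
    s = suc e ℕ.+ suc e′
    open module J = JTP (mono c (suc e)) (mono c (suc e′)) (mono 1ℤ s)
      (≈-trans (mono-* c (suc e) c (suc e′)) (≡⇒≈ (cong (λ x → mono x s) c²))) (mono-≈[] c (s≤s z≤n)) (mono-≈[] c (s≤s z≤n))

    ratio : ∀ e n → IsMono (-ˢ (mono c e *ˢ pw (mono 1ℤ s) n)) (- (c * 1ℤ)) (+ e + + (s ℕ.* n))
    ratio e n = IsMono-neg (IsMono-* (mono-IsMono c e) (s ℕ.* n , refl , pw-1 s n))

    t⁺-mono : ∀ n → IsMono (t⁺ n) (wt F (+ n)) (ex F (+ n))
    t⁺-mono zero    = IsMono-≡ (sym wt-0) (sym ex-0) IsMono-1
    t⁺-mono (suc n) = IsMono-≡ (trans (cong (λ x → - x * wt F (+ n)) (ℤₚ.*-identityʳ c)) (sym (wt-suc (+ n))))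
      (trans (lem (ex F (+ n)) (+ suc e) (+ (s ℕ.* n))) (trans (cong (λ x → ex F (+ n) + (+ suc e + x)) (ℤₚ.pos-* s n)) (sym (ex-suc (+ n)))))
      (IsMono-* (ratio (suc e) n) (t⁺-mono n))
      where
      lem : ∀ x e y → e + y + x ≡ x + (e + y)
      lem = solve-∀

    t⁻-mono : ∀ n → IsMono (t⁻ n) (wt F (- + n)) (ex F (- + n))
    t⁻-mono zero    = IsMono-≡ (sym wt-0) (sym ex-0) IsMono-1
    t⁻-mono (suc n) = IsMono-≡ wt-eq ex-eq (IsMono-* (ratio (suc e′) n) (t⁻-mono n))
      where
      back : ∀ n → 1ℤ + -[1+ n ] ≡ - + n
      back zero    = refl
      back (suc n) = refl
      cancel : ∀ c w → - (c * 1ℤ) * (- c * w) ≡ c * c * w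
      cancel = solve-∀
      wt-eq : - (c * 1ℤ) * wt F (- + n) ≡ wt F -[1+ n ]
      wt-eq = trans (cong (_*_ (- (c * 1ℤ))) (trans (cong (wt F) (sym (back n))) (wt-suc -[1+ n ])))
        (trans (cancel c (wt F -[1+ n ])) (trans (cong (_* wt F -[1+ n ]) c²) (ℤₚ.*-identityˡ (wt F -[1+ n ]))))
      lem : ∀ a b n x → b + (a + b) * n + (x + (a + (a + b) * - (1ℤ + n))) ≡ x
      lem = solve-∀
      ex-eq : + suc e′ + + (s ℕ.* n) + ex F (- + n) ≡ ex F -[1+ n ]
      ex-eq = trans (cong₂ (λ x y → + suc e′ + x + y) (ℤₚ.pos-* s n) (trans (cong (ex F) (sym (back n))) (ex-suc -[1+ n ])))
        (lem (+ suc e) (+ suc e′) (+ n) (ex F -[1+ n ]))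

    t-mono : ∀ j → IsMono (t j) (wt F j) (ex F j)
    t-mono (+ n)    = t⁺-mono n
    t-mono -[1+ n ] = t⁻-mono (suc n)

    fac≈ : ∀ c e k → 1ˢ -ˢ mono c e *ˢ pw (mono 1ℤ s) k ≈ fac c e s k
    fac≈ c e k = -ˢ-cong ≈-refl (≈-trans (*ˢ-congˡ (pw-1 s k)) (≈-trans (mono-* c e 1ℤ (s ℕ.* k)) (≡⇒≈ (cong (λ x → mono x (e ℕ.+ s ℕ.* k)) (ℤₚ.*-identityʳ c)))))

    to-poch : ∀ c e → Π∞ (λ k → 1ˢ -ˢ mono c e *ˢ pw (mono 1ℤ s) k) ≈ poch c e s
    to-poch c e = ≈-trans (Π∞-cong (fac≈ c e)) (≈-sym (poch-Π∞ c e s))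

  product : gf F ≈ P s s *ˢ (poch c (suc e) s *ˢ poch c (suc e′) s)
  product = ≈-trans (≈-sym (gf-unique F rhs (λ n → ⇓-cong (λ j → IsMono-at (t-mono j) n) (triple-product n))))
    (*ˢ-cong (to-poch 1ℤ s) (*ˢ-cong (to-poch c (suc e)) (to-poch c (suc e′))))

-- Product forms of the theta series

private
  neg-1* : ∀ s → - s ≡ - 1ℤ * s
  neg-1* = solve-∀
α-product : gf fα ≈ P 6 6 *ˢ (Pm 1 6 *ˢ Pm 5 6)
α-product = Theta.product (- 1ℤ) refl 0 4 fα refl refl (λ j → refl) lem
  where
  lem : ∀ j → + 3 * (1ℤ + j) * (1ℤ + j) - + 2 * (1ℤ + j) ≡ + 3 * j * j - + 2 * j + (+ 1 + (+ 1 + + 5) * j)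
  lem = solve-∀

β-product : gf fβ ≈ P 6 6 *ˢ (Pm 3 6 *ˢ Pm 3 6)
β-product = Theta.product (- 1ℤ) refl 2 2 fβ refl refl (λ j → refl) lem
  where
  lem : ∀ j → + 3 * (1ℤ + j) * (1ℤ + j) ≡ + 3 * j * j + (+ 3 + (+ 3 + + 3) * j)
  lem = solve-∀

φ-product : gf fφ ≈ P 2 2 *ˢ (Pm 1 2 *ˢ Pm 1 2)
φ-product = Theta.product (- 1ℤ) refl 0 0 fφ refl refl (λ j → refl) lem
  where
  lem : ∀ j → (1ℤ + j) * (1ℤ + j) ≡ j * j + (+ 1 + (+ 1 + + 1) * j)
  lem = solve-∀

η-product : gf fη ≈ P 6 6 *ˢ (P 4 6 *ˢ P 2 6)
η-product = Theta.product 1ℤ refl 3 1 fη refl refl (λ j → trans (sgn-suc j) (neg-1* (sgn j))) lem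
  where
  lem : ∀ j → + 3 * (1ℤ + j) * (1ℤ + j) + (1ℤ + j) ≡ + 3 * j * j + j + (+ 4 + (+ 4 + + 2) * j)
  lem = solve-∀

ψ₁-product : gf fψ₁ ≈ P 4 4 *ˢ (P 3 4 *ˢ P 1 4)
ψ₁-product = Theta.product 1ℤ refl 2 0 fψ₁ refl refl (λ j → trans (sgn-suc j) (neg-1* (sgn j))) lem
  where
  lem : ∀ j → + 2 * (1ℤ + j) * (1ℤ + j) + (1ℤ + j) ≡ + 2 * j * j + j + (+ 3 + (+ 3 + + 1) * j)
  lem = solve-∀

ψ₃-product : gf fψ₃ ≈ P 12 12 *ˢ (P 9 12 *ˢ P 3 12)
ψ₃-product = Theta.product 1ℤ refl 8 2 fψ₃ refl refl (λ j → trans (sgn-suc j) (neg-1* (sgn j))) lem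
  where
  lem : ∀ j → + 6 * (1ℤ + j) * (1ℤ + j) + + 3 * (1ℤ + j) ≡ + 6 * j * j + + 3 * j + (+ 9 + (+ 9 + + 3) * j)
  lem = solve-∀

aˢ : PS
aˢ = gf fa₁ -ˢ gf fa₂

-- The two halves of a are the even and the odd terms of one theta series with X = q, X′ = -q², p =
-- -q³. Since the powers of p alternate in sign, each of its products splits into two of modulus 6
-- with opposite signs.
module aTheta where

  X X′ p : PS
  X  = mono 1ℤ 1
  X′ = mono (- 1ℤ) 2
  p  = mono (- 1ℤ) 3

  open module J = JTP X X′ p (mono-* 1ℤ 1 (- 1ℤ) 2) (mono-≈[] 1ℤ (s≤s z≤n)) (mono-≈[] (- 1ℤ) (s≤s z≤n))

  pw-even : ∀ a → IsMono (pw p (a ℕ.+ a)) 1ℤ (+ 6 * + a)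
  pw-even a = 3 ℕ.* (a ℕ.+ a) , sym (trans (ℤₚ.pos-* 3 (a ℕ.+ a)) (lem (+ a))) , pw-mono (- 1ℤ) refl 3 a
    where
    lem : ∀ a → + 3 * (a + a) ≡ + 6 * a
    lem = solve-∀

  pw-odd : ∀ a → IsMono (pw p (suc (a ℕ.+ a))) (- 1ℤ * 1ℤ) (+ 3 + + 6 * + a)
  pw-odd a = IsMono-* (mono-IsMono (- 1ℤ) 3) (pw-even a)

  t⁺-even : ∀ a → IsMono (t⁺ (a ℕ.+ a)) (sgn (+ a)) (+ 6 * + a * + a - + a)
  t⁺-odd : ∀ a → IsMono (t⁺ (suc (a ℕ.+ a))) (- sgn (+ a)) (+ 6 * + a * + a + + 5 * + a + 1ℤ)
  t⁺-even zero    = IsMono-1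
  t⁺-even (suc a) = subst (λ n → IsMono (t⁺ n) (sgn (+ suc a)) (+ 6 * + suc a * + suc a - + suc a)) (cong suc (sym (ℕₚ.+-suc a a)))
    (IsMono-≡ (trans (l₁ (sgn (+ a))) (sym (sgn-suc (+ a)))) (l₂ (+ a)) (IsMono-* (IsMono-neg (IsMono-* (mono-IsMono 1ℤ 1) (pw-odd a))) (t⁺-odd a)))
    where
    l₁ : ∀ s → - (1ℤ * (- 1ℤ * 1ℤ)) * - s ≡ - s
    l₁ = solve-∀
    l₂ : ∀ a → + 1 + (+ 3 + + 6 * a) + (+ 6 * a * a + + 5 * a + 1ℤ) ≡ + 6 * (1ℤ + a) * (1ℤ + a) - (1ℤ + a)
    l₂ = solve-∀
  t⁺-odd a = IsMono-≡ (l₁ (sgn (+ a))) (l₂ (+ a)) (IsMono-* (IsMono-neg (IsMono-* (mono-IsMono 1ℤ 1) (pw-even a))) (t⁺-even a))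
    where
    l₁ : ∀ s → - (1ℤ * 1ℤ) * s ≡ - s
    l₁ = solve-∀
    l₂ : ∀ a → + 1 + + 6 * a + (+ 6 * a * a - a) ≡ + 6 * a * a + + 5 * a + 1ℤ
    l₂ = solve-∀

  t⁻-even : ∀ a → IsMono (t⁻ (a ℕ.+ a)) (sgn (+ a)) (+ 6 * + a * + a + + a)
  t⁻-odd : ∀ a → IsMono (t⁻ (suc (a ℕ.+ a))) (sgn (+ a)) (+ 6 * + a * + a + + 7 * + a + + 2)
  t⁻-even zero    = IsMono-1
  t⁻-even (suc a) = subst (λ n → IsMono (t⁻ n) (sgn (+ suc a)) (+ 6 * + suc a * + suc a + + suc a)) (cong suc (sym (ℕₚ.+-suc a a)))
    (IsMono-≡ (trans (l₁ (sgn (+ a))) (sym (sgn-suc (+ a)))) (l₂ (+ a)) (IsMono-* (IsMono-neg (IsMono-* (mono-IsMono (- 1ℤ) 2) (pw-odd a))) (t⁻-odd a)))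
    where
    l₁ : ∀ s → - (- 1ℤ * (- 1ℤ * 1ℤ)) * s ≡ - s
    l₁ = solve-∀
    l₂ : ∀ a → + 2 + (+ 3 + + 6 * a) + (+ 6 * a * a + + 7 * a + + 2) ≡ + 6 * (1ℤ + a) * (1ℤ + a) + (1ℤ + a)
    l₂ = solve-∀
  t⁻-odd a = IsMono-≡ (l₁ (sgn (+ a))) (l₂ (+ a)) (IsMono-* (IsMono-neg (IsMono-* (mono-IsMono (- 1ℤ) 2) (pw-even a))) (t⁻-even a))
    where
    l₁ : ∀ s → - (- 1ℤ * 1ℤ) * s ≡ s
    l₁ = solve-∀
    l₂ : ∀ a → + 2 + + 6 * a + (+ 6 * a * a + a) ≡ + 6 * a * a + + 7 * a + + 2
    l₂ = solve-∀

  even : ∀ k n → t (k + k) n ≡ sgn (- k) * δ (+ 6 * (- k) * (- k) + (- k)) (+ n)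
  even (+ a) n = IsMono-at (IsMono-≡ (sym (sgn-neg (+ a))) (l (+ a)) (t⁺-even a)) n
    where
    l : ∀ a → + 6 * a * a - a ≡ + 6 * (- a) * (- a) + (- a)
    l = solve-∀
  even -[1+ a ] n = IsMono-at (subst (λ m → IsMono (t⁻ m) (sgn (+ suc a)) (+ 6 * + suc a * + suc a + + suc a)) (cong suc (ℕₚ.+-suc a a)) (t⁻-even (suc a))) n

  odd : ∀ k n → t (1ℤ + (k + k)) n ≡ - (sgn k * δ (+ 6 * k * k + + 5 * k + 1ℤ) (+ n))
  odd (+ a) n    = trans (IsMono-at (t⁺-odd a) n) (sym (ℤₚ.neg-distribˡ-* (sgn (+ a)) _))
  odd -[1+ a ] n = trans (IsMono-at (IsMono-≡ (sym sg) (l (+ a)) (t⁻-odd a)) n) (sym (ℤₚ.neg-distribˡ-* (sgn -[1+ a ]) _))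
    where
    sg : - sgn -[1+ a ] ≡ sgn (+ a)
    sg = trans (cong -_ (sgn-suc (+ a))) (ℤₚ.neg-involutive (sgn (+ a)))
    l : ∀ a → + 6 * a * a + + 7 * a + + 2 ≡ + 6 * (- (1ℤ + a)) * (- (1ℤ + a)) + + 5 * (- (1ℤ + a)) + 1ℤ
    l = solve-∀

  a≈rhs : aˢ ≈ rhs
  a≈rhs = coeffs λ n → go n (⇓-unsplit 0ℤ 0ℤ (⇓-reindex {f = λ j → t j n} unhalf half half-unhalf (λ j _ → unhalf-half j) (triple-product n)))
    where
    go : ∀ n → (∃₂ λ s₁ s₂ → ((λ k → t (k + k) n) ⇓ s₁) × ((λ k → t (1ℤ + (k + k)) n) ⇓ s₂) × (rhs n ≡ s₁ + s₂)) → aˢ n ≡ rhs n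
    go n (s₁ , s₂ , F₁ , F₂ , q) = trans (minus-at (gf fa₁) (gf fa₂) n) (trans (cong₂ _+_ (⇓-unique A₁ F₁) (⇓-unique A₂ F₂)) (sym q))
      where
      A₁ : (λ k → t (k + k) n) ⇓ gf fa₁ n
      A₁ = ⇓-cong (λ k → sym (even k n)) (⇓-reindex {f = cf (wt fa₁) (ex fa₁) (+ n)} -_ -_ ℤₚ.neg-involutive (λ k _ → ℤₚ.neg-involutive k) (gf-⇓ fa₁ n))
      A₂ : (λ k → t (1ℤ + (k + k)) n) ⇓ - gf fa₂ n
      A₂ = ⇓-cong (λ k → sym (odd k n)) (⇓-neg (gf-⇓ fa₂ n))

  fac-even : ∀ c e k → 1ˢ -ˢ mono c e *ˢ pw p (k ℕ.+ k) ≈ fac c e 6 k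
  fac-even c e k = -ˢ-cong ≈-refl (≈-trans (*ˢ-congˡ (pw-mono (- 1ℤ) refl 3 k)) (≈-trans (mono-* c e 1ℤ _)
    (≡⇒≈ (cong₂ mono (ℤₚ.*-identityʳ c) (cong (e ℕ.+_) (lem k))))))
    where
    lem : ∀ k → 3 ℕ.* (k ℕ.+ k) ≡ 6 ℕ.* k
    lem = solveℕ

  fac-odd : ∀ c e k → 1ˢ -ˢ mono c e *ˢ pw p (suc (k ℕ.+ k)) ≈ fac (c * - 1ℤ) (e ℕ.+ 3) 6 k
  fac-odd c e k = -ˢ-cong ≈-refl (≈-trans (*ˢ-congˡ (≈-trans (*ˢ-congˡ (pw-mono (- 1ℤ) refl 3 k)) (mono-* (- 1ℤ) 3 1ℤ _))) (≈-trans (mono-* c e _ _)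
    (≡⇒≈ (cong (mono (c * - 1ℤ)) (lem e k)))))
    where
    lem : ∀ e k → e ℕ.+ (3 ℕ.+ 3 ℕ.* (k ℕ.+ k)) ≡ e ℕ.+ 3 ℕ.+ 6 ℕ.* k
    lem = solveℕ

  conv-cong : ∀ {f g} → (∀ k → f k ≈ g k) → Conv g → Conv f
  conv-cong h c k i l = trans (h k at i) (c k i l)

  split : ∀ c e → Π∞ (J.factor (mono c (suc e))) ≈ poch c (suc e) 6 *ˢ poch (c * - 1ℤ) (suc e ℕ.+ 3) 6
  split c e = ≈-trans (Π∞-2 (J.factor-conv (mono-≈[] c (s≤s z≤n))) (conv-cong (fac-even c (suc e)) (fac-conv c e 5)) (conv-cong (fac-odd c (suc e)) (fac-conv (c * - 1ℤ) (e ℕ.+ 3) 5)))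
    (*ˢ-cong (≈-trans (Π∞-cong (fac-even c (suc e))) (≈-sym (poch-Π∞ c (suc e) 6))) (≈-trans (Π∞-cong (fac-odd c (suc e))) (≈-sym (poch-Π∞ _ _ 6))))

  product : aˢ ≈ (Pm 3 6 *ˢ P 6 6) *ˢ ((P 1 6 *ˢ Pm 4 6) *ˢ (Pm 2 6 *ˢ P 5 6))
  product = ≈-trans a≈rhs (*ˢ-cong (split (- 1ℤ) 2) (*ˢ-cong (split 1ℤ 0) (split (- 1ℤ) 1)))

opaque
  unfolding gf δ

  α-0 : gf fα 0 ≡ 1ℤ
  α-0 = refl
  η-0 : gf fη 0 ≡ 1ℤ
  η-0 = refl
  φ-0 : gf fφ 0 ≡ 1ℤ
  φ-0 = refl
  ψ₁-0 : gf fψ₁ 0 ≡ 1ℤ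
  ψ₁-0 = refl
  ψ₃-0 : gf fψ₃ 0 ≡ 1ℤ
  ψ₃-0 = refl
  a₁-0 : gf fa₁ 0 ≡ 1ℤ
  a₁-0 = refl
  a₂-0 : gf fa₂ 0 ≡ 0ℤ
  a₂-0 = refl
  J-0 : gf fJ 0 ≡ + 2
  J-0 = refl
  E-0 : gf fE 0 ≡ 0ℤ
  E-0 = refl

aˢ-0 : aˢ 0 ≡ 1ℤ
aˢ-0 = trans (minus-at (gf fa₁) (gf fa₂) 0) (cong₂ _-_ a₁-0 a₂-0)

Eˢ Hˢ ψ₁ ψ₃ : PS
Eˢ = 1ˢ +ˢ cst (+ 3) *ˢ gf fE
Hˢ = 1ˢ +ˢ cst (+ 3) *ˢ gf fH
ψ₁ = gf fψ₁
ψ₃ = gf fψ₃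

Eˢ-0 : Eˢ 0 ≡ 1ℤ
Eˢ-0 = trans (+ˢ-at 1ˢ _ 0) (cong (_+_ 1ℤ) (trans (cst-*ˢ-at (+ 3) (gf fE) 0) (cong (_*_ (+ 3)) E-0)))

-- Jacobi's identity: both sides satisfy the differential equation η DX = 3 (Dη) X.

suc-*-0 : ∀ n x → + suc n * x ≡ 0ℤ → x ≡ 0ℤ
suc-*-0 n x p with ℤₚ.i*j≡0⇒i≡0∨j≡0 (+ suc n) p
... | inj₂ z = z

J≈2η³ : gf fJ ≈ cst (+ 2) *ˢ (gf fη *ˢ (gf fη *ˢ gf fη))
J≈2η³ = ≈-trans J≈r*G (*ˢ-congʳ r≈2)
  where
  η J G r : PS
  η = gf fη
  J = gf fJ
  G = η *ˢ (η *ˢ η)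
  r = J *ˢ inv G
  G-0 : G 0 ≡ 1ℤ
  G-0 = *ˢ-unit {η} {η *ˢ η} η-0 (*ˢ-unit {η} {η} η-0 η-0)
  J≈r*G : J ≈ r *ˢ G
  J≈r*G = ≈-sym (≈-trans (solve 3 (λ j i g → j :* i :* g := j :* (g :* i)) ≈-refl J (inv G) G) (≈-trans (*ˢ-congˡ (*ˢ-inv G G-0)) (*ˢ-1 J)))
  DG : D G ≈ cst (+ 3) *ˢ (η *ˢ η *ˢ D η)
  DG = ≈-trans (D-* η (η *ˢ η)) (≈-trans (+ˢ-cong ≈-refl (*ˢ-congˡ (D-* η η)))
    (solve 2 (λ e d → d :* (e :* e) :+ e :* (d :* e :+ e :* d) := con (+ 3) :* (e :* e :* d)) ≈-refl η (D η)))
  G*DJ : G *ˢ D J ≈ J *ˢ D G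
  G*DJ = ≈-trans (solve 2 (λ e d → e :* (e :* e) :* d := e :* e :* (e :* d)) ≈-refl η (D J)) (≈-trans (*ˢ-congˡ η*DJ≈3*Dη*J)
    (≈-trans (solve 3 (λ e d j → e :* e :* (con (+ 3) :* (d :* j)) := j :* (con (+ 3) :* (e :* e :* d))) ≈-refl η (D η) J) (*ˢ-congˡ (≈-sym DG))))
  Dr≈0 : D r ≈ 0ˢ
  Dr≈0 = *ˢ-cancelˡ {G *ˢ G} (*ˢ-unit {G} {G} G-0 G-0) (
    G *ˢ G *ˢ D r
      ≈⟨ solve 4 (λ g d r e → g :* g :* d := g :* (d :* g :+ r :* e) :- r :* g :* e) ≈-refl G (D r) r (D G) ⟩
    G *ˢ (D r *ˢ G +ˢ r *ˢ D G) -ˢ r *ˢ G *ˢ D G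
      ≈⟨ -ˢ-cong (*ˢ-congˡ (≈-sym (≈-trans (D-cong J≈r*G) (D-* r G)))) (*ˢ-congʳ (≈-sym J≈r*G)) ⟩
    G *ˢ D J -ˢ J *ˢ D G
      ≈⟨ -ˢ-cong G*DJ ≈-refl ⟩
    J *ˢ D G -ˢ J *ˢ D G
      ≈⟨ solve 2 (λ x g → x :- x := g :* con 0ℤ) ≈-refl (J *ˢ D G) (G *ˢ G) ⟩
    G *ˢ G *ˢ 0ˢ ≈∎)
  r-0 : r 0 ≡ + 2
  r-0 = trans (*ˢ-0 J (inv G)) (cong (_* 1ℤ) J-0)
  r≈2 : r ≈ cst (+ 2)
  r≈2 = coeffs λ { zero → r-0 ; (suc n) → suc-*-0 n (r (suc n)) (trans (Dr≈0 at (suc n)) (0ˢ-at (suc n))) }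

2*-cancel : ∀ {f g} → cst (+ 2) *ˢ f ≈ cst (+ 2) *ˢ g → f ≈ g
2*-cancel {f} {g} p = coeffs λ n → ℤₚ.*-cancelˡ-≡ (+ 2) (f n) (g n) (trans (sym (cst-*ˢ-at (+ 2) f n)) (trans (p at n) (cst-*ˢ-at (+ 2) g n)))

W*φ≈η⁴ : gf fW *ˢ gf fφ ≈ gf fη *ˢ (gf fη *ˢ (gf fη *ˢ gf fη))
W*φ≈η⁴ = 2*-cancel (≈-trans 2*W*φ≈η*J (≈-trans (*ˢ-congˡ J≈2η³) (solve 1 (λ e → e :* (con (+ 2) :* (e :* (e :* e))) := con (+ 2) :* (e :* (e :* (e :* e)))) ≈-refl (gf fη))))

-- Every product is refined to the symbols A_i = (q^i; q⁶), m_i = (-q^i; q⁶) and B_i = (q^i; q¹²).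
-- The rules below relate these, and the required identities reduce to comparing monomials.
module Products where

  A₁ A₂ A₃ A₄ A₅ A₆ m₁ m₂ m₃ m₄ m₅ m₆ B₂ B₄ B₆ B₈ B₁₀ B₁₂ : PS
  A₁ = P 1 6
  A₂ = P 2 6
  A₃ = P 3 6
  A₄ = P 4 6
  A₅ = P 5 6
  A₆ = P 6 6
  m₁ = Pm 1 6
  m₂ = Pm 2 6
  m₃ = Pm 3 6
  m₄ = Pm 4 6
  m₅ = Pm 5 6
  m₆ = Pm 6 6
  B₂ = P 2 12
  B₄ = P 4 12
  B₆ = P 6 12
  B₈ = P 8 12
  B₁₀ = P 10 12
  B₁₂ = P 12 12

  P12 : P 1 2 ≈ A₁ *ˢ A₃ *ˢ A₅
  P12 = poch-3 1ℤ 0 1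
  P22 : P 2 2 ≈ A₂ *ˢ A₄ *ˢ A₆
  P22 = poch-3 1ℤ 1 1
  P33 : P 3 3 ≈ A₃ *ˢ A₆
  P33 = poch-2 1ℤ 2 2
  P44 : P 4 4 ≈ B₄ *ˢ B₈ *ˢ B₁₂
  P44 = poch-3 1ℤ 3 3
  Pm12 : Pm 1 2 ≈ m₁ *ˢ m₃ *ˢ m₅
  Pm12 = poch-3 (- 1ℤ) 0 1
  Pm33 : Pm 3 3 ≈ m₃ *ˢ m₆
  Pm33 = poch-2 (- 1ℤ) 2 2

  A₁m₁ : A₁ *ˢ m₁ ≈ B₂
  A₁m₁ = P*Pm 0 5
  A₂m₂ : A₂ *ˢ m₂ ≈ B₄
  A₂m₂ = P*Pm 1 5
  A₃m₃ : A₃ *ˢ m₃ ≈ B₆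
  A₃m₃ = P*Pm 2 5
  A₄m₄ : A₄ *ˢ m₄ ≈ B₈
  A₄m₄ = P*Pm 3 5
  A₅m₅ : A₅ *ˢ m₅ ≈ B₁₀
  A₅m₅ = P*Pm 4 5
  A₆m₆ : A₆ *ˢ m₆ ≈ B₁₂
  A₆m₆ = P*Pm 5 5
  A₂≈ : A₂ ≈ B₂ *ˢ B₈
  A₂≈ = poch-2 1ℤ 1 5
  A₃≈ : P 12 12 *ˢ (P 9 12 *ˢ P 3 12) ≈ B₁₂ *ˢ A₃
  A₃≈ = *ˢ-congˡ (≈-trans (*ˢ-comm (P 9 12) (P 3 12)) (≈-sym (poch-2 1ℤ 2 5)))
  A₄≈ : A₄ ≈ B₄ *ˢ B₁₀
  A₄≈ = poch-2 1ℤ 3 5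
  A₆≈ : A₆ ≈ B₆ *ˢ B₁₂
  A₆≈ = poch-2 1ℤ 5 5

  -- Euler: (q;q²)(-q;q) = 1
  m₆B₆ : m₆ *ˢ B₆ ≈ 1ˢ
  m₆B₆ = *ˢ-cancelˡ {B₁₂} (poch-unit 1ℤ 11 11) (≈-trans (solve 3 (λ x y z → x :* (y :* z) := z :* x :* y) ≈-refl B₁₂ m₆ B₆)
    (≈-trans (*ˢ-congʳ (≈-sym A₆≈)) (≈-trans A₆m₆ (≈-sym (*ˢ-1 B₁₂)))))

  -- Euler's identity in q² restricted to exponents prime to 3: multiply A₂ m₂ = B₄ and A₄ m₄ = B₈
  -- after writing A₂ = B₂ B₈ and A₄ = B₄ B₁₀.
  m₂m₄B₂B₁₀ : m₂ *ˢ m₄ *ˢ (B₂ *ˢ B₁₀) ≈ 1ˢ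
  m₂m₄B₂B₁₀ = *ˢ-cancelˡ {B₄ *ˢ B₈} (*ˢ-unit {B₄} {B₈} (poch-unit 1ℤ 3 11) (poch-unit 1ℤ 7 11))
    (≈-trans (solve 6 (λ b4 b8 m2 m4 b2 b10 → b4 :* b8 :* (m2 :* m4 :* (b2 :* b10)) := (b2 :* b8 :* m2) :* (b4 :* b10 :* m4)) ≈-refl B₄ B₈ m₂ m₄ B₂ B₁₀)
      (≈-trans (*ˢ-cong (≈-trans (*ˢ-congʳ (≈-sym A₂≈)) A₂m₂) (≈-trans (*ˢ-congʳ (≈-sym A₄≈)) A₄m₄)) (≈-sym (*ˢ-1 _))))

  ψ₁≈ : ψ₁ ≈ B₄ *ˢ B₈ *ˢ B₁₂ *ˢ (A₁ *ˢ A₃ *ˢ A₅)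
  ψ₁≈ = ≈-trans ψ₁-product (*ˢ-cong P44 (≈-trans (*ˢ-comm (P 3 4) (P 1 4)) (≈-trans (≈-sym (poch-2 1ℤ 0 1)) P12)))
  ψ₃≈ : ψ₃ ≈ B₁₂ *ˢ A₃
  ψ₃≈ = ≈-trans ψ₃-product A₃≈
  a≈ : aˢ ≈ m₃ *ˢ A₆ *ˢ (A₁ *ˢ m₄ *ˢ (m₂ *ˢ A₅))
  a≈ = aTheta.product
  φ≈ : gf fφ ≈ A₂ *ˢ A₄ *ˢ A₆ *ˢ (m₁ *ˢ m₃ *ˢ m₅ *ˢ (m₁ *ˢ m₃ *ˢ m₅))
  φ≈ = ≈-trans φ-product (*ˢ-cong P22 (*ˢ-cong Pm12 Pm12))

  -- The proportion a : ψ₃ = β : α is what converts α h₀ + β h₁, accessible by rearrangement, into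
  -- the combination ψ₃ h₀ + a h₁ demanded by the linear system.
  aα≈ψ₃β : aˢ *ˢ gf fα ≈ ψ₃ *ˢ gf fβ
  aα≈ψ₃β =
    aˢ *ˢ gf fα
      ≈⟨ *ˢ-cong a≈ α-product ⟩
    m₃ *ˢ A₆ *ˢ (A₁ *ˢ m₄ *ˢ (m₂ *ˢ A₅)) *ˢ (A₆ *ˢ (m₁ *ˢ m₅))
      ≈⟨ solve 8 (λ m3 a6 a1 m4 m2 a5 m1 m5 → m3 :* a6 :* (a1 :* m4 :* (m2 :* a5)) :* (a6 :* (m1 :* m5)) := m3 :* a6 :* a6 :* (m2 :* m4 :* (a1 :* m1 :* (a5 :* m5)))) ≈-refl m₃ A₆ A₁ m₄ m₂ A₅ m₁ m₅ ⟩
    m₃ *ˢ A₆ *ˢ A₆ *ˢ (m₂ *ˢ m₄ *ˢ (A₁ *ˢ m₁ *ˢ (A₅ *ˢ m₅)))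
      ≈⟨ *ˢ-cong (*ˢ-congˡ A₆≈) (≈-trans (*ˢ-congˡ (*ˢ-cong A₁m₁ A₅m₅)) m₂m₄B₂B₁₀) ⟩
    m₃ *ˢ A₆ *ˢ (B₆ *ˢ B₁₂) *ˢ 1ˢ
      ≈⟨ *ˢ-congʳ (*ˢ-congˡ (*ˢ-congʳ (≈-sym A₃m₃))) ⟩
    m₃ *ˢ A₆ *ˢ (A₃ *ˢ m₃ *ˢ B₁₂) *ˢ 1ˢ
      ≈⟨ solve 4 (λ m3 a6 a3 b12 → m3 :* a6 :* (a3 :* m3 :* b12) :* con 1ℤ := b12 :* a3 :* (a6 :* (m3 :* m3))) ≈-refl m₃ A₆ A₃ B₁₂ ⟩
    B₁₂ *ˢ A₃ *ˢ (A₆ *ˢ (m₃ *ˢ m₃))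
      ≈⟨ *ˢ-cong ψ₃≈ β-product ⟨
    ψ₃ *ˢ gf fβ ≈∎

  αφψ₁³≈ψ₃η⁴ : gf fα *ˢ gf fφ *ˢ (ψ₁ *ˢ (ψ₁ *ˢ ψ₁)) ≈ ψ₃ *ˢ (gf fη *ˢ (gf fη *ˢ (gf fη *ˢ gf fη)))
  αφψ₁³≈ψ₃η⁴ = ≈-trans lhs (≈-sym rhs)
    where
    T Y : PS
    T = B₂ *ˢ B₈ *ˢ (B₄ *ˢ B₁₀) *ˢ (B₆ *ˢ B₁₂)
    Y = A₂ *ˢ A₄ *ˢ A₆
    Y≈T : Y ≈ T
    Y≈T = *ˢ-cong (*ˢ-cong A₂≈ A₄≈) A₆≈
    rhs : ψ₃ *ˢ (gf fη *ˢ (gf fη *ˢ (gf fη *ˢ gf fη))) ≈ B₁₂ *ˢ A₃ *ˢ (Y *ˢ (T *ˢ (T *ˢ T)))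
    rhs = *ˢ-cong ψ₃≈ (*ˢ-cong η≈ (*ˢ-cong (≈-trans η≈ Y≈T) (*ˢ-cong (≈-trans η≈ Y≈T) (≈-trans η≈ Y≈T))))
      where
      η≈ : gf fη ≈ Y
      η≈ = ≈-trans η-product (solve 3 (λ a b c → a :* (b :* c) := c :* b :* a) ≈-refl A₆ A₄ A₂)
    lhs : gf fα *ˢ gf fφ *ˢ (ψ₁ *ˢ (ψ₁ *ˢ ψ₁)) ≈ B₁₂ *ˢ A₃ *ˢ (Y *ˢ (T *ˢ (T *ˢ T)))
    lhs = ≈-trans (*ˢ-cong (*ˢ-cong α-product φ≈) (*ˢ-cong ψ₁≈ (*ˢ-cong ψ₁≈ ψ₁≈)))
      (≈-trans (solve 11 (λ a6 m1 m5 y m3 b4 b8 b12 a1 a3 a5 →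
          a6 :* (m1 :* m5) :* (y :* (m1 :* m3 :* m5 :* (m1 :* m3 :* m5))) :* (b4 :* b8 :* b12 :* (a1 :* a3 :* a5) :* (b4 :* b8 :* b12 :* (a1 :* a3 :* a5) :* (b4 :* b8 :* b12 :* (a1 :* a3 :* a5))))
          := a6 :* y :* a3 :* ((b4 :* b8 :* b12) :* ((b4 :* b8 :* b12) :* (b4 :* b8 :* b12))) :* ((a1 :* m1) :* ((a1 :* m1) :* (a1 :* m1))) :* ((a5 :* m5) :* ((a5 :* m5) :* (a5 :* m5))) :* ((a3 :* m3) :* (a3 :* m3)))
          ≈-refl A₆ m₁ m₅ Y m₃ B₄ B₈ B₁₂ A₁ A₃ A₅)
        (≈-trans (*ˢ-cong (*ˢ-cong (*ˢ-cong (*ˢ-congʳ (*ˢ-congʳ (*ˢ-congʳ A₆≈))) (*ˢ-cong A₁m₁ (*ˢ-cong A₁m₁ A₁m₁))) (*ˢ-cong A₅m₅ (*ˢ-cong A₅m₅ A₅m₅))) (*ˢ-cong A₃m₃ A₃m₃))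
          (solve 8 (λ b2 b4 b6 b8 b10 b12 y a3 →
            b6 :* b12 :* y :* a3 :* ((b4 :* b8 :* b12) :* ((b4 :* b8 :* b12) :* (b4 :* b8 :* b12))) :* (b2 :* (b2 :* b2)) :* (b10 :* (b10 :* b10)) :* (b6 :* b6)
            := b12 :* a3 :* (y :* (b2 :* b8 :* (b4 :* b10) :* (b6 :* b12) :* (b2 :* b8 :* (b4 :* b10) :* (b6 :* b12) :* (b2 :* b8 :* (b4 :* b10) :* (b6 :* b12))))))
            ≈-refl B₂ B₄ B₆ B₈ B₁₀ B₁₂ Y A₃)))

-- After multiplication by α φ, the relations α E = W and W φ = η⁴ remove the Lambert series E, and
-- an identity between products remains.
ψ₁³≈ψ₃E : ψ₁ *ˢ (ψ₁ *ˢ ψ₁) ≈ ψ₃ *ˢ Eˢ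
ψ₁³≈ψ₃E = *ˢ-cancelˡ {gf fα *ˢ gf fφ} (*ˢ-unit {gf fα} {gf fφ} α-0 φ-0) (
  gf fα *ˢ gf fφ *ˢ (ψ₁ *ˢ (ψ₁ *ˢ ψ₁))    ≈⟨ Products.αφψ₁³≈ψ₃η⁴ ⟩
  ψ₃ *ˢ (gf fη *ˢ (gf fη *ˢ (gf fη *ˢ gf fη))) ≈⟨ *ˢ-congˡ W*φ≈η⁴ ⟨
  ψ₃ *ˢ (gf fW *ˢ gf fφ)                  ≈⟨ *ˢ-congˡ (*ˢ-congʳ α*E≈W) ⟨
  ψ₃ *ˢ (gf fα *ˢ Eˢ *ˢ gf fφ)            ≈⟨ solve 4 (λ p a e f → p :* (a :* e :* f) := a :* f :* (p :* e)) ≈-refl ψ₃ (gf fα) Eˢ (gf fφ) ⟩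
  gf fα *ˢ gf fφ *ˢ (ψ₃ *ˢ Eˢ)            ≈∎)

ψ₃h₀+ah₁≈ψ₃E : ψ₃ *ˢ h₀ +ˢ aˢ *ˢ h₁ ≈ ψ₃ *ˢ Eˢ
ψ₃h₀+ah₁≈ψ₃E = *ˢ-cancelˡ {gf fα} α-0 (
  gf fα *ˢ (ψ₃ *ˢ h₀ +ˢ aˢ *ˢ h₁)           ≈⟨ solve 5 (λ α p h a k → α :* (p :* h :+ a :* k) := p :* (α :* h) :+ a :* α :* k) ≈-refl (gf fα) ψ₃ h₀ aˢ h₁ ⟩
  ψ₃ *ˢ (gf fα *ˢ h₀) +ˢ aˢ *ˢ gf fα *ˢ h₁  ≈⟨ +ˢ-cong ≈-refl (*ˢ-congʳ Products.aα≈ψ₃β) ⟩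
  ψ₃ *ˢ (gf fα *ˢ h₀) +ˢ ψ₃ *ˢ gf fβ *ˢ h₁  ≈⟨ solve 4 (λ p x b k → p :* x :+ p :* b :* k := p :* (x :+ b :* k)) ≈-refl ψ₃ (gf fα *ˢ h₀) (gf fβ) h₁ ⟩
  ψ₃ *ˢ (gf fα *ˢ h₀ +ˢ gf fβ *ˢ h₁)        ≈⟨ *ˢ-congˡ (≈-trans α*h₀+β*h₁≈W (≈-sym α*E≈W)) ⟩
  ψ₃ *ˢ (gf fα *ˢ Eˢ)                       ≈⟨ solve 3 (λ p a e → p :* (a :* e) := a :* (p :* e)) ≈-refl ψ₃ (gf fα) Eˢ ⟩
  gf fα *ˢ (ψ₃ *ˢ Eˢ)                       ≈∎)

-- Dissection modulo 3

private
  pattern r₀ a = inj₁ a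
  pattern r₁ a = inj₂ (inj₁ a)
  pattern r₂ a = inj₂ (inj₂ a)

  next : ℕ ⊎ (ℕ ⊎ ℕ) → ℕ ⊎ (ℕ ⊎ ℕ)
  next (r₀ a) = r₀ (suc a)
  next (r₁ a) = r₁ (suc a)
  next (r₂ a) = r₂ (suc a)

  thirdℕ : ℕ → ℕ ⊎ (ℕ ⊎ ℕ)
  thirdℕ 0 = r₀ 0
  thirdℕ 1 = r₁ 0
  thirdℕ 2 = r₂ 0
  thirdℕ (suc (suc (suc n))) = next (thirdℕ n)

  unthirdℕ : ℕ ⊎ (ℕ ⊎ ℕ) → ℕ
  unthirdℕ (r₀ a) = a ℕ.+ a ℕ.+ a
  unthirdℕ (r₁ a) = suc (a ℕ.+ a ℕ.+ a)
  unthirdℕ (r₂ a) = suc (suc (a ℕ.+ a ℕ.+ a))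

  3a : ∀ a → suc a ℕ.+ suc a ℕ.+ suc a ≡ suc (suc (suc (a ℕ.+ a ℕ.+ a)))
  3a a = cong suc (trans (ℕₚ.+-suc _ a) (cong suc (cong (ℕ._+ a) (ℕₚ.+-suc a a))))

  third-unthirdℕ : ∀ x → thirdℕ (unthirdℕ x) ≡ x
  third-unthirdℕ (r₀ zero) = refl
  third-unthirdℕ (r₁ zero) = refl
  third-unthirdℕ (r₂ zero) = refl
  third-unthirdℕ (r₀ (suc a)) = trans (cong thirdℕ (3a a)) (cong next (third-unthirdℕ (r₀ a)))
  third-unthirdℕ (r₁ (suc a)) = trans (cong (thirdℕ ∘ suc) (3a a)) (cong next (third-unthirdℕ (r₁ a)))
  third-unthirdℕ (r₂ (suc a)) = trans (cong (thirdℕ ∘ suc ∘ suc) (3a a)) (cong next (third-unthirdℕ (r₂ a)))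

  unthird-thirdℕ : ∀ n → unthirdℕ (thirdℕ n) ≡ n
  unthird-thirdℕ 0 = refl
  unthird-thirdℕ 1 = refl
  unthird-thirdℕ 2 = refl
  unthird-thirdℕ (suc (suc (suc n))) with thirdℕ n | unthird-thirdℕ n
  ... | r₀ a | refl = 3a a
  ... | r₁ a | refl = cong suc (3a a)
  ... | r₂ a | refl = cong (suc ∘ suc) (3a a)

third : ℤ → ℤ ⊎ (ℤ ⊎ ℤ)
third (+ n) with thirdℕ n
... | r₀ a = r₀ (+ a)
... | r₁ a = r₁ (+ a)
... | r₂ a = r₂ (+ a)
third -[1+ n ] with thirdℕ n
... | r₀ a = r₂ -[1+ a ]
... | r₁ a = r₁ -[1+ a ]
... | r₂ a = r₀ -[1+ a ]

unthird : ℤ ⊎ (ℤ ⊎ ℤ) → ℤ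
unthird (r₀ a) = a + a + a
unthird (r₁ a) = 1ℤ + (a + a + a)
unthird (r₂ a) = + 2 + (a + a + a)

third-unthird : ∀ x → third (unthird x) ≡ x
third-unthird (r₀ (+ a))    rewrite third-unthirdℕ (r₀ a) = refl
third-unthird (r₁ (+ a))    rewrite third-unthirdℕ (r₁ a) = refl
third-unthird (r₂ (+ a))    rewrite third-unthirdℕ (r₂ a) = refl
third-unthird (r₀ -[1+ a ]) rewrite third-unthirdℕ (r₂ a) = refl
third-unthird (r₁ -[1+ a ]) rewrite third-unthirdℕ (r₁ a) = refl
third-unthird (r₂ -[1+ a ]) rewrite third-unthirdℕ (r₀ a) = refl

unthird-third : ∀ k → unthird (third k) ≡ k
unthird-third (+ n) with thirdℕ n | unthird-thirdℕ n
... | r₀ a | refl = refl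
... | r₁ a | refl = refl
... | r₂ a | refl = refl
unthird-third -[1+ n ] with thirdℕ n | unthird-thirdℕ n
... | r₀ a | refl = refl
... | r₁ a | refl = refl
... | r₂ a | refl = refl

unthird-inj : ∀ {x y} → unthird x ≡ unthird y → x ≡ y
unthird-inj {x} {y} p = trans (sym (third-unthird x)) (trans (cong third p) (third-unthird y))

+U : ∀ n → (+ (3 ℕ.* n ℕ.+ 0) ≡ unthird (r₀ (+ n))) × (+ (3 ℕ.* n ℕ.+ 1) ≡ unthird (r₁ (+ n))) × (+ (3 ℕ.* n ℕ.+ 2) ≡ unthird (r₂ (+ n)))
+U n = cong +_ (l₀ n) , cong +_ (l₁ n) , cong +_ (l₂ n)
  where
  l₀ : ∀ n → 3 ℕ.* n ℕ.+ 0 ≡ n ℕ.+ n ℕ.+ n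
  l₀ = solveℕ
  l₁ : ∀ n → 3 ℕ.* n ℕ.+ 1 ≡ suc (n ℕ.+ n ℕ.+ n)
  l₁ = solveℕ
  l₂ : ∀ n → 3 ℕ.* n ℕ.+ 2 ≡ suc (suc (n ℕ.+ n ℕ.+ n))
  l₂ = solveℕ

tag : ℕ → ℤ → ℤ ⊎ (ℤ ⊎ ℤ)
tag 0 a = r₀ a
tag 1 a = r₁ a
tag _ a = r₂ a

data Residue : ℕ → Set where
  res₀ : Residue 0
  res₁ : Residue 1
  res₂ : Residue 2

+U′ : ∀ {d} → Residue d → ∀ n → + (3 ℕ.* n ℕ.+ d) ≡ unthird (tag d (+ n))
+U′ res₀ n = proj₁ (+U n)
+U′ res₁ n = proj₁ (proj₂ (+U n))
+U′ res₂ n = proj₂ (proj₂ (+U n))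

δ-same : ∀ {d} → Residue d → ∀ x n → δ (unthird (tag d x)) (+ (3 ℕ.* n ℕ.+ d)) ≡ δ x (+ n)
δ-same {d} r x n = trans (cong (δ (unthird (tag d x))) (+U′ r n)) (δ-iff (λ p → tag-inj r (unthird-inj p)) (λ p → cong (λ y → unthird (tag d y)) p))
  where
  tag-inj : ∀ {d x y} → Residue d → tag d x ≡ tag d y → x ≡ y
  tag-inj res₀ refl = refl
  tag-inj res₁ refl = refl
  tag-inj res₂ refl = refl

δ-diff : ∀ {c d} → Residue c → Residue d → c ≢ d → ∀ x n → δ (unthird (tag c x)) (+ (3 ℕ.* n ℕ.+ d)) ≡ 0ℤ
δ-diff {c} {d} r r′ c≢d x n = δ-≢ (λ p → c≢d (tag-≢ r r′ (unthird-inj {tag c x} {tag d (+ n)} (trans p (+U′ r′ n)))))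
  where
  tag-≢ : ∀ {c d x y} → Residue c → Residue d → tag c x ≡ tag d y → c ≡ d
  tag-≢ res₀ res₀ _ = refl
  tag-≢ res₁ res₁ _ = refl
  tag-≢ res₂ res₂ _ = refl
  tag-≢ res₀ res₁ ()
  tag-≢ res₀ res₂ ()
  tag-≢ res₁ res₀ ()
  tag-≢ res₁ res₂ ()
  tag-≢ res₂ res₀ ()
  tag-≢ res₂ res₁ ()

into₀ into₁ into₂ : {J : Set} → ℤ × J → ℤ × J
into₀ (a , j) = unthird (r₀ a) , j
into₁ (a , j) = unthird (r₁ a) , j
into₂ (a , j) = unthird (r₂ a) , j

⇓-third : {J : Set} (w e : ℤ × J → ℤ) (N : ℤ) {s₀ s₁ s₂ : ℤ} → cf (w ∘ into₀) (e ∘ into₀) N ⇓ s₀ →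
  cf (w ∘ into₁) (e ∘ into₁) N ⇓ s₁ → cf (w ∘ into₂) (e ∘ into₂) N ⇓ s₂ → cf w e N ⇓ s₀ + (s₁ + s₂)
⇓-third {J} w e N F₀ F₁ F₂ = ⇓-unindex {f = cf w e N} φ ψ ψφ (λ (k , j) _ → φψ k j) (⇓-split F₀ (⇓-split F₁ F₂))
  where
  φ : (ℤ × J) ⊎ ((ℤ × J) ⊎ (ℤ × J)) → ℤ × J
  φ (r₀ i) = into₀ i
  φ (r₁ i) = into₁ i
  φ (r₂ i) = into₂ i
  put : ℤ ⊎ (ℤ ⊎ ℤ) → J → (ℤ × J) ⊎ ((ℤ × J) ⊎ (ℤ × J))
  put (r₀ a) j = r₀ (a , j)
  put (r₁ a) j = r₁ (a , j)
  put (r₂ a) j = r₂ (a , j)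
  ψ : ℤ × J → (ℤ × J) ⊎ ((ℤ × J) ⊎ (ℤ × J))
  ψ (k , j) = put (third k) j
  ψφ : ∀ x → ψ (φ x) ≡ x
  ψφ (r₀ (a , j)) = cong (λ x → put x j) (third-unthird (r₀ a))
  ψφ (r₁ (a , j)) = cong (λ x → put x j) (third-unthird (r₁ a))
  ψφ (r₂ (a , j)) = cong (λ x → put x j) (third-unthird (r₂ a))
  φ-put : ∀ x j → φ (put x j) ≡ (unthird x , j)
  φ-put (r₀ a) j = refl
  φ-put (r₁ a) j = refl
  φ-put (r₂ a) j = refl
  φψ : ∀ k j → φ (ψ (k , j)) ≡ (k , j)
  φψ k j = trans (φ-put (third k) j) (cong (_, j) (unthird-third k))

class-other : {I : Set} {c d : ℕ} → Residue c → Residue d → c ≢ d → (w e e′ : I → ℤ) → (∀ i → e i ≡ unthird (tag c (e′ i))) → ∀ n →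
  cf w e (+ (3 ℕ.* n ℕ.+ d)) ⇓ 0ℤ
class-other {c = c} {d} r r′ c≢d w e e′ p n = ⇓-0 λ i →
  trans (cong (_*_ (w i)) (trans (cong (λ x → δ x (+ (3 ℕ.* n ℕ.+ d))) (p i)) (δ-diff r r′ c≢d (e′ i) n))) (ℤₚ.*-zeroʳ (w i))

class-same : {I : Set} {d : ℕ} → Residue d → (w e w′ e′ : I → ℤ) → (∀ i → w i ≡ w′ i) → (∀ i → e i ≡ unthird (tag d (e′ i))) → ∀ n {s} →
  cf w′ e′ (+ n) ⇓ s → cf w e (+ (3 ℕ.* n ℕ.+ d)) ⇓ s
class-same {d = d} r w e w′ e′ q p n = ⇓-cong λ i →
  cong₂ _*_ {w′ i} {w i} (sym (q i)) (sym (trans (cong (λ x → δ x (+ (3 ℕ.* n ℕ.+ d))) (p i)) (δ-same r (e′ i) n)))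

sgn-3 : ∀ a → sgn (a + a + a) ≡ sgn a
sgn-3 a = trans (sgn-+ (a + a) a) (trans (cong (_* sgn a) (sgn-2* a)) (ℤₚ.*-identityˡ (sgn a)))

sgn-3+1 : ∀ a → sgn (1ℤ + (a + a + a)) ≡ - sgn a
sgn-3+1 a = trans (sgn-suc (a + a + a)) (cong -_ (sgn-3 a))

sgn-3+2 : ∀ a → sgn (+ 2 + (a + a + a)) ≡ sgn a
sgn-3+2 a = trans (cong sgn (ℤₚ.+-assoc 1ℤ 1ℤ (a + a + a))) (trans (sgn-suc (1ℤ + (a + a + a))) (trans (cong -_ (sgn-3+1 a)) (ℤₚ.neg-involutive (sgn a))))

neg-* : ∀ a b → - (a * b) ≡ (- a) * b
neg-* = solve-∀

-- The exponent 2k² + k is 0 modulo 3 for k ≡ 0 and k ≡ 1, and 1 for k ≡ 2. The last class becomes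
-- -ψ₃ only after k = 3a + 2 is reflected by a ↦ -1 - a, which also accounts for the sign.
module ψ₁-classes where

  w e w₀′ e₀′ w₁′ e₁′ w₂′ e₂′ : ℤ × ⊤ → ℤ
  w (k , _) = sgn k
  e (k , _) = + 2 * k * k + k
  w₀′ (a , _) = sgn a
  e₀′ (a , _) = + 6 * a * a + a
  w₁′ (a , _) = - sgn a
  e₁′ (a , _) = + 6 * a * a + + 5 * a + 1ℤ
  w₂′ (a , _) = - sgn (- 1ℤ - a)
  e₂′ (a , _) = + 6 * (- 1ℤ - a) * (- 1ℤ - a) + + 3 * (- 1ℤ - a)

  F : ∀ N → cf w e (+ N) ⇓ ψ₁ N
  F N = ⇓-reindex {f = cf (wt fψ₁) (ex fψ₁) (+ N)} proj₁ (_, tt) (λ _ → refl) (λ _ _ → refl) (gf-⇓ fψ₁ N)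

  e₀ : ∀ ((a , _) : ℤ × ⊤) → + 2 * (a + a + a) * (a + a + a) + (a + a + a) ≡ (+ 6 * a * a + a) + (+ 6 * a * a + a) + (+ 6 * a * a + a)
  e₀ (a , _) = l a
    where
    l : ∀ a → + 2 * (a + a + a) * (a + a + a) + (a + a + a) ≡ (+ 6 * a * a + a) + (+ 6 * a * a + a) + (+ 6 * a * a + a)
    l = solve-∀
  e₁ : ∀ ((a , _) : ℤ × ⊤) → let k = 1ℤ + (a + a + a) ; e = + 6 * a * a + + 5 * a + 1ℤ in + 2 * k * k + k ≡ e + e + e
  e₁ (a , _) = l a
    where
    l : ∀ a → + 2 * (1ℤ + (a + a + a)) * (1ℤ + (a + a + a)) + (1ℤ + (a + a + a)) ≡ (+ 6 * a * a + + 5 * a + 1ℤ) + (+ 6 * a * a + + 5 * a + 1ℤ) + (+ 6 * a * a + + 5 * a + 1ℤ)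
    l = solve-∀
  e₂ : ∀ ((a , _) : ℤ × ⊤) → let k = + 2 + (a + a + a) ; b = - 1ℤ - a ; e = + 6 * b * b + + 3 * b in + 2 * k * k + k ≡ 1ℤ + (e + e + e)
  e₂ (a , _) = l a
    where
    l : ∀ a → + 2 * (+ 2 + (a + a + a)) * (+ 2 + (a + a + a)) + (+ 2 + (a + a + a)) ≡ 1ℤ + ((+ 6 * (- 1ℤ - a) * (- 1ℤ - a) + + 3 * (- 1ℤ - a)) + (+ 6 * (- 1ℤ - a) * (- 1ℤ - a) + + 3 * (- 1ℤ - a)) + (+ 6 * (- 1ℤ - a) * (- 1ℤ - a) + + 3 * (- 1ℤ - a)))
    l = solve-∀

  lift : {g : ℤ → ℤ} {s : ℤ} → g ⇓ s → (λ ((k , _) : ℤ × ⊤) → g k) ⇓ s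
  lift {g} = ⇓-reindex {f = g} proj₁ (_, tt) (λ _ → refl) (λ _ _ → refl)

  flip : ∀ a → - 1ℤ - (- 1ℤ - a) ≡ a
  flip = solve-∀

  sgn-flip : ∀ a → - sgn (- 1ℤ - a) ≡ sgn a
  sgn-flip a = trans (sym (sgn-suc (- 1ℤ - a))) (trans (cong sgn (l a)) (sgn-neg a))
    where
    l : ∀ a → 1ℤ + (- 1ℤ - a) ≡ - a
    l = solve-∀

  other₀ : ∀ {d} → Residue d → 0 ≢ d → ∀ n → cf (w ∘ into₀) (e ∘ into₀) (+ (3 ℕ.* n ℕ.+ d)) ⇓ 0ℤ
  other₀ r p = class-other res₀ r p (w ∘ into₀) (e ∘ into₀) e₀′ e₀
  other₁ : ∀ {d} → Residue d → 0 ≢ d → ∀ n → cf (w ∘ into₁) (e ∘ into₁) (+ (3 ℕ.* n ℕ.+ d)) ⇓ 0ℤ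
  other₁ r p = class-other res₀ r p (w ∘ into₁) (e ∘ into₁) e₁′ e₁
  other₂ : ∀ {d} → Residue d → 1 ≢ d → ∀ n → cf (w ∘ into₂) (e ∘ into₂) (+ (3 ℕ.* n ℕ.+ d)) ⇓ 0ℤ
  other₂ r p = class-other res₁ r p (w ∘ into₂) (e ∘ into₂) e₂′ e₂

  U₀ : U 0 ψ₁ ≈ aˢ
  U₀ = coeffs λ n → ⇓-unique (F (3 ℕ.* n ℕ.+ 0)) (⇓-≡ (trans (cong (_+_ (gf fa₁ n)) (ℤₚ.+-identityʳ (- gf fa₂ n))) (sym (minus-at (gf fa₁) (gf fa₂) n)))
    (⇓-third w e (+ (3 ℕ.* n ℕ.+ 0)) (class-same res₀ (w ∘ into₀) (e ∘ into₀) w₀′ e₀′ (λ (a , _) → sgn-3 a) e₀ n (lift (gf-⇓ fa₁ n)))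
      (class-same res₀ (w ∘ into₁) (e ∘ into₁) w₁′ e₁′ (λ (a , _) → sgn-3+1 a) e₁ n
        (⇓-cong (λ (a , _) → neg-* (sgn a) (δ (ex fa₂ a) (+ n))) (lift (⇓-neg (gf-⇓ fa₂ n)))))
      (other₂ res₀ (λ ()) n)))
  U₁ : U 1 ψ₁ ≈ -ˢ ψ₃
  U₁ = coeffs λ n → ⇓-unique (F (3 ℕ.* n ℕ.+ 1)) (⇓-≡ (trans (ℤₚ.+-identityˡ (0ℤ + - ψ₃ n)) (trans (ℤₚ.+-identityˡ (- ψ₃ n)) (sym (-ˢ-at ψ₃ n))))
    (⇓-third w e (+ (3 ℕ.* n ℕ.+ 1)) (other₀ res₁ (λ ()) n) (other₁ res₁ (λ ()) n)
      (class-same res₁ (w ∘ into₂) (e ∘ into₂) w₂′ e₂′ (λ (a , _) → trans (sgn-3+2 a) (sym (sgn-flip a))) e₂ n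
        (lift (⇓-reindex {f = λ b → - sgn b * δ (+ 6 * b * b + + 3 * b) (+ n)} (λ a → - 1ℤ - a) (λ a → - 1ℤ - a) flip (λ a _ → flip a)
          (⇓-cong (λ a → neg-* (sgn a) (δ (+ 6 * a * a + + 3 * a) (+ n))) (⇓-neg (gf-⇓ fψ₃ n))))))))
  U₂ : U 2 ψ₁ ≈ 0ˢ
  U₂ = coeffs λ n → ⇓-unique (F (3 ℕ.* n ℕ.+ 2)) (⇓-≡ (sym (0ˢ-at n))
    (⇓-third w e (+ (3 ℕ.* n ℕ.+ 2)) (other₀ res₂ (λ ()) n) (other₁ res₂ (λ ()) n) (other₂ res₂ (λ ()) n)))

ψ₃≈dil-ψ₁ : ψ₃ ≈ dil ψ₁
ψ₃≈dil-ψ₁ = U-ext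
  (≈-trans (coeffs λ n → ⇓-unique (gf-⇓ fψ₃ (3 ℕ.* n ℕ.+ 0)) (class-same res₀ (wt fψ₃) (ex fψ₃) (wt fψ₁) (ex fψ₁) (λ k → refl) e n (gf-⇓ fψ₁ n))) (≈-sym (U-dil-0 ψ₁)))
  (≈-trans (coeffs λ n → ⇓-unique (gf-⇓ fψ₃ (3 ℕ.* n ℕ.+ 1)) (⇓-≡ (sym (0ˢ-at n)) (class-other res₀ res₁ (λ ()) (wt fψ₃) (ex fψ₃) (ex fψ₁) e n))) (≈-sym (U-dil-suc 0 (s≤s (s≤s z≤n)) ψ₁)))
  (≈-trans (coeffs λ n → ⇓-unique (gf-⇓ fψ₃ (3 ℕ.* n ℕ.+ 2)) (⇓-≡ (sym (0ˢ-at n)) (class-other res₀ res₂ (λ ()) (wt fψ₃) (ex fψ₃) (ex fψ₁) e n))) (≈-sym (U-dil-suc 1 ℕₚ.≤-refl ψ₁)))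
  where
  e : ∀ k → + 6 * k * k + + 3 * k ≡ (+ 2 * k * k + k) + (+ 2 * k * k + k) + (+ 2 * k * k + k)
  e = solve-∀

pos-3 : ∀ a → pos (a + a + a) ≡ pos a
pos-3 (+ a)    = refl
pos-3 -[1+ a ] = refl

pos-3+1 : ∀ a → pos (1ℤ + (a + a + a)) ≡ pos a
pos-3+1 (+ a)    = refl
pos-3+1 -[1+ a ] = refl

pos-3+2 : ∀ a → pos (+ 2 + (a + a + a)) ≡ pos a
pos-3+2 (+ a)    = refl
pos-3+2 -[1+ a ] = refl

nz-3 : ∀ a → nz (a + a + a) ≡ nz a
nz-3 (+ zero)  = refl
nz-3 (+ suc a) = refl
nz-3 -[1+ a ]  = refl

nz-3+1 : ∀ a → nz (1ℤ + (a + a + a)) ≡ 1ℤ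
nz-3+1 (+ a)    = refl
nz-3+1 -[1+ a ] = refl

nz-3+2 : ∀ a → nz (+ 2 + (a + a + a)) ≡ 1ℤ
nz-3+2 (+ a)    = refl
nz-3+2 -[1+ a ] = refl

ε-flip : ∀ a j → ε (- 1ℤ - a) (- 1ℤ - j) ≡ - ε a j
ε-flip a j = trans (cong₂ (λ x y → x + y - 1ℤ) (pos-flip a) (pos-flip j)) (l (pos a) (pos j))
  where
  l : ∀ x y → (1ℤ - x) + (1ℤ - y) - 1ℤ ≡ - (x + y - 1ℤ)
  l = solve-∀

w-3 : ∀ ((a , j) : ℤ × ℤ) → sgn (a + a + a) * nz (a + a + a) * ε (a + a + a) j ≡ sgn a * nz a * ε a j
w-3 (a , j) = cong₂ _*_ (cong₂ _*_ (sgn-3 a) (nz-3 a)) (cong (λ p → p + pos j - 1ℤ) (pos-3 a))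

-- Since k + 6kj ≡ k modulo 3, only k = 3a contributes to component 0, and dividing the exponent by
-- 3 gives the family back with a for k; the sign (-1)^k is unchanged because 3 is odd.
module E-classes where

  w e e₁′ e₂′ : ℤ × ℤ → ℤ
  w = wt fE
  e = ex fE
  e₁′ (a , j) = a + + 6 * a * j + + 2 * j
  e₂′ (a , j) = a + + 6 * a * j + + 4 * j

  e₀ : ∀ ((a , j) : ℤ × ℤ) → (a + a + a) + + 6 * (a + a + a) * j ≡ (a + + 6 * a * j) + (a + + 6 * a * j) + (a + + 6 * a * j)
  e₀ (a , j) = l a j
    where
    l : ∀ a j → (a + a + a) + + 6 * (a + a + a) * j ≡ (a + + 6 * a * j) + (a + + 6 * a * j) + (a + + 6 * a * j)
    l = solve-∀
  e₁ : ∀ ((a , j) : ℤ × ℤ) → let e = a + + 6 * a * j + + 2 * j in (1ℤ + (a + a + a)) + + 6 * (1ℤ + (a + a + a)) * j ≡ 1ℤ + (e + e + e)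
  e₁ (a , j) = l a j
    where
    l : ∀ a j → (1ℤ + (a + a + a)) + + 6 * (1ℤ + (a + a + a)) * j ≡ 1ℤ + ((a + + 6 * a * j + + 2 * j) + (a + + 6 * a * j + + 2 * j) + (a + + 6 * a * j + + 2 * j))
    l = solve-∀
  e₂ : ∀ ((a , j) : ℤ × ℤ) → let e = a + + 6 * a * j + + 4 * j in (+ 2 + (a + a + a)) + + 6 * (+ 2 + (a + a + a)) * j ≡ + 2 + (e + e + e)
  e₂ (a , j) = l a j
    where
    l : ∀ a j → (+ 2 + (a + a + a)) + + 6 * (+ 2 + (a + a + a)) * j ≡ + 2 + ((a + + 6 * a * j + + 4 * j) + (a + + 6 * a * j + + 4 * j) + (a + + 6 * a * j + + 4 * j))
    l = solve-∀

  U₀ : U 0 (gf fE) ≈ gf fE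
  U₀ = coeffs λ n → ⇓-unique (gf-⇓ fE (3 ℕ.* n ℕ.+ 0)) (⇓-≡ (ℤₚ.+-identityʳ (gf fE n))
    (⇓-third w e (+ (3 ℕ.* n ℕ.+ 0)) (class-same res₀ (w ∘ into₀) (e ∘ into₀) w e w-3 e₀ n (gf-⇓ fE n))
      (class-other res₁ res₀ (λ ()) (w ∘ into₁) (e ∘ into₁) e₁′ e₁ n) (class-other res₂ res₀ (λ ()) (w ∘ into₂) (e ∘ into₂) e₂′ e₂ n)))

cst-U : ∀ d → d < 3 → ∀ c f → U d (cst c *ˢ f) ≈ cst c *ˢ U d f
cst-U d _ c f = coeffs λ n → trans (cst-*ˢ-at c f (3 ℕ.* n ℕ.+ d)) (sym (cst-*ˢ-at c (U d f) n))

U-1-0 : U 0 1ˢ ≈ 1ˢ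
U-1-0 = coeffs λ { zero → refl ; (suc n) → refl }

U-1-suc : ∀ d → U (suc d) 1ˢ ≈ 0ˢ
U-1-suc d = coeffs λ n → trans (cong 1ˢ (ℕₚ.+-suc (3 ℕ.* n) d)) (sym (0ˢ-at n))

U₀-E : U 0 Eˢ ≈ Eˢ
U₀-E = ≈-trans (U-+ 0 1ˢ _) (+ˢ-cong U-1-0 (≈-trans (cst-U 0 (s≤s z≤n) (+ 3) (gf fE)) (*ˢ-congˡ E-classes.U₀)))

-- The cube of ψ₁ = dil a - q dil ψ₃, together with the invariance of E under U 0.
ψ₁E≈a³-qψ₃³ : ψ₁ *ˢ Eˢ ≈ aˢ *ˢ (aˢ *ˢ aˢ) -ˢ q^ 1 *ˢ (ψ₃ *ˢ (ψ₃ *ˢ ψ₃))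
ψ₁E≈a³-qψ₃³ =
  ψ₁ *ˢ Eˢ                        ≈⟨ *ˢ-congˡ U₀-E ⟨
  ψ₁ *ˢ U 0 Eˢ                    ≈⟨ U-dil-* 0 (s≤s z≤n) ψ₁ Eˢ ⟨
  U 0 (dil ψ₁ *ˢ Eˢ)              ≈⟨ U-cong 0 (*ˢ-congʳ ψ₃≈dil-ψ₁) ⟨
  U 0 (ψ₃ *ˢ Eˢ)                  ≈⟨ U-cong 0 ψ₁³≈ψ₃E ⟨
  U 0 (ψ₁ *ˢ (ψ₁ *ˢ ψ₁))          ≈⟨ U-*-0 ψ₁ (ψ₁ *ˢ ψ₁) ⟩
  U 0 ψ₁ *ˢ U 0 (ψ₁ *ˢ ψ₁) +ˢ q^ 1 *ˢ (U 1 ψ₁ *ˢ U 2 (ψ₁ *ˢ ψ₁) +ˢ U 2 ψ₁ *ˢ U 1 (ψ₁ *ˢ ψ₁))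
    ≈⟨ +ˢ-cong (*ˢ-cong ψ₁-classes.U₀ sq₀) (*ˢ-congˡ (+ˢ-cong (*ˢ-cong ψ₁-classes.U₁ sq₂) (*ˢ-congʳ ψ₁-classes.U₂))) ⟩
  aˢ *ˢ (aˢ *ˢ aˢ +ˢ q^ 1 *ˢ (-ˢ ψ₃ *ˢ 0ˢ +ˢ 0ˢ *ˢ -ˢ ψ₃)) +ˢ q^ 1 *ˢ (-ˢ ψ₃ *ˢ (aˢ *ˢ 0ˢ +ˢ (-ˢ ψ₃ *ˢ -ˢ ψ₃ +ˢ 0ˢ *ˢ aˢ)) +ˢ 0ˢ *ˢ U 1 (ψ₁ *ˢ ψ₁))
    ≈⟨ solve 4 (λ a p q u → a :* (a :* a :+ q :* (:- p :* con 0ℤ :+ con 0ℤ :* :- p)) :+ q :* (:- p :* (a :* con 0ℤ :+ (:- p :* :- p :+ con 0ℤ :* a)) :+ con 0ℤ :* u)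
         := a :* (a :* a) :- q :* (p :* (p :* p))) ≈-refl aˢ ψ₃ (q^ 1) (U 1 (ψ₁ *ˢ ψ₁)) ⟩
  aˢ *ˢ (aˢ *ˢ aˢ) -ˢ q^ 1 *ˢ (ψ₃ *ˢ (ψ₃ *ˢ ψ₃)) ≈∎
  where
  sq₀ : U 0 (ψ₁ *ˢ ψ₁) ≈ aˢ *ˢ aˢ +ˢ q^ 1 *ˢ (-ˢ ψ₃ *ˢ 0ˢ +ˢ 0ˢ *ˢ -ˢ ψ₃)
  sq₀ = ≈-trans (U-*-0 ψ₁ ψ₁) (+ˢ-cong (*ˢ-cong ψ₁-classes.U₀ ψ₁-classes.U₀)
    (*ˢ-congˡ (+ˢ-cong (*ˢ-cong ψ₁-classes.U₁ ψ₁-classes.U₂) (*ˢ-cong ψ₁-classes.U₂ ψ₁-classes.U₁))))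
  sq₂ : U 2 (ψ₁ *ˢ ψ₁) ≈ aˢ *ˢ 0ˢ +ˢ (-ˢ ψ₃ *ˢ -ˢ ψ₃ +ˢ 0ˢ *ˢ aˢ)
  sq₂ = ≈-trans (U-*-2 ψ₁ ψ₁) (+ˢ-cong (*ˢ-cong ψ₁-classes.U₀ ψ₁-classes.U₂)
    (+ˢ-cong (*ˢ-cong ψ₁-classes.U₁ ψ₁-classes.U₁) (*ˢ-cong ψ₁-classes.U₂ ψ₁-classes.U₀)))

-- The extra term 6kj is divisible by 3, so the classes are those of ψ₁; in particular component 2
-- is empty.
module H-classes where

  w e w₁′ w₂′ e₂′ : ℤ × ℤ → ℤ
  w = wt fH
  e = ex fH
  w₁′ (a , j) = - (sgn a * ε a j)
  w₂′ (a , j) = sgn (- 1ℤ - a) * ε (- 1ℤ - a) (- 1ℤ - j)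
  e₂′ (a , j) = + 6 * (- 1ℤ - a) * (- 1ℤ - a) + + 9 * (- 1ℤ - a) + + 2 + (+ 6 * (- 1ℤ - a) + + 2) * (- 1ℤ - j)

  e₀ : ∀ ((a , j) : ℤ × ℤ) → let k = a + a + a ; e = + 6 * a * a + a + + 6 * a * j in + 2 * k * k + k + + 6 * k * j ≡ e + e + e
  e₀ (a , j) = l a j
    where
    l : ∀ a j → + 2 * (a + a + a) * (a + a + a) + (a + a + a) + + 6 * (a + a + a) * j ≡ (+ 6 * a * a + a + + 6 * a * j) + (+ 6 * a * a + a + + 6 * a * j) + (+ 6 * a * a + a + + 6 * a * j)
    l = solve-∀
  e₁ : ∀ ((a , j) : ℤ × ℤ) → let k = 1ℤ + (a + a + a) ; e = + 6 * a * a + + 5 * a + 1ℤ + (+ 6 * a + + 2) * j in + 2 * k * k + k + + 6 * k * j ≡ e + e + e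
  e₁ (a , j) = l a j
    where
    l : ∀ a j → + 2 * (1ℤ + (a + a + a)) * (1ℤ + (a + a + a)) + (1ℤ + (a + a + a)) + + 6 * (1ℤ + (a + a + a)) * j
      ≡ (+ 6 * a * a + + 5 * a + 1ℤ + (+ 6 * a + + 2) * j) + (+ 6 * a * a + + 5 * a + 1ℤ + (+ 6 * a + + 2) * j) + (+ 6 * a * a + + 5 * a + 1ℤ + (+ 6 * a + + 2) * j)
    l = solve-∀
  e₂ : ∀ ((a , j) : ℤ × ℤ) → let k = + 2 + (a + a + a) ; b = - 1ℤ - a ; i = - 1ℤ - j ; e = + 6 * b * b + + 9 * b + + 2 + (+ 6 * b + + 2) * i in
    + 2 * k * k + k + + 6 * k * j ≡ 1ℤ + (e + e + e)
  e₂ (a , j) = l a j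
    where
    l : ∀ a j → + 2 * (+ 2 + (a + a + a)) * (+ 2 + (a + a + a)) + (+ 2 + (a + a + a)) + + 6 * (+ 2 + (a + a + a)) * j
      ≡ 1ℤ + ((+ 6 * (- 1ℤ - a) * (- 1ℤ - a) + + 9 * (- 1ℤ - a) + + 2 + (+ 6 * (- 1ℤ - a) + + 2) * (- 1ℤ - j)) + (+ 6 * (- 1ℤ - a) * (- 1ℤ - a) + + 9 * (- 1ℤ - a) + + 2 + (+ 6 * (- 1ℤ - a) + + 2) * (- 1ℤ - j)) + (+ 6 * (- 1ℤ - a) * (- 1ℤ - a) + + 9 * (- 1ℤ - a) + + 2 + (+ 6 * (- 1ℤ - a) + + 2) * (- 1ℤ - j)))
    l = solve-∀

  w₁ : ∀ ((a , j) : ℤ × ℤ) → let k = 1ℤ + (a + a + a) in sgn k * nz k * ε k j ≡ - (sgn a * ε a j)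
  w₁ (a , j) = trans (cong₂ _*_ (cong₂ _*_ (sgn-3+1 a) (nz-3+1 a)) (cong (λ p → p + pos j - 1ℤ) (pos-3+1 a))) (l (sgn a) (ε a j))
    where
    l : ∀ s e → - s * 1ℤ * e ≡ - (s * e)
    l = solve-∀
  w₂ : ∀ ((a , j) : ℤ × ℤ) → let k = + 2 + (a + a + a) in sgn k * nz k * ε k j ≡ sgn (- 1ℤ - a) * ε (- 1ℤ - a) (- 1ℤ - j)
  w₂ (a , j) = trans (cong₂ _*_ (cong₂ _*_ (sgn-3+2 a) (nz-3+2 a)) (cong (λ p → p + pos j - 1ℤ) (pos-3+2 a)))
    (trans (cong (λ s → s * 1ℤ * ε a j) (sym (ψ₁-classes.sgn-flip a))) (trans (l (sgn (- 1ℤ - a)) (ε a j)) (cong (_*_ (sgn (- 1ℤ - a))) (sym (ε-flip a j)))))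
    where
    l : ∀ s e → - s * 1ℤ * e ≡ s * - e
    l = solve-∀

  other₀ : ∀ {d} → Residue d → 0 ≢ d → ∀ n → cf (w ∘ into₀) (e ∘ into₀) (+ (3 ℕ.* n ℕ.+ d)) ⇓ 0ℤ
  other₀ r p = class-other res₀ r p (w ∘ into₀) (e ∘ into₀) (ex ft₁) e₀
  other₁ : ∀ {d} → Residue d → 0 ≢ d → ∀ n → cf (w ∘ into₁) (e ∘ into₁) (+ (3 ℕ.* n ℕ.+ d)) ⇓ 0ℤ
  other₁ r p = class-other res₀ r p (w ∘ into₁) (e ∘ into₁) (ex ft₂) e₁
  other₂ : ∀ {d} → Residue d → 1 ≢ d → ∀ n → cf (w ∘ into₂) (e ∘ into₂) (+ (3 ℕ.* n ℕ.+ d)) ⇓ 0ℤ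
  other₂ r p = class-other res₁ r p (w ∘ into₂) (e ∘ into₂) e₂′ e₂

  U₀ : U 0 (gf fH) ≈ gf ft₁ -ˢ gf ft₂
  U₀ = coeffs λ n → ⇓-unique (gf-⇓ fH (3 ℕ.* n ℕ.+ 0)) (⇓-≡ (trans (cong (_+_ (gf ft₁ n)) (ℤₚ.+-identityʳ (- gf ft₂ n))) (sym (minus-at (gf ft₁) (gf ft₂) n)))
    (⇓-third w e (+ (3 ℕ.* n ℕ.+ 0)) (class-same res₀ (w ∘ into₀) (e ∘ into₀) (wt ft₁) (ex ft₁) w-3 e₀ n (gf-⇓ ft₁ n))
      (class-same res₀ (w ∘ into₁) (e ∘ into₁) w₁′ (ex ft₂) w₁ e₁ n
        (⇓-cong (λ (a , j) → neg-* (sgn a * ε a j) (δ (ex ft₂ (a , j)) (+ n))) (⇓-neg (gf-⇓ ft₂ n))))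
      (other₂ res₀ (λ ()) n)))
  U₁ : U 1 (gf fH) ≈ gf ft₃
  U₁ = coeffs λ n → ⇓-unique (gf-⇓ fH (3 ℕ.* n ℕ.+ 1)) (⇓-≡ (trans (ℤₚ.+-identityˡ (0ℤ + gf ft₃ n)) (ℤₚ.+-identityˡ (gf ft₃ n)))
    (⇓-third w e (+ (3 ℕ.* n ℕ.+ 1)) (other₀ res₁ (λ ()) n) (other₁ res₁ (λ ()) n)
      (class-same res₁ (w ∘ into₂) (e ∘ into₂) w₂′ e₂′ w₂ e₂ n
        (⇓-reindex {f = cf (wt ft₃) (ex ft₃) (+ n)} fl fl fl² (λ x _ → fl² x) (gf-⇓ ft₃ n)))))
    where
    fl : ℤ × ℤ → ℤ × ℤ
    fl (a , j) = (- 1ℤ - a , - 1ℤ - j)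
    fl² : ∀ x → fl (fl x) ≡ x
    fl² (a , j) = cong₂ _,_ (ψ₁-classes.flip a) (ψ₁-classes.flip j)
  U₂ : U 2 (gf fH) ≈ 0ˢ
  U₂ = coeffs λ n → ⇓-unique (gf-⇓ fH (3 ℕ.* n ℕ.+ 2)) (⇓-≡ (sym (0ˢ-at n))
    (⇓-third w e (+ (3 ℕ.* n ℕ.+ 2)) (other₀ res₂ (λ ()) n) (other₁ res₂ (λ ()) n) (other₂ res₂ (λ ()) n)))

U₀-H : U 0 Hˢ ≈ h₀
U₀-H = ≈-trans (U-+ 0 1ˢ _) (+ˢ-cong U-1-0 (≈-trans (cst-U 0 (s≤s z≤n) (+ 3) (gf fH)) (*ˢ-congˡ H-classes.U₀)))

U₁-H : U 1 Hˢ ≈ h₁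
U₁-H = ≈-trans (U-+ 1 1ˢ _) (≈-trans (+ˢ-cong (U-1-suc 0) (≈-trans (cst-U 1 (s≤s (s≤s z≤n)) (+ 3) (gf fH)) (*ˢ-congˡ H-classes.U₁)))
  (solve 1 (λ x → con 0ℤ :+ x := x) ≈-refl h₁))

U₂-H : U 2 Hˢ ≈ 0ˢ
U₂-H = ≈-trans (U-+ 2 1ˢ _) (≈-trans (+ˢ-cong (U-1-suc 1) (≈-trans (cst-U 2 ℕₚ.≤-refl (+ 3) (gf fH)) (*ˢ-congˡ H-classes.U₂)))
  (solve 0 (con 0ℤ :+ con (+ 3) :* con 0ℤ := con 0ℤ) ≈-refl))

-- Solution of the linear system

module Solution (F : PS) (ψ₁F≈H : ψ₁ *ˢ F ≈ Hˢ) where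

  private
    A B C : PS
    A = U 0 F
    B = U 1 F
    C = U 2 F

    eq₀ : aˢ *ˢ A -ˢ q^ 1 *ˢ (ψ₃ *ˢ C) ≈ h₀
    eq₀ = ≈-trans (≈-sym (≈-trans (U-*-0 ψ₁ F) (≈-trans (+ˢ-cong (*ˢ-congʳ ψ₁-classes.U₀) (*ˢ-congˡ (+ˢ-cong (*ˢ-congʳ ψ₁-classes.U₁) (*ˢ-congʳ ψ₁-classes.U₂))))
      (solve 6 (λ a p q x y z → a :* x :+ q :* (:- p :* z :+ con 0ℤ :* y) := a :* x :- q :* (p :* z)) ≈-refl aˢ ψ₃ (q^ 1) A B C))))
      (≈-trans (U-cong 0 ψ₁F≈H) U₀-H)

    eq₁ : aˢ *ˢ B -ˢ ψ₃ *ˢ A ≈ h₁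
    eq₁ = ≈-trans (≈-sym (≈-trans (U-*-1 ψ₁ F) (≈-trans (+ˢ-cong (*ˢ-congʳ ψ₁-classes.U₀) (+ˢ-cong (*ˢ-congʳ ψ₁-classes.U₁) (*ˢ-congˡ (*ˢ-congʳ ψ₁-classes.U₂))))
      (solve 6 (λ a p q x y z → a :* y :+ (:- p :* x :+ q :* (con 0ℤ :* z)) := a :* y :- p :* x) ≈-refl aˢ ψ₃ (q^ 1) A B C))))
      (≈-trans (U-cong 1 ψ₁F≈H) U₁-H)

    eq₂ : aˢ *ˢ C ≈ ψ₃ *ˢ B
    eq₂ = ≈-trans (solve 3 (λ a c x → a :* c := (a :* c :- x) :+ x) ≈-refl aˢ C (ψ₃ *ˢ B))
      (≈-trans (+ˢ-cong (≈-trans (≈-sym (≈-trans (U-*-2 ψ₁ F) (≈-trans (+ˢ-cong (*ˢ-congʳ ψ₁-classes.U₀) (+ˢ-cong (*ˢ-congʳ ψ₁-classes.U₁) (*ˢ-congʳ ψ₁-classes.U₂)))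
        (solve 5 (λ a p x y z → a :* z :+ (:- p :* y :+ con 0ℤ :* x) := a :* z :- p :* y) ≈-refl aˢ ψ₃ A B C)))) (≈-trans (U-cong 2 ψ₁F≈H) U₂-H)) ≈-refl)
      (solve 1 (λ x → con 0ℤ :+ x := x) ≈-refl (ψ₃ *ˢ B)))

  -- Cramer's rule: the determinant a³ - q ψ₃³ = ψ₁ E times B equals a (ψ₃ h₀ + a h₁) = a ψ₃ E, and
  -- E cancels.
  ψ₁B : ψ₁ *ˢ B ≈ aˢ *ˢ ψ₃
  ψ₁B = *ˢ-cancelˡ {Eˢ} Eˢ-0 (
    Eˢ *ˢ (ψ₁ *ˢ B)
      ≈⟨ solve 3 (λ e p b → e :* (p :* b) := p :* e :* b) ≈-refl Eˢ ψ₁ B ⟩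
    ψ₁ *ˢ Eˢ *ˢ B
      ≈⟨ *ˢ-congʳ ψ₁E≈a³-qψ₃³ ⟩
    (aˢ *ˢ (aˢ *ˢ aˢ) -ˢ q^ 1 *ˢ (ψ₃ *ˢ (ψ₃ *ˢ ψ₃))) *ˢ B
      ≈⟨ solve 4 (λ a p q b → (a :* (a :* a) :- q :* (p :* (p :* p))) :* b := a :* a :* a :* b :- q :* p :* p :* (p :* b)) ≈-refl aˢ ψ₃ (q^ 1) B ⟩
    aˢ *ˢ aˢ *ˢ aˢ *ˢ B -ˢ q^ 1 *ˢ ψ₃ *ˢ ψ₃ *ˢ (ψ₃ *ˢ B)
      ≈⟨ -ˢ-cong ≈-refl (*ˢ-congˡ eq₂) ⟨
    aˢ *ˢ aˢ *ˢ aˢ *ˢ B -ˢ q^ 1 *ˢ ψ₃ *ˢ ψ₃ *ˢ (aˢ *ˢ C)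
      ≈⟨ solve 6 (λ a p q x y z → a :* a :* a :* y :- q :* p :* p :* (a :* z) := a :* (p :* (a :* x :- q :* (p :* z)) :+ a :* (a :* y :- p :* x))) ≈-refl aˢ ψ₃ (q^ 1) A B C ⟩
    aˢ *ˢ (ψ₃ *ˢ (aˢ *ˢ A -ˢ q^ 1 *ˢ (ψ₃ *ˢ C)) +ˢ aˢ *ˢ (aˢ *ˢ B -ˢ ψ₃ *ˢ A))
      ≈⟨ *ˢ-congˡ (+ˢ-cong (*ˢ-congˡ eq₀) (*ˢ-congˡ eq₁)) ⟩
    aˢ *ˢ (ψ₃ *ˢ h₀ +ˢ aˢ *ˢ h₁)
      ≈⟨ *ˢ-congˡ ψ₃h₀+ah₁≈ψ₃E ⟩
    aˢ *ˢ (ψ₃ *ˢ Eˢ)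
      ≈⟨ solve 3 (λ a p e → a :* (p :* e) := e :* (a :* p)) ≈-refl aˢ ψ₃ Eˢ ⟩
    Eˢ *ˢ (aˢ *ˢ ψ₃) ≈∎)

  ψ₁C : ψ₁ *ˢ C ≈ ψ₃ *ˢ ψ₃
  ψ₁C = *ˢ-cancelˡ {aˢ} aˢ-0 (≈-trans (solve 3 (λ a p c → a :* (p :* c) := p :* (a :* c)) ≈-refl aˢ ψ₁ C)
    (≈-trans (*ˢ-congˡ eq₂) (≈-trans (solve 3 (λ p r b → p :* (r :* b) := r :* (p :* b)) ≈-refl ψ₁ ψ₃ B)
      (≈-trans (*ˢ-congˡ ψ₁B) (solve 2 (λ r a → r :* (a :* r) := a :* (r :* r)) ≈-refl ψ₃ aˢ)))))

  -- Read off from ψ₃ A + h₁ = a B. The Lambert series h₁ stays with A, which is the source of the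
  -- bilateral sum in the first identity.
  ψ₁ψ₃A : ψ₁ *ˢ (ψ₃ *ˢ A +ˢ h₁) ≈ aˢ *ˢ aˢ *ˢ ψ₃
  ψ₁ψ₃A = ≈-trans (*ˢ-congˡ (+ˢ-cong ≈-refl (≈-sym eq₁))) (≈-trans (solve 5 (λ q p x a y → q :* (p :* x :+ (a :* y :- p :* x)) := a :* (q :* y)) ≈-refl ψ₁ ψ₃ A aˢ B)
    (≈-trans (*ˢ-congˡ ψ₁B) (≈-sym (*ˢ-assoc aˢ aˢ ψ₃))))

-- Partitions without repeated odd parts

upTo⁺ : ℕ → List ℕ
upTo⁺ zero    = zero ∷ []
upTo⁺ (suc m) = upTo⁺ m ++ (suc m ∷ [])

private
  upTo⁺-unique : (u : ℕ → List ℕ) → u 0 ≡ 0 ∷ [] → (∀ m → u (suc m) ≡ u m ++ (suc m ∷ [])) → ∀ N → u N ≡ upTo⁺ N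
  upTo⁺-unique u p q zero    = p
  upTo⁺-unique u p q (suc N) = trans (q N) (cong (_++ (suc N ∷ [])) (upTo⁺-unique u p q N))

  -- The list of multiplicities is local to parts≤ and cannot be named: the metavariable in local-upTo is
  -- solved by the goal of parts≤-suc, after the surrounding functions have been abstracted.
  mutual
    local-upTo : ℕ → ℕ → ℕ → List ℕ
    local-upTo k n = _

    parts≤-suc : ∀ k n → parts≤ (suc k) n ≡ foldr _++_ [] (map (λ m → map (replicate m (suc k) ++_) (parts≤ k (n ∸ m ℕ.* suc k))) (upTo⁺ (n / suc k)))
    parts≤-suc k n with n / suc k | foldr {A = List (List ℕ)} _++_ [] | map {A = ℕ} (λ m → map (replicate m (suc k) ++_) (parts≤ k (n ∸ m ℕ.* suc k)))
    ... | N | g | h = cong (λ l → g (h l)) (upTo⁺-unique (local-upTo k n) refl (λ _ → refl) N)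

  sum-concat : (f : List ℕ → ℤ) (c : ℕ → List (List ℕ)) (N : ℕ) → sumL f (foldr _++_ [] (map c (upTo⁺ N))) ≡ Σ< (suc N) (λ m → sumL f (c m))
  sum-concat f c N = trans (go (upTo⁺ N)) (go′ N)
    where
    go : ∀ L → sumL f (foldr _++_ [] (map c L)) ≡ sumL (λ m → sumL f (c m)) L
    go []      = refl
    go (m ∷ L) = trans (sumL-++ f (c m) _) (cong (_+_ (sumL f (c m))) (go L))
    go′ : ∀ N → sumL (λ m → sumL f (c m)) (upTo⁺ N) ≡ Σ< (suc N) (λ m → sumL f (c m))
    go′ zero    = ℤₚ.+-comm (sumL f (c 0)) 0ℤ
    go′ (suc N) = trans (sumL-++ (λ m → sumL f (c m)) (upTo⁺ N) _) (cong₂ _+_ (go′ N) (ℤₚ.+-identityʳ (sumL f (c (suc N)))))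

-- The weight is left arbitrary so that a removed part can be absorbed into it.
G : ℕ → (List ℕ → ℤ) → PS
G K f n = sumL f (parts≤ K n)

private
  G-Σ : ∀ k n f → G (suc k) f n ≡ Σ< (suc (n / suc k)) (λ m → sumL (λ μ → f (replicate m (suc k) ++ μ)) (parts≤ k (n ∸ m ℕ.* suc k)))
  G-Σ k n f = trans (cong (sumL f) (parts≤-suc k n)) (trans (sum-concat f _ (n / suc k))
    (Σ<-cong (suc (n / suc k)) (λ m _ → sumL-map f (replicate m (suc k) ++_) (parts≤ k (n ∸ m ℕ.* suc k)))))

  split-< : ∀ k n f → n < suc k → G (suc k) f n ≡ G k f n
  split-< k n f l = trans (G-Σ k n f) (trans (cong (λ N → Σ< (suc N) (λ m → sumL (λ μ → f (replicate m (suc k) ++ μ)) (parts≤ k (n ∸ m ℕ.* suc k)))) (ℕ÷.m<n⇒m/n≡0 l))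
    (ℤₚ.+-identityˡ _))

  split-+ : ∀ k n f → G (suc k) f (suc k ℕ.+ n) ≡ G k f (suc k ℕ.+ n) + G (suc k) (λ μ → f (suc k ∷ μ)) n
  split-+ k n f = trans (G-Σ k (suc k ℕ.+ n) f) (trans (cong (λ N → Σ< (suc N) h) N≡)
    (trans (Σ<-first (suc (n / suc k)) h) (cong (_+_ (G k f (suc k ℕ.+ n)))
      (trans (Σ<-cong (suc (n / suc k)) (λ m _ → cong (λ l → sumL (λ μ → f (suc k ∷ replicate m (suc k) ++ μ)) (parts≤ k l)) (ℕₚ.[m+n]∸[m+o]≡n∸o (suc k) n (m ℕ.* suc k))))
        (sym (G-Σ k n (λ μ → f (suc k ∷ μ))))))))
    where
    h : ℕ → ℤ
    h m = sumL (λ μ → f (replicate m (suc k) ++ μ)) (parts≤ k (suc k ℕ.+ n ∸ m ℕ.* suc k))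
    N≡ : (suc k ℕ.+ n) / suc k ≡ suc (n / suc k)
    N≡ = trans (ℕ÷.m/n≡1+[m∸n]/n {suc k ℕ.+ n} {suc k} (ℕₚ.m≤m+n (suc k) n)) (cong (λ l → suc (l / suc k)) (ℕₚ.m+n∸m≡n (suc k) n))

-- Either no part equals k + 1, or the first part does and is removed; the new weight remembers it.
G-suc : ∀ k f → G (suc k) f ≈ G k f +ˢ q^ (suc k) *ˢ G (suc k) (λ μ → f (suc k ∷ μ))
G-suc k f = coeffs λ n → trans (go n) (sym (+ˢ-at _ _ n))
  where
  X : PS
  X = G (suc k) (λ μ → f (suc k ∷ μ))
  go : ∀ n → G (suc k) f n ≡ G k f n + (q^ (suc k) *ˢ X) n
  go n with n ℕₚ.<? suc k
  ... | yes l = trans (split-< k n f l) (sym (trans (cong (_+_ (G k f n)) (mono-at-< 1ℤ (suc k) X l)) (ℤₚ.+-identityʳ _)))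
  ... | no ¬l with ℕₚ.m≤n⇒∃[o]m+o≡n (ℕₚ.≮⇒≥ ¬l)
  ...   | o , refl = trans (split-+ k o f) (cong (_+_ (G k f (suc k ℕ.+ o))) (sym (trans (mono-at-+ 1ℤ (suc k) X o) (ℤₚ.*-identityˡ (X o)))))

-- Follows the recursion of `G-suc`. It provides the bounds on the parts and on their number where
-- two weights are compared.
data Part : ℕ → ℕ → List ℕ → Set where
  nil  : Part 0 0 []
  skip : ∀ {k n μ} → Part k n μ → Part (suc k) n μ
  cons : ∀ {k n μ} → Part (suc k) n μ → Part (suc k) (suc k ℕ.+ n) (suc k ∷ μ)

G-cong : ∀ K n {f g} → (∀ μ → Part K n μ → f μ ≡ g μ) → G K f n ≡ G K g n
G-cong K n = go K n n ℕₚ.≤-refl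
  where
  -- `b` is fuel: removing a part lowers n, but not structurally.
  go : ∀ K n b → n ≤ b → ∀ {f g} → (∀ μ → Part K n μ → f μ ≡ g μ) → G K f n ≡ G K g n
  go zero    zero    b l h = cong (_+ 0ℤ) (h [] nil)
  go zero    (suc n) b l h = refl
  go (suc k) n b l {f} {g} h with n ℕₚ.<? suc k
  ... | yes n<k = trans (split-< k n f n<k) (trans (go k n b l (λ μ p → h μ (skip p))) (sym (split-< k n g n<k)))
  ... | no ¬l with ℕₚ.m≤n⇒∃[o]m+o≡n (ℕₚ.≮⇒≥ ¬l)
  go (suc k) _ (suc b) (s≤s l) {f} {g} h | no _ | o , refl = trans (split-+ k o f)
    (trans (cong₂ _+_ (go k (suc k ℕ.+ o) (suc b) (s≤s l) (λ μ p → h μ (skip p))) (go (suc k) o b (ℕₚ.≤-trans (ℕₚ.m≤n+m o k) l) (λ μ p → h (suc k ∷ μ) (cons p))))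
      (sym (split-+ k o g)))

Part-All : ∀ {K n μ} → Part K n μ → All (_≤ K) μ
Part-All nil      = []
Part-All (skip p) = All.map ℕₚ.m≤n⇒m≤1+n (Part-All p)
Part-All (cons p) = ℕₚ.≤-refl ∷ Part-All p

Part-length : ∀ {K n μ} → Part K n μ → length μ ≤ n
Part-length nil                     = z≤n
Part-length (skip p)                = Part-length p
Part-length (cons {k} {n} p) = s≤s (ℕₚ.≤-trans (Part-length p) (ℕₚ.m≤n+m n k))

𝟙 : Bool → ℤ
𝟙 b = if b then 1ℤ else 0ℤ

nro : List ℕ → ℤ
nro μ = 𝟙 (noRepeatedOdd μ)

private
  count : ℕ → List ℕ → ℕ
  count p μ = length (filter (λ x → x ℕ.≟ p) μ)

  ok : List ℕ → ℕ → Bool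
  ok μ p = not (isOdd p) ∨ (count p μ ℕ.≤ᵇ 1)

  allᵇ-cong : ∀ {p q : ℕ → Bool} μ → All (λ x → p x ≡ q x) μ → allᵇ p μ ≡ allᵇ q μ
  allᵇ-cong []      []       = refl
  allᵇ-cong (x ∷ μ) (e ∷ es) = cong₂ _∧_ e (allᵇ-cong μ es)

  count-≢ : ∀ {x p} μ → x ≢ p → count p (x ∷ μ) ≡ count p μ
  count-≢ {x} {p} μ ne = cong length (filter-reject (λ y → y ℕ.≟ p) {x} {μ} ne)

  count-≡ : ∀ x μ → count x (x ∷ μ) ≡ suc (count x μ)
  count-≡ x μ = cong length (filter-accept (λ y → y ℕ.≟ x) {x} {μ} refl)

  count-0 : ∀ {x} μ → All (λ y → y ≢ x) μ → count x μ ≡ 0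
  count-0 []      []       = refl
  count-0 (y ∷ μ) (n ∷ ns) = trans (count-≢ μ n) (count-0 μ ns)

nro-even : ∀ x μ → isOdd x ≡ false → nro (x ∷ μ) ≡ nro μ
nro-even x μ e = cong 𝟙 (trans (cong (λ b → (not b ∨ (count x (x ∷ μ) ℕ.≤ᵇ 1)) ∧ allᵇ (ok (x ∷ μ)) μ) e)
  (allᵇ-cong μ (All.universal same μ)))
  where
  same : ∀ p → ok (x ∷ μ) p ≡ ok μ p
  same p with x ℕₚ.≟ p
  ... | yes refl = trans (cong (λ b → not b ∨ (count x (x ∷ μ) ℕ.≤ᵇ 1)) e) (sym (cong (λ b → not b ∨ (count x μ ℕ.≤ᵇ 1)) e))
  ... | no ne    = cong (λ c → not (isOdd p) ∨ (c ℕ.≤ᵇ 1)) (count-≢ μ ne)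

nro-new : ∀ x μ → All (_< x) μ → nro (x ∷ μ) ≡ nro μ
nro-new x μ a = cong 𝟙 (trans (cong (λ c → (not (isOdd x) ∨ (c ℕ.≤ᵇ 1)) ∧ allᵇ (ok (x ∷ μ)) μ) (trans (count-≡ x μ) (cong suc (count-0 μ (All.map ℕₚ.<⇒≢ a)))))
  (trans (cong (_∧ allᵇ (ok (x ∷ μ)) μ) (Boolₚ.∨-zeroʳ (not (isOdd x))))
    (allᵇ-cong μ (All.map (λ {p} p<x → cong (λ c → not (isOdd p) ∨ (c ℕ.≤ᵇ 1)) (count-≢ μ (λ e → ℕₚ.<⇒≢ p<x (sym e)))) a))))

nro-twice : ∀ x μ → isOdd x ≡ true → nro (x ∷ x ∷ μ) ≡ 0ℤ
nro-twice x μ o = cong 𝟙 (trans (cong (λ b → (not b ∨ (count x (x ∷ x ∷ μ) ℕ.≤ᵇ 1)) ∧ allᵇ (ok (x ∷ x ∷ μ)) (x ∷ μ)) o)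
  (cong (λ c → (c ℕ.≤ᵇ 1) ∧ allᵇ (ok (x ∷ x ∷ μ)) (x ∷ μ)) (trans (count-≡ x (x ∷ μ)) (cong suc (count-≡ x μ)))))

isOdd-2k : ∀ k → isOdd (k ℕ.+ k) ≡ false
isOdd-2k zero    = refl
isOdd-2k (suc k) = trans (cong (λ n → isOdd (suc n)) (ℕₚ.+-suc k k)) (isOdd-2k k)

isOdd-2k+1 : ∀ k → isOdd (suc (k ℕ.+ k)) ≡ true
isOdd-2k+1 zero    = refl
isOdd-2k+1 (suc k) = trans (cong (λ n → isOdd (suc (suc n))) (ℕₚ.+-suc k k)) (isOdd-2k+1 k)

cons-even : ∀ k (g : List ℕ → ℤ) (v : ℕ → ℤ) → isOdd (suc k) ≡ false → (∀ n μ → Part (suc k) n μ → g (suc k ∷ μ) ≡ nro (suc k ∷ μ) * v (length μ)) →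
  G (suc k) (λ μ → g (suc k ∷ μ)) ≈ G (suc k) (λ μ → nro μ * v (length μ))
cons-even k g v e h = coeffs λ n → G-cong (suc k) n (λ μ p → trans (h n μ p) (cong (_* v (length μ)) (nro-even (suc k) μ e)))

-- A second copy of an odd part annihilates `nro`, so once one copy is removed all remaining parts
-- are at most k.
cons-odd : ∀ k (g : List ℕ → ℤ) (v : ℕ → ℤ) → isOdd (suc k) ≡ true → (∀ n μ → Part (suc k) n μ → g (suc k ∷ μ) ≡ nro (suc k ∷ μ) * v (length μ)) →
  G (suc k) (λ μ → g (suc k ∷ μ)) ≈ G k (λ μ → nro μ * v (length μ))
cons-odd k g v o h =
  G (suc k) (λ μ → g (suc k ∷ μ))
    ≈⟨ G-suc k _ ⟩
  G k (λ μ → g (suc k ∷ μ)) +ˢ q^ (suc k) *ˢ G (suc k) (λ μ → g (suc k ∷ suc k ∷ μ))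
    ≈⟨ +ˢ-cong (coeffs λ n → G-cong k n (λ μ p → trans (h n μ (skip p)) (cong (_* v (length μ)) (nro-new (suc k) μ (All.map s≤s (Part-All p))))))
         (*ˢ-congˡ (coeffs λ n → trans (G-cong (suc k) n (λ μ p → trans (h _ (suc k ∷ μ) (cons p)) (cong (_* v (suc (length μ))) (nro-twice (suc k) μ o))))
           (trans (sumL-0 (parts≤ (suc k) n) (λ μ _ → ℤₚ.*-zeroˡ (v (suc (length μ))))) (sym (0ˢ-at n))))) ⟩
  G k (λ μ → nro μ * v (length μ)) +ˢ q^ (suc k) *ˢ 0ˢ
    ≈⟨ solve 2 (λ a b → a :+ b :* con 0ℤ := a) ≈-refl _ (q^ (suc k)) ⟩
  G k (λ μ → nro μ * v (length μ)) ≈∎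

opaque
  S : ℕ → (ℕ → ℤ) → PS
  S k w = G (k ℕ.+ k) (λ μ → nro μ * w (length μ))

opaque
  unfolding S

  S-0 : ∀ w → S 0 w ≈ cst (w 0)
  S-0 w = coeffs λ { zero → trans (ℤₚ.+-identityʳ _) (ℤₚ.*-identityˡ (w 0)) ; (suc n) → refl }

2k+2 : ∀ k → suc k ℕ.+ suc k ≡ suc (suc (k ℕ.+ k))
2k+2 k = cong suc (ℕₚ.+-suc k k)

q₁ q₂ : ℕ → PS
q₁ k = q^ (suc (k ℕ.+ k))
q₂ k = q^ (suc (suc (k ℕ.+ k)))

private
  opaque
    unfolding S

    S′ : ∀ k w → S (suc k) w ≡ G (suc (suc (k ℕ.+ k))) (λ μ → nro μ * w (length μ))
    S′ k w = cong (λ K → G K (λ μ → nro μ * w (length μ))) (2k+2 k)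

opaque
  unfolding S

  -- The part 2k + 2 may be repeated, hence `S (suc k)` in the last term; the odd part 2k + 1 may
  -- not, hence `S k` in the middle one.
  S-suc : ∀ k w → S (suc k) w ≈ S k w +ˢ q₁ k *ˢ S k (w ∘ suc) +ˢ q₂ k *ˢ S (suc k) (w ∘ suc)
  S-suc k w = ≈-trans (≡⇒≈ (S′ k w)) (≈-trans (G-suc (suc (k ℕ.+ k)) _) (+ˢ-cong
    (≈-trans (G-suc (k ℕ.+ k) _) (+ˢ-cong ≈-refl (*ˢ-congˡ (cons-odd (k ℕ.+ k) (λ μ → nro μ * w (length μ)) (w ∘ suc) (isOdd-2k+1 k) (λ _ _ _ → refl)))))
    (*ˢ-congˡ (≈-trans (cons-even (suc (k ℕ.+ k)) (λ μ → nro μ * w (length μ)) (w ∘ suc) (isOdd-2k k) (λ _ _ _ → refl)) (≡⇒≈ (sym (S′ k (w ∘ suc))))))))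

opaque
  unfolding S

  S-cong : ∀ k n {w v} → (∀ i → i ≤ n → w i ≡ v i) → S k w n ≡ S k v n
  S-cong k n h = G-cong (k ℕ.+ k) n (λ μ p → cong (nro μ *_) (h (length μ) (Part-length p)))

S-≈ : ∀ k {w v} → (∀ i → w i ≡ v i) → S k w ≈ S k v
S-≈ k h = coeffs λ n → S-cong k n (λ i _ → h i)

opaque
  unfolding S

  S-+ : ∀ k w v → S k (λ i → w i + v i) ≈ S k w +ˢ S k v
  S-+ k w v = coeffs λ n → trans (sumL-cong (parts≤ (k ℕ.+ k) n) (λ μ _ → ℤₚ.*-distribˡ-+ (nro μ) _ _))
    (trans (sumL-+ _ _ (parts≤ (k ℕ.+ k) n)) (sym (+ˢ-at (S k w) (S k v) n)))

  S-* : ∀ k c w → S k (λ i → c * w i) ≈ cst c *ˢ S k w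
  S-* k c w = coeffs λ n → trans (sumL-cong (parts≤ (k ℕ.+ k) n) (λ μ _ → lem (nro μ) c (w (length μ))))
    (trans (sumL-*ˡ c _ (parts≤ (k ℕ.+ k) n)) (sym (cst-*ˢ-at c (S k w) n)))
    where
    lem : ∀ a b c → a * (b * c) ≡ b * (a * c)
    lem = solve-∀

-- Rw w is the generating function of nonempty partitions, of weight w (M₂-rank), sorted by ⌈largest part / 2⌉ = k + 1.

rank-wt : (ℤ → ℤ) → ℕ → ℕ → ℤ
rank-wt w k i = w (+ k - + i)

Rterm : (ℤ → ℤ) → ℕ → PS
Rterm w k = q₁ k *ˢ S k (rank-wt w k) +ˢ q₂ k *ˢ S (suc k) (rank-wt w k)

Rterm-ord : ∀ w k → Rterm w k ≈[ suc k ] 0ˢ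
Rterm-ord w k = ≈[]-trans (≈[]-+ (*-≈[]-0ˡ _ (mono-≈[] 1ℤ (s≤s (ℕₚ.m≤m+n k k)))) (*-≈[]-0ˡ _ (mono-≈[] 1ℤ (s≤s (ℕₚ.m≤n⇒m≤1+n (ℕₚ.m≤m+n k k))))))
  (≈⇒≈[] (solve 0 (con 0ℤ :+ con 0ℤ := con 0ℤ) ≈-refl))

Rw : (ℤ → ℤ) → PS
Rw w n = Σ< (suc n) (λ k → Rterm w k n)

sumL-upTo : ∀ (f : ℕ → ℤ) n → sumL f (upTo n) ≡ Σ< n f
sumL-upTo f n = go id n
  where
  go : ∀ g n → sumL f (applyUpTo g n) ≡ Σ< n (f ∘ g)
  go g zero    = refl
  go g (suc n) = trans (cong (_+_ (f (g 0))) (go (g ∘ suc) n)) (sym (Σ<-first n (f ∘ g)))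

Rw-⇛ : ∀ w → Rterm w ⇛ Rw w
Rw-⇛ w n = ⇓-≡ (sumL-upTo (λ k → Rterm w k n) (suc n)) (Sum-⇛ (Rterm w) (λ k → ≈[]-≤ (ℕₚ.n≤1+n k) (Rterm-ord w k)) n)

private
  half-ceil-odd : ∀ k → (suc (k ℕ.+ k) ℕ.+ 1) / 2 ≡ suc k
  half-ceil-odd k = trans (cong (_/ 2) (lem k)) (ℕ÷.m*n/n≡m (suc k) 2)
    where
    lem : ∀ k → suc (k ℕ.+ k) ℕ.+ 1 ≡ suc k ℕ.* 2
    lem = solveℕ

  half-ceil-even : ∀ k → (suc (suc (k ℕ.+ k)) ℕ.+ 1) / 2 ≡ suc k
  half-ceil-even zero    = refl
  half-ceil-even (suc k) = trans (cong (λ n → (suc (suc (suc n)) ℕ.+ 1) / 2) (ℕₚ.+-suc k k))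
    (trans (ℕ÷.m/n≡1+[m∸n]/n {suc (suc (suc (suc (k ℕ.+ k)))) ℕ.+ 1} {2} (s≤s (s≤s z≤n))) (cong suc (half-ceil-even k)))

  largest-cons : ∀ x μ → All (_≤ x) μ → largestPart (x ∷ μ) ≡ x
  largest-cons x μ a = ℕₚ.m≥n⇒m⊔n≡m (go μ a)
    where
    go : ∀ μ → All (_≤ x) μ → largestPart μ ≤ x
    go []      []       = z≤n
    go (y ∷ μ) (l ∷ ls) = ℕₚ.⊔-lub l (go μ ls)

  M2rank-cons : ∀ x k {n} μ → Part x n μ → (x ℕ.+ 1) / 2 ≡ suc k → M2rank (x ∷ μ) ≡ + k - + length μ
  M2rank-cons x k μ p e = trans (cong (λ l → + ((l ℕ.+ 1) / 2) - + suc (length μ)) (largest-cons x μ (Part-All p)))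
    (trans (cong (λ c → + c - + suc (length μ)) e) (lem (+ k) (+ length μ)))
    where
    lem : ∀ k l → 1ℤ + k - (1ℤ + l) ≡ k - l
    lem = solve-∀

ranked : (ℤ → ℤ) → List ℕ → ℤ
ranked w μ = nro μ * w (M2rank μ)

private
  opaque
    unfolding S

    G-2 : ∀ w k → G (suc k ℕ.+ suc k) (ranked w) ≈ G (k ℕ.+ k) (ranked w) +ˢ Rterm w k
    G-2 w k = ≈-trans (≡⇒≈ (cong (λ K → G K (ranked w)) (2k+2 k))) (≈-trans (G-suc (suc (k ℕ.+ k)) (ranked w)) (≈-trans (+ˢ-cong
        (≈-trans (G-suc (k ℕ.+ k) (ranked w)) (+ˢ-cong ≈-refl (*ˢ-congˡ (cons-odd (k ℕ.+ k) (ranked w) (rank-wt w k) (isOdd-2k+1 k)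
          (λ n μ p → cong (λ r → nro (suc (k ℕ.+ k) ∷ μ) * w r) (M2rank-cons _ k μ p (half-ceil-odd k)))))))
        (*ˢ-congˡ (≈-trans (cons-even (suc (k ℕ.+ k)) (ranked w) (rank-wt w k) (isOdd-2k k)
          (λ n μ p → cong (λ r → nro (suc (suc (k ℕ.+ k)) ∷ μ) * w r) (M2rank-cons _ k μ p (half-ceil-even k))))
          (≡⇒≈ (sym (S′ k (rank-wt w k)))))))
      (solve 3 (λ a b c → a :+ b :+ c := a :+ (b :+ c)) ≈-refl _ _ _)))

  G-2M : ∀ w M n → G (M ℕ.+ M) (ranked w) n ≡ G 0 (ranked w) n + Σ< M (λ k → Rterm w k n)
  G-2M w zero    n = sym (ℤₚ.+-identityʳ _)
  G-2M w (suc M) n = trans (G-2 w M at n) (trans (+ˢ-at _ _ n) (trans (cong (_+ Rterm w M n) (G-2M w M n)) (ℤₚ.+-assoc (G 0 (ranked w) n) _ _)))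

  G-stable : ∀ f n d → G (d ℕ.+ n) f n ≡ G n f n
  G-stable f n zero    = refl
  G-stable f n (suc d) = trans (split-< (d ℕ.+ n) n f (s≤s (ℕₚ.m≤n+m n d))) (G-stable f n d)

Rw-partitions : ∀ w n → sumL (ranked w) (partitions (suc n)) ≡ Rw w (suc n)
Rw-partitions w n = trans (sym (G-stable (ranked w) N (suc N ℕ.+ 1))) (trans (cong (λ K → G K (ranked w) N) (lem N)) (trans (G-2M w (suc N) N) (ℤₚ.+-identityˡ _)))
  where
  N = suc n
  lem : ∀ N → suc N ℕ.+ 1 ℕ.+ N ≡ suc N ℕ.+ suc N
  lem = solveℕ

private
  length-filter₂ : {A : Set} {P Q : A → Set} (P? : ∀ x → Dec (P x)) (Q? : ∀ x → Dec (Q x)) (L : List A) →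
    + length (filter P? (filter Q? L)) ≡ sumL (λ x → 𝟙 (does (Q? x)) * 𝟙 (does (P? x))) L
  length-filter₂ P? Q? [] = refl
  length-filter₂ P? Q? (x ∷ L) with does (Q? x)
  ... | false = trans (length-filter₂ P? Q? L) (sym (ℤₚ.+-identityˡ _))
  ... | true with does (P? x)
  ...   | true  = cong (_+_ 1ℤ) (length-filter₂ P? Q? L)
  ...   | false = trans (length-filter₂ P? Q? L) (sym (ℤₚ.+-identityˡ _))

  does-≟-true : ∀ b → does (b Bool.≟ true) ≡ b
  does-≟-true true  = refl
  does-≟-true false = refl

class : ℤ → ℤ → ℤ
class s r = 𝟙 (does (((r - s) %ℕ 3) ℕ.≟ 0))

N2-Rw : ∀ s n → + N2 s 3 n ≡ Rw (class s) n
N2-Rw s zero    = sym (trans (ℤₚ.+-identityˡ _) (trans (Rterm-ord (class s) 0 0 (s≤s z≤n)) (0ˢ-at 0)))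
N2-Rw s (suc n) = trans (length-filter₂ (λ μ → ((M2rank μ - s) %ℕ 3) ℕ.≟ 0) (λ μ → noRepeatedOdd μ Bool.≟ true) (partitions (suc n)))
  (trans (sumL-cong (partitions (suc n)) (λ μ _ → cong (λ b → 𝟙 b * class s (M2rank μ)) (does-≟-true (noRepeatedOdd μ)))) (Rw-partitions (class s) n))

Rw-cong : ∀ n {w v} → (∀ k i → k ≤ n → i ≤ n → w (+ k - + i) ≡ v (+ k - + i)) → Rw w n ≡ Rw v n
Rw-cong n {w} {v} h = Σ<-cong (suc n) (λ k k≤n → trans (+ˢ-at _ _ n) (trans (cong₂ _+_
  (*ˢ-congᵇ n (λ _ _ → refl) (λ m m≤n → S-cong k m (λ i i≤m → h k i (ℕₚ.≤-pred k≤n) (ℕₚ.≤-trans i≤m m≤n))))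
  (*ˢ-congᵇ n (λ _ _ → refl) (λ m m≤n → S-cong (suc k) m (λ i i≤m → h k i (ℕₚ.≤-pred k≤n) (ℕₚ.≤-trans i≤m m≤n))))) (sym (+ˢ-at _ _ n))))

Rw-≈ : ∀ {w v} → (∀ r → w r ≡ v r) → Rw w ≈ Rw v
Rw-≈ {w} {v} h = coeffs λ n → Rw-cong n {w} {v} (λ k i _ _ → h (+ k - + i))

Rw-+ : ∀ w v → Rw (λ r → w r + v r) ≈ Rw w +ˢ Rw v
Rw-+ w v = ⇛-unique (Rw-⇛ (λ r → w r + v r)) (⇛-cong (λ k → ≈-sym (≈-trans
  (+ˢ-cong (*ˢ-congˡ (S-+ k (rank-wt w k) (rank-wt v k))) (*ˢ-congˡ (S-+ (suc k) (rank-wt w k) (rank-wt v k))))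
  (solve 6 (λ a b c d e f → a :* (b :+ c) :+ d :* (e :+ f) := a :* b :+ d :* e :+ (a :* c :+ d :* f)) ≈-refl _ _ _ _ _ _))) (⇛-+ (Rw-⇛ w) (Rw-⇛ v)))

Rw-* : ∀ c w → Rw (λ r → c * w r) ≈ cst c *ˢ Rw w
Rw-* c w = ⇛-unique (Rw-⇛ (λ r → c * w r)) (⇛-cong (λ k → ≈-sym (≈-trans
  (+ˢ-cong (*ˢ-congˡ (S-* k c (rank-wt w k))) (*ˢ-congˡ (S-* (suc k) c (rank-wt w k))))
  (solve 5 (λ a b c d e → a :* (c :* b) :+ d :* (c :* e) := c :* (a :* b :+ d :* e)) ≈-refl _ _ _ _ _))) (⇛-*ˡ (cst c) (Rw-⇛ w)))

Rw-minus : ∀ w v → Rw (λ r → w r - v r) ≈ Rw w -ˢ Rw v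
Rw-minus w v = ≈-trans (Rw-≈ {λ r → w r - v r} {λ r → w r + - 1ℤ * v r} (λ r → cong (_+_ (w r)) (sym (ℤₚ.-1*i≡-i (v r))))) (≈-trans (Rw-+ w (λ r → - 1ℤ * v r)) (+ˢ-cong ≈-refl
  (≈-trans (Rw-* (- 1ℤ) v) (solve 1 (λ x → con (- 1ℤ) :* x := :- x) ≈-refl (Rw v)))))

ge le : ℤ → ℤ → ℤ
ge m r = pos (r - m)
le m r = pos (m - r)

δ-neg : ∀ i n → δ (+ i) -[1+ n ] ≡ 0ℤ
δ-neg i n = δ-≢ (λ ())

pos-pred : ∀ x → pos (x - 1ℤ) ≡ pos x - δ x 0ℤ
pos-pred (+ zero)  = cong (_-_ 1ℤ) (sym (δ-≡ {0ℤ} refl))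
pos-pred (+ suc n) = cong (_-_ 1ℤ) (sym (δ-≢ {+ suc n} (λ ())))
pos-pred -[1+ n ]  = cong (_-_ 0ℤ) (sym (δ-≢ { -[1+ n ]} (λ ())))

-- gn k j, dn k j: exactly, respectively at most, j parts, all of size at most 2k

gz : ℕ → ℤ → PS
gz k j = S k (λ i → δ (+ i) j)

gn dn : ℕ → ℕ → PS
gn k j = gz k (+ j)
dn k j = S k (λ i → pos (+ j - + i))

gz-neg : ∀ k n → gz k -[1+ n ] ≈ 0ˢ
gz-neg k n = ≈-trans (S-≈ k {v = λ _ → 0ℤ * 0ℤ} (λ i → δ-neg i n)) (≈-trans (S-* k 0ℤ (λ _ → 0ℤ)) (solve 1 (λ x → con 0ℤ :* x := con 0ℤ) ≈-refl (S k (λ _ → 0ℤ))))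

S-zero : ∀ k {w} → (∀ i → w i ≡ 0ℤ) → S k w ≈ 0ˢ
S-zero k h = ≈-trans (S-≈ k {v = λ _ → 0ℤ * 0ℤ} h) (≈-trans (S-* k 0ℤ (λ _ → 0ℤ)) (solve 1 (λ x → con 0ℤ :* x := con 0ℤ) ≈-refl (S k (λ _ → 0ℤ))))

gn-suc-0 : ∀ k → gn (suc k) 0 ≈ gn k 0
gn-suc-0 k = ≈-trans (S-suc k _) (≈-trans (+ˢ-cong (+ˢ-cong ≈-refl (*ˢ-congˡ (S-zero k (λ i → δ-≢ (λ ()))))) (*ˢ-congˡ (S-zero (suc k) (λ i → δ-≢ (λ ())))))
  (solve 3 (λ a b c → a :+ b :* con 0ℤ :+ c :* con 0ℤ := a) ≈-refl (gn k 0) (q₁ k) (q₂ k)))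

gn-suc-suc : ∀ k j → gn (suc k) (suc j) ≈ gn k (suc j) +ˢ q₁ k *ˢ gn k j +ˢ q₂ k *ˢ gn (suc k) j
gn-suc-suc k j = ≈-trans (S-suc k _) (+ˢ-cong (+ˢ-cong ≈-refl (*ˢ-congˡ (S-≈ k shift))) (*ˢ-congˡ (S-≈ (suc k) shift)))
  where
  shift : ∀ i → δ (+ suc i) (+ suc j) ≡ δ (+ i) (+ j)
  shift i = δ-iff (λ p → cong +_ (ℕₚ.suc-injective (ℤₚ.+-injective p))) (λ p → cong (λ x → 1ℤ + x) p)

-- Sequences of series, read as coefficients of powers of z: M c multiplies by 1 + cz, and Z substitutes q²z for z.

Seq : Set
Seq = ℕ → PS

M : PS → Seq → Seq
M c a zero    = a zero
M c a (suc j) = a (suc j) +ˢ c *ˢ a j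

Z : Seq → Seq
Z a j = q^ (j ℕ.+ j) *ˢ a j

infix 4 _≋_
_≋_ : Seq → Seq → Set
a ≋ b = ∀ j → a j ≈ b j

≋-trans : ∀ {a b c} → a ≋ b → b ≋ c → a ≋ c
≋-trans p q j = ≈-trans (p j) (q j)

≋-sym : ∀ {a b} → a ≋ b → b ≋ a
≋-sym p j = ≈-sym (p j)

M-cong : ∀ {c d a b} → c ≈ d → a ≋ b → M c a ≋ M d b
M-cong p q zero    = q zero
M-cong p q (suc j) = +ˢ-cong (q (suc j)) (*ˢ-cong p (q j))

M-comm : ∀ c d a → M c (M d a) ≋ M d (M c a)
M-comm c d a zero          = ≈-refl
M-comm c d a (suc zero)    = solve 4 (λ c d x y → x :+ d :* y :+ c :* y := x :+ c :* y :+ d :* y) ≈-refl c d (a 1) (a 0)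
M-comm c d a (suc (suc j)) = solve 5 (λ c d x y z → x :+ d :* y :+ c :* (y :+ d :* z) := x :+ c :* y :+ d :* (y :+ c :* z)) ≈-refl c d (a (suc (suc j))) (a (suc j)) (a j)

M-inj : ∀ c {a b} → M c a ≋ M c b → a ≋ b
M-inj c p zero    = p zero
M-inj c {a} {b} p (suc j) =
  a (suc j)                          ≈⟨ solve 3 (λ x c y → x := x :+ c :* y :- c :* y) ≈-refl (a (suc j)) c (a j) ⟩
  a (suc j) +ˢ c *ˢ a j -ˢ c *ˢ a j  ≈⟨ -ˢ-cong (p (suc j)) (*ˢ-congˡ (M-inj c p j)) ⟩
  b (suc j) +ˢ c *ˢ b j -ˢ c *ˢ b j  ≈⟨ solve 3 (λ x c y → x :+ c :* y :- c :* y := x) ≈-refl (b (suc j)) c (b j) ⟩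
  b (suc j)                          ≈∎

q-2j+2 : ∀ j → q^ (suc j ℕ.+ suc j) ≈ q^ 2 *ˢ q^ (j ℕ.+ j)
q-2j+2 j = ≈-trans (≡⇒≈ (cong q^_ (2k+2 j))) (≈-sym (q^-+ 2 (j ℕ.+ j)))

Z-M : ∀ c a → Z (M c a) ≋ M (q^ 2 *ˢ c) (Z a)
Z-M c a zero    = ≈-refl
Z-M c a (suc j) = ≈-trans (solve 4 (λ z x c y → z :* (x :+ c :* y) := z :* x :+ z :* (c :* y)) ≈-refl (q^ (suc j ℕ.+ suc j)) (a (suc j)) c (a j))
  (+ˢ-cong ≈-refl (≈-trans (*ˢ-congʳ (q-2j+2 j)) (solve 4 (λ t z c y → t :* z :* (c :* y) := t :* c :* (z :* y)) ≈-refl (q^ 2) (q^ (j ℕ.+ j)) c (a j))))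

Z-cong : ∀ {a b} → a ≋ b → Z a ≋ Z b
Z-cong p j = *ˢ-congˡ (p j)

-- In g_k(z) = Σ_j `gn k j` z^j the new part sizes 2k + 1 and 2k + 2 contribute the factor (1 + z
-- q^{2k+1}) / (1 - z q^{2k+2}).
gn-step : ∀ k → M (-ˢ q₂ k) (gn (suc k)) ≋ M (q₁ k) (gn k)
gn-step k zero    = gn-suc-0 k
gn-step k (suc j) = ≈-trans (+ˢ-cong (gn-suc-suc k j) ≈-refl)
  (solve 5 (λ a b c d e → a :+ b :* c :+ d :* e :+ :- d :* e := a :+ b :* c) ≈-refl (gn k (suc j)) (q₁ k) (gn k j) (q₂ k) (gn (suc k) j))

gn-0-suc : ∀ j → gn 0 (suc j) ≈ 0ˢ
gn-0-suc j = ≈-trans (S-0 _) (≡⇒≈ (cong cst (δ-≢ {0ℤ} {+ suc j} (λ ()))))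

-- (1 - zq²) g_{k+1}(z) = (1 + zq) g_k(zq²): remove 2 from every part
gn-dilate : ∀ k → M (-ˢ q^ 2) (gn (suc k)) ≋ M (q^ 1) (Z (gn k))
gn-dilate zero    = ≋-trans (gn-step 0) (M-cong ≈-refl fixed)
  where
  fixed : gn 0 ≋ Z (gn 0)
  fixed zero    = ≈-sym (≈-trans (*ˢ-congʳ q^-0) (1-*ˢ _))
  fixed (suc j) = ≈-sym (≈-trans (*ˢ-congˡ (gn-0-suc j)) (≈-trans (solve 1 (λ x → x :* con 0ℤ := con 0ℤ) ≈-refl (q^ (suc j ℕ.+ suc j))) (≈-sym (gn-0-suc j))))
gn-dilate (suc k) = M-inj (-ˢ q₂ (suc k)) (≋-trans left (≋-sym right))
  where
  e : ∀ k → 2 ℕ.+ suc (k ℕ.+ k) ≡ suc (suc k ℕ.+ suc k)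
  e = solveℕ
  e′ : ∀ k → 2 ℕ.+ suc (suc (k ℕ.+ k)) ≡ suc (suc (suc k ℕ.+ suc k))
  e′ = solveℕ
  c₁ : q^ 2 *ˢ q₁ k ≈ q₁ (suc k)
  c₁ = ≈-trans (q^-+ 2 (suc (k ℕ.+ k))) (≡⇒≈ (cong q^_ (e k)))
  c₂ : q^ 2 *ˢ -ˢ q₂ k ≈ -ˢ q₂ (suc k)
  c₂ = ≈-trans (solve 2 (λ a b → a :* :- b := :- (a :* b)) ≈-refl (q^ 2) (q₂ k)) (negˢ-cong (≈-trans (q^-+ 2 (suc (suc (k ℕ.+ k)))) (≡⇒≈ (cong q^_ (e′ k)))))
  left : M (-ˢ q₂ (suc k)) (M (-ˢ q^ 2) (gn (suc (suc k)))) ≋ M (q₁ (suc k)) (M (q^ 1) (Z (gn k)))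
  left = ≋-trans (M-comm _ _ _) (≋-trans (M-cong ≈-refl (gn-step (suc k))) (≋-trans (M-comm _ _ _) (M-cong ≈-refl (gn-dilate k))))
  right : M (-ˢ q₂ (suc k)) (M (q^ 1) (Z (gn (suc k)))) ≋ M (q₁ (suc k)) (M (q^ 1) (Z (gn k)))
  right = ≋-trans (M-comm _ _ _) (≋-trans (M-cong ≈-refl (≋-trans (M-cong (≈-sym c₂) (λ _ → ≈-refl)) (≋-trans (≋-sym (Z-M (-ˢ q₂ k) (gn (suc k))))
    (≋-trans (Z-cong (gn-step k)) (≋-trans (Z-M (q₁ k) (gn k)) (M-cong c₁ (λ _ → ≈-refl))))))) (M-comm _ _ _))

dn-0 : ∀ k → dn k 0 ≈ gn k 0
dn-0 k = S-≈ k lem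
  where
  lem : ∀ i → pos (0ℤ - + i) ≡ δ (+ i) 0ℤ
  lem zero    = sym (δ-≡ {0ℤ} refl)
  lem (suc i) = sym (δ-≢ {+ suc i} (λ ()))

dn-suc : ∀ k j → dn k (suc j) ≈ dn k j +ˢ gn k (suc j)
dn-suc k j = ≈-trans (S-≈ k lem) (S-+ k _ _)
  where
  l₁ : ∀ j i → 1ℤ + j - i - 1ℤ ≡ j - i
  l₁ = solve-∀
  l₂ : ∀ j i → 1ℤ + j - i ≡ 0ℤ → i ≡ 1ℤ + j
  l₂ j i p = trans (e j i) (trans (cong (λ x → 1ℤ + j - x) p) (e′ j))
    where
    e : ∀ j i → i ≡ 1ℤ + j - (1ℤ + j - i)
    e = solve-∀
    e′ : ∀ j → 1ℤ + j - 0ℤ ≡ 1ℤ + j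
    e′ = solve-∀
  l₃ : ∀ j → 1ℤ + j - (1ℤ + j) ≡ 0ℤ
  l₃ = solve-∀
  lem : ∀ i → pos (+ suc j - + i) ≡ pos (+ j - + i) + δ (+ i) (+ suc j)
  lem i = trans (e (pos (+ suc j - + i)) (δ (+ suc j - + i) 0ℤ)) (cong₂ _+_ (trans (sym (pos-pred (+ suc j - + i))) (cong pos (l₁ (+ j) (+ i))))
    (δ-iff {+ suc j - + i} {0ℤ} {+ i} {+ suc j} (l₂ (+ j) (+ i)) (λ p → trans (cong (_-_ (+ suc j)) p) (l₃ (+ j)))))
    where
    e : ∀ p d → p ≡ (p - d) + d
    e = solve-∀

gn-dn-0 : ∀ k → gn (suc k) 0 ≈ dn k 0
gn-dn-0 k = ≈-trans (gn-suc-0 k) (≈-sym (dn-0 k))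

-- Partial sums amount to division by 1 - z, so d_k(z) = g_k(z) / (1 - z), and `gn-dilate` becomes
-- g_{k+1}(z) = (1 + zq) d_k(zq²). Combinatorially, removing 2 from every part makes parts 2
-- disappear, which turns exactly j parts into at most j; the factor 1 + zq accounts for a possible
-- part 1.
gn-dn-suc : ∀ k j → gn (suc k) (suc j) ≈ q^ (suc j ℕ.+ suc j) *ˢ dn k (suc j) +ˢ q^ (suc (j ℕ.+ j)) *ˢ dn k j
gn-dn-suc k j = ≈-trans (solve 3 (λ x c y → x := x :+ :- c :* y :+ c :* y) ≈-refl (gn (suc k) (suc j)) (q^ 2) (gn (suc k) j))
  (≈-trans (+ˢ-cong (gn-dilate k (suc j)) (*ˢ-congˡ (ih j)))
    (≈-trans (close j) (+ˢ-cong (*ˢ-congˡ (≈-sym (dn-suc k j))) ≈-refl)))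
  where
  prev : ℕ → PS
  prev zero    = 0ˢ
  prev (suc j) = q^ (suc (j ℕ.+ j)) *ˢ dn k j
  ih : ∀ j → gn (suc k) j ≈ q^ (j ℕ.+ j) *ˢ dn k j +ˢ prev j
  ih zero    = ≈-trans (gn-dn-0 k) (≈-trans (solve 1 (λ x → x := con 1ℤ :* x :+ con 0ℤ) ≈-refl (dn k 0)) (+ˢ-cong (*ˢ-congʳ (≈-sym q^-0)) ≈-refl))
  ih (suc j) = gn-dn-suc k j
  odd : ∀ j → q^ (suc (j ℕ.+ j)) ≈ q^ 1 *ˢ q^ (j ℕ.+ j)
  odd j = ≈-sym (q^-+ 1 (j ℕ.+ j))
  close : ∀ j → q^ (suc j ℕ.+ suc j) *ˢ gn k (suc j) +ˢ q^ 1 *ˢ (q^ (j ℕ.+ j) *ˢ gn k j) +ˢ q^ 2 *ˢ (q^ (j ℕ.+ j) *ˢ dn k j +ˢ prev j)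
    ≈ q^ (suc j ℕ.+ suc j) *ˢ (dn k j +ˢ gn k (suc j)) +ˢ q^ (suc (j ℕ.+ j)) *ˢ dn k j
  close zero = ≈-trans (+ˢ-cong (+ˢ-cong ≈-refl (*ˢ-congˡ (*ˢ-congˡ (≈-sym (dn-0 k))))) ≈-refl)
    (≈-trans (solve 5 (λ t x q z d → t :* x :+ q :* (z :* d) :+ t :* (z :* d :+ con 0ℤ) := t :* (z :* d :+ x) :+ q :* z :* d) ≈-refl (q^ 2) (gn k 1) (q^ 1) (q^ 0) (dn k 0))
      (+ˢ-cong (*ˢ-congˡ (+ˢ-cong (≈-trans (*ˢ-congʳ q^-0) (1-*ˢ _)) ≈-refl)) (*ˢ-congʳ (≈-trans (*ˢ-congˡ q^-0) (*ˢ-1 _)))))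
  close (suc j) = ≈-trans (+ˢ-cong ≈-refl (*ˢ-congˡ (+ˢ-cong (*ˢ-congˡ ≈-refl) (*ˢ-congʳ (odd j)))))
    (≈-trans (+ˢ-cong (+ˢ-cong (*ˢ-congʳ (q-2j+2 (suc j))) ≈-refl) ≈-refl)
    (≈-trans (+ˢ-cong (+ˢ-cong ≈-refl (*ˢ-congˡ (*ˢ-congʳ (q-2j+2 j)))) (*ˢ-congˡ (+ˢ-cong (*ˢ-congʳ (q-2j+2 j)) ≈-refl)))
    (≈-trans (+ˢ-cong (+ˢ-cong (*ˢ-congʳ (*ˢ-congˡ (q-2j+2 j))) ≈-refl) ≈-refl)
    (≈-trans (solve 7 (λ t z q x y d e → t :* (t :* z) :* x :+ q :* (t :* z :* y) :+ t :* (t :* z :* d :+ q :* z :* e) := t :* (t :* z) :* (d :+ x) :+ q :* (t :* z) :* (e :+ y))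
        ≈-refl (q^ 2) (q^ (j ℕ.+ j)) (q^ 1) (gn k (suc (suc j))) (gn k (suc j)) (dn k (suc j)) (dn k j))
    (≈-trans (+ˢ-cong (*ˢ-congʳ (≈-sym (≈-trans (q-2j+2 (suc j)) (*ˢ-congˡ (q-2j+2 j))))) (*ˢ-cong (≈-sym (≈-trans (odd (suc j)) (*ˢ-congˡ (q-2j+2 j)))) (≈-sym (dn-suc k j))))
      ≈-refl)))))

⇓-telescope : ∀ (f : ℕ → ℤ) K → (∀ k → K ≤ k → f k ≡ 0ℤ) → (λ k → f (suc k) - f k) ⇓ - f 0
⇓-telescope f K h = ⇓-≡ (trans (sumL-upTo (λ k → f (suc k) - f k) K) (trans (tele K) (trans (cong (_- f 0) (h K ℕₚ.≤-refl)) (ℤₚ.+-identityˡ _))))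
  (⇓-list (upTo K) (Unique.upTo⁺ K) cov)
  where
  cov : ∀ k → f (suc k) - f k ≢ 0ℤ → _
  cov k p with k ℕₚ.<? K
  ... | yes l = ∈-upTo⁺ l
  ... | no ¬l = ⊥-elim (p (cong₂ _-_ (h (suc k) (ℕₚ.m≤n⇒m≤1+n (ℕₚ.≮⇒≥ ¬l))) (h k (ℕₚ.≮⇒≥ ¬l))))
  tele : ∀ K → Σ< K (λ k → f (suc k) - f k) ≡ f K - f 0
  tele zero    = sym (ℤₚ.+-inverseʳ (f 0))
  tele (suc K) = trans (cong (_+ (f (suc K) - f K)) (tele K)) (lem (f K) (f 0) (f (suc K)))
    where
    lem : ∀ a b c → a - b + (c - a) ≡ c - b
    lem = solve-∀

-- partitions of M₂-rank at most m, the empty one included if m ≥ 0, sorted by their number of parts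
le-sum : ∀ m → (λ k → gz k (+ k - m)) ⇛ Rw (le m) +ˢ cst (pos m)
le-sum m n = ⇓-≡ (trans (lem₁ (Rw (le m) n) (e 0 n)) (sym (trans (+ˢ-at _ _ n) (cong (_+_ (Rw (le m) n)) (sym (e-0 at n))))))
  (⇓-cong pt (⇓-minus (Rw-⇛ (le m) n) (⇓-telescope (λ k → e k n) K e-late)))
  where
  -- Partitions into parts at most 2k with at least k - m parts. Passing from k to k + 1 admits
  -- largest parts 2k + 1 and 2k + 2 of rank at most m, and loses the partitions with exactly k - m
  -- parts. The differences telescope, since for large k too many parts would be required.
  e : ℕ → PS
  e k = S k (λ i → pos (+ i - + k + m))
  lem₁ : ∀ a b → a - - b ≡ a + b
  lem₁ = solve-∀
  e-0 : e 0 ≈ cst (pos m)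
  e-0 = ≈-trans (S-0 _) (≡⇒≈ (cong (λ x → cst (pos x)) (ℤₚ.+-identityˡ m)))
  K = suc (n ℕ.+ ∣ m ∣)
  e-late : ∀ k → K ≤ k → e k n ≡ 0ℤ
  e-late k l = trans (S-cong k n {v = λ _ → 0ℤ} (λ i i≤n → neg m k i (ℕₚ.≤-trans (s≤s (ℕₚ.+-monoˡ-≤ _ i≤n)) l))) (trans (S-zero k (λ _ → refl) at n) (0ˢ-at n))
    where
    neg : ∀ m k i → suc (i ℕ.+ ∣ m ∣) ≤ k → pos (+ i - + k + m) ≡ 0ℤ
    neg m k i l with ℕₚ.m≤n⇒∃[o]m+o≡n l
    ... | o , refl = go m
      where
      l₁ : ∀ i o a → i - (1ℤ + (i + a) + o) + a ≡ - (1ℤ + o)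
      l₁ = solve-∀
      l₂ : ∀ i o a → i - (1ℤ + (i + a) + o) + - a ≡ - (1ℤ + (a + a + o))
      l₂ = solve-∀
      go : ∀ m → pos (+ i - + (suc (i ℕ.+ ∣ m ∣) ℕ.+ o) + m) ≡ 0ℤ
      go (+ a)    = cong pos (l₁ (+ i) (+ o) (+ a))
      go -[1+ a ] = cong pos (l₂ (+ i) (+ o) (+ suc a))
  step : ∀ k → Rterm (le m) k ≈ e (suc k) -ˢ e k +ˢ gz k (+ k - m)
  step k = ≈-trans (≈-trans (solve 3 (λ a b c → b :+ c := (a :+ b :+ c) :- a) ≈-refl (S k v) (q₁ k *ˢ S k (rank-wt (le m) k)) (q₂ k *ˢ S (suc k) (rank-wt (le m) k)))
      (-ˢ-cong (≈-sym (≈-trans (S-suc k v) (+ˢ-cong (+ˢ-cong ≈-refl (*ˢ-congˡ (S-≈ k v-suc))) (*ˢ-congˡ (S-≈ (suc k) v-suc))))) ≈-refl))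
    (≈-trans (-ˢ-cong (S-≈ (suc k) v-e) (≈-trans (S-≈ k v-δ) (≈-trans (S-+ k _ _) (+ˢ-cong ≈-refl (S-* k (- 1ℤ) _)))))
      (solve 3 (λ a b c → a :- (b :+ con (- 1ℤ) :* c) := a :- b :+ c) ≈-refl (e (suc k)) (e k) (gz k (+ k - m))))
    where
    v : ℕ → ℤ
    v i = pos (+ i - + k + m - 1ℤ)
    v-suc : ∀ i → v (suc i) ≡ rank-wt (le m) k i
    v-suc i = cong pos (l (+ i) (+ k) m)
      where
      l : ∀ i k m → 1ℤ + i - k + m - 1ℤ ≡ m - (k - i)
      l = solve-∀
    v-e : ∀ i → v i ≡ pos (+ i - + suc k + m)
    v-e i = cong pos (l (+ i) (+ k) m)
      where
      l : ∀ i k m → i - k + m - 1ℤ ≡ i - (1ℤ + k) + m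
      l = solve-∀
    v-δ : ∀ i → v i ≡ pos (+ i - + k + m) + - 1ℤ * δ (+ i) (+ k - m)
    v-δ i = trans (pos-pred (+ i - + k + m)) (trans (cong (λ d → pos (+ i - + k + m) - d) (δ-iff {d = + k - m} (λ p → trans (l₁ (+ i) (+ k) m) (trans (cong (_+ (+ k - m)) p) (ℤₚ.+-identityˡ _)))
        (λ p → trans (cong (λ x → x - + k + m) p) (l₂ (+ k) m)))) (cong (_+_ (pos (+ i - + k + m))) (sym (ℤₚ.-1*i≡-i _))))
      where
      l₁ : ∀ i k m → i ≡ i - k + m + (k - m)
      l₁ = solve-∀
      l₂ : ∀ k m → k - m - k + m ≡ 0ℤ
      l₂ = solve-∀
  pt : ∀ k → Rterm (le m) k n - (e (suc k) n - e k n) ≡ gz k (+ k - m) n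
  pt k = trans (cong (_- (e (suc k) n - e k n)) (trans (step k at n) (trans (+ˢ-at _ _ n) (cong (_+ gz k (+ k - m) n) (minus-at (e (suc k)) (e k) n)))))
    (l (e (suc k) n - e k n) (gz k (+ k - m) n))
    where
    l : ∀ a b → a + b - a ≡ b
    l = solve-∀

-- Pairs each U_k with the V of the neighbouring index. In Dyson's map one value of k collects
-- partitions whose new largest parts 2k + 1 and 2k + 2 belong to consecutive summands on the other
-- side.
⇛-shift : ∀ {Uₛ V V′ : ℕ → PS} {S} → (∀ k → V k ≈[ k ] 0ˢ) → (∀ k → V′ (suc k) ≈ V k) → (λ k → Uₛ k +ˢ V k) ⇛ S → (λ k → Uₛ k +ˢ V′ k) ⇛ S +ˢ V′ 0
⇛-shift {Uₛ} {V} {V′} {S} ord h F = ⇛-≈ (solve 3 (λ s x y → s :- x :+ (y :+ x) := s :+ y) ≈-refl S SV (V′ 0))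
  (⇛-cong (λ k → +ˢ-cong (solve 2 (λ u v → u :+ v :- v := u) ≈-refl (Uₛ k) (V k)) ≈-refl)
    (⇛-+ (⇛-minus F ΣV) ΣV′))
  where
  SV : PS
  SV = Sum V ord
  ΣV : V ⇛ SV
  ΣV = Sum-⇛ V ord
  head rest : ℕ → PS
  head zero    = V′ 0
  head (suc k) = 0ˢ
  rest zero    = 0ˢ
  rest (suc k) = V′ (suc k)
  Σhead : head ⇛ V′ 0
  Σhead n = ⇓-single {f = λ k → head k n} 0 (λ { zero _ → refl ; (suc k) p → ⊥-elim (p (0ˢ-at n)) })
  Σrest : rest ⇛ SV
  Σrest n = ⇓-unindex {f = λ k → rest k n} suc ℕ.pred (λ _ → refl) (λ { zero p → ⊥-elim (p (0ˢ-at n)) ; (suc k) _ → refl })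
    (⇓-cong (λ k → sym (h k at n)) (ΣV n))
  ΣV′ : V′ ⇛ V′ 0 +ˢ SV
  ΣV′ = ⇛-cong (λ { zero → solve 1 (λ x → x :+ con 0ℤ := x) ≈-refl (V′ 0) ; (suc k) → solve 1 (λ x → con 0ℤ :+ x := x) ≈-refl (V′ (suc k)) }) (⇛-+ Σhead Σrest)

q^-ord : ∀ {k} m f → k ≤ m → q^ m *ˢ f ≈[ k ] 0ˢ
q^-ord m f l = *-≈[]-0ˡ f (mono-≈[] 1ℤ l)

-- Dyson's relation for the M₂-rank: remove 2 from every part and insert a new largest part
dyson⁺ : ∀ m → Rw (ge (+ m)) ≈ q^ (suc (m ℕ.+ m)) *ˢ (1ˢ +ˢ Rw (le (+ suc m)))
dyson⁺ m = ≈-sym (⇛-unique (⇛-cong same (⇛-*ˡ (q^ (suc (m ℕ.+ m))) L-sum)) (⇛-≈ (solve 1 (λ x → x :+ con 0ℤ := x) ≈-refl (Rw (ge (+ m)))) (⇛-shift V-ord (λ _ → ≈-refl) A-sum)))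
  where
  Uₛ V V′ : ℕ → PS
  Uₛ j = q₁ (m ℕ.+ j) *ˢ dn (m ℕ.+ j) j
  V j = q₂ (m ℕ.+ j) *ˢ dn (suc (m ℕ.+ j)) j
  V′ zero    = 0ˢ
  V′ (suc j) = V j
  V-ord : ∀ j → V j ≈[ j ] 0ˢ
  V-ord j = q^-ord _ _ (ℕₚ.≤-trans (ℕₚ.m≤n+m j m) (ℕₚ.≤-trans (ℕₚ.m≤m+n (m ℕ.+ j) (m ℕ.+ j)) (ℕₚ.≤-trans (ℕₚ.n≤1+n _) (ℕₚ.n≤1+n _))))
  shift-rank : ∀ j i → rank-wt (ge (+ m)) (m ℕ.+ j) i ≡ pos (+ j - + i)
  shift-rank j i = cong pos (l (+ m) (+ j) (+ i))
    where
    l : ∀ m j i → m + j - i - m ≡ j - i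
    l = solve-∀
  late : ∀ n k → Rterm (ge (+ m)) k n ≢ 0ℤ → m ℕ.+ (k ∸ m) ≡ k
  late n k p with m ℕₚ.≤? k
  ... | yes l = ℕₚ.m+[n∸m]≡n l
  ... | no ¬l = ⊥-elim (p (trans (vanish (ℕₚ.m≤n⇒∃[o]m+o≡n (ℕₚ.≰⇒> ¬l)) at n) (0ˢ-at n)))
    where
    l : ∀ k i o → k - i - (1ℤ + k + o) ≡ - (1ℤ + (i + o))
    l = solve-∀
    vanish : (∃ λ o → suc k ℕ.+ o ≡ m) → Rterm (ge (+ m)) k ≈ 0ˢ
    vanish (o , refl) = ≈-trans (+ˢ-cong (*ˢ-congˡ (S-zero k (λ i → cong pos (l (+ k) (+ i) (+ o))))) (*ˢ-congˡ (S-zero (suc k) (λ i → cong pos (l (+ k) (+ i) (+ o))))))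
      (solve 2 (λ a b → a :* con 0ℤ :+ b :* con 0ℤ := con 0ℤ) ≈-refl (q₁ k) (q₂ k))
  A-sum : (λ j → Uₛ j +ˢ V j) ⇛ Rw (ge (+ m))
  A-sum = ⇛-cong (λ j → +ˢ-cong (*ˢ-congˡ (S-≈ (m ℕ.+ j) (shift-rank j))) (*ˢ-congˡ (S-≈ (suc (m ℕ.+ j)) (shift-rank j))))
    (λ n → ⇓-reindex {f = λ k → Rterm (ge (+ m)) k n} (m ℕ.+_) (_∸ m) (ℕₚ.m+n∸m≡n m) (late n) (Rw-⇛ (ge (+ m)) n))
  lateL : ∀ n k → gz k (+ k - + suc m) n ≢ 0ℤ → suc m ℕ.+ (k ∸ suc m) ≡ k
  lateL n k p with suc m ℕₚ.≤? k
  ... | yes l = ℕₚ.m+[n∸m]≡n l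
  ... | no ¬l with ℕₚ.m≤n⇒∃[o]m+o≡n (ℕₚ.≰⇒> ¬l)
  ...   | o , e = ⊥-elim (p (trans (cong (λ j → gz k j n) (trans (cong (λ x → + k - + x) (sym e)) (l (+ k) (+ o)))) (trans (gz-neg k o at n) (0ˢ-at n))))
    where
    l : ∀ k o → k - (1ℤ + k + o) ≡ - (1ℤ + o)
    l = solve-∀
  L-sum : (λ j → gn (suc m ℕ.+ j) j) ⇛ 1ˢ +ˢ Rw (le (+ suc m))
  L-sum = ⇛-≈ (solve 1 (λ x → x :+ con 1ℤ := con 1ℤ :+ x) ≈-refl (Rw (le (+ suc m)))) (⇛-cong (λ j → ≡⇒≈ (cong (gz (suc m ℕ.+ j)) (l (+ m) (+ j))))
    (λ n → ⇓-reindex {f = λ k → gz k (+ k - + suc m) n} (suc m ℕ.+_) (_∸ suc m) (ℕₚ.m+n∸m≡n (suc m)) (lateL n) (le-sum (+ suc m) n)))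
    where
    l : ∀ m j → 1ℤ + m + j - (1ℤ + m) ≡ j
    l = solve-∀
  same : ∀ j → q^ (suc (m ℕ.+ m)) *ˢ gn (suc m ℕ.+ j) j ≈ Uₛ j +ˢ V′ j
  same zero    = ≈-trans (*ˢ-cong (≡⇒≈ (cong q^_ (l m))) (gn-dn-0 (m ℕ.+ 0))) (solve 1 (λ x → x := x :+ con 0ℤ) ≈-refl (Uₛ 0))
    where
    l : ∀ m → suc (m ℕ.+ m) ≡ suc (m ℕ.+ 0 ℕ.+ (m ℕ.+ 0))
    l = solveℕ
  same (suc j) = ≈-trans (*ˢ-congˡ (gn-dn-suc (m ℕ.+ suc j) j)) (≈-trans (solve 5 (λ q a x b y → q :* (a :* x :+ b :* y) := q :* a :* x :+ q :* b :* y) ≈-refl (q^ (suc (m ℕ.+ m))) (q^ (suc j ℕ.+ suc j)) (dn (m ℕ.+ suc j) (suc j)) (q^ (suc (j ℕ.+ j))) (dn (m ℕ.+ suc j) j))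
    (+ˢ-cong (*ˢ-congʳ (≈-trans (q^-+ (suc (m ℕ.+ m)) (suc j ℕ.+ suc j)) (≡⇒≈ (cong q^_ (l₁ m j))))) (*ˢ-cong (≈-trans (q^-+ (suc (m ℕ.+ m)) (suc (j ℕ.+ j))) (≡⇒≈ (cong q^_ (l₂ m j)))) (≡⇒≈ (cong (λ k → dn k j) (ℕₚ.+-suc m j))))))
    where
    l₁ : ∀ m j → suc (m ℕ.+ m) ℕ.+ (suc j ℕ.+ suc j) ≡ suc (m ℕ.+ suc j ℕ.+ (m ℕ.+ suc j))
    l₁ = solveℕ
    l₂ : ∀ m j → suc (m ℕ.+ m) ℕ.+ suc (j ℕ.+ j) ≡ suc (suc (m ℕ.+ j ℕ.+ (m ℕ.+ j)))
    l₂ = solveℕ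

-- The counterpart for negative thresholds, with the same law of exponents: threshold -r, where r =
-- s + 1, gives q^{2r+1}. The unpaired summand `V′ 0` is the empty partition and supplies the 1.
dyson⁻ : ∀ s → Rw (le -[1+ s ]) ≈ q^ (suc (suc s ℕ.+ suc s)) *ˢ (1ˢ +ˢ Rw (ge -[1+ suc s ]))
dyson⁻ s = ⇛-unique L-sum (⇛-≈ (≈-trans (+ˢ-cong ≈-refl V′0) (solve 2 (λ q a → q :* a :+ q := q :* (con 1ℤ :+ a)) ≈-refl Q (Rw (ge -[1+ suc s ]))))
  (⇛-cong same (⇛-shift {Uₛ} {V} {V′} V-ord V′-suc (⇛-cong (λ k → solve 5 (λ q a x b y → q :* (a :* x :+ b :* y) := q :* a :* x :+ q :* b :* y) ≈-refl Q (q₁ k) (dn k (k ℕ.+ suc (suc s))) (q₂ k) (dn (suc k) (k ℕ.+ suc (suc s)))) (⇛-*ˡ Q A-sum)))))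
  where
  Q : PS
  Q = q^ (suc (suc s ℕ.+ suc s))
  Uₛ V V′ : ℕ → PS
  Uₛ k = Q *ˢ q₁ k *ˢ dn k (k ℕ.+ suc (suc s))
  V k = Q *ˢ q₂ k *ˢ dn (suc k) (k ℕ.+ suc (suc s))
  V′ k = q^ (suc (k ℕ.+ suc s ℕ.+ (k ℕ.+ suc s))) *ˢ dn k (k ℕ.+ suc s)
  V-ord : ∀ k → V k ≈[ k ] 0ˢ
  V-ord k = *-≈[]-0ˡ (dn (suc k) (k ℕ.+ suc (suc s))) (*-≈[]-0ʳ Q (mono-≈[] 1ℤ (ℕₚ.≤-trans (ℕₚ.m≤m+n k k) (ℕₚ.≤-trans (ℕₚ.n≤1+n _) (ℕₚ.n≤1+n _)))))
  V′-suc : ∀ k → V′ (suc k) ≈ V k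
  V′-suc k = *ˢ-cong (≈-trans (≡⇒≈ (cong q^_ (l k s))) (≈-sym (q^-+ (suc (suc s ℕ.+ suc s)) (suc (suc (k ℕ.+ k)))))) (≡⇒≈ (cong (dn (suc k)) (sym (ℕₚ.+-suc k (suc s)))))
    where
    l : ∀ k s → suc (suc k ℕ.+ suc s ℕ.+ (suc k ℕ.+ suc s)) ≡ suc (suc s ℕ.+ suc s) ℕ.+ suc (suc (k ℕ.+ k))
    l = solveℕ
  V′0 : V′ 0 ≈ Q
  V′0 = ≈-trans (*ˢ-congˡ (≈-trans (S-0 _) ≈-refl)) (*ˢ-1 Q)
  same : ∀ k → Uₛ k +ˢ V′ k ≈ gz (suc k) (+ suc k - -[1+ s ])
  same k = ≈-sym (≈-trans (≡⇒≈ (cong (λ j → gn (suc k) (suc j)) refl)) (≈-trans (gn-dn-suc k (k ℕ.+ suc s))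
    (+ˢ-cong (*ˢ-cong (≈-trans (≡⇒≈ (cong q^_ (l k s))) (≈-sym (q^-+ (suc (suc s ℕ.+ suc s)) (suc (k ℕ.+ k))))) (≡⇒≈ (cong (dn k) (sym (ℕₚ.+-suc k (suc s)))))) ≈-refl)))
    where
    l : ∀ k s → suc (k ℕ.+ suc s) ℕ.+ suc (k ℕ.+ suc s) ≡ suc (suc s ℕ.+ suc s) ℕ.+ suc (k ℕ.+ k)
    l = solveℕ
  A-sum : (λ k → q₁ k *ˢ dn k (k ℕ.+ suc (suc s)) +ˢ q₂ k *ˢ dn (suc k) (k ℕ.+ suc (suc s))) ⇛ Rw (ge -[1+ suc s ])
  A-sum = ⇛-cong (λ k → +ˢ-cong (*ˢ-congˡ (S-≈ k (rank≡ k))) (*ˢ-congˡ (S-≈ (suc k) (rank≡ k)))) (Rw-⇛ (ge -[1+ suc s ]))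
    where
    l : ∀ k i s → k - i - - (1ℤ + (1ℤ + s)) ≡ k + (1ℤ + (1ℤ + s)) - i
    l = solve-∀
    rank≡ : ∀ k i → rank-wt (ge -[1+ suc s ]) k i ≡ pos (+ (k ℕ.+ suc (suc s)) - + i)
    rank≡ k i = cong pos (l (+ k) (+ i) (+ s))
  L-sum : (λ k → gz (suc k) (+ suc k - -[1+ s ])) ⇛ Rw (le -[1+ s ])
  L-sum = ⇛-≈ (solve 1 (λ x → x :+ con 0ℤ := x) ≈-refl (Rw (le -[1+ s ]))) (⇛-pred (gn-0-suc s) (le-sum -[1+ s ]))

-- Solution of the rank recurrence

one : ℤ → ℤ
one _ = 1ℤ

Pˢ : PS
Pˢ = 1ˢ +ˢ Rw one

ge+le : ∀ m r → ge (1ℤ + m) r + le m r ≡ 1ℤ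
ge+le m r = trans (cong₂ (λ x y → pos x + pos y) (l₁ m r) refl) (trans (cong (_+ pos (m - r)) (pos-flip (m - r))) (l₂ (pos (m - r))))
  where
  l₁ : ∀ m r → r - (1ℤ + m) ≡ - 1ℤ - (m - r)
  l₁ = solve-∀
  l₂ : ∀ x → 1ℤ - x + x ≡ 1ℤ
  l₂ = solve-∀

Rw-ge+le : ∀ m → Rw one ≈ Rw (ge (1ℤ + m)) +ˢ Rw (le m)
Rw-ge+le m = ≈-trans (Rw-≈ {one} {λ r → ge (1ℤ + m) r + le m r} (λ r → sym (ge+le m r))) (Rw-+ (ge (1ℤ + m)) (le m))

T⁺ T⁻ : ℕ → PS
T⁺ r = Rw (ge (+ r))
T⁻ r = Rw (le (- + r))

-- Ranks at most r + 1 are the complement of ranks at least r + 2, so Dyson's relation becomes a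
-- recurrence within one family.
T⁺-rec : ∀ r → T⁺ r ≈ q^ (suc (r ℕ.+ r)) *ˢ (Pˢ -ˢ T⁺ (suc (suc r)))
T⁺-rec r = ≈-trans (dyson⁺ r) (*ˢ-congˡ (≈-trans (solve 3 (λ o a b → o :+ a := o :+ (b :+ a) :- b) ≈-refl 1ˢ (Rw (le (+ suc r))) (T⁺ (suc (suc r))))
  (-ˢ-cong (+ˢ-cong ≈-refl (≈-sym (Rw-ge+le (+ suc r)))) ≈-refl)))

T⁻-rec : ∀ s → T⁻ (suc s) ≈ q^ (suc (suc s ℕ.+ suc s)) *ˢ (Pˢ -ˢ T⁻ (suc (suc (suc s))))
T⁻-rec s = ≈-trans (dyson⁻ s) (*ˢ-congˡ (≈-trans (solve 3 (λ o a b → o :+ a := o :+ (a :+ b) :- b) ≈-refl 1ˢ (Rw (ge -[1+ suc s ])) (T⁻ (suc (suc (suc s)))))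
  (-ˢ-cong (+ˢ-cong ≈-refl (≈-sym (Rw-ge+le -[1+ suc (suc s) ]))) ≈-refl)))

mono-shift-≈[] : ∀ {n f g} m → f ≈[ n ] g → q^ (suc m) *ˢ f ≈[ suc n ] q^ (suc m) *ˢ g
mono-shift-≈[] {n} {f} {g} m p i l with i ℕₚ.<? suc m
... | yes i<m = trans (mono-at-< 1ℤ (suc m) f i<m) (sym (mono-at-< 1ℤ (suc m) g i<m))
... | no ¬l with ℕₚ.m≤n⇒∃[o]m+o≡n (ℕₚ.≮⇒≥ ¬l)
...   | o , refl = trans (mono-at-+ 1ℤ (suc m) f o) (trans (cong (1ℤ *_) (p o (ℕₚ.≤-trans (s≤s (ℕₚ.m≤n+m o m)) (ℕₚ.≤-pred l)))) (sym (mono-at-+ 1ℤ (suc m) g o)))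

-- Each use of the recurrence multiplies a discrepancy by at least one q, so two solutions agree to
-- every order without any initial value.
rec-unique : ∀ (e : ℕ → ℕ) (Q : PS) (X X′ : ℕ → PS) → (∀ r → X r ≈ q^ (suc (e r)) *ˢ (Q -ˢ X (suc (suc r)))) →
  (∀ r → X′ r ≈ q^ (suc (e r)) *ˢ (Q -ˢ X′ (suc (suc r)))) → ∀ r → X r ≈ X′ r
rec-unique e Q X X′ h h′ r = coeffs λ n → go (suc n) r n ℕₚ.≤-refl
  where
  go : ∀ n r → X r ≈[ n ] X′ r
  go zero    r i ()
  go (suc n) r = ≈[]-trans (≈⇒≈[] (h r)) (≈[]-trans (mono-shift-≈[] (e r) (≈[]-+ ≈[]-refl (≈[]-neg (go n (suc (suc r)))))) (≈⇒≈[] (≈-sym (h′ r))))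

-- The solution of the recurrence Y_r = q^{2r+1} (1 - Y_{r+2}), normalised by the full generating function.

eY : ℕ → ℕ → ℕ
eY r k = suc k ℕ.* suc (k ℕ.+ k ℕ.+ (r ℕ.+ r))

Yterm : ℕ → ℕ → PS
Yterm r k = mono (sgn (+ k)) (eY r k)

Yterm-ord : ∀ r k → Yterm r k ≈[ k ] 0ˢ
Yterm-ord r k = mono-≈[] (sgn (+ k)) (ℕₚ.≤-trans (ℕₚ.n≤1+n k) (ℕₚ.m≤m*n (suc k) (suc (k ℕ.+ k ℕ.+ (r ℕ.+ r)))))

Y : ℕ → PS
Y r = Sum (Yterm r) (Yterm-ord r)

Y-⇛ : ∀ r → Yterm r ⇛ Y r
Y-⇛ r = Sum-⇛ (Yterm r) (Yterm-ord r)

Y-rec : ∀ r → Y r ≈ q^ (suc (r ℕ.+ r)) *ˢ (1ˢ -ˢ Y (suc (suc r)))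
Y-rec r = ⇛-unique (Y-⇛ r) target
  where
  Q : PS
  Q = q^ (suc (r ℕ.+ r))
  l₀ : ∀ r → suc (r ℕ.+ r) ≡ 1 ℕ.* suc (0 ℕ.+ 0 ℕ.+ (r ℕ.+ r))
  l₀ = solveℕ
  l₁ : ∀ r k → suc (r ℕ.+ r) ℕ.+ suc k ℕ.* suc (k ℕ.+ k ℕ.+ (suc (suc r) ℕ.+ suc (suc r))) ≡ suc (suc k) ℕ.* suc (suc k ℕ.+ suc k ℕ.+ (r ℕ.+ r))
  l₁ = solveℕ
  fam₀ : ℕ → PS
  fam₀ zero    = Q
  fam₀ (suc k) = -ˢ (Q *ˢ Yterm (suc (suc r)) k)
  head : fam₀ 0 ≈ Yterm r 0
  head = ≡⇒≈ (cong q^_ (l₀ r))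
  tail′ : ∀ k → fam₀ (suc k) ≈ Yterm r (suc k)
  tail′ k = ≈-trans (negˢ-cong (mono-* 1ℤ (suc (r ℕ.+ r)) (sgn (+ k)) (eY (suc (suc r)) k))) (≈-trans (mono-neg (1ℤ * sgn (+ k)) (suc (r ℕ.+ r) ℕ.+ eY (suc (suc r)) k)) (≡⇒≈ (cong₂ mono {x = - (1ℤ * sgn (+ k))} {y = sgn (+ suc k)} (trans (cong -_ (ℤₚ.*-identityˡ (sgn (+ k)))) (sym (sgn-suc (+ k)))) (l₁ r k))))
  rest : ℕ → PS
  rest zero    = 0ˢ
  rest (suc k) = -ˢ (Q *ˢ Yterm (suc (suc r)) k)
  first : ℕ → PS
  first zero    = Q
  first (suc k) = 0ˢ
  Σrest : rest ⇛ -ˢ (Q *ˢ Y (suc (suc r)))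
  Σrest n = ⇓-unindex {f = λ k → rest k n} suc ℕ.pred (λ _ → refl) (λ { zero p → ⊥-elim (p (0ˢ-at n)) ; (suc k) _ → refl })
    (⇛-neg (⇛-*ˡ Q (Y-⇛ (suc (suc r)))) n)
  Σfirst : first ⇛ Q
  Σfirst n = ⇓-single {f = λ k → first k n} 0 (λ { zero _ → refl ; (suc k) p → ⊥-elim (p (0ˢ-at n)) })
  joined : fam₀ ⇛ Q +ˢ -ˢ (Q *ˢ Y (suc (suc r)))
  joined = ⇛-cong (λ { zero → solve 1 (λ x → x :+ con 0ℤ := x) ≈-refl Q ; (suc k) → solve 1 (λ x → con 0ℤ :+ x := x) ≈-refl (fam₀ (suc k)) }) (⇛-+ Σfirst Σrest)
  target : Yterm r ⇛ Q *ˢ (1ˢ -ˢ Y (suc (suc r)))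
  target = ⇛-≈ (solve 2 (λ q y → q :+ :- (q :* y) := q :* (con 1ℤ :- y)) ≈-refl Q (Y (suc (suc r)))) (⇛-cong (λ { zero → head ; (suc k) → tail′ k }) joined)

P*Y-rec : ∀ r → Pˢ *ˢ Y r ≈ q^ (suc (r ℕ.+ r)) *ˢ (Pˢ -ˢ Pˢ *ˢ Y (suc (suc r)))
P*Y-rec r = ≈-trans (*ˢ-congˡ (Y-rec r)) (solve 3 (λ p q y → p :* (q :* (con 1ℤ :- y)) := q :* (p :- p :* y)) ≈-refl Pˢ (q^ (suc (r ℕ.+ r))) (Y (suc (suc r))))

T⁺≈P*Y : ∀ r → T⁺ r ≈ Pˢ *ˢ Y r
T⁺≈P*Y = rec-unique (λ r → r ℕ.+ r) Pˢ T⁺ (λ r → Pˢ *ˢ Y r) T⁺-rec P*Y-rec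

T⁻≈P*Y : ∀ s → T⁻ (suc s) ≈ Pˢ *ˢ Y (suc s)
T⁻≈P*Y = rec-unique (λ s → suc s ℕ.+ suc s) Pˢ (λ s → T⁻ (suc s)) (λ s → Pˢ *ˢ Y (suc s)) T⁻-rec (λ s → P*Y-rec (suc s))

-- Every nonempty partition has M₂-rank at least 0 or at most -1. Cutting there turns the solution
-- of the recurrence into an equation for `Pˢ` itself, which identifies `Pˢ` as 1 / ψ₁.
P≈1+P*Y₀+P*Y₁ : Pˢ ≈ 1ˢ +ˢ (Pˢ *ˢ Y 0 +ˢ Pˢ *ˢ Y 1)
P≈1+P*Y₀+P*Y₁ = +ˢ-cong ≈-refl (≈-trans (Rw-ge+le -[1+ 0 ]) (+ˢ-cong (T⁺≈P*Y 0) (T⁻≈P*Y 0)))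

Yterm-at : ∀ r k n → Yterm r k n ≡ sgn (+ k) * δ ((1ℤ + + k) * (1ℤ + (+ k + + k + (+ r + + r)))) (+ n)
Yterm-at r k n = trans (mono-at (sgn (+ k)) (eY r k) n) (cong (λ e → sgn (+ k) * δ e (+ n)) (ℤₚ.pos-* (suc k) (suc (k ℕ.+ k ℕ.+ (r ℕ.+ r)))))

-- The index k = 0 gives 1, positive k give the terms of `Y 1` and negative k those of `Y 0`; the
-- sign is reversed because the sums Y start counting at k = 1.
ψ₁≈1-Y₁-Y₀ : ψ₁ ≈ 1ˢ +ˢ (-ˢ Y 1 +ˢ -ˢ Y 0)
ψ₁≈1-Y₁-Y₀ = coeffs λ n → ⇓-unique (gf-⇓ fψ₁ n) (⇓-≡ (sym (trans (+ˢ-at 1ˢ _ n) (cong (_+_ (1ˢ n)) (+ˢ-at _ _ n))))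
  (⇓-unindex {f = cf (λ k → sgn k) (λ k → + 2 * k * k + k) (+ n)} φ ψ ψφ (λ k _ → φψ k)
    (⇓-split (⇓-cong (λ _ → zero-term n) (⇓-single {f = λ (_ : ⊤) → 1ˢ n} tt (λ _ _ → refl)))
      (⇓-split (⇓-cong (λ a → sym (pos-term n a)) (⇛-neg (Y-⇛ 1) n)) (⇓-cong (λ a → sym (neg-term n a)) (⇛-neg (Y-⇛ 0) n))))))
  where
  φ : ⊤ ⊎ (ℕ ⊎ ℕ) → ℤ
  φ (inj₁ _)        = 0ℤ
  φ (inj₂ (inj₁ a)) = + suc a
  φ (inj₂ (inj₂ a)) = -[1+ a ]
  ψ : ℤ → ⊤ ⊎ (ℕ ⊎ ℕ)
  ψ (+ zero)  = inj₁ tt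
  ψ (+ suc a) = inj₂ (inj₁ a)
  ψ -[1+ a ]  = inj₂ (inj₂ a)
  ψφ : ∀ x → ψ (φ x) ≡ x
  ψφ (inj₁ _)        = refl
  ψφ (inj₂ (inj₁ a)) = refl
  ψφ (inj₂ (inj₂ a)) = refl
  φψ : ∀ k → φ (ψ k) ≡ k
  φψ (+ zero)  = refl
  φψ (+ suc a) = refl
  φψ -[1+ a ]  = refl
  zero-term : ∀ n → 1ˢ n ≡ sgn 0ℤ * δ 0ℤ (+ n)
  zero-term n = trans (sym (mono-cst 1ℤ at n)) (mono-at 1ℤ 0 n)
  pos-term : ∀ n a → sgn (+ suc a) * δ (+ 2 * + suc a * + suc a + + suc a) (+ n) ≡ (-ˢ Yterm 1 a) n
  pos-term n a = trans (cong₂ (λ s e → s * δ e (+ n)) (sgn-suc (+ a)) (l (+ a))) (trans (sym (ℤₚ.neg-distribˡ-* (sgn (+ a)) _)) (sym (trans (-ˢ-at (Yterm 1 a) n) (cong -_ (Yterm-at 1 a n)))))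
    where
    l : ∀ a → + 2 * (1ℤ + a) * (1ℤ + a) + (1ℤ + a) ≡ (1ℤ + a) * (1ℤ + (a + a + + 2))
    l = solve-∀
  neg-term : ∀ n a → sgn -[1+ a ] * δ (+ 2 * -[1+ a ] * -[1+ a ] + -[1+ a ]) (+ n) ≡ (-ˢ Yterm 0 a) n
  neg-term n a = trans (cong₂ (λ s e → s * δ e (+ n)) (sgn-suc (+ a)) (l (+ a))) (trans (sym (ℤₚ.neg-distribˡ-* (sgn (+ a)) _)) (sym (trans (-ˢ-at (Yterm 0 a) n) (cong -_ (Yterm-at 0 a n)))))
    where
    l : ∀ a → + 2 * (- (1ℤ + a)) * (- (1ℤ + a)) + (- (1ℤ + a)) ≡ (1ℤ + a) * (1ℤ + (a + a + + 0))
    l = solve-∀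

ψ₁*P≈1 : ψ₁ *ˢ Pˢ ≈ 1ˢ
ψ₁*P≈1 = ≈-trans (*ˢ-congʳ ψ₁≈1-Y₁-Y₀) (≈-trans (solve 3 (λ p a b → (con 1ℤ :+ (:- b :+ :- a)) :* p := p :- (p :* a :+ p :* b)) ≈-refl Pˢ (Y 0) (Y 1))
  (≈-trans (-ˢ-cong P≈1+P*Y₀+P*Y₁ ≈-refl) (solve 2 (λ o x → o :+ x :- x := o) ≈-refl 1ˢ (Pˢ *ˢ Y 0 +ˢ Pˢ *ˢ Y 1))))

Ydiff : ℕ → PS
Ydiff t = Y (t ℕ.+ t ℕ.+ t ℕ.+ 3) -ˢ Y (t ℕ.+ t ℕ.+ t ℕ.+ 1)

-- The quadrant k = 1 + a, j = t of `fH` is -Y_{3t+1} and the quadrant k = -1 - a, j = -1 - t is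
-- Y_{3t+3}; summation over t produces the denominators 1 - q^{6k}.
Ydiff-⇛ : Ydiff ⇛ gf fH
Ydiff-⇛ n = go (⇓-unsplit (0 , 0) (0 , 0) (⇓-reindex {f = fHₙ} φ ψ ψφ φψ (gf-⇓ fH n)))
  where
  fHₙ : ℤ × ℤ → ℤ
  fHₙ = cf (wt fH) (ex fH) (+ n)
  φ : (ℕ × ℕ) ⊎ (ℕ × ℕ) → ℤ × ℤ
  φ (inj₁ (t , a)) = + suc a , + t
  φ (inj₂ (t , a)) = -[1+ a ] , -[1+ t ]
  ψ : ℤ × ℤ → (ℕ × ℕ) ⊎ (ℕ × ℕ)
  ψ (+ suc a , + t)        = inj₁ (t , a)
  ψ (-[1+ a ] , -[1+ t ])  = inj₂ (t , a)
  ψ (+ zero , _)           = inj₁ (0 , 0)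
  ψ (+ suc _ , -[1+ _ ])   = inj₁ (0 , 0)
  ψ (-[1+ _ ] , + _)       = inj₁ (0 , 0)
  ψφ : ∀ x → ψ (φ x) ≡ x
  ψφ (inj₁ (t , a)) = refl
  ψφ (inj₂ (t , a)) = refl
  φψ : ∀ i → cf (wt fH) (ex fH) (+ n) i ≢ 0ℤ → φ (ψ i) ≡ i
  φψ (+ suc a , + t)        _ = refl
  φψ (-[1+ a ] , -[1+ t ])  _ = refl
  φψ (+ zero , j)           p = ⊥-elim (p (trans (cong (λ w → w * ε 0ℤ j * δ (ex fH (0ℤ , j)) (+ n)) (ℤₚ.*-zeroʳ 1ℤ)) (l (ε 0ℤ j) (δ (ex fH (0ℤ , j)) (+ n)))))
    where
    l : ∀ e d → 0ℤ * e * d ≡ 0ℤ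
    l = solve-∀
  φψ (+ suc a , -[1+ t ])   p = ⊥-elim (p (l (sgn (+ suc a)) (δ (ex fH (+ suc a , -[1+ t ])) (+ n))))
    where
    l : ∀ s d → s * 1ℤ * 0ℤ * d ≡ 0ℤ
    l = solve-∀
  φψ (-[1+ a ] , + t)       p = ⊥-elim (p (l (sgn -[1+ a ]) (δ (ex fH (-[1+ a ] , + t)) (+ n))))
    where
    l : ∀ s d → s * 1ℤ * 0ℤ * d ≡ 0ℤ
    l = solve-∀
  pos-term : ∀ t a → - Yterm (t ℕ.+ t ℕ.+ t ℕ.+ 1) a n ≡ cf (wt fH) (ex fH) (+ n) (+ suc a , + t)
  pos-term t a = trans (cong -_ (Yterm-at (t ℕ.+ t ℕ.+ t ℕ.+ 1) a n)) (trans (l₁ (sgn (+ a)) _) (sym (cong₂ (λ s e → s * 1ℤ * 1ℤ * δ e (+ n)) (sgn-suc (+ a)) (l₂ (+ a) (+ t)))))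
    where
    l₁ : ∀ s d → - (s * d) ≡ - s * 1ℤ * 1ℤ * d
    l₁ = solve-∀
    l₂ : ∀ a t → + 2 * (1ℤ + a) * (1ℤ + a) + (1ℤ + a) + + 6 * (1ℤ + a) * t ≡ (1ℤ + a) * (1ℤ + (a + a + ((t + t + t + 1ℤ) + (t + t + t + 1ℤ))))
    l₂ = solve-∀
  neg-term : ∀ t a → Yterm (t ℕ.+ t ℕ.+ t ℕ.+ 3) a n ≡ cf (wt fH) (ex fH) (+ n) (-[1+ a ] , -[1+ t ])
  neg-term t a = trans (Yterm-at (t ℕ.+ t ℕ.+ t ℕ.+ 3) a n) (trans (l₁ (sgn (+ a)) _) (sym (cong₂ (λ s e → s * 1ℤ * - 1ℤ * δ e (+ n)) (sgn-suc (+ a)) (l₂ (+ a) (+ t)))))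
    where
    l₁ : ∀ s d → s * d ≡ - s * 1ℤ * - 1ℤ * d
    l₁ = solve-∀
    l₂ : ∀ a t → + 2 * (- (1ℤ + a)) * (- (1ℤ + a)) + (- (1ℤ + a)) + + 6 * (- (1ℤ + a)) * (- (1ℤ + t)) ≡ (1ℤ + a) * (1ℤ + (a + a + ((t + t + t + + 3) + (t + t + t + + 3))))
    l₂ = solve-∀
  go : (∃₂ λ s₁ s₂ → ((λ x → fHₙ (φ (inj₁ x))) ⇓ s₁) × ((λ x → fHₙ (φ (inj₂ x))) ⇓ s₂) × (gf fH n ≡ s₁ + s₂)) → (λ t → Ydiff t n) ⇓ gf fH n
  go (s₁ , s₂ , F₁ , F₂ , q) = ⇓-≡ (sym q) (⇓-cong (λ t → trans (ℤₚ.+-comm (- Y (t ℕ.+ t ℕ.+ t ℕ.+ 1) n) (Y (t ℕ.+ t ℕ.+ t ℕ.+ 3) n)) (sym (minus-at (Y (t ℕ.+ t ℕ.+ t ℕ.+ 3)) (Y (t ℕ.+ t ℕ.+ t ℕ.+ 1)) n)))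
    (⇓-+ (⇓-rows (λ t → ⇓-cong (λ a → pos-term t a) (⇓-neg (Y-⇛ (t ℕ.+ t ℕ.+ t ℕ.+ 1) n))) ℕₚ._≟_ F₁)
         (⇓-rows (λ t → ⇓-cong (λ a → neg-term t a) (Y-⇛ (t ℕ.+ t ℕ.+ t ℕ.+ 3) n)) ℕₚ._≟_ F₂)))

-- The weight modulo 3 as a combination of half-lines

module HalfLines (α β γ : ℤ) (sum-0 : α + β + γ ≡ 0ℤ) where

  h : ℕ → ℕ → ℕ → ℤ
  h N t c = pos (+ N - (+ t + + t + + t + + c))

  s : ℕ → ℕ → ℤ
  s N t = α * h N t 1 + β * h N t 2 + γ * h N t 3

  private
    s-shift : ∀ N t → s (3 ℕ.+ N) (suc t) ≡ s N t
    s-shift N t = cong₂ _+_ (cong₂ _+_ (cong (_*_ α) (e 1)) (cong (_*_ β) (e 2))) (cong (_*_ γ) (e 3))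
      where
      l : ∀ N t c → + 3 + N - ((1ℤ + t) + (1ℤ + t) + (1ℤ + t) + c) ≡ N - (t + t + t + c)
      l = solve-∀
      e : ∀ c → h (3 ℕ.+ N) (suc t) c ≡ h N t c
      e c = cong pos (l (+ N) (+ t) (+ c))

    s-first : ∀ N → s (3 ℕ.+ N) 0 ≡ 0ℤ
    s-first N = trans (cong₂ _+_ (cong₂ _+_ (cong (_*_ α) (cong pos (l (+ 2) (+ N) (+ 1) )))  (cong (_*_ β) (cong pos (l (+ 1) (+ N) (+ 2))))) (cong (_*_ γ) (cong pos (l 0ℤ (+ N) (+ 3)))))
      (trans (l′ α β γ) sum-0)
      where
      l : ∀ d N c → (c + d) + N - (0ℤ + 0ℤ + 0ℤ + c) ≡ d + N
      l = solve-∀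
      l′ : ∀ a b c → a * 1ℤ + b * 1ℤ + c * 1ℤ ≡ a + b + c
      l′ = solve-∀

    s-late : ∀ N d t → N ℕ.+ d ≡ 2 → s N (suc t) ≡ 0ℤ
    s-late N d t e = trans (cong₂ _+_ (cong₂ _+_ (cong (_*_ α) (z 1)) (cong (_*_ β) (z 2))) (cong (_*_ γ) (z 3))) (l′ α β γ)
      where
      l′ : ∀ a b c → a * 0ℤ + b * 0ℤ + c * 0ℤ ≡ 0ℤ
      l′ = solve-∀
      l : ∀ N d t c → N - ((1ℤ + t) + (1ℤ + t) + (1ℤ + t) + c) ≡ (N + d - + 2) - (1ℤ + (t + t + t + c + d))
      l = solve-∀
      z : ∀ c → h N (suc t) c ≡ 0ℤ
      z c = trans (cong pos (trans (l (+ N) (+ d) (+ t) (+ c)) (cong (λ x → (+ x - + 2) - (1ℤ + (+ t + + t + + t + + c + + d))) e))) refl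

  f : ℕ → ℕ → ℤ
  f N M = Σ< M (s N)

  f-shift : ∀ N M → f (3 ℕ.+ N) (suc M) ≡ f N M
  f-shift N M = trans (Σ<-first M (s (3 ℕ.+ N))) (trans (cong₂ _+_ (s-first N) (Σ<-cong M (λ t _ → s-shift N t))) (ℤₚ.+-identityˡ _))

  f-small : ∀ N d M → N ℕ.+ d ≡ 2 → f N (suc M) ≡ s N 0
  f-small N d M e = trans (Σ<-first M (s N)) (trans (cong (_+_ (s N 0)) (Σ<-0 M (λ t _ → s-late N d t e))) (ℤₚ.+-identityʳ _))

  f-0 : ∀ M → f 0 M ≡ 0ℤ
  f-0 zero    = refl
  f-0 (suc M) = trans (f-small 0 2 M refl) (l α β γ)
    where
    l : ∀ a b c → a * 0ℤ + b * 0ℤ + c * 0ℤ ≡ 0ℤ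
    l = solve-∀
  f-1 : ∀ M → f 1 (suc M) ≡ α
  f-1 M = trans (f-small 1 1 M refl) (l α β γ)
    where
    l : ∀ a b c → a * 1ℤ + b * 0ℤ + c * 0ℤ ≡ a
    l = solve-∀
  f-2 : ∀ M → f 2 (suc M) ≡ α + β
  f-2 M = trans (f-small 2 0 M refl) (l α β γ)
    where
    l : ∀ a b c → a * 1ℤ + b * 1ℤ + c * 0ℤ ≡ a + b
    l = solve-∀

-- The jumps of χ = 1, -1, 0, 1, ... along 0, 1, 2, 3 are -2, 1, 1; along 0, -1, -2, -3 the values
-- 1, 0, -1, 1 have the jumps -1, -1, 2. They add up to 0 over a period.
module Pos = HalfLines (- + 2) 1ℤ 1ℤ refl
module Neg = HalfLines (- 1ℤ) (- 1ℤ) (+ 2) refl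

χ : ℤ → ℤ
χ r = class 0ℤ r - class 1ℤ r

χ-pos : ∀ N M → N ≤ M ℕ.+ M ℕ.+ M → χ (+ N) ≡ 1ℤ + Pos.f N M
χ-pos 0 M l = cong (_+_ 1ℤ) (sym (Pos.f-0 M))
χ-pos 1 (suc M) l = cong (_+_ 1ℤ) (sym (Pos.f-1 M))
χ-pos 2 (suc M) l = cong (_+_ 1ℤ) (sym (Pos.f-2 M))
χ-pos (suc (suc (suc N))) (suc M) l = trans (periodic N) (trans (χ-pos N M l′) (cong (_+_ 1ℤ) (sym (Pos.f-shift N M))))
  where
  periodic : ∀ N → χ (+ (3 ℕ.+ N)) ≡ χ (+ N)
  periodic zero    = refl
  periodic (suc N) = refl
  l′ : N ≤ M ℕ.+ M ℕ.+ M
  l′ = ℕₚ.+-cancelˡ-≤ 3 N _ (subst (suc (suc (suc N)) ≤_) (e M) l)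
    where
    e : ∀ M → suc M ℕ.+ suc M ℕ.+ suc M ≡ 3 ℕ.+ (M ℕ.+ M ℕ.+ M)
    e = solveℕ

χ-neg : ∀ N M → N ≤ M ℕ.+ M ℕ.+ M → χ (- + N) ≡ 1ℤ + Neg.f N M
χ-neg 0 M l = cong (_+_ 1ℤ) (sym (Neg.f-0 M))
χ-neg 1 (suc M) l = cong (_+_ 1ℤ) (sym (Neg.f-1 M))
χ-neg 2 (suc M) l = cong (_+_ 1ℤ) (sym (Neg.f-2 M))
χ-neg (suc (suc (suc N))) (suc M) l = trans (periodic N) (trans (χ-neg N M l′) (cong (_+_ 1ℤ) (sym (Neg.f-shift N M))))
  where
  periodic : ∀ N → χ (- + (3 ℕ.+ N)) ≡ χ (- + N)
  periodic zero    = refl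
  periodic (suc N) = refl
  l′ : N ≤ M ℕ.+ M ℕ.+ M
  l′ = ℕₚ.+-cancelˡ-≤ 3 N _ (subst (suc (suc (suc N)) ≤_) (e M) l)
    where
    e : ∀ M → suc M ℕ.+ suc M ℕ.+ suc M ≡ 3 ℕ.+ (M ℕ.+ M ℕ.+ M)
    e = solveℕ

private
  r_c : ℕ → ℕ → ℕ
  r_c t c = t ℕ.+ t ℕ.+ t ℕ.+ c

  lin : ℤ → ℤ → ℤ → (ℕ → ℤ → ℤ) → ℤ → ℤ
  lin α β γ w r = α * w 1 r + β * w 2 r + γ * w 3 r

  gec lec : ℕ → ℕ → ℤ → ℤ
  gec t c = ge (+ r_c t c)
  lec t c = le (- + r_c t c)

  v : ℕ → ℤ → ℤ
  v t r = lin (- + 2) 1ℤ 1ℤ (gec t) r + lin (- 1ℤ) (- 1ℤ) (+ 2) (lec t) r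

  gec-neg : ∀ t c N → gec t (suc c) (- + N) ≡ 0ℤ
  gec-neg t c N = cong pos (l (+ t) (+ c) (+ N))
    where
    l : ∀ t c N → - N - (t + t + t + (1ℤ + c)) ≡ - (1ℤ + (t + t + t + c + N))
    l = solve-∀

  lec-pos : ∀ t c N → lec t (suc c) (+ N) ≡ 0ℤ
  lec-pos t c N = cong pos (l (+ t) (+ c) (+ N))
    where
    l : ∀ t c N → - (t + t + t + (1ℤ + c)) - N ≡ - (1ℤ + (t + t + t + c + N))
    l = solve-∀

  lec-neg : ∀ t c N → lec t c (- + N) ≡ Neg.h N t c
  lec-neg t c N = cong pos (l (+ t) (+ c) (+ N))
    where
    l : ∀ t c N → - (t + t + t + c) - - N ≡ N - (t + t + t + c)
    l = solve-∀

  lin-0 : ∀ α β γ {x y z} → x ≡ 0ℤ → y ≡ 0ℤ → z ≡ 0ℤ → α * x + β * y + γ * z ≡ 0ℤ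
  lin-0 α β γ refl refl refl = l α β γ
    where
    l : ∀ α β γ → α * 0ℤ + β * 0ℤ + γ * 0ℤ ≡ 0ℤ
    l = solve-∀

  v-pos : ∀ t N → v t (+ N) ≡ Pos.s N t
  v-pos t N = trans (cong (_+_ (Pos.s N t)) (lin-0 (- 1ℤ) (- 1ℤ) (+ 2) (lec-pos t 0 N) (lec-pos t 1 N) (lec-pos t 2 N))) (ℤₚ.+-identityʳ (Pos.s N t))

  v-neg : ∀ t N → v t (- + N) ≡ Neg.s N t
  v-neg t N = trans (cong₂ _+_ (lin-0 (- + 2) 1ℤ 1ℤ (gec-neg t 0 N) (gec-neg t 1 N) (gec-neg t 2 N))
    (cong₂ _+_ (cong₂ _+_ (cong (_*_ (- 1ℤ)) (lec-neg t 1 N)) (cong (_*_ (- 1ℤ)) (lec-neg t 2 N))) (cong (_*_ (+ 2)) (lec-neg t 3 N)))) (ℤₚ.+-identityˡ (Neg.s N t))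

  χ-sum : ℕ → ℤ → ℤ
  χ-sum M r = 1ℤ + Σ< M (λ t → v t r)

  χ≡χ-sum : ∀ n r → ∣ r ∣ ≤ n → χ r ≡ χ-sum (suc n) r
  χ≡χ-sum n (+ N)      l = trans (χ-pos N (suc n) (ℕₚ.≤-trans l (big n))) (cong (_+_ 1ℤ) (Σ<-cong (suc n) (λ t _ → sym (v-pos t N))))
    where
    big : ∀ n → n ≤ suc n ℕ.+ suc n ℕ.+ suc n
    big n = ℕₚ.≤-trans (ℕₚ.n≤1+n n) (ℕₚ.m≤n+m (suc n) (suc n ℕ.+ suc n))
  χ≡χ-sum n -[1+ N ]   l = trans (χ-neg (suc N) (suc n) (ℕₚ.≤-trans l (big n))) (cong (_+_ 1ℤ) (Σ<-cong (suc n) (λ t _ → sym (v-neg t (suc N)))))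
    where
    big : ∀ n → n ≤ suc n ℕ.+ suc n ℕ.+ suc n
    big n = ℕₚ.≤-trans (ℕₚ.n≤1+n n) (ℕₚ.m≤n+m (suc n) (suc n ℕ.+ suc n))

  Rw-lin : ∀ α β γ w → Rw (lin α β γ w) ≈ cst α *ˢ Rw (w 1) +ˢ cst β *ˢ Rw (w 2) +ˢ cst γ *ˢ Rw (w 3)
  Rw-lin α β γ w = ≈-trans (Rw-+ (λ r → α * w 1 r + β * w 2 r) (λ r → γ * w 3 r))
    (+ˢ-cong (≈-trans (Rw-+ (λ r → α * w 1 r) (λ r → β * w 2 r)) (+ˢ-cong (Rw-* α (w 1)) (Rw-* β (w 2)))) (Rw-* γ (w 3)))

  T⁻-c : ∀ t c → Rw (lec t (suc c)) ≈ Pˢ *ˢ Y (r_c t (suc c))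
  T⁻-c t c = subst (λ r → T⁻ r ≈ Pˢ *ˢ Y r) (sym (ℕₚ.+-suc (t ℕ.+ t ℕ.+ t) c)) (T⁻≈P*Y (t ℕ.+ t ℕ.+ t ℕ.+ c))

  -- Ranks ≥ r and ranks ≤ -r both have generating function `Pˢ *ˢ Y r` for r ≥ 1, so the jumps (-2,
  -- 1, 1) and (-1, -1, 2) add up to (-3, 0, 3).
  Rw-v : ∀ t → Rw (v t) ≈ cst (+ 3) *ˢ Pˢ *ˢ Ydiff t
  Rw-v t = ≈-trans (Rw-+ (lin (- + 2) 1ℤ 1ℤ (gec t)) (lin (- 1ℤ) (- 1ℤ) (+ 2) (lec t)))
    (≈-trans (+ˢ-cong (≈-trans (Rw-lin (- + 2) 1ℤ 1ℤ (gec t)) (+ˢ-cong (+ˢ-cong (*ˢ-congˡ (T⁺≈P*Y (r_c t 1))) (*ˢ-congˡ (T⁺≈P*Y (r_c t 2)))) (*ˢ-congˡ (T⁺≈P*Y (r_c t 3)))))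
        (≈-trans (Rw-lin (- 1ℤ) (- 1ℤ) (+ 2) (lec t)) (+ˢ-cong (+ˢ-cong (*ˢ-congˡ (T⁻-c t 0)) (*ˢ-congˡ (T⁻-c t 1))) (*ˢ-congˡ (T⁻-c t 2)))))
      (solve 4 (λ p x y z → con (- + 2) :* (p :* x) :+ con 1ℤ :* (p :* y) :+ con 1ℤ :* (p :* z) :+ (con (- 1ℤ) :* (p :* x) :+ con (- 1ℤ) :* (p :* y) :+ con (+ 2) :* (p :* z)) := con (+ 3) :* p :* (z :- x))
        ≈-refl Pˢ (Y (r_c t 1)) (Y (r_c t 2)) (Y (r_c t 3))))

  Rw-χ-sum : ∀ M n → Rw (χ-sum M) n ≡ Rw one n + Σ< M (λ t → Rw (v t) n)
  Rw-χ-sum zero    n = trans (Rw-≈ {χ-sum 0} {one} (λ r → refl) at n) (sym (ℤₚ.+-identityʳ (Rw one n)))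
  Rw-χ-sum (suc M) n = trans (Rw-≈ {χ-sum (suc M)} {λ r → χ-sum M r + v M r} (λ r → sym (ℤₚ.+-assoc 1ℤ (Σ< M (λ t → v t r)) (v M r))) at n)
    (trans (Rw-+ (χ-sum M) (v M) at n) (trans (+ˢ-at (Rw (χ-sum M)) (Rw (v M)) n) (trans (cong (_+ Rw (v M) n) (Rw-χ-sum M n)) (ℤₚ.+-assoc (Rw one n) _ _))))

  Y-ord : ∀ r → Y r ≈[ suc (r ℕ.+ r) ] 0ˢ
  Y-ord r = ≈[]-trans (≈⇒≈[] (Y-rec r)) (*-≈[]-0ˡ (1ˢ -ˢ Y (suc (suc r))) (mono-≈[] 1ℤ ℕₚ.≤-refl))

  Ydiff-ord : ∀ t → cst (+ 3) *ˢ Pˢ *ˢ Ydiff t ≈[ t ] 0ˢ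
  Ydiff-ord t = *-≈[]-0ʳ (cst (+ 3) *ˢ Pˢ) (≈[]-trans (≈[]-+ (≈[]-≤ (big 3) (Y-ord (r_c t 3))) (≈[]-neg (≈[]-≤ (big 1) (Y-ord (r_c t 1))))) (≈⇒≈[] (solve 0 (con 0ℤ :- con 0ℤ := con 0ℤ) ≈-refl)))
    where
    big : ∀ c → t ≤ suc (r_c t c ℕ.+ r_c t c)
    big c = ℕₚ.≤-trans (ℕₚ.m≤n+m t (t ℕ.+ t)) (ℕₚ.≤-trans (ℕₚ.m≤m+n (t ℕ.+ t ℕ.+ t) c) (ℕₚ.≤-trans (ℕₚ.m≤m+n (r_c t c) (r_c t c)) (ℕₚ.n≤1+n _)))

  Σ-Ydiff : ∀ n → Σ< (suc n) (λ t → (cst (+ 3) *ˢ Pˢ *ˢ Ydiff t) n) ≡ (cst (+ 3) *ˢ Pˢ *ˢ gf fH) n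
  Σ-Ydiff n = trans (sym (sumL-upTo (λ t → (cst (+ 3) *ˢ Pˢ *ˢ Ydiff t) n) (suc n)))
    (⇓-unique (Sum-⇛ (λ t → cst (+ 3) *ˢ Pˢ *ˢ Ydiff t) Ydiff-ord n) (⇛-*ˡ (cst (+ 3) *ˢ Pˢ) Ydiff-⇛ n))

-- At the coefficient q^n only ranks of absolute value at most n matter, so n + 1 triples of
-- half-lines represent `χ` exactly.
Rw-χ : Rw χ ≈ Rw one +ˢ cst (+ 3) *ˢ Pˢ *ˢ gf fH
Rw-χ = coeffs λ n → trans (Rw-cong n {χ} {χ-sum (suc n)} (λ k i k≤n i≤n → χ≡χ-sum n (+ k - + i) (ℕₚ.≤-trans (ℕₚ.≤-reflexive (cong ∣_∣ (ℤₚ.m-n≡m⊖n k i))) (ℕₚ.≤-trans (ℤₚ.∣m⊝n∣≤m⊔n k i) (ℕₚ.⊔-lub k≤n i≤n)))))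
  (trans (Rw-χ-sum (suc n) n) (trans (cong (_+_ (Rw one n)) (trans (Σ<-cong (suc n) (λ t _ → Rw-v t at n)) (Σ-Ydiff n))) (sym (+ˢ-at (Rw one) _ n))))

-- the empty partition supplies the constant term 1
Fˢ : PS
Fˢ = 1ˢ +ˢ Rw χ

ψ₁*F≈H : ψ₁ *ˢ Fˢ ≈ Hˢ
ψ₁*F≈H = ≈-trans (*ˢ-congˡ (+ˢ-cong ≈-refl Rw-χ)) (≈-trans (solve 3 (λ p r h → p :* (con 1ℤ :+ (r :+ con (+ 3) :* (con 1ℤ :+ r) :* h)) := p :* (con 1ℤ :+ r) :* (con 1ℤ :+ con (+ 3) :* h)) ≈-refl ψ₁ (Rw one) (gf fH))
  (≈-trans (*ˢ-congʳ ψ₁*P≈1) (1-*ˢ Hˢ)))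

R-Rw : ∀ d n → R 0ℤ 1ℤ d n ≡ Rw χ (3 ℕ.* n ℕ.+ d)
R-Rw d n = trans (cong₂ _-_ (N2-Rw 0ℤ N) (N2-Rw 1ℤ N)) (sym (trans (Rw-minus (class 0ℤ) (class 1ℤ) at N) (minus-at _ _ N)))
  where
  N : ℕ
  N = 3 ℕ.* n ℕ.+ d

-- The bilateral sum of the first identity

private
  T⇒true : ∀ {b} → Bool.T b → b ≡ true
  T⇒true {true} _ = refl

  ¬T⇒false : ∀ {b} → ¬ Bool.T b → b ≡ false
  ¬T⇒false {true}  h = ⊥-elim (h _)
  ¬T⇒false {false} _ = refl

  ≤ᵇ-true : ∀ {a M} → a ℤ.≤ M → (a ≤ᵇ M) ≡ true
  ≤ᵇ-true p = T⇒true (ℤₚ.≤⇒≤ᵇ p)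

  ≤ᵇ-false : ∀ {a M} → ¬ a ℤ.≤ M → (a ≤ᵇ M) ≡ false
  ≤ᵇ-false h = ¬T⇒false (h ∘ ℤₚ.≤ᵇ⇒≤)

  gap : ∀ {a M} → a ℤ.≤ M → ∃ λ d → M ≡ a + + d
  gap {a} {M} p = ∣ M - a ∣ , trans (l a M) (cong (_+_ a) (sym (ℤₚ.0≤i⇒+∣i∣≡i (ℤₚ.i≤j⇒0≤j-i p))))
    where
    l : ∀ a M → M ≡ a + (M - a)
    l = solve-∀

-- Σ_{y ≥ 0} q^{a + by}, b = β + 1
geometric : ∀ a β M (c : Bool) → (∀ d → M ≡ a + + d → c ≡ ((d % suc β) ≡ᵇ 0)) →
  (λ (y : ℕ) → δ (a + + suc β * + y) M) ⇓ (if (a ≤ᵇ M) ∧ c then 1ℤ else 0ℤ)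
geometric a β M c h with a ℤₚ.≤? M
... | no ¬p = ⇓-≡ (cong (λ b → if b ∧ c then 1ℤ else 0ℤ) (sym (≤ᵇ-false ¬p))) (⇓-0 (λ y → δ-≢ (λ e → ¬p (subst (a ℤ.≤_) e
      (subst (λ z → a ℤ.≤ a + z) (ℤₚ.pos-* (suc β) y) (ℤₚ.i≤i+j a (+ (suc β ℕ.* y))))))))
... | yes p with gap p
...   | d , M≡ with (d % suc β) ℕₚ.≟ 0
...     | yes r = ⇓-≡ (trans (δ-≡ hit) (sym (cong (λ b → if b then 1ℤ else 0ℤ) (trans (cong (_∧ c) (≤ᵇ-true p)) (trans (h d M≡) (cong (_≡ᵇ 0) r))))))
        (⇓-single {f = λ y → δ (a + + suc β * + y) M} (d / suc β) (λ y ne → ℕₚ.*-cancelˡ-≡ y (d / suc β) (suc β)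
          (trans (sym (eq y (δ-nz ne))) d≡)))
      where
      d≡ : d ≡ suc β ℕ.* (d / suc β)
      d≡ = trans (ℕ÷.m≡m%n+[m/n]*n d (suc β)) (trans (cong (ℕ._+ (d / suc β) ℕ.* suc β) r) (ℕₚ.*-comm (d / suc β) (suc β)))
      hit : a + + suc β * + (d / suc β) ≡ M
      hit = trans (cong (_+_ a) (trans (sym (ℤₚ.pos-* (suc β) (d / suc β))) (cong +_ (sym d≡)))) (sym M≡)
      eq : ∀ y → a + + suc β * + y ≡ M → d ≡ suc β ℕ.* y
      eq y e = ℤₚ.+-injective (trans (l a (+ d)) (trans (cong (_- a) (trans (sym M≡) (sym e))) (trans (sym (l a (+ suc β * + y))) (sym (ℤₚ.pos-* (suc β) y)))))
        where
        l : ∀ a d → d ≡ a + d - a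
        l = solve-∀
...     | no r  = ⇓-≡ (sym (cong (λ b → if b then 1ℤ else 0ℤ) (trans (cong (_∧ c) (≤ᵇ-true p)) (trans (h d M≡) (¬T⇒false (λ t → r (ℕₚ.≡ᵇ⇒≡ (d % suc β) 0 t)))))))
        (⇓-0 (λ y → δ-≢ (λ e → r (trans (cong (_% suc β) (eq y e)) (trans (cong (_% suc β) (ℕₚ.*-comm (suc β) y)) (ℕ÷.m*n%n≡0 y (suc β)))))))
      where
      eq : ∀ y → a + + suc β * + y ≡ M → d ≡ suc β ℕ.* y
      eq y e = ℤₚ.+-injective (trans (l a (+ d)) (trans (cong (_- a) (trans (sym M≡) (sym e))) (trans (sym (l a (+ suc β * + y))) (sym (ℤₚ.pos-* (suc β) y)))))
        where
        l : ∀ a d → d ≡ a + d - a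
        l = solve-∀

private
  if-neg : ∀ b → (if b then - 1ℤ else 0ℤ) ≡ - (if b then 1ℤ else 0ℤ)
  if-neg true  = refl
  if-neg false = refl

geomCoeff-pos : ∀ a β M → (λ (y : ℕ) → δ (a + + suc β * + y) M) ⇓ geomCoeff a (+ suc β) M
geomCoeff-pos a β M = geometric a β M (divb (suc β) ∣ M - a ∣) (λ d e → cong (divb (suc β)) (trans (cong (λ M → ∣ M - a ∣) e) (cong ∣_∣ (l a (+ d)))))
  where
  l : ∀ a d → a + d - a ≡ d
  l = solve-∀

geomCoeff-neg : ∀ a β M → (λ (y : ℕ) → δ (a + + suc β + + suc β * + y) M) ⇓ - geomCoeff a -[1+ β ] M
geomCoeff-neg a β M = ⇓-≡ (sym (trans (cong -_ (if-neg ((a + + suc β ≤ᵇ M) ∧ divb (suc β) ∣ M - a ∣))) (ℤₚ.neg-involutive _)))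
  (geometric (a + + suc β) β M (divb (suc β) ∣ M - a ∣) (λ d e → trans (cong (divb (suc β)) (trans (cong (λ M → ∣ M - a ∣) e) (cong ∣_∣ (l a (+ suc β) (+ d)))))
    (cong (_≡ᵇ 0) (ℕ÷.[m+n]%n≡m%n d (suc β)))))
  where
  l : ∀ a b d → a + b + d - a ≡ d + b
  l = solve-∀

geomCoeff-bound : ∀ a β M → geomCoeff a (+ suc β) M ≢ 0ℤ → a ℤ.≤ M
geomCoeff-bound a β M p with a ℤₚ.≤? M
... | yes q = q
... | no ¬q = ⊥-elim (p (cong (λ b → if b ∧ divb (suc β) ∣ M - a ∣ then 1ℤ else 0ℤ) (≤ᵇ-false ¬q)))

geomCoeff-bound⁻ : ∀ a β M → geomCoeff a -[1+ β ] M ≢ 0ℤ → a + + suc β ℤ.≤ M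
geomCoeff-bound⁻ a β M p with (a + + suc β) ℤₚ.≤? M
... | yes q = q
... | no ¬q = ⊥-elim (p (cong (λ b → if b ∧ divb (suc β) ∣ M - a ∣ then - 1ℤ else 0ℤ) (≤ᵇ-false ¬q)))

private
  6x+4 : ∀ x → + 6 * + x + + 4 ≡ + suc (6 ℕ.* x ℕ.+ 3)
  6x+4 x = trans (cong (_+ + 4) (sym (ℤₚ.pos-* 6 x))) (cong +_ (ℕₚ.+-suc (6 ℕ.* x) 3))

  6n+4 : ∀ x → + 6 * -[1+ x ] + + 4 ≡ -[1+ 6 ℕ.* x ℕ.+ 1 ]
  6n+4 x = trans (l (+ x)) (cong (λ z → - (1ℤ + (z + 1ℤ))) (sym (ℤₚ.pos-* 6 x)))
    where
    l : ∀ x → + 6 * - (1ℤ + x) + + 4 ≡ - (1ℤ + (+ 6 * x + 1ℤ))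
    l = solve-∀

  n≤-of : ∀ x e M → e ≡ + x + + (6 ℕ.* (x ℕ.* x) ℕ.+ 8 ℕ.* x) - 1ℤ → e ℤ.≤ M → x ℕ.≤ ∣ M ∣ ℕ.+ 1
  n≤-of x e M e≡ p = ℤₚ.drop‿+≤+ (ℤₚ.≤-trans (ℤₚ.i≤i+j (+ x) (+ r)) (ℤₚ.≤-trans (ℤₚ.≤-reflexive (l (+ x + + r))) (ℤₚ.+-monoˡ-≤ 1ℤ (ℤₚ.≤-trans (ℤₚ.≤-reflexive (sym e≡)) (ℤₚ.≤-trans p (below M))))))
    where
    r = 6 ℕ.* (x ℕ.* x) ℕ.+ 8 ℕ.* x
    l : ∀ y → y ≡ y - 1ℤ + 1ℤ
    l = solve-∀
    below : ∀ M → M ℤ.≤ + ∣ M ∣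
    below (+ n)    = ℤₚ.≤-refl
    below -[1+ n ] = ℤ.-≤+

-- The expansion starts at exponent 6x² + 9x for n = x and at 6x² + 9x - 1 for n = -1 - x; either is
-- at least x - 1, so all contributing n lie inside the window of `Scoeff`.
Sterm-bound : ∀ M n → Sterm n M ≢ 0ℤ → ∣ n ∣ ℕ.≤ ∣ M ∣ ℕ.+ 5
Sterm-bound M (+ x) p = ℕₚ.≤-trans (n≤-of x _ M (trans (cong (_- 1ℤ) (l (+ x))) (cong (λ z → + x + z - 1ℤ) (sym (r≡ x)))) (ℤₚ.≤-trans (ℤₚ.i≤j⇒i-k≤j 1ℤ ℤₚ.≤-refl) (geomCoeff-bound _ _ M (λ z → *-nzʳ {sgn (+ x)} p (trans (cong (λ b → geomCoeff (+ 6 * + x * + x + + 9 * + x) b M) (6x+4 x)) z)))))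
  (ℕₚ.+-monoʳ-≤ ∣ M ∣ (s≤s z≤n))
  where
  l : ∀ x → + 6 * x * x + + 9 * x ≡ x + (+ 6 * (x * x) + + 8 * x)
  l = solve-∀
  r≡ : ∀ x → + (6 ℕ.* (x ℕ.* x) ℕ.+ 8 ℕ.* x) ≡ + 6 * (+ x * + x) + + 8 * + x
  r≡ x = cong₂ _+_ (trans (ℤₚ.pos-* 6 (x ℕ.* x)) (cong (_*_ (+ 6)) (ℤₚ.pos-* x x))) (ℤₚ.pos-* 8 x)
Sterm-bound M -[1+ x ] p = ℕₚ.≤-trans (s≤s (n≤-of x _ M (trans (cong (_+_ (+ 6 * -[1+ x ] * -[1+ x ] + + 9 * -[1+ x ])) (cong (_+_ 1ℤ) (cong (_+ 1ℤ) (ℤₚ.pos-* 6 x)))) (trans (l (+ x)) (cong (λ z → + x + z - 1ℤ) (sym (r≡ x)))))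
    (geomCoeff-bound⁻ _ _ M (λ z → *-nzʳ {sgn -[1+ x ]} p (trans (cong (λ b → geomCoeff (+ 6 * -[1+ x ] * -[1+ x ] + + 9 * -[1+ x ]) b M) (6n+4 x)) z)))))
  (ℕₚ.≤-trans (ℕₚ.≤-reflexive (sym (ℕₚ.+-suc ∣ M ∣ 1))) (ℕₚ.+-monoʳ-≤ ∣ M ∣ (s≤s (s≤s z≤n))))
  where
  l : ∀ x → + 6 * - (1ℤ + x) * - (1ℤ + x) + + 9 * - (1ℤ + x) + (1ℤ + (+ 6 * x + 1ℤ)) ≡ x + (+ 6 * (x * x) + + 8 * x) - 1ℤ
  l = solve-∀
  r≡ : ∀ x → + (6 ℕ.* (x ℕ.* x) ℕ.+ 8 ℕ.* x) ≡ + 6 * (+ x * + x) + + 8 * + x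
  r≡ x = cong₂ _+_ (trans (ℤₚ.pos-* 6 (x ℕ.* x)) (cong (_*_ (+ 6)) (ℤₚ.pos-* x x))) (ℤₚ.pos-* 8 x)

Scoeff-⇓ : ∀ M → (λ n → Sterm n M) ⇓ Scoeff M
Scoeff-⇓ M = ⇓-≡ (trans (sumL-map (λ n → Sterm n M) shift (upTo (suc (2 ℕ.* B)))) (sumL-upTo (λ i → Sterm (shift i) M) (suc (2 ℕ.* B))))
  (⇓-list (map shift (upTo (suc (2 ℕ.* B)))) (Unique.map⁺ (λ {x} {y} e → ℤₚ.+-injective (trans (l₁ (+ x) (+ B)) (trans (cong (_+ + B) e) (sym (l₁ (+ y) (+ B)))))) (Unique.upTo⁺ (suc (2 ℕ.* B))))
    (λ n p → subst (_∈ map shift (upTo (suc (2 ℕ.* B)))) (proj₂ (place n (Sterm-bound M n p))) (∈-map⁺ shift (∈-upTo⁺ (s≤s (proj₁ (proj₂ (idx n (Sterm-bound M n p)))))))))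
  where
  B = ∣ M ∣ ℕ.+ 5
  shift : ℕ → ℤ
  shift i = + i - + B
  l₁ : ∀ x b → x ≡ x - b + b
  l₁ = solve-∀
  idx : ∀ n → ∣ n ∣ ℕ.≤ B → ∃ λ i → (i ℕ.≤ 2 ℕ.* B) × (shift i ≡ n)
  idx (+ x) p = x ℕ.+ B , ℕₚ.≤-trans (ℕₚ.+-monoˡ-≤ B p) (ℕₚ.≤-reflexive (l B)) , l₂ (+ x) (+ B)
    where
    l : ∀ B → B ℕ.+ B ≡ 2 ℕ.* B
    l = solveℕ
    l₂ : ∀ x b → x + b - b ≡ x
    l₂ = solve-∀
  idx -[1+ x ] p with ℕₚ.m≤n⇒∃[o]m+o≡n p
  ... | o , q = o , ℕₚ.≤-trans (ℕₚ.m≤n+m o (suc x)) (ℕₚ.≤-trans (ℕₚ.≤-reflexive q) (ℕₚ.m≤m+n B (B ℕ.+ 0))) , trans (cong (λ b → + o - + b) (sym q)) (l₂ (+ o) (+ x))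
    where
    l₂ : ∀ o x → o - (1ℤ + x + o) ≡ - (1ℤ + x)
    l₂ = solve-∀
  place : ∀ n (p : ∣ n ∣ ℕ.≤ B) → (proj₁ (idx n p) ℕ.≤ 2 ℕ.* B) × shift (proj₁ (idx n p)) ≡ n
  place n p = proj₂ (idx n p)

-- With n = -1 - k the n-th summand of q³S is Σ_j of the (k, j) summands of t₃.
t₃-row : ∀ N k → (λ j → cf (wt ft₃) (ex ft₃) N (k , j)) ⇓ Sterm (- 1ℤ - k) (N - + 3)
t₃-row N (+ x) = ⇓-≡ val (⇓-unindex {f = λ j → cf (wt ft₃) (ex ft₃) N (+ x , j)} +_ ∣_∣ (λ _ → refl) only
    (⇓-cong pt (⇓-*ˡ (sgn (+ x)) (geomCoeff-neg a (6 ℕ.* x ℕ.+ 1) (N - + 3)))))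
  where
  a : ℤ
  a = + 6 * -[1+ x ] * -[1+ x ] + + 9 * -[1+ x ]
  only : ∀ j → cf (wt ft₃) (ex ft₃) N (+ x , j) ≢ 0ℤ → + ∣ j ∣ ≡ j
  only (+ j)    _ = refl
  only -[1+ j ] p = ⊥-elim (p (l (sgn (+ x)) (δ (ex ft₃ (+ x , -[1+ j ])) N)))
    where
    l : ∀ s d → s * 0ℤ * d ≡ 0ℤ
    l = solve-∀
  l₂ : ∀ x y → + 6 * x * x + + 9 * x + + 2 + (+ 6 * x + + 2) * y ≡ + 3 + (+ 6 * - (1ℤ + x) * - (1ℤ + x) + + 9 * - (1ℤ + x) + (1ℤ + (+ 6 * x + 1ℤ)) + (1ℤ + (+ 6 * x + 1ℤ)) * y)
  l₂ = solve-∀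
  l₃ : ∀ s d → s * d ≡ s * 1ℤ * d
  l₃ = solve-∀
  pt : ∀ y → sgn (+ x) * δ (a + + suc (6 ℕ.* x ℕ.+ 1) + + suc (6 ℕ.* x ℕ.+ 1) * + y) (N - + 3) ≡ cf (wt ft₃) (ex ft₃) N (+ x , + y)
  pt y = trans (cong (_*_ (sgn (+ x))) (trans (sym (δ-+ _ (+ 3) N)) (cong (λ e → δ e N) (trans
      (cong (λ z → + 3 + (a + (1ℤ + (z + 1ℤ)) + (1ℤ + (z + 1ℤ)) * + y)) (ℤₚ.pos-* 6 x)) (sym (l₂ (+ x) (+ y)))))))
    (l₃ (sgn (+ x)) (δ (ex ft₃ (+ x , + y)) N))
  back : ∀ x → - 1ℤ - + x ≡ -[1+ x ]
  back zero    = refl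
  back (suc x) = refl
  val : sgn (+ x) * - geomCoeff a -[1+ 6 ℕ.* x ℕ.+ 1 ] (N - + 3) ≡ Sterm (- 1ℤ - + x) (N - + 3)
  val = trans (trans (l (sgn (+ x)) (geomCoeff a -[1+ 6 ℕ.* x ℕ.+ 1 ] (N - + 3))) (cong₂ _*_ (sym (sgn-suc (+ x))) (cong (λ b → geomCoeff a b (N - + 3)) (sym (6n+4 x)))))
    (cong (λ n → Sterm n (N - + 3)) (sym (back x)))
    where
    l : ∀ s g → s * - g ≡ - s * g
    l = solve-∀
t₃-row N -[1+ x ] = ⇓-≡ val (⇓-unindex {f = λ j → cf (wt ft₃) (ex ft₃) N (-[1+ x ] , j)} -[1+_] (ℕ.pred ∘ ∣_∣) (λ _ → refl) only
    (⇓-cong pt (⇓-*ˡ (sgn (+ x)) (geomCoeff-pos a (6 ℕ.* x ℕ.+ 3) (N - + 3)))))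
  where
  a : ℤ
  a = + 6 * + x * + x + + 9 * + x
  only : ∀ j → cf (wt ft₃) (ex ft₃) N (-[1+ x ] , j) ≢ 0ℤ → -[1+ ℕ.pred ∣ j ∣ ] ≡ j
  only -[1+ j ] _ = refl
  only (+ j)    p = ⊥-elim (p (l (sgn -[1+ x ]) (δ (ex ft₃ (-[1+ x ] , + j)) N)))
    where
    l : ∀ s d → s * 0ℤ * d ≡ 0ℤ
    l = solve-∀
  l₂ : ∀ x y → + 6 * - (1ℤ + x) * - (1ℤ + x) + + 9 * - (1ℤ + x) + + 2 + (+ 6 * - (1ℤ + x) + + 2) * - (1ℤ + y) ≡ + 3 + (+ 6 * x * x + + 9 * x + (1ℤ + (+ 6 * x + + 3)) * y)
  l₂ = solve-∀
  l₃ : ∀ s d → s * d ≡ - s * - 1ℤ * d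
  l₃ = solve-∀
  pt : ∀ y → sgn (+ x) * δ (a + + suc (6 ℕ.* x ℕ.+ 3) * + y) (N - + 3) ≡ cf (wt ft₃) (ex ft₃) N (-[1+ x ] , -[1+ y ])
  pt y = trans (cong (_*_ (sgn (+ x))) (trans (sym (δ-+ _ (+ 3) N)) (cong (λ e → δ e N) (trans
      (cong (λ z → + 3 + (a + (1ℤ + (z + + 3)) * + y)) (ℤₚ.pos-* 6 x)) (sym (l₂ (+ x) (+ y)))))))
    (trans (l₃ (sgn (+ x)) (δ (ex ft₃ (-[1+ x ] , -[1+ y ])) N)) (cong (λ s → s * - 1ℤ * δ (ex ft₃ (-[1+ x ] , -[1+ y ])) N) (sym (sgn-suc (+ x)))))
  back : ∀ x → - 1ℤ - -[1+ x ] ≡ + x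
  back zero    = refl
  back (suc x) = refl
  val : sgn (+ x) * geomCoeff a (+ suc (6 ℕ.* x ℕ.+ 3)) (N - + 3) ≡ Sterm (- 1ℤ - -[1+ x ]) (N - + 3)
  val = trans (cong (λ b → sgn (+ x) * geomCoeff a b (N - + 3)) (sym (6x+4 x))) (cong (λ n → Sterm n (N - + 3)) (sym (back x)))

q³S≈t₃ : qShiftS 3 ≈ gf ft₃
q³S≈t₃ = coeffs λ n → ⇓-unique (⇓-reindex {f = λ m → Sterm m (+ n - + 3)} (λ k → - 1ℤ - k) (λ k → - 1ℤ - k) flip (λ k _ → flip k) (Scoeff-⇓ (+ n - + 3)))
  (⇓-rows {f = cf (wt ft₃) (ex ft₃) (+ n)} (t₃-row (+ n)) ℤₚ._≟_ (gf-⇓ ft₃ n))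
  where
  flip : ∀ k → - 1ℤ - (- 1ℤ - k) ≡ k
  flip = solve-∀

-- Comparison with the stated quotients

open Solution Fˢ ψ₁*F≈H
open Products

⊗-≈ : ∀ f g → (f ⊗ g) ≈ f *ˢ g
⊗-≈ f g = ≡⇒≈ (sym (*ˢ-⊗ f g))

⊗-cong : ∀ {f f′ g g′} → f ≈ f′ → g ≈ g′ → (f ⊗ g) ≈ f′ *ˢ g′
⊗-cong {f} {f′} {g} {g′} p q = ≈-trans (⊗-≈ f g) (*ˢ-cong p q)

^ˢ-2 : ∀ f → (f ^ˢ 2) ≈ f *ˢ f
^ˢ-2 f = ⊗-cong ≈-refl (≈-trans (⊗-≈ f (cst 1ℤ)) (*ˢ-1 f))

^ˢ-4 : ∀ f → (f ^ˢ 4) ≈ f *ˢ (f *ˢ (f *ˢ f))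
^ˢ-4 f = ⊗-cong ≈-refl (⊗-cong ≈-refl (^ˢ-2 f))

unit-≈ : ∀ {f g} → f ≈ g → g 0 ≡ 1ℤ → f 0 ≡ 1ℤ
unit-≈ p q = trans (p at 0) q

-- The solution of the linear system is known through its products with ψ₁, so a quotient is checked
-- after multiplication by ψ₁ and by its denominator.
⊘-via-ψ₁ : ∀ {f g h f′ g′} → f ≈ f′ → g ≈ g′ → g′ 0 ≡ 1ℤ → ψ₁ *ˢ h *ˢ g′ ≈ ψ₁ *ˢ f′ → (f ⊘ g) ≈ h
⊘-via-ψ₁ {f} {g} {h} {f′} {g′} p q u e = ⊘-unique (unit-≈ q u) (≈-trans (*ˢ-congˡ q) (≈-trans (*ˢ-cancelˡ {ψ₁} ψ₁-0 (≈-trans (≈-sym (*ˢ-assoc ψ₁ h g′)) e)) (≈-sym p)))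

part₁ : ((Pm 3 6 ⊗ P 6 6) ⊘ (P 2 6 ⊗ P 4 6)) ≈ U 1 Fˢ
part₁ = ⊘-via-ψ₁ (⊗-≈ m₃ A₆) (⊗-≈ A₂ A₄) (*ˢ-unit {A₂} {A₄} (poch-unit 1ℤ 1 5) (poch-unit 1ℤ 3 5)) (
  ψ₁ *ˢ U 1 Fˢ *ˢ (A₂ *ˢ A₄)
    ≈⟨ *ˢ-congʳ (≈-trans ψ₁B (*ˢ-cong a≈ ψ₃≈)) ⟩
  m₃ *ˢ A₆ *ˢ (A₁ *ˢ m₄ *ˢ (m₂ *ˢ A₅)) *ˢ (B₁₂ *ˢ A₃) *ˢ (A₂ *ˢ A₄)
    ≈⟨ solve 10 (λ m3 a6 a1 m4 m2 a5 b12 a3 a2 a4 → m3 :* a6 :* (a1 :* m4 :* (m2 :* a5)) :* (b12 :* a3) :* (a2 :* a4) := (a2 :* m2) :* (a4 :* m4) :* b12 :* (a1 :* a3 :* a5) :* (m3 :* a6))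
         ≈-refl m₃ A₆ A₁ m₄ m₂ A₅ B₁₂ A₃ A₂ A₄ ⟩
  A₂ *ˢ m₂ *ˢ (A₄ *ˢ m₄) *ˢ B₁₂ *ˢ (A₁ *ˢ A₃ *ˢ A₅) *ˢ (m₃ *ˢ A₆)
    ≈⟨ *ˢ-congʳ (≈-trans (*ˢ-congʳ (*ˢ-congʳ (*ˢ-cong A₂m₂ A₄m₄))) (≈-sym ψ₁≈)) ⟩
  ψ₁ *ˢ (m₃ *ˢ A₆) ≈∎)

part₂ : ((P 3 3 ⊗ Pm 6 6) ⊘ (P 1 6 ⊗ P 5 6 ⊗ P 4 12 ⊗ P 8 12)) ≈ U 2 Fˢ
part₂ = ⊘-via-ψ₁ (⊗-cong P33 ≈-refl) (⊗-cong (⊗-cong (⊗-≈ A₁ A₅) ≈-refl) ≈-refl)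
  (*ˢ-unit {A₁ *ˢ A₅ *ˢ B₄} {B₈} (*ˢ-unit {A₁ *ˢ A₅} {B₄} (*ˢ-unit {A₁} {A₅} (poch-unit 1ℤ 0 5) (poch-unit 1ℤ 4 5)) (poch-unit 1ℤ 3 11)) (poch-unit 1ℤ 7 11)) (
  ψ₁ *ˢ U 2 Fˢ *ˢ (A₁ *ˢ A₅ *ˢ B₄ *ˢ B₈)
    ≈⟨ *ˢ-congʳ (≈-trans ψ₁C (*ˢ-cong ψ₃≈ ψ₃≈)) ⟩
  B₁₂ *ˢ A₃ *ˢ (B₁₂ *ˢ A₃) *ˢ (A₁ *ˢ A₅ *ˢ B₄ *ˢ B₈)
    ≈⟨ solve 6 (λ b12 a3 a1 a5 b4 b8 → b12 :* a3 :* (b12 :* a3) :* (a1 :* a5 :* b4 :* b8) := b4 :* b8 :* b12 :* (a1 :* a3 :* a5) :* (a3 :* b12)) ≈-refl B₁₂ A₃ A₁ A₅ B₄ B₈ ⟩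
  B₄ *ˢ B₈ *ˢ B₁₂ *ˢ (A₁ *ˢ A₃ *ˢ A₅) *ˢ (A₃ *ˢ B₁₂)
    ≈⟨ *ˢ-cong ψ₁≈ (≈-trans (*ˢ-assoc A₃ A₆ m₆) (*ˢ-congˡ A₆m₆)) ⟨
  ψ₁ *ˢ (A₃ *ˢ A₆ *ˢ m₆) ≈∎)

private
  V : PS
  V = Pm 3 6 ⊘ P 6 6

  -- Because A₃ m₃ B₁₂ = B₆ B₁₂ = A₆. Thus the prefactor of the bilateral sum is 1 / ψ₃, the factor
  -- with which h₁ enters component 0.
  ψ₃V≈1 : ψ₃ *ˢ V ≈ 1ˢ
  ψ₃V≈1 = *ˢ-cancelˡ {A₆} (poch-unit 1ℤ 5 5) (
    A₆ *ˢ (ψ₃ *ˢ V)                 ≈⟨ *ˢ-congˡ (*ˢ-cong ψ₃≈ (≡⇒≈ (sym (*ˢ-⊗ m₃ (inv A₆))))) ⟩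
    A₆ *ˢ (B₁₂ *ˢ A₃ *ˢ (m₃ *ˢ inv A₆)) ≈⟨ solve 5 (λ a6 b a3 m i → a6 :* (b :* a3 :* (m :* i)) := (a3 :* m) :* b :* (a6 :* i)) ≈-refl A₆ B₁₂ A₃ m₃ (inv A₆) ⟩
    A₃ *ˢ m₃ *ˢ B₁₂ *ˢ (A₆ *ˢ inv A₆) ≈⟨ *ˢ-cong (≈-trans (*ˢ-congʳ A₃m₃) (≈-sym A₆≈)) (*ˢ-inv A₆ (poch-unit 1ℤ 5 5)) ⟩
    A₆ *ˢ 1ˢ                        ≈∎)

  -- Component 0 freed of its Lambert part; it equals a² / ψ₁, the infinite product of the first
  -- identity.
  W₀ : PS
  W₀ = U 0 Fˢ +ˢ h₁ *ˢ V

  ψ₁W₀ : ψ₁ *ˢ W₀ ≈ aˢ *ˢ aˢ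
  ψ₁W₀ = *ˢ-cancelˡ {ψ₃} ψ₃-0 (≈-trans (solve 5 (λ r p x h v → r :* (p :* (x :+ h :* v)) := p :* (r :* x :+ h :* (r :* v))) ≈-refl ψ₃ ψ₁ (U 0 Fˢ) h₁ V)
    (≈-trans (*ˢ-congˡ (+ˢ-cong ≈-refl (≈-trans (*ˢ-congˡ ψ₃V≈1) (*ˢ-1 h₁)))) (≈-trans ψ₁ψ₃A (*ˢ-comm (aˢ *ˢ aˢ) ψ₃))))

  Num Den : PS
  Num = (P 6 6 ^ˢ 4) ⊗ (Pm 3 3 ^ˢ 4) ⊗ P 1 2
  Den = P 4 4 ⊗ ((P 2 12 ⊗ P 10 12 ⊗ P 12 12) ^ˢ 2)

  product₀ : (Num ⊘ Den) ≈ W₀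
  product₀ = ⊘-via-ψ₁ num den unit (
    ψ₁ *ˢ W₀ *ˢ (B₄ *ˢ B₈ *ˢ B₁₂ *ˢ (X *ˢ X))
      ≈⟨ *ˢ-congʳ (≈-trans ψ₁W₀ (*ˢ-cong a≈ a≈)) ⟩
    m₃ *ˢ A₆ *ˢ (A₁ *ˢ m₄ *ˢ (m₂ *ˢ A₅)) *ˢ (m₃ *ˢ A₆ *ˢ (A₁ *ˢ m₄ *ˢ (m₂ *ˢ A₅))) *ˢ (B₄ *ˢ B₈ *ˢ B₁₂ *ˢ (X *ˢ X))
      ≈⟨ solve 11 (λ m3 a6 a1 m4 m2 a5 b4 b8 b12 b2 b10 →
           m3 :* a6 :* (a1 :* m4 :* (m2 :* a5)) :* (m3 :* a6 :* (a1 :* m4 :* (m2 :* a5))) :* (b4 :* b8 :* b12 :* (b2 :* b10 :* b12 :* (b2 :* b10 :* b12)))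
           := b4 :* b8 :* b12 :* (a1 :* a1 :* a5 :* a5) :* (m3 :* m3 :* a6 :* a6) :* (b12 :* b12) :* ((m2 :* m4 :* (b2 :* b10)) :* (m2 :* m4 :* (b2 :* b10))))
           ≈-refl m₃ A₆ A₁ m₄ m₂ A₅ B₄ B₈ B₁₂ B₂ B₁₀ ⟩
    K *ˢ (m₂ *ˢ m₄ *ˢ (B₂ *ˢ B₁₀) *ˢ (m₂ *ˢ m₄ *ˢ (B₂ *ˢ B₁₀)))
      ≈⟨ *ˢ-congˡ (*ˢ-cong m₂m₄B₂B₁₀ m₂m₄B₂B₁₀) ⟩
    K *ˢ (1ˢ *ˢ 1ˢ)
      -- The square of m₆ B₆ = 1 is inserted to supply the factors A₃ and m₆ of the stated
      -- numerator, through B₆ = A₃ m₃ and B₁₂ = A₆ m₆.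
      ≈⟨ *ˢ-congˡ (*ˢ-cong m₆B₆ m₆B₆) ⟨
    K *ˢ (m₆ *ˢ B₆ *ˢ (m₆ *ˢ B₆))
      ≈⟨ *ˢ-cong (*ˢ-congˡ (*ˢ-cong A₆m₆ A₆m₆)) (*ˢ-cong (*ˢ-congˡ A₃m₃) (*ˢ-congˡ A₃m₃)) ⟨
    B₄ *ˢ B₈ *ˢ B₁₂ *ˢ (A₁ *ˢ A₁ *ˢ A₅ *ˢ A₅) *ˢ (m₃ *ˢ m₃ *ˢ A₆ *ˢ A₆) *ˢ (A₆ *ˢ m₆ *ˢ (A₆ *ˢ m₆)) *ˢ (m₆ *ˢ (A₃ *ˢ m₃) *ˢ (m₆ *ˢ (A₃ *ˢ m₃)))
      ≈⟨ solve 9 (λ b4 b8 b12 a1 a5 m3 a6 m6 a3 →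
           b4 :* b8 :* b12 :* (a1 :* a1 :* a5 :* a5) :* (m3 :* m3 :* a6 :* a6) :* (a6 :* m6 :* (a6 :* m6)) :* (m6 :* (a3 :* m3) :* (m6 :* (a3 :* m3)))
           := b4 :* b8 :* b12 :* (a1 :* a3 :* a5) :* (a6 :* (a6 :* (a6 :* a6)) :* (m3 :* m6 :* (m3 :* m6 :* (m3 :* m6 :* (m3 :* m6)))) :* (a1 :* a3 :* a5)))
           ≈-refl B₄ B₈ B₁₂ A₁ A₅ m₃ A₆ m₆ A₃ ⟩
    B₄ *ˢ B₈ *ˢ B₁₂ *ˢ (A₁ *ˢ A₃ *ˢ A₅) *ˢ num′
      ≈⟨ *ˢ-congʳ ψ₁≈ ⟨
    ψ₁ *ˢ num′ ≈∎)
    where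
    X K num′ : PS
    X = B₂ *ˢ B₁₀ *ˢ B₁₂
    K = B₄ *ˢ B₈ *ˢ B₁₂ *ˢ (A₁ *ˢ A₁ *ˢ A₅ *ˢ A₅) *ˢ (m₃ *ˢ m₃ *ˢ A₆ *ˢ A₆) *ˢ (B₁₂ *ˢ B₁₂)
    num′ = A₆ *ˢ (A₆ *ˢ (A₆ *ˢ A₆)) *ˢ (m₃ *ˢ m₆ *ˢ (m₃ *ˢ m₆ *ˢ (m₃ *ˢ m₆ *ˢ (m₃ *ˢ m₆)))) *ˢ (A₁ *ˢ A₃ *ˢ A₅)
    X-unit : X 0 ≡ 1ℤ
    X-unit = *ˢ-unit {B₂ *ˢ B₁₀} {B₁₂} (*ˢ-unit {B₂} {B₁₀} (poch-unit 1ℤ 1 11) (poch-unit 1ℤ 9 11)) (poch-unit 1ℤ 11 11)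
    num : Num ≈ num′
    num = ⊗-cong (⊗-cong (^ˢ-4 A₆) (≈-trans (^ˢ-4 (Pm 3 3)) (*ˢ-cong Pm33 (*ˢ-cong Pm33 (*ˢ-cong Pm33 Pm33))))) P12
    den : Den ≈ B₄ *ˢ B₈ *ˢ B₁₂ *ˢ (X *ˢ X)
    den = ⊗-cong P44 (≈-trans (^ˢ-2 _) (*ˢ-cong X≈ X≈))
      where
      X≈ : (P 2 12 ⊗ P 10 12 ⊗ P 12 12) ≈ X
      X≈ = ⊗-cong (⊗-≈ B₂ B₁₀) ≈-refl
    unit : (B₄ *ˢ B₈ *ˢ B₁₂ *ˢ (X *ˢ X)) 0 ≡ 1ℤ
    unit = *ˢ-unit {B₄ *ˢ B₈ *ˢ B₁₂} {X *ˢ X} (*ˢ-unit {B₄ *ˢ B₈} {B₁₂} (*ˢ-unit {B₄} {B₈} (poch-unit 1ℤ 3 11) (poch-unit 1ℤ 7 11)) (poch-unit 1ℤ 11 11)) (*ˢ-unit {X} {X} X-unit X-unit)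

part₀ : (cst (- (+ 1)) ⊝ cst (+ 3) ⊗ qShiftS 3 ⊗ V ⊕ Num ⊘ Den) ≈ cst (- 1ℤ) +ˢ U 0 Fˢ
part₀ =
  (cst (- (+ 1)) ⊝ cst (+ 3) ⊗ qShiftS 3 ⊗ V ⊕ Num ⊘ Den)
    ≈⟨ ≡⇒≈ (sym (trans (+ˢ-⊕ _ _) (cong (_⊕ (Num ⊘ Den)) (-ˢ-⊝ _ _)))) ⟩
  cst (- 1ℤ) -ˢ (cst (+ 3) ⊗ qShiftS 3 ⊗ V) +ˢ (Num ⊘ Den)
    ≈⟨ +ˢ-cong (-ˢ-cong ≈-refl (⊗-cong (⊗-cong ≈-refl q³S≈t₃) ≈-refl)) product₀ ⟩
  cst (- 1ℤ) -ˢ h₁ *ˢ V +ˢ W₀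
    ≈⟨ solve 3 (λ m x u → m :- x :+ (u :+ x) := m :+ u) ≈-refl (cst (- 1ℤ)) (h₁ *ˢ V) (U 0 Fˢ) ⟩
  cst (- 1ℤ) +ˢ U 0 Fˢ ≈∎

-- The constant 1 in `Fˢ` counts the empty partition, which N₂ leaves out; it lies in component 0,
-- hence the correction -1 here only.
R₀ : ∀ N → R (+ 0) (+ 1) 0 N ≡ (cst (- 1ℤ) +ˢ U 0 Fˢ) N
R₀ N = trans (R-Rw 0 N) (≈-trans (solve 1 (λ x → x := con (- 1ℤ) :+ (con 1ℤ :+ x)) ≈-refl (U 0 (Rw χ)))
  (+ˢ-cong ≈-refl (≈-trans (+ˢ-cong (≈-sym U-1-0) ≈-refl) (≈-sym (U-+ 0 1ˢ (Rw χ))))) at N)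

R-suc : ∀ d N → R (+ 0) (+ 1) (suc d) N ≡ U (suc d) Fˢ N
R-suc d N = trans (R-Rw (suc d) N) (≈-trans (solve 1 (λ x → x := con 0ℤ :+ x) ≈-refl (U (suc d) (Rw χ)))
  (≈-trans (+ˢ-cong (≈-sym (U-1-suc d)) ≈-refl) (≈-sym (U-+ (suc d) 1ˢ (Rw χ)))) at N)

theorem1p1 : (∀ (N : ℕ) → R (+ 0) (+ 1) 0 N
    ≡ (cst (- (+ 1))
    ⊝ cst (+ 3) ⊗ qShiftS 3 ⊗ (Pm 3 6 ⊘ P 6 6)
    ⊕ ((P 6 6 ^ˢ 4) ⊗ (Pm 3 3 ^ˢ 4) ⊗ P 1 2)
    ⊘ (P 4 4 ⊗ ((P 2 12 ⊗ P 10 12 ⊗ P 12 12) ^ˢ 2))) N)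
    × (∀ (N : ℕ) → R (+ 0) (+ 1) 1 N
    ≡ ((Pm 3 6 ⊗ P 6 6) ⊘ (P 2 6 ⊗ P 4 6)) N)
    × (∀ (N : ℕ) → R (+ 0) (+ 1) 2 N
    ≡ ((P 3 3 ⊗ Pm 6 6) ⊘ (P 1 6 ⊗ P 5 6 ⊗ P 4 12 ⊗ P 8 12)) N)
theorem1p1 = (λ N → trans (R₀ N) (sym (part₀ at N)))
           , (λ N → trans (R-suc 0 N) (sym (part₁ at N)))
           , (λ N → trans (R-suc 1 N) (sym (part₂ at N)))
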